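{- Let $\mathcal{F}$ be an adequate MSO-class of forests, and let $\mathcal{T}$ be the class of trees in $\mathcal{F}$ (so $\mathcal{F} = (\ge 1)\mathcal{T}$). Then the following are equivalent: (i) $\mathcal{F}$ has a monadic second-order 0--1 law; (ii) the radius of $\mathcal{F}$ is $1$; (iii) the radius of $\mathcal{T}$ is $\ge 1$.
   Context: A (finite rooted) forest is a finite nonempty poset $(F,<)$ such that for every $x\in F$ the set $\{y\in F: y\ge x\}$ is a chain; a tree is a forest with a greatest element (its root). Forests are considered up to isomorphism (unlabelled). The sum $F_1+F_2$ of forests is their disjoint union; every forest is uniquely a sum of trees (its components). For a class $\mathcal{T}$ of trees, $(\ge 1)\mathcal{T}$ is the class of all forests that are sums of one or more trees from $\mathcal{T}$ (repetitions allowed). A class $\mathcal{F}$ of forests is adequate if it is closed under sums and under extraction of component trees; equivalently $\mathcal{F}=(\ge1)\mathcal{T}$ for $\mathcal{T}$ the class of trees in $\mathcal{F}$. For a class $\mathcal{C}$, $c(n)$ is the number of isomorphism types of members of $\mathcal{C}$ of size $n$, its (ordinary) generating function is $\mathbf{C}(x)=\sum_n c(n)x^n$, and the radius of $\mathcal{C}$ is the radius of convergence of $\mathbf{C}(x)$. Monadic second-order (MSO) logic here is over the single binary relation symbol $<$ (with equality), with first-order variables and monadic (set) second-order variables, quantifiers over both. An MSO-class is the class of finite models (forests, resp. trees) of an MSO sentence. Let $d$ be the gcd of the sizes of the members of $\mathcal{F}$. $\mathcal{F}$ has an MSO 0--1 law if for every MSO sentence $\varphi$, letting $\mathcal{F}_\varphi$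 be the members of $\mathcal{F}$ satisfying $\varphi$ with counting function $f_\varphi(n)$, the limit $\lim_{n\to\infty} f_\varphi(nd)/f(nd)$ exists and equals $0$ or $1$. -}

module Defs where

open import Data.Nat as ℕ using (ℕ; zero; suc; _+_; _*_; _∸_; _≤_; _<_; _≥_)
open import Data.Nat.Divisibility using (_∣_)
open import Data.Fin using (Fin; splitAt)
open import Data.Bool using (Bool; true; false)
open import Data.Sum using (_⊎_; inj₁; inj₂)
open import Data.Product using (Σ; ∃; ∃-syntax; _×_; _,_)
open import Data.Empty using (⊥)
open import Relation.Nullary using (¬_)
open import Relation.Binary.PropositionalEquality using (_≡_)
open import Function.Bundles using (_↔_; Inverse)
import Data.Rational as ℚ
open ℚ using (ℚ; 0ℚ; 1ℚ)
open import Data.Integer using (+_)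

record Str : Set where
  constructor mkStr
  field
    size : ℕ
    lt   : Fin size → Fin size → Bool
open Str public

_⊢_≺_ : (S : Str) → Fin (size S) → Fin (size S) → Set
S ⊢ x ≺ y = lt S x y ≡ true

_⊢_≼_ : (S : Str) → Fin (size S) → Fin (size S) → Set
S ⊢ x ≼ y = (x ≡ y) ⊎ (S ⊢ x ≺ y)

record _≅_ (A B : Str) : Set where
  field
    bij  : Fin (size A) ↔ Fin (size B)
    pres : ∀ x y → lt A x y ≡ lt B (Inverse.to bij x) (Inverse.to bij y)

record IsForest (S : Str) : Set where
  field
    nonempty : 1 ≤ size S
    irrefl   : ∀ x → ¬ (S ⊢ x ≺ x)
    trans    : ∀ x y z → S ⊢ x ≺ y → S ⊢ y ≺ z → S ⊢ x ≺ z
    upChain  : ∀ x y z → S ⊢ x ≼ y → S ⊢ x ≼ z → (S ⊢ y ≼ z) ⊎ (S ⊢ z ≼ y)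

IsTree : Str → Set
IsTree S = IsForest S × (Σ (Fin (size S)) λ r → ∀ x → S ⊢ x ≼ r)

_⊕_ : Str → Str → Str
A ⊕ B = mkStr (size A + size B) rel
  where
  rel : Fin (size A + size B) → Fin (size A + size B) → Bool
  rel x y with splitAt (size A) x | splitAt (size A) y
  ... | inj₁ a | inj₁ a' = lt A a a'
  ... | inj₂ b | inj₂ b' = lt B b b'
  ... | inj₁ _ | inj₂ _  = false
  ... | inj₂ _ | inj₁ _  = false

IsComponent : Str → Str → Set
IsComponent T F = IsTree T × ((F ≅ T) ⊎ (Σ Str λ G → IsForest G × (F ≅ (T ⊕ G))))

Class : Set₁
Class = Str → Set

record Adequate (F : Class) : Set where
  field
    sums       : ∀ A B → F A → F B → F (A ⊕ B)
    components : ∀ T A → F A → IsComponent T A → F T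

TreesOf : Class → Class
TreesOf F S = F S × IsTree S

CountIs : Class → ℕ → ℕ → Set
CountIs C n k =
  Σ (Fin k → Str) λ v →
      (∀ i → C (v i) × size (v i) ≡ n)
    × (∀ i j → v i ≅ v j → i ≡ j)
    × (∀ S → C S → size S ≡ n → Σ (Fin k) λ i → S ≅ v i)

CountingFunction : Class → (ℕ → ℕ) → Set
CountingFunction C c = ∀ n → CountIs C n (c n)

IsGcdOfSizes : Class → ℕ → Set
IsGcdOfSizes F d =
    (∀ S → F S → d ∣ size S)
  × (∀ e → (∀ S → F S → e ∣ size S) → e ∣ d)

-- Monadic second-order logic over  <  (de Bruijn indices:
-- i first-order variables, j set variables in scope)

data Formula : ℕ → ℕ → Set where
  _≺'_  : ∀ {i j} → Fin i → Fin i → Formula i j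
  _≐_   : ∀ {i j} → Fin i → Fin i → Formula i j
  _∈'_  : ∀ {i j} → Fin i → Fin j → Formula i j
  ¬'_   : ∀ {i j} → Formula i j → Formula i j
  _∧'_  : ∀ {i j} → Formula i j → Formula i j → Formula i j
  _∨'_  : ∀ {i j} → Formula i j → Formula i j → Formula i j
  ∃₁    : ∀ {i j} → Formula (suc i) j → Formula i j
  ∀₁    : ∀ {i j} → Formula (suc i) j → Formula i j
  ∃₂    : ∀ {i j} → Formula i (suc j) → Formula i j
  ∀₂    : ∀ {i j} → Formula i (suc j) → Formula i j

Sentence : Set
Sentence = Formula 0 0

extend : ∀ {A : Set} {i} → A → (Fin i → A) → Fin (suc i) → A
extend a ρ Fin.zero    = a
extend a ρ (Fin.suc k) = ρ k

Sat : (S : Str) {i j : ℕ} → (Fin i → Fin (size S)) → (Fin j → (Fin (size S) → Bool)) → Formula i j → Set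
Sat S ρ σ (x ≺' y) = S ⊢ ρ x ≺ ρ y
Sat S ρ σ (x ≐ y)  = ρ x ≡ ρ y
Sat S ρ σ (x ∈' X) = σ X (ρ x) ≡ true
Sat S ρ σ (¬' φ)   = ¬ Sat S ρ σ φ
Sat S ρ σ (φ ∧' ψ) = Sat S ρ σ φ × Sat S ρ σ ψ
Sat S ρ σ (φ ∨' ψ) = Sat S ρ σ φ ⊎ Sat S ρ σ ψ
Sat S ρ σ (∃₁ φ)   = Σ (Fin (size S)) λ a → Sat S (extend a ρ) σ φ
Sat S ρ σ (∀₁ φ)   = ∀ a → Sat S (extend a ρ) σ φ
Sat S ρ σ (∃₂ φ)   = Σ (Fin (size S) → Bool) λ X → Sat S ρ (extend X σ) φ
Sat S ρ σ (∀₂ φ)   = ∀ X → Sat S ρ (extend X σ) φ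

noFO : ∀ {A : Set} → Fin 0 → A
noFO ()

_⊨_ : Str → Sentence → Set
S ⊨ φ = Sat S noFO noFO φ

MSOForestClass : Sentence → Class
MSOForestClass φ S = IsForest S × S ⊨ φ

Restrict : Class → Sentence → Class
Restrict F ψ S = F S × S ⊨ ψ

-- MSO 0-1 law (limits of ratios f_ψ(nd)/f(nd), stated with ε = 1/(k+1))

LimitZero : (ℕ → ℕ) → (ℕ → ℕ) → ℕ → Set
LimitZero fψ f d = ∀ k → ∃[ N ] ∀ n → N ≤ n →
  (0 < f (n * d)) × (suc k * fψ (n * d) ≤ f (n * d))

-- lim f_ψ(nd)/f(nd) = 1   (|f_ψ/f - 1| ≤ 1/(k+1))
LimitOne : (ℕ → ℕ) → (ℕ → ℕ) → ℕ → Set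
LimitOne fψ f d = ∀ k → ∃[ N ] ∀ n → N ≤ n →
  (0 < f (n * d)) × (fψ (n * d) ≤ f (n * d))
    × (suc k * (f (n * d) ∸ fψ (n * d)) ≤ f (n * d))

ZeroOneLaw : Class → (ℕ → ℕ) → ℕ → Set
ZeroOneLaw F f d = ∀ (ψ : Sentence) (fψ : ℕ → ℕ) →
  CountingFunction (Restrict F ψ) fψ → LimitZero fψ f d ⊎ LimitOne fψ f d

ofℕ : ℕ → ℚ
ofℕ n = + n ℚ./ 1

pow : ℚ → ℕ → ℚ
pow x zero    = 1ℚ
pow x (suc n) = x ℚ.* pow x n

partialSum : (ℕ → ℕ) → ℚ → ℕ → ℚ
partialSum c x zero    = 0ℚ
partialSum c x (suc N) = partialSum c x N ℚ.+ (ofℕ (c N) ℚ.* pow x N)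

-- the series converges at x ≥ 0 (nonneg. terms: partial sums bounded)
ConvergesAt : (ℕ → ℕ) → ℚ → Set
ConvergesAt c x = Σ ℚ λ B → ∀ N → partialSum c x N ℚ.≤ B

RadiusGe1 : (ℕ → ℕ) → Set
RadiusGe1 c = ∀ x → 0ℚ ℚ.≤ x → x ℚ.< 1ℚ → ConvergesAt c x

RadiusLe1 : (ℕ → ℕ) → Set
RadiusLe1 c = ∀ x → 1ℚ ℚ.< x → ¬ ConvergesAt c x

RadiusEq1 : (ℕ → ℕ) → Set
RadiusEq1 c = RadiusGe1 c × RadiusLe1 c

{-# OPTIONS --safe #-}

-- Every MSO sentence is recognised by a finite commutative aperiodic forest algebra, so the type of a
-- forest depends only on the multiplicities of the types of its component trees, up to a threshold.
--
-- Call a counting sequence c negligible (for a step e) if c(n) is o of the sum of the c(n - l e) with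
-- l ≥ 1 and 2 l e ≤ n.  If the trees of each type are negligible, so are the forests of each type: count
-- pairs of a forest and a node in it, and shrink simultaneously all copies of the marked tree; the
-- forests that consist mostly of small trees are handled by deleting copies of a frequent small tree.
--
-- If the trees have radius ≥ 1, two loops at the same type must commute as words of contexts (otherwise
-- they generate exponentially many trees).  Hence a type recurs only along one periodic chain, and
-- induction on the set of allowed types shows that trees of each type are negligible.  Applied to the
-- forests that avoid a fixed tree T of size m, negligibility yields f(n) - f(n - m) = o(f(n)).  This gives
-- radius 1, and it shows that almost every forest contains every realised tree type often, so that
-- almost all forests have the same type.
--
-- Conversely, the 0-1 law for "T is a component" makes f(n - m)/f(n) tend to 0 or 1.  The limit 0 is excluded
-- by f(n) ≤ 2^(2n+1), and the limit 1 gives radius 1.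

module Submission where

open import Defs
open import Data.Bool using (Bool; true; false; _∧_; _∨_; not)
import Data.Bool
open import Data.Bool.Properties using (∧-identityʳ; ∨-assoc; ∨-comm)
open import Data.Empty using (⊥; ⊥-elim)
open import Data.Fin using (Fin; toℕ; fromℕ<; splitAt; _↑ˡ_; _↑ʳ_)
import Data.Fin
import Data.Fin.Properties as Finₚ
import Data.Integer as ℤ
open ℤ using () renaming (+_ to ⁺_)
import Data.Integer.Properties as ℤₚ
open import Data.List using (List; []; _∷_; _++_; map; length; filter; upTo; allFin; cartesianProduct; lookup)
open import Data.List.Membership.Propositional using (_∈_)
open import Data.List.Membership.Propositional.Properties
import Data.List.Properties as Listₚ
open import Data.List.Properties using (length-map; length-++; ++-assoc; ++-cancelˡ; ∷-injective)
open import Data.List.Relation.Unary.All as All using (All; []; _∷_)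
import Data.List.Relation.Unary.All.Properties as Allₚ
open import Data.List.Relation.Unary.AllPairs using ([]; _∷_)
open import Data.List.Relation.Unary.Any as Any using (Any; here; there)
import Data.List.Relation.Unary.Any.Properties as Anyₚ
open import Data.List.Relation.Unary.Unique.Propositional using (Unique)
import Data.List.Relation.Unary.Unique.Propositional.Properties as Uniqueₚ
open import Data.Nat using (ℕ; zero; suc; _+_; _*_; _∸_; _^_; _≤_; _<_; z≤n; s≤s; z<s; NonZero; >-nonZero; _≟_; _≤?_; _<?_)
open import Data.Nat.DivMod using (_%_; _/_; /-monoˡ-≤; m≡m%n+[m/n]*n; m%n<n; m%n%n≡m%n; %-distribˡ-+; [m+kn]%n≡m%n; m<n⇒m%n≡m)
open import Data.Nat.Divisibility using (_∣_; divides; ∣-trans; m∣m*n; n∣m*n; ∣-antisym; ∣m+n∣m⇒∣n; ∣n⇒∣m*n; _∣?_; m%n≡0⇒n∣m)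
open import Data.Nat.Properties
open import Data.Nat.Tactic.RingSolver using (solve-∀)
open import Data.Product using (Σ; ∃; ∃-syntax; _×_; _,_; proj₁; proj₂; uncurry)
open import Data.Product.Properties using (≡-dec)
import Data.Rational as ℚ
open ℚ using (ℚ; 0ℚ; 1ℚ)
import Data.Rational.Properties as ℚₚ
import Data.Rational.Solver
import Data.Rational.Unnormalised as ℚᵘ
import Data.Rational.Unnormalised.Properties as ℚᵘₚ
import Data.Sum
open import Data.Sum using (_⊎_; inj₁; inj₂; [_,_]′)
open import Data.Unit using (⊤; tt)
open import Data.Vec using (Vec; []; _∷_)
import Data.Vec as Vec
import Data.Vec.Properties as Vecₚ
open import Function using (_∘_; id; case_of_)
open import Function.Bundles using (_↔_; Inverse; mk↔ₛ′)
open import Relation.Binary.Definitions using (DecidableEquality)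
open import Relation.Binary.PropositionalEquality hiding (J)
open import Relation.Nullary using (¬_; Dec; yes; no; does)
open import Relation.Nullary.Decidable using (map′; _×-dec_; _⊎-dec_; ¬?; dec-true; dec-false)

-- Finite sums

-- No asymptotic formula for the counts is available: the growth of the class may be anything from
-- bounded to superpolynomial. This is why a sequence is compared with its own shifted values. The
-- comparison survives finite sums, chains and multisets, and it pays off once the step is a
-- multiple of the size of T: the tail of the number of forests without T then counts forests with
-- various exact numbers of copies of T, and these are disjoint families inside the whole class. So
-- forests without T are rare, whatever the growth is. The step e must be divisible by the period of
-- each recurring type, so that shifts stay on the chain, and by the size of T. Hence the induction
-- delivers all multiples of some e₀ instead of a single step. If loops X and Y do not commute, XY
-- and YX are two different blocks of equal length and size. They form 2^k words of one common size,
-- and a tree can be read as such a word in at most linearly many ways. All estimates are made over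
-- the naturals: "o of" means that for every L the inequality with factor L holds eventually.

∑ : ∀ {A : Set} → List A → (A → ℕ) → ℕ
∑ []       f = 0
∑ (x ∷ xs) f = f x + ∑ xs f

χ : Bool → ℕ
χ true  = 1
χ false = 0

χ≤1 : ∀ b → χ b ≤ 1
χ≤1 true  = ≤-refl
χ≤1 false = z≤n

χ>0⇒true : ∀ {b} → 0 < χ b → b ≡ true
χ>0⇒true {true} _ = refl

χ-∧ : ∀ a b → χ (a ∧ b) ≡ χ a * χ b
χ-∧ true  b = sym (+-identityʳ (χ b))
χ-∧ false b = refl

∧-elimˡ : ∀ {a b} → a ∧ b ≡ true → a ≡ true
∧-elimˡ {true} _ = refl

∧-elimʳ : ∀ {a b} → a ∧ b ≡ true → b ≡ true
∧-elimʳ {true} p = p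

∧-intro : ∀ {a b} → a ≡ true → b ≡ true → a ∧ b ≡ true
∧-intro refl refl = refl

∨-elim : ∀ {a b} → a ∨ b ≡ true → (a ≡ true) ⊎ (b ≡ true)
∨-elim {true}  _ = inj₁ refl
∨-elim {false} p = inj₂ p

∨-introˡ : ∀ {a b} → a ≡ true → a ∨ b ≡ true
∨-introˡ refl = refl

∨-introʳ : ∀ {a b} → b ≡ true → a ∨ b ≡ true
∨-introʳ {true}  _ = refl
∨-introʳ {false} p = p

∧-swap : ∀ x y z → x ∧ (y ∧ z) ≡ y ∧ (x ∧ z)
∧-swap true  true  z = refl
∧-swap true  false z = refl
∧-swap false true  z = refl
∧-swap false false z = refl

bool-ext : ∀ {a b} → (a ≡ true → b ≡ true) → (b ≡ true → a ≡ true) → a ≡ b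
bool-ext {true}  f g = sym (f refl)
bool-ext {false} {true}  f g = g refl
bool-ext {false} {false} f g = refl

true-or-false : ∀ b → (b ≡ true) ⊎ (b ≡ false)
true-or-false true  = inj₁ refl
true-or-false false = inj₂ refl

true≢false : ∀ {b} → b ≡ true → b ≡ false → ⊥
true≢false refl ()

does⇒ : ∀ {P : Set} (d : Dec P) → does d ≡ true → P
does⇒ (yes p) _ = p

⇒does : ∀ {P : Set} (d : Dec P) → P → does d ≡ true
⇒does d p = dec-true d p

*-swap : ∀ x y z → x * (y * z) ≡ y * (x * z)
*-swap = solve-∀

∑-cong : ∀ {A : Set} (xs : List A) {f g : A → ℕ} → (∀ {x} → x ∈ xs → f x ≡ g x) → ∑ xs f ≡ ∑ xs g
∑-cong []       h = refl
∑-cong (x ∷ xs) h = cong₂ _+_ (h (here refl)) (∑-cong xs (λ p → h (there p)))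

∑-mono : ∀ {A : Set} (xs : List A) {f g : A → ℕ} → (∀ {x} → x ∈ xs → f x ≤ g x) → ∑ xs f ≤ ∑ xs g
∑-mono []       h = z≤n
∑-mono (x ∷ xs) h = +-mono-≤ (h (here refl)) (∑-mono xs (λ p → h (there p)))

∑-0 : ∀ {A : Set} (xs : List A) → ∑ xs (λ _ → 0) ≡ 0
∑-0 []       = refl
∑-0 (x ∷ xs) = ∑-0 xs

∑-zero : ∀ {A : Set} (xs : List A) {f : A → ℕ} → (∀ {x} → x ∈ xs → f x ≡ 0) → ∑ xs f ≡ 0
∑-zero xs h = trans (∑-cong xs h) (∑-0 xs)

∑-const : ∀ {A : Set} (xs : List A) c → ∑ xs (λ _ → c) ≡ length xs * c
∑-const []       c = refl
∑-const (x ∷ xs) c = cong (c +_) (∑-const xs c)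

∑-+ : ∀ {A : Set} (xs : List A) (f g : A → ℕ) → ∑ xs (λ x → f x + g x) ≡ ∑ xs f + ∑ xs g
∑-+ []       f g = refl
∑-+ (x ∷ xs) f g = trans (cong (f x + g x +_) (∑-+ xs f g)) (+-interchange (f x) (g x) (∑ xs f) (∑ xs g))
  where
  +-interchange : ∀ a b c d → a + b + (c + d) ≡ a + c + (b + d)
  +-interchange = solve-∀

∑-*ˡ : ∀ {A : Set} (xs : List A) c (f : A → ℕ) → ∑ xs (λ x → c * f x) ≡ c * ∑ xs f
∑-*ˡ []       c f = sym (*-zeroʳ c)
∑-*ˡ (x ∷ xs) c f = trans (cong (c * f x +_) (∑-*ˡ xs c f)) (sym (*-distribˡ-+ c (f x) (∑ xs f)))

∑-*ʳ : ∀ {A : Set} (xs : List A) c (f : A → ℕ) → ∑ xs (λ x → f x * c) ≡ ∑ xs f * c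
∑-*ʳ xs c f = trans (∑-cong xs (λ {x} _ → *-comm (f x) c)) (trans (∑-*ˡ xs c f) (*-comm c _))

∑-swap : ∀ {A B : Set} (xs : List A) (ys : List B) (f : A → B → ℕ) →
         ∑ xs (λ x → ∑ ys (f x)) ≡ ∑ ys (λ y → ∑ xs (λ x → f x y))
∑-swap []       ys f = sym (∑-0 ys)
∑-swap (x ∷ xs) ys f =
  trans (cong (∑ ys (f x) +_) (∑-swap xs ys f)) (sym (∑-+ ys (f x) (λ y → ∑ xs (λ z → f z y))))

∑-++ : ∀ {A : Set} (xs ys : List A) (f : A → ℕ) → ∑ (xs ++ ys) f ≡ ∑ xs f + ∑ ys f
∑-++ []       ys f = refl
∑-++ (x ∷ xs) ys f = trans (cong (f x +_) (∑-++ xs ys f)) (sym (+-assoc (f x) _ _))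

∑-map : ∀ {A B : Set} (g : A → B) (xs : List A) (f : B → ℕ) → ∑ (map g xs) f ≡ ∑ xs (f ∘ g)
∑-map g []       f = refl
∑-map g (x ∷ xs) f = cong (f (g x) +_) (∑-map g xs f)

∑-× : ∀ {A B : Set} (xs : List A) (ys : List B) (f : A × B → ℕ) →
      ∑ (cartesianProduct xs ys) f ≡ ∑ xs (λ x → ∑ ys (λ y → f (x , y)))
∑-× []       ys f = refl
∑-× (x ∷ xs) ys f = trans (∑-++ (map (x ,_) ys) _ f) (cong₂ _+_ (∑-map (x ,_) ys f) (∑-× xs ys f))

∑-∈ : ∀ {A : Set} {xs : List A} {x} (f : A → ℕ) → x ∈ xs → f x ≤ ∑ xs f
∑-∈ f (here refl) = m≤m+n _ _
∑-∈ f (there p)   = ≤-trans (∑-∈ f p) (m≤n+m _ _)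

∑≡0⇒ : ∀ {A : Set} {xs : List A} {x} {f : A → ℕ} → ∑ xs f ≡ 0 → x ∈ xs → f x ≡ 0
∑≡0⇒ {f = f} e p = n≤0⇒n≡0 (≤-trans (∑-∈ f p) (≤-reflexive e))

-- Only the support of f is mapped, so φ may be arbitrary elsewhere: deleting copies of a tree, for
-- instance, makes sense only where enough copies exist. Most counts below are compared in this way.
∑-inj : ∀ {A B : Set} {f : A → ℕ} {g : B → ℕ} {xs : List A} (ys : List B) (φ : A → B) → Unique xs →
        (∀ {x} → x ∈ xs → 0 < f x → φ x ∈ ys × f x ≤ g (φ x)) →
        (∀ {x y} → x ∈ xs → y ∈ xs → 0 < f x → 0 < f y → φ x ≡ φ y → x ≡ y) →
        ∑ xs f ≤ ∑ ys g
∑-inj {xs = []} ys φ u into inj = z≤n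
∑-inj {f = f} {g} {x ∷ xs} ys φ (x∉xs ∷ u) into inj with f x in eq
... | zero = ∑-inj ys φ u (λ p → into (there p)) (λ p q → inj (there p) (there q))
... | suc _ with into (here refl) (subst (0 <_) (sym eq) z<s)
...   | φx∈ys , fx≤ with ∈-∃++ φx∈ys
...     | as , bs , refl = begin
  suc _ + ∑ xs f                    ≡⟨ cong (_+ ∑ xs f) (sym eq) ⟩
  f x + ∑ xs f                      ≤⟨ +-mono-≤ fx≤ (∑-inj (as ++ bs) φ u into′ (λ p q → inj (there p) (there q))) ⟩
  g (φ x) + ∑ (as ++ bs) g          ≡⟨ cong (g (φ x) +_) (∑-++ as bs g) ⟩
  g (φ x) + (∑ as g + ∑ bs g)       ≡⟨ move (g (φ x)) (∑ as g) (∑ bs g) ⟩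
  ∑ as g + (g (φ x) + ∑ bs g)       ≡⟨ sym (∑-++ as (φ x ∷ bs) g) ⟩
  ∑ (as ++ φ x ∷ bs) g              ∎
  where
  open ≤-Reasoning
  move : ∀ a b c → a + (b + c) ≡ b + (a + c)
  move = solve-∀
  into′ : ∀ {y} → y ∈ xs → 0 < f y → φ y ∈ (as ++ bs) × f y ≤ g (φ y)
  into′ {y} y∈ fy with into (there y∈) fy
  ... | φy∈ , le with ∈-++⁻ as φy∈
  ...   | inj₁ p         = ∈-++⁺ˡ p , le
  ...   | inj₂ (there p) = ∈-++⁺ʳ as p , le
  ...   | inj₂ (here e)  = ⊥-elim (All.lookup x∉xs y∈ (sym (inj (there y∈) (here refl) fy (subst (0 <_) (sym eq) z<s) e)))

∑-≤ : ∀ {A : Set} {xs : List A} (f : A → ℕ) c → (∀ {x} → x ∈ xs → f x ≤ c) → ∑ xs f ≤ length xs * c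
∑-≤ {xs = xs} f c h = ≤-trans (∑-mono xs h) (≤-reflexive (∑-const xs c))

∑-δ : ∀ {A : Set} (_≟A_ : DecidableEquality A) {xs : List A} {a} (f : A → ℕ) → Unique xs → a ∈ xs →
      ∑ xs (λ x → χ (does (a ≟A x)) * f x) ≡ f a
∑-δ _≟A_ {x ∷ xs} {a} f (x∉ ∷ u) (here refl) with a ≟A a
... | no ¬p = ⊥-elim (¬p refl)
... | yes _ = trans (cong₂ _+_ (+-identityʳ (f a)) (∑-zero xs zer)) (+-identityʳ (f a))
  where
  zer : ∀ {y} → y ∈ xs → χ (does (a ≟A y)) * f y ≡ 0
  zer {y} y∈ rewrite dec-false (a ≟A y) (All.lookup x∉ y∈) = refl
∑-δ _≟A_ {x ∷ xs} {a} f (x∉ ∷ u) (there p)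
  rewrite dec-false (a ≟A x) (λ e → All.lookup x∉ p (sym e)) = ∑-δ _≟A_ f u p

max-bound : ∀ {A : Set} (xs : List A) (P : A → ℕ → Set) →
            (∀ x → ∃[ N ] ∀ n → N ≤ n → P x n) → ∃[ N ] ∀ {x} → x ∈ xs → ∀ n → N ≤ n → P x n
max-bound []       P h = 0 , λ ()
max-bound (x ∷ xs) P h with h x | max-bound xs P h
... | N₁ , p₁ | N₂ , p₂ = N₁ + N₂ , λ where
  (here refl) n le → p₁ n (≤-trans (m≤m+n N₁ N₂) le)
  (there q)   n le → p₂ q n (≤-trans (m≤n+m N₂ N₁) le)

-- Unlabelled forests as multisets of trees

-- `a ▸ b` is the forest consisting of the tree whose root has child forest `a`,
-- together with the trees of `b`.  A tree is identified with its child forest.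
infixr 5 _▸_
data Fo : Set where
  ε   : Fo
  _▸_ : Fo → Fo → Fo

sz : Fo → ℕ
sz ε       = 0
sz (a ▸ b) = suc (sz a + sz b)

▸-injective : ∀ {a b c d} → a ▸ b ≡ c ▸ d → a ≡ c × b ≡ d
▸-injective refl = refl , refl

-- The pairing 2^a(2b+1) is injective, so comparing codes is a total order on forests. Sorting by it
-- yields canonical representatives of unlabelled forests.
code : Fo → ℕ
code ε       = 0
code (a ▸ b) = suc (2 ^ code a * suc (2 * code b))

pair-injective : ∀ a b c d → 2 ^ a * suc (2 * b) ≡ 2 ^ c * suc (2 * d) → a ≡ c × b ≡ d
pair-injective zero b zero d e =
  refl , *-cancelˡ-≡ b d 2 (suc-injective (trans (sym (+-identityʳ _)) (trans e (+-identityʳ _))))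
pair-injective zero b (suc c) d e =
  ⊥-elim (even≢odd (2 ^ c * suc (2 * d)) b (sym (trans (sym (+-identityʳ _)) (trans e (*-assoc 2 (2 ^ c) _)))))
pair-injective (suc a) b zero d e =
  ⊥-elim (even≢odd (2 ^ a * suc (2 * b)) d (trans (sym (*-assoc 2 (2 ^ a) _)) (trans e (+-identityʳ _))))
pair-injective (suc a) b (suc c) d e
  with pair-injective a b c d (*-cancelˡ-≡ _ _ 2 (trans (sym (*-assoc 2 (2 ^ a) _)) (trans e (*-assoc 2 (2 ^ c) _))))
... | p , q = cong suc p , q

code-injective : ∀ {a b} → code a ≡ code b → a ≡ b
code-injective {ε}     {ε}     e = refl
code-injective {a ▸ b} {c ▸ d} e with pair-injective (code a) (code b) (code c) (code d) (suc-injective e)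
... | p , q = cong₂ _▸_ (code-injective p) (code-injective q)

_≟F_ : DecidableEquality Fo
ε       ≟F ε       = yes refl
ε       ≟F (_ ▸ _) = no λ ()
(_ ▸ _) ≟F ε       = no λ ()
(a ▸ b) ≟F (c ▸ d) with a ≟F c | b ≟F d
... | yes p | yes q = yes (cong₂ _▸_ p q)
... | yes _ | no ¬q = no (¬q ∘ proj₂ ∘ ▸-injective)
... | no ¬p | _     = no (¬p ∘ proj₁ ∘ ▸-injective)

_==_ : Fo → Fo → Bool
a == b = does (a ≟F b)

==-refl : ∀ a → (a == a) ≡ true
==-refl a = dec-true (a ≟F a) refl

infix 4 _⊑_
_⊑_ : Fo → Fo → Set
a ⊑ b = code a ≤ code b

_⊑?_ : ∀ a b → Dec (a ⊑ b)
a ⊑? b = code a ≤? code b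

⊑-antisym : ∀ {a b} → a ⊑ b → b ⊑ a → a ≡ b
⊑-antisym p q = code-injective (≤-antisym p q)

⊑-flip : ∀ {a b} → ¬ (a ⊑ b) → b ⊑ a
⊑-flip ¬p = <⇒≤ (≰⇒> ¬p)

ins : Fo → Fo → Fo
ins a ε = a ▸ ε
ins a (b ▸ c) with a ⊑? b
... | yes _ = a ▸ b ▸ c
... | no  _ = b ▸ ins a c

ins-≤ : ∀ {a b} c → a ⊑ b → ins a (b ▸ c) ≡ a ▸ b ▸ c
ins-≤ {a} {b} c p with a ⊑? b
... | yes _ = refl
... | no ¬p = ⊥-elim (¬p p)

ins-> : ∀ {a b} c → ¬ (a ⊑ b) → ins a (b ▸ c) ≡ b ▸ ins a c
ins-> {a} {b} c ¬p with a ⊑? b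
... | yes p = ⊥-elim (¬p p)
... | no _  = refl

-- Sorting forgets the order of insertion. Through this law `norm` is constant on the classes of
-- `~`, whose only essential generator is `~swap`.
ins-comm : ∀ a b c → ins a (ins b c) ≡ ins b (ins a c)
ins-comm a b ε with a ⊑? b | b ⊑? a
... | yes p | yes q = cong₂ (λ x y → x ▸ y ▸ ε) (⊑-antisym p q) (⊑-antisym q p)
... | yes p | no ¬q = refl
... | no ¬p | yes q = refl
... | no ¬p | no ¬q = ⊥-elim (¬q (⊑-flip ¬p))
ins-comm a b (c ▸ d) with b ⊑? c | a ⊑? c
... | yes p | yes q = lem
  where
  lem : ins a (b ▸ c ▸ d) ≡ ins b (a ▸ c ▸ d)
  lem with a ⊑? b | b ⊑? a
  ... | yes r | yes s = cong₂ (λ x y → x ▸ y ▸ c ▸ d) (⊑-antisym r s) (⊑-antisym s r)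
  ... | yes r | no ¬s = cong (a ▸_) (sym (ins-≤ d p))
  ... | no ¬r | yes s = cong (b ▸_) (ins-≤ d q)
  ... | no ¬r | no ¬s = ⊥-elim (¬s (⊑-flip ¬r))
... | yes p | no ¬q = trans (ins-> (c ▸ d) (λ r → ¬q (≤-trans r p))) (trans (cong (b ▸_) (ins-> d ¬q)) (sym (ins-≤ (ins a d) p)))
... | no ¬p | yes q = trans (ins-≤ (ins b d) q) (sym (trans (ins-> (c ▸ d) (λ r → ¬p (≤-trans r q))) (cong (a ▸_) (ins-> d ¬p))))
... | no ¬p | no ¬q = trans (ins-> (ins b d) ¬q) (trans (cong (c ▸_) (ins-comm a b d)) (sym (ins-> (ins a d) ¬p)))

Hd : Fo → Fo → Set
Hd a ε       = ⊤
Hd a (b ▸ c) = a ⊑ b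

-- Lists of trees are sorted by code at every level, so that isomorphic canonical forests are equal
-- (`iso⇒~` followed by `~⇒≡`).
Can : Fo → Set
Can ε       = ⊤
Can (a ▸ b) = Can a × Can b × Hd a b

Hd? : ∀ a b → Dec (Hd a b)
Hd? a ε       = yes tt
Hd? a (b ▸ c) = a ⊑? b

Can? : ∀ a → Dec (Can a)
Can? ε       = yes tt
Can? (a ▸ b) = Can? a ×-dec (Can? b ×-dec Hd? a b)

ins-Hd : ∀ {a b} → Hd a b → ins a b ≡ a ▸ b
ins-Hd {b = ε}     h = refl
ins-Hd {b = b ▸ c} h = ins-≤ c h

Hd-ins : ∀ {a b c} → a ⊑ b → Hd a c → Hd a (ins b c)
Hd-ins {c = ε} p h = p
Hd-ins {b = b} {c ▸ d} p h with b ⊑? c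
... | yes _ = p
... | no  _ = h

Can-ins : ∀ {a b} → Can a → Can b → Can (ins a b)
Can-ins {b = ε} ca cb = ca , tt , tt
Can-ins {a} {b ▸ c} ca (cb , cc , h) with a ⊑? b
... | yes p = ca , (cb , cc , h) , p
... | no ¬p = cb , Can-ins ca cc , Hd-ins (⊑-flip ¬p) h

norm : Fo → Fo
norm ε       = ε
norm (a ▸ b) = ins (norm a) (norm b)

Can-norm : ∀ a → Can (norm a)
Can-norm ε       = tt
Can-norm (a ▸ b) = Can-ins (Can-norm a) (Can-norm b)

norm-Can : ∀ {a} → Can a → norm a ≡ a
norm-Can {ε}     c = refl
norm-Can {a ▸ b} (ca , cb , h) = trans (cong₂ ins (norm-Can ca) (norm-Can cb)) (ins-Hd h)

infix 4 _~_
data _~_ : Fo → Fo → Set where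
  ~ε     : ε ~ ε
  ~▸     : ∀ {a b c d} → a ~ c → b ~ d → a ▸ b ~ c ▸ d
  ~swap  : ∀ {a b c} → a ▸ b ▸ c ~ b ▸ a ▸ c
  ~trans : ∀ {a b c} → a ~ b → b ~ c → a ~ c

~refl : ∀ {a} → a ~ a
~refl {ε}     = ~ε
~refl {a ▸ b} = ~▸ ~refl ~refl

~sym : ∀ {a b} → a ~ b → b ~ a
~sym ~ε           = ~ε
~sym (~▸ p q)     = ~▸ (~sym p) (~sym q)
~sym ~swap        = ~swap
~sym (~trans p q) = ~trans (~sym q) (~sym p)

ins-~ : ∀ a b → ins a b ~ a ▸ b
ins-~ a ε = ~refl
ins-~ a (b ▸ c) with a ⊑? b
... | yes _ = ~refl
... | no  _ = ~trans (~▸ ~refl (ins-~ a c)) ~swap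

norm-~ : ∀ a → norm a ~ a
norm-~ ε       = ~ε
norm-~ (a ▸ b) = ~trans (ins-~ (norm a) (norm b)) (~▸ (norm-~ a) (norm-~ b))

~⇒norm : ∀ {a b} → a ~ b → norm a ≡ norm b
~⇒norm ~ε           = refl
~⇒norm (~▸ p q)     = cong₂ ins (~⇒norm p) (~⇒norm q)
~⇒norm (~swap {a} {b} {c}) = ins-comm (norm a) (norm b) (norm c)
~⇒norm (~trans p q) = trans (~⇒norm p) (~⇒norm q)

~⇒≡ : ∀ {a b} → Can a → Can b → a ~ b → a ≡ b
~⇒≡ ca cb p = trans (sym (norm-Can ca)) (trans (~⇒norm p) (norm-Can cb))

mult : Fo → Fo → ℕ
mult a ε       = 0
mult a (b ▸ c) = χ (a == b) + mult a c

mult-ins : ∀ a b c → mult a (ins b c) ≡ χ (a == b) + mult a c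
mult-ins a b ε = refl
mult-ins a b (c ▸ d) with b ⊑? c
... | yes _ = refl
... | no  _ = trans (cong (χ (a == c) +_) (mult-ins a b d)) (swap (χ (a == c)) (χ (a == b)) (mult a d))
  where
  swap : ∀ x y z → x + (y + z) ≡ y + (x + z)
  swap = solve-∀

del : Fo → Fo → Fo
del a ε = ε
del a (b ▸ c) with a ≟F b
... | yes _ = c
... | no  _ = b ▸ del a c

del-ins : ∀ a b → del a (ins a b) ≡ b
del-ins a ε with a ≟F a
... | yes _ = refl
... | no ¬p = ⊥-elim (¬p refl)
del-ins a (b ▸ c) with a ⊑? b
... | yes p with a ≟F a
...   | yes _ = refl
...   | no ¬q = ⊥-elim (¬q refl)
del-ins a (b ▸ c) | no ¬p with a ≟F b
...   | yes refl = ⊥-elim (¬p ≤-refl)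
...   | no _     = cong (b ▸_) (del-ins a c)

ins-injectiveʳ : ∀ a {b c} → ins a b ≡ ins a c → b ≡ c
ins-injectiveʳ a {b} {c} e = trans (sym (del-ins a b)) (trans (cong (del a) e) (del-ins a c))

-- If a and b differed, the multiplicity of a would tell the two insertions apart.
ins-injectiveˡ : ∀ {a b} c → ins a c ≡ ins b c → a ≡ b
ins-injectiveˡ {a} {b} c e with a ≟F b
... | yes p = p
... | no ¬p = ⊥-elim (1+n≢n (begin
  suc (mult a c)           ≡⟨ cong (λ z → χ z + mult a c) (sym (==-refl a)) ⟩
  χ (a == a) + mult a c    ≡⟨ sym (mult-ins a a c) ⟩
  mult a (ins a c)         ≡⟨ cong (mult a) e ⟩
  mult a (ins b c)         ≡⟨ mult-ins a b c ⟩
  χ (a == b) + mult a c    ≡⟨ cong (λ z → χ z + mult a c) (dec-false (a ≟F b) ¬p) ⟩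
  mult a c                 ∎))
  where open ≡-Reasoning

Hd-mult : ∀ {a b c} → Can c → Hd b c → 0 < mult a c → b ⊑ a
Hd-mult {a} {b} {c ▸ d} (cc , cd , h) p m with a ≟F c
... | yes refl = p
... | no ¬q    = ≤-trans p (Hd-mult cd h m)

Hd-del : ∀ {a b} c → Can c → Hd b c → Hd b (del a c)
Hd-del ε _ h = tt
Hd-del {a} (c ▸ d) (cc , cd , h′) h with a ≟F c
Hd-del (c ▸ ε) (cc , cd , h′) h | yes _ = tt
Hd-del (c ▸ d ▸ e) (cc , cd , h′) h | yes _ = ≤-trans h h′
... | no _  = h

Can-del : ∀ {a} b → Can b → Can (del a b)
Can-del ε c = tt
Can-del {a} (b ▸ c) (cb , cc , h) with a ≟F b
... | yes _ = cc
... | no  _ = cb , Can-del c cc , Hd-del c cc h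

ins-del : ∀ {a b} → Can b → 0 < mult a b → ins a (del a b) ≡ b
ins-del {a} {b ▸ c} (cb , cc , h) m with a ≟F b
... | yes refl = ins-Hd h
... | no ¬p    = trans (ins-> (del a c) (λ q → ¬p (⊑-antisym q (Hd-mult cc h m)))) (cong (b ▸_) (ins-del cc m))

size-ins : ∀ a b → (sz (ins a b)) ≡ suc ((sz a) + (sz b))
size-ins a ε = refl
size-ins a (b ▸ c) with a ⊑? b
... | yes _ = refl
... | no  _ = cong suc (trans (cong ((sz b) +_) (size-ins a c)) (swap (sz b) (sz a) (sz c)))
  where
  swap : ∀ x y z → x + suc (y + z) ≡ y + suc (x + z)
  swap = solve-∀

insn : ℕ → Fo → Fo → Fo
insn zero    a b = b
insn (suc i) a b = ins a (insn i a b)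

mult-insn-same : ∀ i a b → mult a (insn i a b) ≡ i + mult a b
mult-insn-same zero    a b = refl
mult-insn-same (suc i) a b =
  trans (mult-ins a a (insn i a b)) (cong₂ (λ z w → χ z + w) (==-refl a) (mult-insn-same i a b))

Can-insn : ∀ i {a b} → Can a → Can b → Can (insn i a b)
Can-insn zero    ca cb = cb
Can-insn (suc i) ca cb = Can-ins ca (Can-insn i ca cb)

insn-injective : ∀ i a {b c} → insn i a b ≡ insn i a c → b ≡ c
insn-injective zero    a e = e
insn-injective (suc i) a e = insn-injective i a (ins-injectiveʳ a e)

size-insn : ∀ i a b → (sz (insn i a b)) ≡ i * suc (sz a) + (sz b)
size-insn zero    a b = refl
size-insn (suc i) a b = trans (size-ins a _) (cong suc (trans (cong ((sz a) +_) (size-insn i a b)) (sym (+-assoc (sz a) _ _))))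

insn-split : ∀ i {a b} → Can b → i ≤ mult a b → Σ Fo λ c → Can c × b ≡ insn i a c × mult a b ≡ i + mult a c
insn-split zero {b = b} cb _ = b , cb , refl , refl
insn-split (suc i) {a} {b} cb le with insn-split i (Can-del {a} b cb) le′
  where
  eq : mult a b ≡ suc (mult a (del a b))
  eq = trans (cong (mult a) (sym (ins-del cb (≤-trans (s≤s z≤n) le))))
             (trans (mult-ins a a (del a b)) (cong (λ z → χ z + mult a (del a b)) (==-refl a)))
  le′ : i ≤ mult a (del a b)
  le′ = ≤-pred (subst (suc i ≤_) eq le)
... | c , cc , e , m = c , cc , trans (sym (ins-del cb (≤-trans (s≤s z≤n) le))) (cong (ins a) e) ,
  trans (cong (mult a) (sym (ins-del cb (≤-trans (s≤s z≤n) le))))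
   (trans (mult-ins a a (del a b)) (cong₂ (λ z w → χ z + w) (==-refl a) m))

-- Enumeration of the canonical forests of a given size

enumDepth : ℕ → List Fo
enumDepth zero    = ε ∷ []
enumDepth (suc k) = ε ∷ map (uncurry _▸_) (cartesianProduct (enumDepth k) (enumDepth k))

enumDepth! : ∀ k → Unique (enumDepth k)
enumDepth! zero    = [] ∷ []
enumDepth! (suc k) =
  All.tabulate (λ p e → case ∈-map⁻ (uncurry _▸_) p of λ where (_ , _ , q) → ε≢▸ (trans e q))
  ∷ Uniqueₚ.map⁺ (λ e → cong₂ _,_ (proj₁ (▸-injective e)) (proj₂ (▸-injective e)))
      (Uniqueₚ.cartesianProduct⁺ (enumDepth! k) (enumDepth! k))
  where
  ε≢▸ : ∀ {a b} → ε ≢ a ▸ b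
  ε≢▸ ()

∈-enumDepth : ∀ k a → (sz a) ≤ k → a ∈ enumDepth k
∈-enumDepth zero    ε       _ = here refl
∈-enumDepth (suc k) ε       _ = here refl
∈-enumDepth (suc k) (a ▸ b) (s≤s le) =
  there (∈-map⁺ (uncurry _▸_) (∈-cartesianProduct⁺ (∈-enumDepth k a (≤-trans (m≤m+n _ _) le)) (∈-enumDepth k b (≤-trans (m≤n+m _ _) le))))

abstract
  E : ℕ → List Fo
  E n = filter (λ a → Can? a ×-dec ((sz a) ≟ n)) (enumDepth n)

  E! : ∀ n → Unique (E n)
  E! n = Uniqueₚ.filter⁺ _ (enumDepth! n)

  ∈-E⁺ : ∀ {a} → Can a → a ∈ E (sz a)
  ∈-E⁺ {a} c = ∈-filter⁺ _ (∈-enumDepth (sz a) a ≤-refl) (c , refl)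

  ∈-E⁻ : ∀ {a n} → a ∈ E n → Can a × (sz a) ≡ n
  ∈-E⁻ {n = n} p = proj₂ (∈-filter⁻ (λ a → Can? a ×-dec ((sz a) ≟ n)) {xs = enumDepth n} p)

∈-E⁺′ : ∀ {a n} → Can a → (sz a) ≡ n → a ∈ E n
∈-E⁺′ c refl = ∈-E⁺ c

count : ℕ → (Fo → Bool) → ℕ
count n P = ∑ (E n) (λ a → χ (P a))

allC : (Fo → Bool) → Fo → Bool
allC B ε       = true
allC B (a ▸ b) = B a ∧ allC B b

allC-ins : ∀ B a b → allC B (ins a b) ≡ B a ∧ allC B b
allC-ins B a ε = refl
allC-ins B a (b ▸ c) with a ⊑? b
... | yes _ = refl
... | no  _ = trans (cong (B b ∧_) (allC-ins B a c)) (∧-swap (B b) (B a) (allC B c))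

csum : (Fo → ℕ) → Fo → ℕ
csum w ε       = 0
csum w (a ▸ b) = w a + csum w b

-- Trees are represented by their child forests, so every component of a forest of size at most n
-- has an index of size below n; `upTo n` therefore meets each of them.
csum-mult : ∀ w n {a} → Can a → (sz a) ≤ n → ∑ (upTo n) (λ k → ∑ (E k) (λ b → w b * mult b a)) ≡ csum w a
csum-mult w n {ε} ca le = ∑-zero (upTo n) (λ {k} _ → ∑-zero (E k) (λ {b} _ → *-zeroʳ (w b)))
csum-mult w n {a ▸ a′} (ca , ca′ , _) le = begin
  ∑ (upTo n) (λ k → ∑ (E k) (λ b → w b * (χ (b == a) + mult b a′)))
    ≡⟨ ∑-cong (upTo n) (λ {k} _ → trans (∑-cong (E k) (λ {b} _ → *-distribˡ-+ (w b) (χ (b == a)) (mult b a′))) (∑-+ (E k) _ _)) ⟩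
  ∑ (upTo n) (λ k → ∑ (E k) (λ b → w b * χ (b == a)) + ∑ (E k) (λ b → w b * mult b a′))
    ≡⟨ ∑-+ (upTo n) _ _ ⟩
  ∑ (upTo n) (λ k → ∑ (E k) (λ b → w b * χ (b == a))) + ∑ (upTo n) (λ k → ∑ (E k) (λ b → w b * mult b a′))
    ≡⟨ cong₂ _+_ (trans (∑-cong (upTo n) inner) (∑-δ _≟_ {a = sz a} (λ _ → w a) (Uniqueₚ.upTo⁺ n) (∈-upTo⁺ (≤-trans (s≤s (m≤m+n _ _)) le))))
                 (csum-mult w n ca′ (≤-trans (≤-trans (m≤n+m _ _) (n≤1+n _)) le)) ⟩
  w a + csum w a′ ∎
  where
  open ≡-Reasoning
  χ-sym : ∀ b → χ (b == a) ≡ χ (a == b)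
  χ-sym b = cong χ (bool-ext (λ p → ⇒does (a ≟F b) (sym (does⇒ (b ≟F a) p))) (λ p → ⇒does (b ≟F a) (sym (does⇒ (a ≟F b) p))))
  inner : ∀ {k} → k ∈ upTo n → ∑ (E k) (λ b → w b * χ (b == a)) ≡ χ (does ((sz a) ≟ k)) * w a
  inner {k} _ with (sz a) ≟ k
  ... | yes refl = trans (∑-cong (E k) (λ {b} _ → trans (*-comm (w b) _) (cong (_* w b) (χ-sym b))))
                     (trans (∑-δ _≟F_ w (E! k) (∈-E⁺ ca)) (trans (sym (+-identityʳ (w a)))
                       (cong (λ z → χ z * w a) (sym (dec-true (sz a ≟ sz a) refl)))))
  ... | no ¬p = trans (∑-zero (E k) zer) (cong (λ z → χ z * w a) (sym (dec-false (sz a ≟ k) ¬p)))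
    where
    zer : ∀ {b} → b ∈ E k → w b * χ (b == a) ≡ 0
    zer {b} b∈ rewrite dec-false (b ≟F a) (λ e → ¬p (trans (cong sz (sym e)) (proj₂ (∈-E⁻ b∈)))) = *-zeroʳ (w b)

-- Finite aperiodic forest algebras

record Finite (A : Set) : Set where
  field
    elems    : List A
    complete : ∀ x → x ∈ elems
    unique   : Unique elems
    _≈?_     : DecidableEquality A

  ∃? : ∀ {P : A → Set} → (∀ x → Dec (P x)) → Dec (∃ P)
  ∃? P? = map′ Any.satisfied (λ (x , p) → lose′ (complete x) p) (Any.any? P? elems)
    where
    lose′ : ∀ {P : A → Set} {x xs} → x ∈ xs → P x → Any P xs
    lose′ (here refl) p = here p
    lose′ (there q)   p = there (lose′ q p)

  ∀? : ∀ {P : A → Set} → (∀ x → Dec (P x)) → Dec (∀ x → P x)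
  ∀? P? = map′ (λ a x → All.lookup a (complete x)) (λ f → All.tabulate (λ {x} _ → f x)) (All.all? P? elems)

finBool : Finite Bool
finBool = record
  { elems    = true ∷ false ∷ []
  ; complete = λ where true → here refl ; false → there (here refl)
  ; unique   = ((λ ()) ∷ []) ∷ [] ∷ []
  ; _≈?_     = Data.Bool._≟_
  }

fin× : ∀ {A B} → Finite A → Finite B → Finite (A × B)
fin× a b = record
  { elems    = cartesianProduct (elems a) (elems b)
  ; complete = λ (x , y) → ∈-cartesianProduct⁺ (complete a x) (complete b y)
  ; unique   = Uniqueₚ.cartesianProduct⁺ (unique a) (unique b)
  ; _≈?_     = ≡-dec (_≈?_ a) (_≈?_ b)
  }
  where open Finite

finFin : ∀ n → Finite (Fin n)
finFin n = record
  { elems = allFin n ; complete = ∈-allFin ; unique = Uniqueₚ.allFin⁺ n ; _≈?_ = Finₚ._≟_ }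

finVec : ∀ n → Finite (Vec Bool n)
finVec zero = record
  { elems = [] ∷ [] ; complete = (λ where [] → here refl) ; unique = [] ∷ [] ; _≈?_ = λ where [] [] → yes refl }
finVec (suc n) = record
  { elems    = map (uncurry _∷_) (elems F)
  ; complete = λ where (b ∷ v) → ∈-map⁺ (uncurry _∷_) (complete F (b , v))
  ; unique   = Uniqueₚ.map⁺ (λ where refl → refl) (unique F)
  ; _≈?_     = Vecₚ.≡-dec Data.Bool._≟_
  }
  where
  open Finite
  F : Finite (Bool × Vec Bool n)
  F = fin× finBool (finVec n)

data Count : Set where none one many : Count

finCount : Finite Count
finCount = record
  { elems    = none ∷ one ∷ many ∷ []
  ; complete = λ where none → here refl ; one → there (here refl) ; many → there (there (here refl))
  ; unique   = ((λ ()) ∷ (λ ()) ∷ []) ∷ ((λ ()) ∷ []) ∷ [] ∷ []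
  ; _≈?_     = λ where none none → yes refl ; none one → no λ () ; none many → no λ ()
                       one none → no λ () ; one one → yes refl ; one many → no λ ()
                       many none → no λ () ; many one → no λ () ; many many → yes refl
  }

power : {M : Set} → (M → M → M) → M → ℕ → M → M
power _∙_ e zero    x = e
power _∙_ e (suc n) x = x ∙ power _∙_ e n x

-- Forest values form a commutative monoid, and `rt l` adds a root labelled l. Siblings are
-- unordered, so formulas cannot count them modulo an integer; `aperiodic` records this, and every
-- construction has to preserve it, projection included.
record Alg (L : Set) : Set₁ where
  infixr 6 _∙_
  field
    M    : Set
    fin  : Finite M
    _∙_  : M → M → M
    e₀   : M
    rt   : L → M → M
    assoc : ∀ x y z → (x ∙ y) ∙ z ≡ x ∙ (y ∙ z)
    comm  : ∀ x y → x ∙ y ≡ y ∙ x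
    idˡ   : ∀ x → e₀ ∙ x ≡ x
    threshold : ℕ
    aperiodic : ∀ x → power _∙_ e₀ (suc threshold) x ≡ power _∙_ e₀ threshold x

  open Finite fin public

  pw : ℕ → M → M
  pw = power _∙_ e₀

  idʳ : ∀ x → x ∙ e₀ ≡ x
  idʳ x = trans (comm x e₀) (idˡ x)

  swap-∙ : ∀ x y z → x ∙ (y ∙ z) ≡ y ∙ (x ∙ z)
  swap-∙ x y z = trans (sym (assoc x y z)) (trans (cong (_∙ z) (comm x y)) (assoc y x z))

  pw-+ : ∀ m n x → pw (m + n) x ≡ pw m x ∙ pw n x
  pw-+ zero    n x = sym (idˡ _)
  pw-+ (suc m) n x = trans (cong (x ∙_) (pw-+ m n x)) (sym (assoc x _ _))

  pw-stable : ∀ n x → threshold ≤ n → pw n x ≡ pw threshold x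
  pw-stable n x le = trans (cong (λ k → pw k x) (sym (m∸n+n≡m le))) (go (n ∸ threshold))
    where
    go : ∀ d → pw (d + threshold) x ≡ pw threshold x
    go zero    = refl
    go (suc d) = trans (cong (x ∙_) (go d)) (aperiodic x)

-- Nodes of a forest and evaluation of labelled forests

data Pos : Fo → Set where
  top   : ∀ {a b} → Pos (a ▸ b)
  down  : ∀ {a b} → Pos a → Pos (a ▸ b)
  right : ∀ {a b} → Pos b → Pos (a ▸ b)

ltP : ∀ {a} → Pos a → Pos a → Bool
ltP (down p)  top       = true
ltP (down p)  (down q)  = ltP p q
ltP (right p) (right q) = ltP p q
ltP top       _         = false
ltP (down _)  (right _) = false
ltP (right _) top       = false
ltP (right _) (down _)  = false

_≟P_ : ∀ {a} → DecidableEquality (Pos a)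
top     ≟P top     = yes refl
top     ≟P down _  = no λ ()
top     ≟P right _ = no λ ()
down _  ≟P top     = no λ ()
down p  ≟P down q  = map′ (cong down) (λ where refl → refl) (p ≟P q)
down _  ≟P right _ = no λ ()
right _ ≟P top     = no λ ()
right _ ≟P down _  = no λ ()
right p ≟P right q = map′ (cong right) (λ where refl → refl) (p ≟P q)

eqP : ∀ {a} → Pos a → Pos a → Bool
eqP p q = does (p ≟P q)

glue : ∀ {A : Set} {a b} → A → (Pos a → A) → (Pos b → A) → Pos (a ▸ b) → A
glue x f g top       = x
glue x f g (down p)  = f p
glue x f g (right p) = g p

module _ {L : Set} (A : Alg L) where
  open Alg A

  fold : ∀ a → (Pos a → L) → M
  fold ε       α = e₀
  fold (a ▸ b) α = rt (α top) (fold a (α ∘ down)) ∙ fold b (α ∘ right)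

  fold-ext : ∀ a {α β : Pos a → L} → (∀ p → α p ≡ β p) → fold a α ≡ fold a β
  fold-ext ε       h = refl
  fold-ext (a ▸ b) h =
    cong₂ _∙_ (cong₂ rt (h top) (fold-ext a (λ p → h (down p)))) (fold-ext b (λ p → h (right p)))

module _ {L : Set} (bx by : L → Bool) where

  private
    B₂ : Set
    B₂ = Bool × Bool
    _⊹_ : B₂ → B₂ → B₂
    (a , b) ⊹ (c , d) = a ∨ c , b ∨ d

  -- First component: some node satisfies `bx`.  Second: some node satisfying `bx` lies below one satisfying `by`.
  belowAlg : Alg L
  belowAlg = record
    { M = B₂ ; fin = fin× finBool finBool ; _∙_ = _⊹_ ; e₀ = false , false
    ; rt = λ l (h , g) → h ∨ bx l , g ∨ (by l ∧ h)
    ; assoc = λ (a , b) (c , d) (e , f) → cong₂ _,_ (∨-assoc a c e) (∨-assoc b d f)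
    ; comm = λ (a , b) (c , d) → cong₂ _,_ (∨-comm a c) (∨-comm b d)
    ; idˡ = λ _ → refl
    ; threshold = 1
    ; aperiodic = λ where (true , true) → refl ; (true , false) → refl ; (false , true) → refl ; (false , false) → refl
    }

  has⇒ : ∀ a (α : Pos a → L) → proj₁ (fold belowAlg a α) ≡ true → ∃ λ p → bx (α p) ≡ true
  has⇒ (a ▸ b) α e with ∨-elim {proj₁ (fold belowAlg a (α ∘ down)) ∨ bx (α top)} e
  ... | inj₂ e₂ = let p , q = has⇒ b _ e₂ in right p , q
  ... | inj₁ e₁ with ∨-elim {proj₁ (fold belowAlg a (α ∘ down))} e₁
  ...   | inj₁ e₃ = let p , q = has⇒ a _ e₃ in down p , q
  ...   | inj₂ e₃ = top , e₃

  ⇒has : ∀ a (α : Pos a → L) p → bx (α p) ≡ true → proj₁ (fold belowAlg a α) ≡ true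
  ⇒has (a ▸ b) α top       e = ∨-introˡ (∨-introʳ {proj₁ (fold belowAlg a (α ∘ down))} e)
  ⇒has (a ▸ b) α (down p)  e = ∨-introˡ (∨-introˡ (⇒has a _ p e))
  ⇒has (a ▸ b) α (right p) e = ∨-introʳ {proj₁ (fold belowAlg a (α ∘ down)) ∨ bx (α top)} (⇒has b _ p e)

  below⇒ : ∀ a (α : Pos a → L) → proj₂ (fold belowAlg a α) ≡ true →
           ∃ λ p → ∃ λ q → bx (α p) ≡ true × by (α q) ≡ true × ltP p q ≡ true
  below⇒ (a ▸ b) α e with ∨-elim {proj₂ (fold belowAlg a (α ∘ down)) ∨ (by (α top) ∧ proj₁ (fold belowAlg a (α ∘ down)))} e
  ... | inj₂ e₂ = let p , q , r = below⇒ b _ e₂ in right p , right q , r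
  ... | inj₁ e₁ with ∨-elim {proj₂ (fold belowAlg a (α ∘ down))} e₁
  ...   | inj₁ e₃ = let p , q , r = below⇒ a _ e₃ in down p , down q , r
  ...   | inj₂ e₃ = let p , q = has⇒ a _ (∧-elimʳ {by (α top)} e₃) in down p , top , q , ∧-elimˡ e₃ , refl

  ⇒below : ∀ a (α : Pos a → L) p q → bx (α p) ≡ true → by (α q) ≡ true → ltP p q ≡ true →
           proj₂ (fold belowAlg a α) ≡ true
  ⇒below (a ▸ b) α (down p) top x y l =
    ∨-introˡ (∨-introʳ {proj₂ (fold belowAlg a (α ∘ down))} (∧-intro y (⇒has a _ p x)))
  ⇒below (a ▸ b) α (down p) (down q) x y l = ∨-introˡ (∨-introˡ (⇒below a _ p q x y l))
  ⇒below (a ▸ b) α (right p) (right q) x y l =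
    ∨-introʳ {proj₂ (fold belowAlg a (α ∘ down)) ∨ (by (α top) ∧ proj₁ (fold belowAlg a (α ∘ down)))} (⇒below b _ p q x y l)

_⊹_ : Count → Count → Count
none ⊹ y    = y
one  ⊹ none = one
one  ⊹ one  = many
one  ⊹ many = many
many ⊹ _    = many

mark : Bool → Count
mark true  = one
mark false = none

-- Telling one from many is what turns a set variable into a first-order variable: the value `one`
-- certifies a singleton.
countAlg : ∀ {L : Set} → (L → Bool) → Alg L
countAlg b = record
  { M = Count ; fin = finCount ; _∙_ = _⊹_ ; e₀ = none ; rt = λ l s → mark (b l) ⊹ s
  ; assoc = λ where none _ _ → refl ; many _ _ → refl ; one none _ → refl ; one many _ → refl
                    one one none → refl ; one one one → refl ; one one many → refl
  ; comm = λ where none none → refl ; none one → refl ; none many → refl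
                   one none → refl ; one one → refl ; one many → refl
                   many none → refl ; many one → refl ; many many → refl
  ; idˡ = λ _ → refl
  ; threshold = 2
  ; aperiodic = λ where none → refl ; one → refl ; many → refl
  }

⊹-none : ∀ {x y} → x ⊹ y ≡ none → x ≡ none × y ≡ none
⊹-none {none} e = refl , e
⊹-none {one} {none} ()
⊹-none {one} {one} ()
⊹-none {one} {many} ()

⊹-one : ∀ {x y} → x ⊹ y ≡ one → (x ≡ one × y ≡ none) ⊎ (x ≡ none × y ≡ one)
⊹-one {none} e = inj₂ (refl , e)
⊹-one {one} {none} e = inj₁ (refl , refl)

mark-none : ∀ {b} → mark b ≡ none → b ≡ false
mark-none {false} _ = refl

mark-one : ∀ {b} → mark b ≡ one → b ≡ true
mark-one {true} _ = refl

module _ {L : Set} (b : L → Bool) where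

  count-none : ∀ a (α : Pos a → L) → fold (countAlg b) a α ≡ none → ∀ p → b (α p) ≡ false
  count-none (a ▸ a′) α e p with ⊹-none {mark (b (α top)) ⊹ fold (countAlg b) a (α ∘ down)} e
  ... | e₁ , e₂ with ⊹-none {mark (b (α top))} e₁
  count-none (a ▸ a′) α e top       | e₁ , e₂ | e₃ , e₄ = mark-none e₃
  count-none (a ▸ a′) α e (down p)  | e₁ , e₂ | e₃ , e₄ = count-none a _ e₄ p
  count-none (a ▸ a′) α e (right p) | e₁ , e₂ | e₃ , e₄ = count-none a′ _ e₂ p

  none-count : ∀ a (α : Pos a → L) → (∀ p → b (α p) ≡ false) → fold (countAlg b) a α ≡ none
  none-count ε        α h = refl
  none-count (a ▸ a′) α h rewrite h top | none-count a (α ∘ down) (h ∘ down) = none-count a′ _ (h ∘ right)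

  count-one : ∀ a (α : Pos a → L) → fold (countAlg b) a α ≡ one → ∃ λ p → ∀ q → b (α q) ≡ eqP p q
  count-one (a ▸ a′) α e with ⊹-one {mark (b (α top)) ⊹ fold (countAlg b) a (α ∘ down)} e
  ... | inj₂ (e₁ , e₂) with ⊹-none {mark (b (α top))} e₁
  ...   | e₃ , e₄ = let p , h = count-one a′ _ e₂ in right p , λ where
            top       → mark-none e₃
            (down q)  → count-none a _ e₄ q
            (right q) → h q
  count-one (a ▸ a′) α e | inj₁ (e₁ , e₂) with ⊹-one {mark (b (α top))} e₁
  ...   | inj₁ (e₃ , e₄) = top , λ where
            top       → mark-one e₃
            (down q)  → count-none a _ e₄ q
            (right q) → count-none a′ _ e₂ q
  ...   | inj₂ (e₃ , e₄) = let p , h = count-one a _ e₄ in down p , λ where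
            top       → mark-none e₃
            (down q)  → h q
            (right q) → count-none a′ _ e₂ q

  one-count : ∀ a (α : Pos a → L) p → (∀ q → b (α q) ≡ eqP p q) → fold (countAlg b) a α ≡ one
  one-count (a ▸ a′) α top h
    rewrite h top | none-count a (α ∘ down) (h ∘ down) | none-count a′ (α ∘ right) (h ∘ right) = refl
  one-count (a ▸ a′) α (down p) h
    rewrite h top | one-count a (α ∘ down) p (h ∘ down) | none-count a′ (α ∘ right) (h ∘ right) = refl
  one-count (a ▸ a′) α (right p) h
    rewrite h top | none-count a (α ∘ down) (h ∘ down) = one-count a′ _ p (h ∘ right)

module _ {L : Set} (A B : Alg L) where
  private
    module A = Alg A
    module B = Alg B
    C : ℕ
    C = A.threshold + B.threshold
    _⊛_ : A.M × B.M → A.M × B.M → A.M × B.M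
    (x , y) ⊛ (z , w) = x A.∙ z , y B.∙ w
    pw× : ℕ → A.M × B.M → A.M × B.M
    pw× = power _⊛_ (A.e₀ , B.e₀)
    pw×-pair : ∀ n x y → pw× n (x , y) ≡ (A.pw n x , B.pw n y)
    pw×-pair zero    x y = refl
    pw×-pair (suc n) x y = cong ((x , y) ⊛_) (pw×-pair n x y)
    aper : ∀ x → (x ⊛ pw× C x) ≡ pw× C x
    aper (x , y) = trans (pw×-pair (suc C) x y) (trans (cong₂ _,_
      (trans (A.pw-stable (suc C) x (m≤n⇒m≤1+n (m≤m+n _ _))) (sym (A.pw-stable C x (m≤m+n _ _))))
      (trans (B.pw-stable (suc C) y (m≤n⇒m≤1+n (m≤n+m B.threshold A.threshold))) (sym (B.pw-stable C y (m≤n+m B.threshold A.threshold)))))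
      (sym (pw×-pair C x y)))

  _⊗_ : Alg L
  _⊗_ = record
    { M = A.M × B.M ; fin = fin× A.fin B.fin ; _∙_ = _⊛_ ; e₀ = A.e₀ , B.e₀
    ; rt = λ l (x , y) → A.rt l x , B.rt l y
    ; assoc = λ (a , b) (c , d) (e , f) → cong₂ _,_ (A.assoc a c e) (B.assoc b d f)
    ; comm = λ (a , b) (c , d) → cong₂ _,_ (A.comm a c) (B.comm b d)
    ; idˡ = λ (a , b) → cong₂ _,_ (A.idˡ a) (B.idˡ b)
    ; threshold = C
    ; aperiodic = aper
    }

  fold-⊗ : ∀ a α → fold _⊗_ a α ≡ (fold A a α , fold B a α)
  fold-⊗ ε       α = refl
  fold-⊗ (a ▸ b) α rewrite fold-⊗ a (α ∘ down) | fold-⊗ b (α ∘ right) = refl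

lookup-unique : ∀ {A : Set} {xs : List A} → Unique xs → ∀ i j → lookup xs i ≡ lookup xs j → i ≡ j
lookup-unique (_ ∷ u) Fin.zero    Fin.zero    e = refl
lookup-unique (p ∷ u) Fin.zero    (Fin.suc j) e = ⊥-elim (All.lookup p (∈-lookup j) e)
lookup-unique (p ∷ u) (Fin.suc i) Fin.zero    e = ⊥-elim (All.lookup p (∈-lookup i) (sym e))
lookup-unique (_ ∷ u) (Fin.suc i) (Fin.suc j) e = cong Fin.suc (lookup-unique u i j e)

-- Bit vectors instead of predicates: equality is then extensional, as the monoid laws of the power
-- set algebra demand, and finiteness comes from `finVec`.
module Subsets {A : Set} (F : Finite A) where
  open Finite F

  Subset : Set
  Subset = Vec Bool (length elems)

  idx : A → Fin (length elems)
  idx x = Any.index (complete x)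

  lookup-idx : ∀ x → lookup elems (idx x) ≡ x
  lookup-idx x = sym (Anyₚ.lookup-index (complete x))

  abstract
   mem : Subset → A → Bool
   mem s x = Vec.lookup s (idx x)

   mem-ext : ∀ s t → (∀ x → mem s x ≡ mem t x) → s ≡ t
   mem-ext s t h = trans (sym (Vecₚ.tabulate∘lookup s)) (trans (Vecₚ.tabulate-cong pt) (Vecₚ.tabulate∘lookup t))
     where
     pt : ∀ i → Vec.lookup s i ≡ Vec.lookup t i
     pt i = subst (λ j → Vec.lookup s j ≡ Vec.lookup t j) (lookup-unique unique _ _ (lookup-idx (lookup elems i))) (h (lookup elems i))

   mk : {P : A → Set} → (∀ x → Dec (P x)) → Subset
   mk P? = Vec.tabulate (λ i → does (P? (lookup elems i)))

   mem-mk : ∀ {P : A → Set} (P? : ∀ x → Dec (P x)) x → mem (mk P?) x ≡ does (P? x)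
   mem-mk P? x = trans (Vecₚ.lookup∘tabulate _ (idx x)) (cong (λ y → does (P? y)) (lookup-idx x))

  mem⇒ : ∀ {P : A → Set} (P? : ∀ x → Dec (P x)) {x} → mem (mk P?) x ≡ true → P x
  mem⇒ P? {x} e = does⇒ (P? x) (trans (sym (mem-mk P? x)) e)

  ⇒mem : ∀ {P : A → Set} (P? : ∀ x → Dec (P x)) {x} → P x → mem (mk P?) x ≡ true
  ⇒mem P? {x} p = trans (mem-mk P? x) (⇒does (P? x) p)

-- Existential projection: the algebra of sets of values over all ways of adding one bit to every label.
module Projection {L L′ : Set} (A : Alg L) (π : Bool → L′ → L) where
  open Alg A
  open Subsets fin

  private
    _∋_ : Subset → M → Set
    s ∋ x = mem s x ≡ true

    ∋? : ∀ s x → Dec (s ∋ x)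
    ∋? s x = mem s x Data.Bool.≟ true

    ext : ∀ s t → (∀ x → s ∋ x → t ∋ x) → (∀ x → t ∋ x → s ∋ x) → s ≡ t
    ext s t f g = mem-ext s t (λ x → bool-ext (f x) (g x))

    Prod : Subset → Subset → M → Set
    Prod s t z = ∃ λ x → ∃ λ y → s ∋ x × t ∋ y × x ∙ y ≡ z

    Prod? : ∀ s t z → Dec (Prod s t z)
    Prod? s t z = ∃? λ x → ∃? λ y → ∋? s x ×-dec (∋? t y ×-dec ((x ∙ y) ≈? z))

    Rt : L′ → Subset → M → Set
    Rt l s z = ∃ λ b → ∃ λ x → s ∋ x × rt (π b l) x ≡ z

    Rt? : ∀ l s z → Dec (Rt l s z)
    Rt? l s z = Finite.∃? finBool λ b → ∃? λ x → ∋? s x ×-dec (rt (π b l) x ≈? z)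

    abstract
      _⊚_ : Subset → Subset → Subset
      s ⊚ t = mk (Prod? s t)

      ⊚⇒ : ∀ s t {z} → (s ⊚ t) ∋ z → Prod s t z
      ⊚⇒ s t = mem⇒ (Prod? s t)

      ⇒⊚ : ∀ s t {z} → Prod s t z → (s ⊚ t) ∋ z
      ⇒⊚ s t = ⇒mem (Prod? s t)

      unit : Subset
      unit = mk (λ z → z ≈? e₀)

      unit⇒ : ∀ {z} → unit ∋ z → z ≡ e₀
      unit⇒ = mem⇒ (λ z → z ≈? e₀)

      ⇒unit : unit ∋ e₀
      ⇒unit = ⇒mem (λ z → z ≈? e₀) refl

      rtS : L′ → Subset → Subset
      rtS l s = mk (Rt? l s)

      rtS⇒ : ∀ l s {z} → rtS l s ∋ z → Rt l s z
      rtS⇒ l s = mem⇒ (Rt? l s)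

      ⇒rtS : ∀ l s {z} → Rt l s z → rtS l s ∋ z
      ⇒rtS l s = ⇒mem (Rt? l s)

    ⊚-comm : ∀ s t → s ⊚ t ≡ t ⊚ s
    ⊚-comm s t = ext _ _ (half s t) (half t s)
      where
      half : ∀ s t x → (s ⊚ t) ∋ x → (t ⊚ s) ∋ x
      half s t z p with ⊚⇒ s t p
      ... | x , y , px , py , e = ⇒⊚ t s (y , x , py , px , trans (comm y x) e)

    ⊚-assoc : ∀ s t u → (s ⊚ t) ⊚ u ≡ s ⊚ (t ⊚ u)
    ⊚-assoc s t u = ext _ _ f g
      where
      f : ∀ z → ((s ⊚ t) ⊚ u) ∋ z → (s ⊚ (t ⊚ u)) ∋ z
      f z p with ⊚⇒ (s ⊚ t) u p
      ... | w , c , pw′ , pc , refl with ⊚⇒ s t pw′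
      ...   | a , b , pa , pb , refl = ⇒⊚ s (t ⊚ u) (a , b ∙ c , pa , ⇒⊚ t u (b , c , pb , pc , refl) , sym (assoc a b c))
      g : ∀ z → (s ⊚ (t ⊚ u)) ∋ z → ((s ⊚ t) ⊚ u) ∋ z
      g z p with ⊚⇒ s (t ⊚ u) p
      ... | a , w , pa , pw′ , refl with ⊚⇒ t u pw′
      ...   | b , c , pb , pc , refl = ⇒⊚ (s ⊚ t) u (a ∙ b , c , ⇒⊚ s t (a , b , pa , pb , refl) , pc , assoc a b c)

    ⊚-idˡ : ∀ s → unit ⊚ s ≡ s
    ⊚-idˡ s = ext _ _ f (λ z p → ⇒⊚ unit s (e₀ , z , ⇒unit , p , idˡ z))
      where
      f : ∀ z → (unit ⊚ s) ∋ z → s ∋ z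
      f z p with ⊚⇒ unit s p
      ... | x , y , px , py , refl with unit⇒ px
      ...   | refl = subst (s ∋_) (sym (idˡ y)) py

    msum : List M → M
    msum []       = e₀
    msum (x ∷ xs) = x ∙ msum xs

    cnt : M → List M → ℕ
    cnt x xs = ∑ xs (λ y → χ (does (y ≈? x)))

    -- The accumulator j counts the copies of x already moved to the front. When the list is
    -- exhausted, at least `threshold` copies stand together and swallow one more.
    absorb : ∀ x j xs → threshold ≤ cnt x xs + j → x ∙ (pw j x ∙ msum xs) ≡ pw j x ∙ msum xs
    absorb x j [] le = trans (sym (assoc x _ _)) (cong (_∙ e₀) (trans (pw-stable (suc j) x (m≤n⇒m≤1+n le)) (sym (pw-stable j x le))))
    absorb x j (y ∷ ys) le with y ≈? x
    ... | yes refl = trans (cong (x ∙_) r) (trans (absorb x (suc j) ys (subst (threshold ≤_) (sym (+-suc _ j)) le)) (sym r))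
      where
      r : pw j x ∙ (x ∙ msum ys) ≡ pw (suc j) x ∙ msum ys
      r = trans (swap-∙ _ _ _) (sym (assoc x _ _))
    ... | no _ = trans (cong (x ∙_) (swap-∙ _ y _)) (trans (swap-∙ x y _) (trans (cong (y ∙_) (absorb x j ys le)) (swap-∙ y _ _)))

    absorb₀ : ∀ x xs → threshold ≤ cnt x xs → x ∙ msum xs ≡ msum xs
    absorb₀ x xs le = trans (cong (x ∙_) (sym (idˡ _))) (trans (absorb x 0 xs (subst (threshold ≤_) (sym (+-identityʳ _)) le)) (idˡ _))

    cnt-∈ : ∀ x xs → 0 < cnt x xs → x ∈ xs
    cnt-∈ x (y ∷ ys) lt with y ≈? x
    ... | yes e = here (sym e)
    ... | no _  = there (cnt-∈ x ys lt)

    length-cnt : ∀ xs → length xs ≡ ∑ elems (λ x → cnt x xs)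
    length-cnt xs = sym (trans (∑-swap elems xs _) (trans (∑-cong xs (λ {y} _ →
      trans (∑-cong elems (λ {x} _ → sym (*-identityʳ (χ (does (y ≈? x)))))) (∑-δ _≈?_ (λ _ → 1) unique (complete y))))
      (trans (∑-const xs 1) (*-identityʳ _))))

    pigeonhole : ∀ xs → length elems * threshold < length xs → ∃ λ x → threshold < cnt x xs
    pigeonhole xs le with ∃? (λ x → threshold <? cnt x xs)
    ... | yes p = p
    ... | no ¬p = ⊥-elim (<-irrefl refl (≤-trans le (≤-trans (≤-reflexive (length-cnt xs))
                    (∑-≤ {xs = elems} (λ x → cnt x xs) threshold (λ {x} _ → ≮⇒≥ (λ q → ¬p (x , q)))))))

    msum-mid : ∀ as x bs → msum (as ++ x ∷ bs) ≡ x ∙ msum (as ++ bs)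
    msum-mid []       x bs = refl
    msum-mid (a ∷ as) x bs = trans (cong (a ∙_) (msum-mid as x bs)) (swap-∙ a x _)

    ∈-mid : ∀ {y : M} as x bs → y ∈ as ++ bs → y ∈ as ++ x ∷ bs
    ∈-mid as x bs p with ∈-++⁻ as p
    ... | inj₁ q = ∈-++⁺ˡ q
    ... | inj₂ q = ∈-++⁺ʳ as (there q)

    pwS : ℕ → Subset → Subset
    pwS = power _⊚_ unit

    List-pw : ∀ s xs → (∀ {x} → x ∈ xs → s ∋ x) → pwS (length xs) s ∋ msum xs
    List-pw s []       h = ⇒unit
    List-pw s (x ∷ xs) h = ⇒⊚ s (pwS (length xs) s) (x , msum xs , h (here refl) , List-pw s xs (h ∘ there) , refl)

    pw-List : ∀ s n z → pwS n s ∋ z → ∃ λ xs → length xs ≡ n × (∀ {x} → x ∈ xs → s ∋ x) × msum xs ≡ z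
    pw-List s zero    z p = [] , refl , (λ ()) , sym (unit⇒ p)
    pw-List s (suc n) z p with ⊚⇒ s (pwS n s) p
    ... | x , y , px , py , refl with pw-List s n y py
    ...   | xs , refl , h , refl = x ∷ xs , refl , (λ where (here refl) → px ; (there q) → h q) , refl

    cnt-mid : ∀ x as bs → cnt x (as ++ x ∷ bs) ≡ suc (cnt x (as ++ bs))
    cnt-mid x []       bs = cong (λ c → χ c + cnt x bs) (dec-true (x ≈? x) refl)
    cnt-mid x (a ∷ as) bs = trans (cong (χ (does (a ≈? x)) +_) (cnt-mid x as bs)) (+-suc _ _)

    shrink : ∀ n s → length elems * threshold < n → ∀ z → pwS (suc n) s ∋ z → pwS n s ∋ z
    shrink n s big z p with pw-List s (suc n) z p
    ... | xs , len , h , refl with pigeonhole xs (≤-trans big (≤-trans (n≤1+n n) (≤-reflexive (sym len))))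
    ...   | x , lt with ∈-∃++ (cnt-∈ x xs (≤-trans (s≤s z≤n) lt))
    ...     | as , bs , refl = subst₂ (λ k w → pwS k s ∋ w) len′ (sym eq) (List-pw s (as ++ bs) (h ∘ ∈-mid as x bs))
      where
      len′ : length (as ++ bs) ≡ n
      len′ = suc-injective (trans (cong suc (length-++ as)) (trans (sym (trans (length-++ as) (+-suc (length as) (length bs)))) len))
      eq : msum (as ++ x ∷ bs) ≡ msum (as ++ bs)
      eq = trans (msum-mid as x bs) (absorb₀ x (as ++ bs) (≤-pred (subst (threshold <_) (cnt-mid x as bs) lt)))

    grow : ∀ n s → length elems * threshold < n → ∀ z → pwS n s ∋ z → pwS (suc n) s ∋ z
    grow n s big z p with pw-List s n z p
    ... | xs , len , h , refl with pigeonhole xs (≤-trans big (≤-reflexive (sym len)))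
    ...   | x , lt = subst₂ (λ k w → pwS k s ∋ w) (cong suc len) (absorb₀ x xs (<⇒≤ lt))
                       (List-pw s (x ∷ xs) (λ where (here refl) → h (cnt-∈ x xs (≤-trans (s≤s z≤n) lt)) ; (there q) → h q))

    aper : ∀ n s → length elems * threshold < n → pwS (suc n) s ≡ pwS n s
    aper n s big = ext _ _ (shrink n s big) (grow n s big)

  projAlg : Alg L′
  projAlg = record
    { M = Subset ; fin = finVec _ ; _∙_ = _⊚_ ; e₀ = unit ; rt = rtS
    ; assoc = ⊚-assoc ; comm = ⊚-comm ; idˡ = ⊚-idˡ ; threshold = suc (length elems * threshold)
    ; aperiodic = λ s → aper _ s ≤-refl }

  proj⇒ : ∀ a α x → mem (fold projAlg a α) x ≡ true → ∃ λ (X : Pos a → Bool) → fold A a (λ p → π (X p) (α p)) ≡ x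
  proj⇒ ε       α x e = (λ ()) , sym (unit⇒ e)
  proj⇒ (a ▸ b) α x e with ⊚⇒ (rtS (α top) (fold projAlg a (α ∘ down))) (fold projAlg b (α ∘ right)) e
  ... | u , v , pu , pv , refl with rtS⇒ (α top) (fold projAlg a (α ∘ down)) pu | proj⇒ b _ v pv
  ...   | β , w , pw′ , refl | Y , refl with proj⇒ a _ w pw′
  ...     | X , refl = glue β X Y , refl

  ⇒proj : ∀ a α (X : Pos a → Bool) → mem (fold projAlg a α) (fold A a (λ p → π (X p) (α p))) ≡ true
  ⇒proj ε       α X = ⇒unit
  ⇒proj (a ▸ b) α X = ⇒⊚ (rtS (α top) (fold projAlg a (α ∘ down))) (fold projAlg b (α ∘ right))
    (_ , _ , ⇒rtS (α top) (fold projAlg a (α ∘ down)) (X top , _ , ⇒proj a _ (X ∘ down) , refl) , ⇒proj b _ (X ∘ right) , refl)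

-- Recognisability of MSO formulas

-- The semantics `Sat` on an arbitrary carrier, so that formulas can be read on the nodes `Pos a`
-- and carried along order isomorphisms.
SatD : (D : Set) (lt : D → D → Bool) {i j : ℕ} → (Fin i → D) → (Fin j → D → Bool) → Formula i j → Set
SatD D lt ρ σ (x ≺' y) = lt (ρ x) (ρ y) ≡ true
SatD D lt ρ σ (x ≐ y)  = ρ x ≡ ρ y
SatD D lt ρ σ (x ∈' X) = σ X (ρ x) ≡ true
SatD D lt ρ σ (¬' φ)   = ¬ SatD D lt ρ σ φ
SatD D lt ρ σ (φ ∧' ψ) = SatD D lt ρ σ φ × SatD D lt ρ σ ψ
SatD D lt ρ σ (φ ∨' ψ) = SatD D lt ρ σ φ ⊎ SatD D lt ρ σ ψ
SatD D lt ρ σ (∃₁ φ)   = Σ D λ a → SatD D lt (extend a ρ) σ φ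
SatD D lt ρ σ (∀₁ φ)   = ∀ a → SatD D lt (extend a ρ) σ φ
SatD D lt ρ σ (∃₂ φ)   = Σ (D → Bool) λ X → SatD D lt ρ (extend X σ) φ
SatD D lt ρ σ (∀₂ φ)   = ∀ X → SatD D lt ρ (extend X σ) φ

Label : ℕ → ℕ → Set
Label i j = Vec Bool i × Vec Bool j

label : ∀ {a i j} → (Fin i → Pos a) → (Fin j → Pos a → Bool) → Pos a → Label i j
label ρ σ p = Vec.tabulate (λ k → eqP (ρ k) p) , Vec.tabulate (λ k → σ k p)

record Recognizer {i j} (φ : Formula i j) : Set₁ where
  field
    alg : Alg (Label i j)
    acc : Alg.M alg → Bool
    sound    : ∀ a ρ σ → SatD (Pos a) ltP ρ σ φ → acc (fold alg a (label ρ σ)) ≡ true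
    complete : ∀ a ρ σ → acc (fold alg a (label ρ σ)) ≡ true → SatD (Pos a) ltP ρ σ φ

foBit : ∀ {i j} → Fin i → Label i j → Bool
foBit x (u , v) = Vec.lookup u x

soBit : ∀ {i j} → Fin j → Label i j → Bool
soBit X (u , v) = Vec.lookup v X

module _ {i j} {a : Fo} (ρ : Fin i → Pos a) (σ : Fin j → Pos a → Bool) where

  foBit⇒ : ∀ x p → foBit x (label ρ σ p) ≡ true → ρ x ≡ p
  foBit⇒ x p e = does⇒ (ρ x ≟P p) (trans (sym (Vecₚ.lookup∘tabulate (λ k → eqP (ρ k) p) x)) e)

  ⇒foBit : ∀ x → foBit x (label ρ σ (ρ x)) ≡ true
  ⇒foBit x = trans (Vecₚ.lookup∘tabulate (λ k → eqP (ρ k) (ρ x)) x) (⇒does (ρ x ≟P ρ x) refl)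

  soBit-label : ∀ X p → soBit X (label ρ σ p) ≡ σ X p
  soBit-label X p = Vecₚ.lookup∘tabulate (λ k → σ k p) X

module Quantifier₁ {i j} {φ : Formula (suc i) j} (R : Recognizer φ) where
  open Recognizer R
  private
    bit₀ : Label (suc i) j → Bool
    bit₀ (u , v) = Vec.head u
    π : Bool → Label i j → Label (suc i) j
    π b (u , v) = b ∷ u , v
    -- The added factor checks that the projected bit marks exactly one node; projection over sets
    -- then acts as quantification over nodes.
    AS : Alg (Label (suc i) j)
    AS = alg ⊗ countAlg bit₀
    module P = Projection AS π
    module S = Subsets (Alg.fin AS)
    open Alg AS using (∃?; ∀?)

    val : ∀ {a} (ρ : Fin i → Pos a) σ x → fold AS a (label (extend x ρ) σ) ≡ (fold alg a (label (extend x ρ) σ) , one)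
    val {a} ρ σ x = trans (fold-⊗ alg (countAlg bit₀) a (label (extend x ρ) σ))
      (cong (fold alg a (label (extend x ρ) σ) ,_) (one-count bit₀ a (label (extend x ρ) σ) x (λ q → refl)))

    pick : ∀ {a} (ρ : Fin i → Pos a) σ m → S.mem (fold P.projAlg a (label ρ σ)) (m , one) ≡ true →
           ∃ λ x → fold alg a (label (extend x ρ) σ) ≡ m
    pick {a} ρ σ m e with P.proj⇒ a (label ρ σ) (m , one) e
    ... | X , eq = proj₁ found , trans (fold-ext alg a (λ q → cong (λ b → π b (label ρ σ q)) (sym (proj₂ found q)))) (sym (cong proj₁ eq′))
      where
      α : Pos a → Label (suc i) j
      α p = π (X p) (label ρ σ p)
      eq′ : (m , one) ≡ (fold alg a α , fold (countAlg bit₀) a α)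
      eq′ = trans (sym eq) (fold-⊗ alg (countAlg bit₀) a α)
      found : ∃ λ x → ∀ q → X q ≡ eqP x q
      found = count-one bit₀ a α (sym (cong proj₂ eq′))

    put : ∀ {a} (ρ : Fin i → Pos a) σ x → S.mem (fold P.projAlg a (label ρ σ)) (fold alg a (label (extend x ρ) σ) , one) ≡ true
    put {a} ρ σ x = subst (λ w → S.mem (fold P.projAlg a (label ρ σ)) w ≡ true) (val ρ σ x) (P.⇒proj a (label ρ σ) (eqP x))

    module F = Finite (Alg.fin alg)

    ex? : ∀ s → Dec (∃ λ m → S.mem s (m , one) ≡ true × acc m ≡ true)
    ex? s = F.∃? λ m → (S.mem s (m , one) Data.Bool.≟ true) ×-dec (acc m Data.Bool.≟ true)

    al? : ∀ s → Dec (∃ λ m → S.mem s (m , one) ≡ true × acc m ≡ false)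
    al? s = F.∃? λ m → (S.mem s (m , one) Data.Bool.≟ true) ×-dec (acc m Data.Bool.≟ false)

  rec-∃₁ : Recognizer (∃₁ φ)
  rec-∃₁ = record
    { alg = P.projAlg ; acc = λ s → does (ex? s)
    ; sound = λ a ρ σ (x , s) → ⇒does (ex? (fold P.projAlg a (label ρ σ))) (_ , put ρ σ x , sound a (extend x ρ) σ s)
    ; complete = λ a ρ σ e → let m , q , r = does⇒ (ex? (fold P.projAlg a (label ρ σ))) e ; x , eq = pick ρ σ m q in
        x , complete a (extend x ρ) σ (trans (cong acc eq) r) }

  -- Acceptance means that no rejected value is reachable. Constructively, the step from "no
  -- counterexample" to "for all" is justified because `acc` decides the formula under the
  -- quantifier.
  rec-∀₁ : Recognizer (∀₁ φ)
  rec-∀₁ = record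
    { alg = P.projAlg ; acc = λ s → not (does (al? s))
    ; sound = λ a ρ σ s → cong not (dec-false (al? (fold P.projAlg a (label ρ σ))) λ (m , q , r) → let x , eq = pick ρ σ m q in
        true≢false (sound a (extend x ρ) σ (s x)) (trans (cong acc eq) r))
    ; complete = λ a ρ σ e x → complete a (extend x ρ) σ ([ id , (λ f → ⊥-elim (true≢false e (cong not (⇒does (al? (fold P.projAlg a (label ρ σ))) (_ , put ρ σ x , f))))) ]′
        (true-or-false (acc (fold alg a (label (extend x ρ) σ))))) }

module Quantifier₂ {i j} {φ : Formula i (suc j)} (R : Recognizer φ) where
  open Recognizer R
  private
    π : Bool → Label i j → Label i (suc j)
    π b (u , v) = u , b ∷ v
    module P = Projection alg π
    module S = Subsets (Alg.fin alg)
    module F = Finite (Alg.fin alg)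

    ex? : ∀ s → Dec (∃ λ m → S.mem s m ≡ true × acc m ≡ true)
    ex? s = F.∃? λ m → (S.mem s m Data.Bool.≟ true) ×-dec (acc m Data.Bool.≟ true)

    al? : ∀ s → Dec (∃ λ m → S.mem s m ≡ true × acc m ≡ false)
    al? s = F.∃? λ m → (S.mem s m Data.Bool.≟ true) ×-dec (acc m Data.Bool.≟ false)

  rec-∃₂ : Recognizer (∃₂ φ)
  rec-∃₂ = record
    { alg = P.projAlg ; acc = λ s → does (ex? s)
    ; sound = λ a ρ σ (X , s) → ⇒does (ex? (fold P.projAlg a (label ρ σ))) (_ , P.⇒proj a (label ρ σ) X , sound a ρ (extend X σ) s)
    ; complete = λ a ρ σ e → let m , q , r = does⇒ (ex? (fold P.projAlg a (label ρ σ))) e ; X , eq = P.proj⇒ a (label ρ σ) m q in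
        X , complete a ρ (extend X σ) (trans (cong acc eq) r) }

  rec-∀₂ : Recognizer (∀₂ φ)
  rec-∀₂ = record
    { alg = P.projAlg ; acc = λ s → not (does (al? s))
    ; sound = λ a ρ σ s → cong not (dec-false (al? (fold P.projAlg a (label ρ σ))) λ (m , q , r) → let X , eq = P.proj⇒ a (label ρ σ) m q in
        true≢false (sound a ρ (extend X σ) (s X)) (trans (cong acc eq) r))
    ; complete = λ a ρ σ e X → complete a ρ (extend X σ) ([ id , (λ f → ⊥-elim (true≢false e (cong not (⇒does (al? (fold P.projAlg a (label ρ σ))) (_ , P.⇒proj a (label ρ σ) X , f))))) ]′
        (true-or-false (acc (fold alg a (label ρ (extend X σ)))))) }

recognize : ∀ {i j} (φ : Formula i j) → Recognizer φ
recognize (x ≺' y) = record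
  { alg = belowAlg (foBit x) (foBit y) ; acc = proj₂
  ; sound = λ a ρ σ s → ⇒below (foBit x) (foBit y) a (label ρ σ) (ρ x) (ρ y) (⇒foBit ρ σ x) (⇒foBit ρ σ y) s
  ; complete = λ a ρ σ e → let p , q , ep , eq , l = below⇒ (foBit x) (foBit y) a (label ρ σ) e in
      subst₂ (λ u v → ltP u v ≡ true) (sym (foBit⇒ ρ σ x p ep)) (sym (foBit⇒ ρ σ y q eq)) l }
-- Equality and membership both ask for one node that carries two bits, which is the first component
-- of `belowAlg`.
recognize (x ≐ y) = record
  { alg = belowAlg (λ l → foBit x l ∧ foBit y l) (λ _ → false) ; acc = proj₁
  ; sound = λ a ρ σ s → ⇒has (λ l → foBit x l ∧ foBit y l) (λ _ → false) a (label ρ σ) (ρ x) (∧-intro (⇒foBit ρ σ x) (subst (λ z → foBit y (label ρ σ z) ≡ true) (sym s) (⇒foBit ρ σ y)))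
  ; complete = λ a ρ σ e → let p , q = has⇒ (λ l → foBit x l ∧ foBit y l) (λ _ → false) a (label ρ σ) e in
      trans (foBit⇒ ρ σ x p (∧-elimˡ q)) (sym (foBit⇒ ρ σ y p (∧-elimʳ {foBit x (label ρ σ p)} q))) }
recognize (x ∈' X) = record
  { alg = belowAlg (λ l → foBit x l ∧ soBit X l) (λ _ → false) ; acc = proj₁
  ; sound = λ a ρ σ s → ⇒has (λ l → foBit x l ∧ soBit X l) (λ _ → false) a (label ρ σ) (ρ x) (∧-intro (⇒foBit ρ σ x) (trans (soBit-label ρ σ X (ρ x)) s))
  ; complete = λ a ρ σ e → let p , q = has⇒ (λ l → foBit x l ∧ soBit X l) (λ _ → false) a (label ρ σ) e in
      trans (cong (σ X) (foBit⇒ ρ σ x p (∧-elimˡ q))) (trans (sym (soBit-label ρ σ X p)) (∧-elimʳ {foBit x (label ρ σ p)} q)) }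
recognize (¬' φ) = record
  { alg = alg ; acc = not ∘ acc
  ; sound = λ a ρ σ s → [ (λ e → ⊥-elim (s (complete a ρ σ e))) , cong not ]′ (true-or-false (acc (fold alg a (label ρ σ))))
  ; complete = λ a ρ σ e s → true≢false e (cong not (sound a ρ σ s)) }
  where open Recognizer (recognize φ)
recognize (φ ∧' ψ) = record
  { alg = R.alg ⊗ S.alg ; acc = λ (x , y) → R.acc x ∧ S.acc y
  ; sound = λ a ρ σ (s , t) → trans (cong both (fold-⊗ R.alg S.alg a (label ρ σ))) (∧-intro (R.sound a ρ σ s) (S.sound a ρ σ t))
  ; complete = λ a ρ σ e → let e′ = trans (sym (cong both (fold-⊗ R.alg S.alg a (label ρ σ)))) e in
      R.complete a ρ σ (∧-elimˡ e′) , S.complete a ρ σ (∧-elimʳ {R.acc (fold R.alg a (label ρ σ))} e′) }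
  where
  module R = Recognizer (recognize φ)
  module S = Recognizer (recognize ψ)
  both : Alg.M R.alg × Alg.M S.alg → Bool
  both (x , y) = R.acc x ∧ S.acc y
recognize (φ ∨' ψ) = record
  { alg = R.alg ⊗ S.alg ; acc = either
  ; sound = λ a ρ σ → [ (λ s → trans (cong either (fold-⊗ R.alg S.alg a (label ρ σ))) (∨-introˡ (R.sound a ρ σ s)))
                      , (λ t → trans (cong either (fold-⊗ R.alg S.alg a (label ρ σ))) (∨-introʳ {R.acc (fold R.alg a (label ρ σ))} (S.sound a ρ σ t))) ]′
  ; complete = λ a ρ σ e → [ inj₁ ∘ R.complete a ρ σ , inj₂ ∘ S.complete a ρ σ ]′
      (∨-elim (trans (sym (cong either (fold-⊗ R.alg S.alg a (label ρ σ)))) e)) }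
  where
  module R = Recognizer (recognize φ)
  module S = Recognizer (recognize ψ)
  either : Alg.M R.alg × Alg.M S.alg → Bool
  either (x , y) = R.acc x ∨ S.acc y
recognize (∃₁ φ) = Quantifier₁.rec-∃₁ (recognize φ)
recognize (∀₁ φ) = Quantifier₁.rec-∀₁ (recognize φ)
recognize (∃₂ φ) = Quantifier₂.rec-∃₂ (recognize φ)
recognize (∀₂ φ) = Quantifier₂.rec-∀₂ (recognize φ)

-- Finite structures versus forests

record OIso {D D′ : Set} (l : D → D → Bool) (l′ : D′ → D′ → Bool) : Set where
  field
    to      : D → D′
    from    : D′ → D
    to-from : ∀ y → to (from y) ≡ y
    from-to : ∀ x → from (to x) ≡ x
    pres    : ∀ x y → l x y ≡ l′ (to x) (to y)

  to-injective : ∀ {x y} → to x ≡ to y → x ≡ y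
  to-injective {x} {y} e = trans (sym (from-to x)) (trans (cong from e) (from-to y))

oid : ∀ {D : Set} {l : D → D → Bool} → OIso l l
oid = record { to = id ; from = id ; to-from = λ _ → refl ; from-to = λ _ → refl ; pres = λ _ _ → refl }

osym : ∀ {D D′ : Set} {l : D → D → Bool} {l′ : D′ → D′ → Bool} → OIso l l′ → OIso l′ l
osym {l′ = l′} I = record
  { to = from ; from = to ; to-from = from-to ; from-to = to-from
  ; pres = λ x y → trans (sym (cong₂ l′ (to-from x) (to-from y))) (sym (pres (from x) (from y))) }
  where open OIso I

otrans : ∀ {D D′ D″ : Set} {l : D → D → Bool} {l′ : D′ → D′ → Bool} {l″ : D″ → D″ → Bool} →
         OIso l l′ → OIso l′ l″ → OIso l l″
otrans I J = record
  { to = J.to ∘ I.to ; from = I.from ∘ J.from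
  ; to-from = λ y → trans (cong J.to (I.to-from (J.from y))) (J.to-from y)
  ; from-to = λ x → trans (cong I.from (J.from-to (I.to x))) (I.from-to x)
  ; pres = λ x y → trans (I.pres x y) (J.pres (I.to x) (I.to y)) }
  where
  module I = OIso I
  module J = OIso J

-- Negation reverses the direction of transfer, so `go` and `back` are proved together; a quantified
-- set is pulled back along `from` or `to`.
satD-transfer : ∀ {D D′ : Set} {l : D → D → Bool} {l′ : D′ → D′ → Bool} (I : OIso l l′) → ∀ {i j} (φ : Formula i j)
  {ρ : Fin i → D} {ρ′ : Fin i → D′} {σ : Fin j → D → Bool} {σ′ : Fin j → D′ → Bool} →
  (∀ k → ρ′ k ≡ OIso.to I (ρ k)) → (∀ k x → σ′ k (OIso.to I x) ≡ σ k x) →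
  SatD D l ρ σ φ → SatD D′ l′ ρ′ σ′ φ
satD-transfer {D} {D′} {l} {l′} I = go
  where
  open OIso I
  go : ∀ {i j} (φ : Formula i j) {ρ : Fin i → D} {ρ′ : Fin i → D′} {σ : Fin j → D → Bool} {σ′ : Fin j → D′ → Bool} →
       (∀ k → ρ′ k ≡ to (ρ k)) → (∀ k x → σ′ k (to x) ≡ σ k x) → SatD D l ρ σ φ → SatD D′ l′ ρ′ σ′ φ
  back : ∀ {i j} (φ : Formula i j) {ρ : Fin i → D} {ρ′ : Fin i → D′} {σ : Fin j → D → Bool} {σ′ : Fin j → D′ → Bool} →
       (∀ k → ρ′ k ≡ to (ρ k)) → (∀ k x → σ′ k (to x) ≡ σ k x) → SatD D′ l′ ρ′ σ′ φ → SatD D l ρ σ φ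
  ext-ρ : ∀ {i} {ρ : Fin i → D} {ρ′ : Fin i → D′} a → (∀ k → ρ′ k ≡ to (ρ k)) → ∀ k → extend (to a) ρ′ k ≡ to (extend a ρ k)
  ext-ρ a r Fin.zero    = refl
  ext-ρ a r (Fin.suc k) = r k
  ext-ρ′ : ∀ {i} {ρ : Fin i → D} {ρ′ : Fin i → D′} a → (∀ k → ρ′ k ≡ to (ρ k)) → ∀ k → extend a ρ′ k ≡ to (extend (from a) ρ k)
  ext-ρ′ a r Fin.zero    = sym (to-from a)
  ext-ρ′ a r (Fin.suc k) = r k
  ext-σ : ∀ {j} {σ : Fin j → D → Bool} {σ′ : Fin j → D′ → Bool} X → (∀ k x → σ′ k (to x) ≡ σ k x) →
          ∀ k x → extend (X ∘ from) σ′ k (to x) ≡ extend X σ k x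
  ext-σ X s Fin.zero    x = cong X (from-to x)
  ext-σ X s (Fin.suc k) x = s k x
  ext-σ′ : ∀ {j} {σ : Fin j → D → Bool} {σ′ : Fin j → D′ → Bool} X → (∀ k x → σ′ k (to x) ≡ σ k x) →
          ∀ k x → extend X σ′ k (to x) ≡ extend (X ∘ to) σ k x
  ext-σ′ X s Fin.zero    x = refl
  ext-σ′ X s (Fin.suc k) x = s k x
  go (x ≺' y) r s p = trans (cong₂ l′ (r x) (r y)) (trans (sym (pres _ _)) p)
  go (x ≐ y)  r s p = trans (r x) (trans (cong to p) (sym (r y)))
  go (x ∈' X) {σ′ = σ′} r s p = trans (cong (σ′ X) (r x)) (trans (s X _) p)
  go (¬' φ)   r s p q = p (back φ r s q)
  go (φ ∧' ψ) r s (p , q) = go φ r s p , go ψ r s q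
  go (φ ∨' ψ) r s (inj₁ p) = inj₁ (go φ r s p)
  go (φ ∨' ψ) r s (inj₂ p) = inj₂ (go ψ r s p)
  go (∃₁ φ)   r s (a , p) = to a , go φ (ext-ρ a r) s p
  go (∀₁ φ)   r s p a = go φ (ext-ρ′ a r) s (p (from a))
  go (∃₂ φ)   r s (X , p) = X ∘ from , go φ r (ext-σ X s) p
  go (∀₂ φ)   r s p X = go φ r (ext-σ′ X s) (p (X ∘ to))
  back (x ≺' y) r s p = trans (pres _ _) (trans (sym (cong₂ l′ (r x) (r y))) p)
  back (x ≐ y)  r s p = to-injective (trans (sym (r x)) (trans p (r y)))
  back (x ∈' X) {σ′ = σ′} r s p = trans (sym (s X _)) (trans (sym (cong (σ′ X) (r x))) p)
  back (¬' φ)   r s p q = p (go φ r s q)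
  back (φ ∧' ψ) r s (p , q) = back φ r s p , back ψ r s q
  back (φ ∨' ψ) r s (inj₁ p) = inj₁ (back φ r s p)
  back (φ ∨' ψ) r s (inj₂ p) = inj₂ (back ψ r s p)
  back (∃₁ φ)   r s (a , p) = from a , back φ (ext-ρ′ a r) s p
  back (∀₁ φ)   r s p a = back φ (ext-ρ a r) s (p (to a))
  back (∃₂ φ)   r s (X , p) = X ∘ to , back φ r (ext-σ′ X s) p
  back (∀₂ φ)   r s p X = back φ r (ext-σ X s) (p (X ∘ from))

Sat⇒SatD : ∀ S {i j} (φ : Formula i j) {ρ σ} → Sat S ρ σ φ → SatD (Fin (size S)) (lt S) ρ σ φ
SatD⇒Sat : ∀ S {i j} (φ : Formula i j) {ρ σ} → SatD (Fin (size S)) (lt S) ρ σ φ → Sat S ρ σ φ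
Sat⇒SatD S (x ≺' y) p = p
Sat⇒SatD S (x ≐ y)  p = p
Sat⇒SatD S (x ∈' X) p = p
Sat⇒SatD S (¬' φ)   p = p ∘ SatD⇒Sat S φ
Sat⇒SatD S (φ ∧' ψ) (p , q) = Sat⇒SatD S φ p , Sat⇒SatD S ψ q
Sat⇒SatD S (φ ∨' ψ) (inj₁ p) = inj₁ (Sat⇒SatD S φ p)
Sat⇒SatD S (φ ∨' ψ) (inj₂ p) = inj₂ (Sat⇒SatD S ψ p)
Sat⇒SatD S (∃₁ φ)   (a , p) = a , Sat⇒SatD S φ p
Sat⇒SatD S (∀₁ φ)   p a = Sat⇒SatD S φ (p a)
Sat⇒SatD S (∃₂ φ)   (X , p) = X , Sat⇒SatD S φ p
Sat⇒SatD S (∀₂ φ)   p X = Sat⇒SatD S φ (p X)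
SatD⇒Sat S (x ≺' y) p = p
SatD⇒Sat S (x ≐ y)  p = p
SatD⇒Sat S (x ∈' X) p = p
SatD⇒Sat S (¬' φ)   p = p ∘ Sat⇒SatD S φ
SatD⇒Sat S (φ ∧' ψ) (p , q) = SatD⇒Sat S φ p , SatD⇒Sat S ψ q
SatD⇒Sat S (φ ∨' ψ) (inj₁ p) = inj₁ (SatD⇒Sat S φ p)
SatD⇒Sat S (φ ∨' ψ) (inj₂ p) = inj₂ (SatD⇒Sat S ψ p)
SatD⇒Sat S (∃₁ φ)   (a , p) = a , SatD⇒Sat S φ p
SatD⇒Sat S (∀₁ φ)   p a = SatD⇒Sat S φ (p a)
SatD⇒Sat S (∃₂ φ)   (X , p) = X , SatD⇒Sat S φ p
SatD⇒Sat S (∀₂ φ)   p X = SatD⇒Sat S φ (p X)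

no-pos : ¬ Pos ε
no-pos ()

PIso : Fo → Fo → Set
PIso a b = OIso (ltP {a}) (ltP {b})

▸-iso : ∀ {a b c d} → PIso a c → PIso b d → PIso (a ▸ b) (c ▸ d)
▸-iso {a} {b} {c} {d} I J = record
  { to = glue top (down ∘ I.to) (right ∘ J.to)
  ; from = glue top (down ∘ I.from) (right ∘ J.from)
  ; to-from = λ where top → refl ; (down p) → cong down (I.to-from p) ; (right p) → cong right (J.to-from p)
  ; from-to = λ where top → refl ; (down p) → cong down (I.from-to p) ; (right p) → cong right (J.from-to p)
  ; pres = pr }
  where
  module I = OIso I
  module J = OIso J
  f : Pos (a ▸ b) → Pos (c ▸ d)
  f = glue top (down ∘ I.to) (right ∘ J.to)
  pr : ∀ x y → ltP x y ≡ ltP (f x) (f y)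
  pr top       top       = refl
  pr top       (down q)  = refl
  pr top       (right q) = refl
  pr (down p)  top       = refl
  pr (down p)  (down q)  = I.pres p q
  pr (down p)  (right q) = refl
  pr (right p) top       = refl
  pr (right p) (down q)  = refl
  pr (right p) (right q) = J.pres p q

swap-iso : ∀ {a b c} → PIso (a ▸ b ▸ c) (b ▸ a ▸ c)
swap-iso {a} {b} {c} = record { to = sw ; from = sw ; to-from = sw-sw ; from-to = sw-sw ; pres = pr }
  where
  sw : ∀ {a b} → Pos (a ▸ b ▸ c) → Pos (b ▸ a ▸ c)
  sw top               = right top
  sw (down p)          = right (down p)
  sw (right top)       = top
  sw (right (down p))  = down p
  sw (right (right p)) = right (right p)
  sw-sw : ∀ {a b} (x : Pos (a ▸ b ▸ c)) → sw (sw x) ≡ x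
  sw-sw top               = refl
  sw-sw (down p)          = refl
  sw-sw (right top)       = refl
  sw-sw (right (down p))  = refl
  sw-sw (right (right p)) = refl
  pr : ∀ x y → ltP x y ≡ ltP (sw x) (sw y)
  pr top       top       = refl
  pr top       (down q)  = refl
  pr (down p)  top       = refl
  pr (down p)  (down q)  = refl
  pr top       (right top)       = refl
  pr top       (right (down q))  = refl
  pr top       (right (right q)) = refl
  pr (down p)  (right top)       = refl
  pr (down p)  (right (down q))  = refl
  pr (down p)  (right (right q)) = refl
  pr (right top)       top = refl
  pr (right (down p))  top = refl
  pr (right (right p)) top = refl
  pr (right top)       (down q) = refl
  pr (right (down p))  (down q) = refl
  pr (right (right p)) (down q) = refl
  pr (right top)       (right top)       = refl
  pr (right top)       (right (down q))  = refl
  pr (right top)       (right (right q)) = refl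
  pr (right (down p))  (right top)       = refl
  pr (right (down p))  (right (down q))  = refl
  pr (right (down p))  (right (right q)) = refl
  pr (right (right p)) (right top)       = refl
  pr (right (right p)) (right (down q))  = refl
  pr (right (right p)) (right (right q)) = refl

~⇒iso : ∀ {a b} → a ~ b → PIso a b
~⇒iso ~ε           = oid
~⇒iso (~▸ p q)     = ▸-iso (~⇒iso p) (~⇒iso q)
~⇒iso ~swap        = swap-iso
~⇒iso (~trans p q) = otrans (~⇒iso p) (~⇒iso q)

record RootFirst (a : Fo) (r : Pos a) : Set where
  field
    kids rest : Fo
    equiv : a ~ kids ▸ rest
    iso   : PIso a (kids ▸ rest)
    moved : OIso.to iso r ≡ top

-- A maximal node is the root of a component, and repeated swaps bring this component to the front.
root-first : ∀ a (r : Pos a) → (∀ q → ltP r q ≡ false) → RootFirst a r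
root-first (a ▸ b) top      mx = record { kids = a ; rest = b ; equiv = ~refl ; iso = oid ; moved = refl }
root-first (a ▸ b) (down p) mx with mx top
... | ()
root-first (a ▸ b) (right p) mx = record
  { kids = kids ; rest = a ▸ rest ; equiv = ~trans (~▸ ~refl equiv) ~swap
  ; iso = otrans (▸-iso oid iso) swap-iso ; moved = lem (OIso.to iso p) moved }
  where
  open RootFirst (root-first b p (λ q → mx (right q)))
  lem : ∀ x → x ≡ top → OIso.to (swap-iso {a} {kids} {rest}) (right x) ≡ top
  lem .top refl = refl

module TopFixed {a b c d : Fo} (I : PIso (a ▸ b) (c ▸ d)) (fix : OIso.to I top ≡ top) where
  open OIso I

  to-down : ∀ p → ∃ λ q → to (down p) ≡ down q
  to-down p with to (down p) in eq
  ... | down q = q , refl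
  ... | top with trans (sym (cong₂ ltP eq fix)) (sym (pres (down p) top))
  ...   | ()
  to-down p | right q with trans (sym (cong₂ ltP eq fix)) (sym (pres (down p) top))
  ...   | ()

  to-right : ∀ p → ∃ λ q → to (right p) ≡ right q
  to-right p with to (right p) in eq
  ... | right q = q , refl
  ... | top with to-injective (trans eq (sym fix))
  ...   | ()
  to-right p | down q with trans (sym (cong₂ ltP eq fix)) (sym (pres (right p) top))
  ...   | ()

down-injective : ∀ {a b} {p q : Pos a} → down {a} {b} p ≡ down q → p ≡ q
down-injective refl = refl

right-injective : ∀ {a b} {p q : Pos b} → right {a} {b} p ≡ right q → p ≡ q
right-injective refl = refl

module _ {a b c d : Fo} (I : PIso (a ▸ b) (c ▸ d)) (fix : OIso.to I top ≡ top) where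
  private
    fix′ : OIso.to (osym I) top ≡ top
    fix′ = trans (cong (OIso.from I) (sym fix)) (OIso.from-to I top)
    module F = TopFixed I fix
    module B = TopFixed (osym I) fix′
    open OIso I

  iso-down : PIso a c
  iso-down = record
    { to = proj₁ ∘ F.to-down ; from = proj₁ ∘ B.to-down
    ; to-from = λ y → down-injective (trans (sym (proj₂ (F.to-down _))) (trans (cong to (sym (proj₂ (B.to-down y)))) (to-from _)))
    ; from-to = λ x → down-injective (trans (sym (proj₂ (B.to-down _))) (trans (cong from (sym (proj₂ (F.to-down x)))) (from-to _)))
    ; pres = λ x y → trans (pres (down x) (down y)) (cong₂ ltP (proj₂ (F.to-down x)) (proj₂ (F.to-down y))) }

  iso-right : PIso b d
  iso-right = record
    { to = proj₁ ∘ F.to-right ; from = proj₁ ∘ B.to-right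
    ; to-from = λ y → right-injective (trans (sym (proj₂ (F.to-right _))) (trans (cong to (sym (proj₂ (B.to-right y)))) (to-from _)))
    ; from-to = λ x → right-injective (trans (sym (proj₂ (B.to-right _))) (trans (cong from (sym (proj₂ (F.to-right x)))) (from-to _)))
    ; pres = λ x y → trans (pres (right x) (right y)) (cong₂ ltP (proj₂ (F.to-right x)) (proj₂ (F.to-right y))) }

-- The image of the first root is maximal, so its component can be moved to the front of c. The
-- isomorphism then fixes `top`, hence maps descendants to descendants and the remaining components
-- to the remaining components, and the recursion applies to both parts.
iso⇒~ : ∀ a b → PIso a b → a ~ b
iso⇒~ ε       ε       I = ~ε
iso⇒~ ε       (c ▸ d) I with OIso.from I top
... | ()
iso⇒~ (a ▸ b) c I = ~trans (~▸ (iso⇒~ a kids (iso-down K moved)) (iso⇒~ b rest (iso-right K moved))) (~sym equiv)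
  where
  open OIso I using (to; from; to-from; pres)
  maximal : ∀ q → ltP (to top) q ≡ false
  maximal q = trans (cong (ltP (to top)) (sym (to-from q))) (sym (pres top (from q)))
  open RootFirst (root-first c (to top) maximal)
  K : PIso (a ▸ b) (kids ▸ rest)
  K = otrans I iso

Rep : Str → Fo → Set
Rep S a = OIso (lt S) (ltP {a})

posFin : ∀ a → Pos a → Fin (sz a)
posFin (a ▸ b) top       = Fin.zero
posFin (a ▸ b) (down p)  = Fin.suc (posFin a p ↑ˡ sz b)
posFin (a ▸ b) (right p) = Fin.suc (sz a ↑ʳ posFin b p)

finPos : ∀ a → Fin (sz a) → Pos a
finPos (a ▸ b) Fin.zero    = top
finPos (a ▸ b) (Fin.suc k) = [ down ∘ finPos a , right ∘ finPos b ]′ (splitAt (sz a) k)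

finPos-posFin : ∀ a p → finPos a (posFin a p) ≡ p
finPos-posFin (a ▸ b) top = refl
finPos-posFin (a ▸ b) (down p) rewrite Finₚ.splitAt-↑ˡ (sz a) (posFin a p) (sz b) = cong down (finPos-posFin a p)
finPos-posFin (a ▸ b) (right p) rewrite Finₚ.splitAt-↑ʳ (sz a) (sz b) (posFin b p) = cong right (finPos-posFin b p)

posFin-finPos : ∀ a k → posFin a (finPos a k) ≡ k
posFin-finPos (a ▸ b) Fin.zero = refl
posFin-finPos (a ▸ b) (Fin.suc k) with splitAt (sz a) k in eq
... | inj₁ x = cong Fin.suc (trans (cong (_↑ˡ sz b) (posFin-finPos a x)) (Finₚ.splitAt⁻¹-↑ˡ eq))
... | inj₂ y = cong Fin.suc (trans (cong (sz a ↑ʳ_) (posFin-finPos b y)) (Finₚ.splitAt⁻¹-↑ʳ eq))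

strOf : Fo → Str
strOf a = mkStr (sz a) (λ x y → ltP (finPos a x) (finPos a y))

strOf-rep : ∀ a → Rep (strOf a) a
strOf-rep a = record
  { to = finPos a ; from = posFin a ; to-from = finPos-posFin a ; from-to = posFin-finPos a ; pres = λ _ _ → refl }

OIso⇒↔ : ∀ {D D′ : Set} {l : D → D → Bool} {l′ : D′ → D′ → Bool} → OIso l l′ → D ↔ D′
OIso⇒↔ I = mk↔ₛ′ to from to-from from-to
  where open OIso I

OIso⇒≅ : ∀ {S T} → OIso (lt S) (lt T) → S ≅ T
OIso⇒≅ I = record { bij = OIso⇒↔ I ; pres = OIso.pres I }

≅⇒OIso : ∀ {S T} → S ≅ T → OIso (lt S) (lt T)
≅⇒OIso I = record
  { to = to ; from = from ; to-from = λ y → inverseˡ refl ; from-to = λ x → inverseʳ refl ; pres = _≅_.pres I }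
  where open Inverse (_≅_.bij I)

rep-size : ∀ {S a} → Rep S a → size S ≡ sz a
rep-size {S} {a} I = ≤-antisym (Finₚ.injective⇒≤ (OIso.to-injective K)) (Finₚ.injective⇒≤ (OIso.to-injective (osym K)))
  where
  K : OIso (lt S) (lt (strOf a))
  K = otrans I (osym (strOf-rep a))

ltP-irrefl : ∀ {a} (p : Pos a) → ltP p p ≢ true
ltP-irrefl (down p)  = ltP-irrefl p
ltP-irrefl (right p) = ltP-irrefl p

ltP-trans : ∀ {a} (p q r : Pos a) → ltP p q ≡ true → ltP q r ≡ true → ltP p r ≡ true
ltP-trans (down p)  (down q)  top       e f = refl
ltP-trans (down p)  (down q)  (down r)  e f = ltP-trans p q r e f
ltP-trans (right p) (right q) (right r) e f = ltP-trans p q r e f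

ltP-chain : ∀ {a} (p q r : Pos a) → ltP p q ≡ true → ltP p r ≡ true →
            (q ≡ r ⊎ ltP q r ≡ true) ⊎ (r ≡ q ⊎ ltP r q ≡ true)
ltP-chain (down p)  top       top       e f = inj₁ (inj₁ refl)
ltP-chain (down p)  top       (down r)  e f = inj₂ (inj₂ refl)
ltP-chain (down p)  (down q)  top       e f = inj₁ (inj₂ refl)
ltP-chain (down p)  (down q)  (down r)  e f with ltP-chain p q r e f
... | inj₁ (inj₁ x) = inj₁ (inj₁ (cong down x))
... | inj₁ (inj₂ x) = inj₁ (inj₂ x)
... | inj₂ (inj₁ x) = inj₂ (inj₁ (cong down x))
... | inj₂ (inj₂ x) = inj₂ (inj₂ x)
ltP-chain (right p) (right q) (right r) e f with ltP-chain p q r e f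
... | inj₁ (inj₁ x) = inj₁ (inj₁ (cong right x))
... | inj₁ (inj₂ x) = inj₁ (inj₂ x)
... | inj₂ (inj₁ x) = inj₂ (inj₁ (cong right x))
... | inj₂ (inj₂ x) = inj₂ (inj₂ x)

rep-forest : ∀ {S a} → Rep S a → a ≢ ε → IsForest S
rep-forest {S} {a} I ne = record
  { nonempty = subst (1 ≤_) (sym (rep-size I)) (pos a ne)
  ; irrefl = λ x e → ltP-irrefl (to x) (trans (sym (pres x x)) e)
  ; trans = λ x y z e f → trans (pres x z) (ltP-trans (to x) (to y) (to z) (trans (sym (pres x y)) e) (trans (sym (pres y z)) f))
  ; upChain = chain }
  where
  open OIso I
  pos : ∀ a → a ≢ ε → 1 ≤ sz a
  pos ε       n = ⊥-elim (n refl)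
  pos (_ ▸ _) n = s≤s z≤n
  back : ∀ {y z} → (to y ≡ to z ⊎ ltP (to y) (to z) ≡ true) → S ⊢ y ≼ z
  back (inj₁ e) = inj₁ (to-injective e)
  back (inj₂ e) = inj₂ (trans (pres _ _) e)
  chain : ∀ x y z → S ⊢ x ≼ y → S ⊢ x ≼ z → (S ⊢ y ≼ z) ⊎ (S ⊢ z ≼ y)
  chain x .x z (inj₁ refl) q = inj₁ q
  chain x y .x (inj₂ p) (inj₁ refl) = inj₂ (inj₂ p)
  chain x y z (inj₂ p) (inj₂ q) with ltP-chain (to x) (to y) (to z) (trans (sym (pres x y)) p) (trans (sym (pres x z)) q)
  ... | inj₁ r = inj₁ (back r)
  ... | inj₂ r = inj₂ (back r)

module Decompose (S : Str) (F : IsForest S) where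
  open IsForest F using (irrefl; upChain) renaming (trans to ≺-trans)

  private
    N = Fin (size S)

    below? : ∀ r x → Dec (S ⊢ x ≺ r)
    below? r x = lt S x r Data.Bool.≟ true

    apart? : ∀ r x → Dec (¬ (S ⊢ x ≼ r))
    apart? r x = ¬? ((x Finₚ.≟ r) ⊎-dec below? r x)

    ≼-≺ : ∀ {x y z} → S ⊢ x ≼ y → S ⊢ y ≺ z → S ⊢ x ≺ z
    ≼-≺ (inj₁ refl) q = q
    ≼-≺ (inj₂ p)    q = ≺-trans _ _ _ p q

    -- The clause that m is at or above r carries the induction: an element y that was passed over
    -- because it does not lie above r cannot lie above m either.
    maximum : ∀ r ys → ∃ λ m → m ∈ r ∷ ys × (S ⊢ r ≼ m) × (∀ {y} → y ∈ r ∷ ys → ¬ (S ⊢ m ≺ y))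
    maximum r [] = r , here refl , inj₁ refl , λ where (here refl) → irrefl r
    maximum r (y ∷ ys) with below? y r
    ... | yes r≺y with maximum y ys
    ...   | m , m∈ , y≼m , mx = m , there m∈ , inj₂ (≺-≼ r≺y y≼m) , λ where
              (here refl) m≺r → irrefl y (≼-≺ y≼m (≺-trans _ _ _ m≺r r≺y))
              (there p)   → mx p
      where
      ≺-≼ : ∀ {x y z} → S ⊢ x ≺ y → S ⊢ y ≼ z → S ⊢ x ≺ z
      ≺-≼ p (inj₁ refl) = p
      ≺-≼ p (inj₂ q)    = ≺-trans _ _ _ p q
    maximum r (y ∷ ys) | no ¬r≺y with maximum r ys
    ...   | m , m∈ , r≼m , mx = m , skip m∈ , r≼m , λ where
              (here refl)         → mx (here refl)
              (there (here refl)) m≺y → ¬r≺y (≼-≺ r≼m m≺y)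
              (there (there p))   → mx (there p)
      where
      skip : ∀ {m} → m ∈ r ∷ ys → m ∈ r ∷ y ∷ ys
      skip (here e)  = here e
      skip (there p) = there (there p)

  record Realizes (xs : List N) : Set where
    field
      shape  : Fo
      node   : Pos shape → N
      node∈  : ∀ p → node p ∈ xs
      onto   : ∀ {x} → x ∈ xs → ∃ λ p → node p ≡ x
      node-injective : ∀ {p q} → node p ≡ node q → p ≡ q
      pres   : ∀ p q → ltP p q ≡ lt S (node p) (node q)

  -- A maximal element r becomes a root. The elements below r give its child forest, and those
  -- neither equal to r nor below it give the other trees; both lists omit r and are therefore
  -- shorter.
  realize : ∀ k xs → length xs ≤ k → Realizes xs
  realize k [] _ = record
    { shape = ε ; node = λ () ; node∈ = λ () ; onto = λ () ; node-injective = λ {p} → ⊥-elim (no-pos p) ; pres = λ () }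
  realize (suc k) (x₀ ∷ ys) (s≤s le) with maximum x₀ ys
  ... | r , r∈ , _ , mx = record
    { shape = D.shape ▸ R.shape ; node = g ; node∈ = g∈ ; onto = onto′
    ; node-injective = λ {p} {q} → inj p q ; pres = pr }
    where
    xs : List N
    xs = x₀ ∷ ys
    shorter : ∀ {P : N → Set} (P? : ∀ x → Dec (P x)) → ¬ P r → length (filter P? xs) ≤ k
    shorter P? ¬p = ≤-pred (≤-trans (Listₚ.filter-notAll P? xs (Any.map (λ where refl → ¬p) r∈)) (s≤s le))
    module D = Realizes (realize k (filter (below? r) xs) (shorter (below? r) (irrefl r)))
    module R = Realizes (realize k (filter (apart? r) xs) (shorter (apart? r) (λ n → n (inj₁ refl))))
    D≺ : ∀ p → S ⊢ D.node p ≺ r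
    D≺ p = proj₂ (∈-filter⁻ (below? r) {xs = xs} (D.node∈ p))
    R≺ : ∀ p → ¬ (S ⊢ R.node p ≼ r)
    R≺ p = proj₂ (∈-filter⁻ (apart? r) {xs = xs} (R.node∈ p))
    R∈ : ∀ p → R.node p ∈ xs
    R∈ p = proj₁ (∈-filter⁻ (apart? r) {xs = xs} (R.node∈ p))
    g : Pos (D.shape ▸ R.shape) → N
    g = glue r D.node R.node
    g∈ : ∀ p → g p ∈ xs
    g∈ top       = r∈
    g∈ (down p)  = proj₁ (∈-filter⁻ (below? r) {xs = xs} (D.node∈ p))
    g∈ (right p) = R∈ p
    onto′ : ∀ {x} → x ∈ xs → ∃ λ p → g p ≡ x
    onto′ {x} x∈ with x Finₚ.≟ r | below? r x
    ... | yes refl | _ = top , refl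
    ... | no  _    | yes b = let p , e = D.onto (∈-filter⁺ (below? r) x∈ b) in down p , e
    ... | no  n    | no ¬b = let p , e = R.onto (∈-filter⁺ (apart? r) x∈ [ n , ¬b ]′) in right p , e
    inj : ∀ p q → g p ≡ g q → p ≡ q
    inj top       top       e = refl
    inj top       (down q)  e = ⊥-elim (irrefl r (subst (λ z → S ⊢ z ≺ r) (sym e) (D≺ q)))
    inj top       (right q) e = ⊥-elim (R≺ q (inj₁ (sym e)))
    inj (down p)  top       e = ⊥-elim (irrefl r (subst (λ z → S ⊢ z ≺ r) e (D≺ p)))
    inj (down p)  (down q)  e = cong down (D.node-injective e)
    inj (down p)  (right q) e = ⊥-elim (R≺ q (inj₂ (subst (λ z → S ⊢ z ≺ r) e (D≺ p))))
    inj (right p) top       e = ⊥-elim (R≺ p (inj₁ e))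
    inj (right p) (down q)  e = ⊥-elim (R≺ p (inj₂ (subst (λ z → S ⊢ z ≺ r) (sym e) (D≺ q))))
    inj (right p) (right q) e = cong right (R.node-injective e)
    not≺ : ∀ {x y} → ¬ (S ⊢ x ≺ y) → false ≡ lt S x y
    not≺ {x} {y} n with lt S x y
    ... | true  = ⊥-elim (n refl)
    ... | false = refl
    pr : ∀ p q → ltP p q ≡ lt S (g p) (g q)
    pr top       q         = not≺ (mx (g∈ q))
    pr (down p)  top       = sym (D≺ p)
    pr (down p)  (down q)  = D.pres p q
    -- If the node of p lay below that of q, the chain condition would make q comparable with r. But
    -- q is not at or below r by the choice of the rest, and not above r by maximality.
    pr (down p)  (right q) = not≺ λ l → [ (λ q≼r → R≺ q q≼r) , [ (λ e → R≺ q (inj₁ (sym e))) , mx (R∈ q) ]′ ]′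
                                     (upChain (D.node p) (R.node q) r (inj₂ l) (inj₂ (D≺ p)))
    pr (right p) top       = not≺ (λ l → R≺ p (inj₂ l))
    pr (right p) (down q)  = not≺ (λ l → R≺ p (inj₂ (≺-trans _ _ _ l (D≺ q))))
    pr (right p) (right q) = R.pres p q

  canonical : Σ Fo λ a → Can a × Rep S a
  canonical = norm R.shape , Can-norm R.shape , otrans I (~⇒iso (~sym (norm-~ R.shape)))
    where
    module R = Realizes (realize (size S) (allFin (size S)) (≤-reflexive (Listₚ.length-tabulate id)))
    I : Rep S R.shape
    I = record
      { to = λ x → proj₁ (R.onto (∈-allFin x)) ; from = R.node
      ; to-from = λ p → R.node-injective (proj₂ (R.onto (∈-allFin (R.node p))))
      ; from-to = λ x → proj₂ (R.onto (∈-allFin x))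
      ; pres = λ x y → sym (trans (R.pres _ _) (cong₂ (lt S) (proj₂ (R.onto (∈-allFin x))) (proj₂ (R.onto (∈-allFin y))))) }

-- Concatenation of forests as disjoint sum

app : Fo → Fo → Fo
app ε       c = c
app (a ▸ b) c = a ▸ app b c

lt⊎ : ∀ {A B : Set} → (A → A → Bool) → (B → B → Bool) → A ⊎ B → A ⊎ B → Bool
lt⊎ l m (inj₁ x) (inj₁ y) = l x y
lt⊎ l m (inj₂ x) (inj₂ y) = m x y
lt⊎ l m (inj₁ _) (inj₂ _) = false
lt⊎ l m (inj₂ _) (inj₁ _) = false

app-iso : ∀ a c → OIso (ltP {app a c}) (lt⊎ (ltP {a}) (ltP {c}))
app-iso ε c = record
  { to = inj₂ ; from = λ where (inj₂ p) → p
  ; to-from = λ where (inj₂ p) → refl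
  ; from-to = λ _ → refl ; pres = λ _ _ → refl }
app-iso (a ▸ b) c = record { to = f ; from = g ; to-from = fg ; from-to = gf ; pres = pr }
  where
  open OIso (app-iso b c)
  h : Pos b ⊎ Pos c → Pos (a ▸ b) ⊎ Pos c
  h (inj₁ p) = inj₁ (right p)
  h (inj₂ p) = inj₂ p
  f : Pos (a ▸ app b c) → Pos (a ▸ b) ⊎ Pos c
  f top       = inj₁ top
  f (down p)  = inj₁ (down p)
  f (right p) = h (to p)
  g : Pos (a ▸ b) ⊎ Pos c → Pos (a ▸ app b c)
  g (inj₁ top)       = top
  g (inj₁ (down p))  = down p
  g (inj₁ (right p)) = right (from (inj₁ p))
  g (inj₂ p)         = right (from (inj₂ p))
  fg : ∀ y → f (g y) ≡ y
  fg (inj₁ top)       = refl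
  fg (inj₁ (down p))  = refl
  fg (inj₁ (right p)) = cong h (to-from (inj₁ p))
  fg (inj₂ p)         = cong h (to-from (inj₂ p))
  gh : ∀ s → g (h s) ≡ right (from s)
  gh (inj₁ p) = refl
  gh (inj₂ p) = refl
  gf : ∀ x → g (f x) ≡ x
  gf top       = refl
  gf (down p)  = refl
  gf (right p) = trans (gh (to p)) (cong right (from-to p))
  hh : ∀ s t → lt⊎ ltP ltP s t ≡ lt⊎ (ltP {a ▸ b}) ltP (h s) (h t)
  hh (inj₁ p) (inj₁ q) = refl
  hh (inj₁ p) (inj₂ q) = refl
  hh (inj₂ p) (inj₁ q) = refl
  hh (inj₂ p) (inj₂ q) = refl
  top-h : ∀ s → false ≡ lt⊎ (ltP {a ▸ b}) ltP (inj₁ top) (h s)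
  top-h (inj₁ p) = refl
  top-h (inj₂ p) = refl
  h-top : ∀ s → false ≡ lt⊎ (ltP {a ▸ b}) ltP (h s) (inj₁ top)
  h-top (inj₁ p) = refl
  h-top (inj₂ p) = refl
  down-h : ∀ p s → false ≡ lt⊎ (ltP {a ▸ b}) ltP (inj₁ (down p)) (h s)
  down-h p (inj₁ _) = refl
  down-h p (inj₂ _) = refl
  h-down : ∀ p s → false ≡ lt⊎ (ltP {a ▸ b}) ltP (h s) (inj₁ (down p))
  h-down p (inj₁ _) = refl
  h-down p (inj₂ _) = refl
  pr : ∀ x y → ltP x y ≡ lt⊎ ltP ltP (f x) (f y)
  pr top       top       = refl
  pr top       (down q)  = refl
  pr top       (right q) = top-h (to q)
  pr (down p)  top       = refl
  pr (down p)  (down q)  = refl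
  pr (down p)  (right q) = down-h p (to q)
  pr (right p) top       = h-top (to p)
  pr (right p) (down q)  = h-down q (to p)
  pr (right p) (right q) = trans (pres p q) (hh (to p) (to q))

rep-⊕ : ∀ {S T a b} → Rep S a → Rep T b → Rep (S ⊕ T) (app a b)
rep-⊕ {S} {T} {a} {b} I J = otrans split (otrans both (osym (app-iso a b)))
  where
  module I = OIso I
  module J = OIso J
  split : OIso (lt (S ⊕ T)) (lt⊎ (lt S) (lt T))
  split = record
    { to = splitAt (size S) ; from = Data.Fin.join (size S) (size T)
    ; to-from = Finₚ.splitAt-join (size S) (size T) ; from-to = Finₚ.join-splitAt (size S) (size T)
    ; pres = pr }
    where
    pr : ∀ x y → lt (S ⊕ T) x y ≡ lt⊎ (lt S) (lt T) (splitAt (size S) x) (splitAt (size S) y)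
    pr x y with splitAt (size S) x | splitAt (size S) y
    ... | inj₁ _ | inj₁ _ = refl
    ... | inj₂ _ | inj₂ _ = refl
    ... | inj₁ _ | inj₂ _ = refl
    ... | inj₂ _ | inj₁ _ = refl
  both : OIso (lt⊎ (lt S) (lt T)) (lt⊎ (ltP {a}) (ltP {b}))
  both = record
    { to = Data.Sum.map I.to J.to ; from = Data.Sum.map I.from J.from
    ; to-from = λ where (inj₁ x) → cong inj₁ (I.to-from x) ; (inj₂ x) → cong inj₂ (J.to-from x)
    ; from-to = λ where (inj₁ x) → cong inj₁ (I.from-to x) ; (inj₂ x) → cong inj₂ (J.from-to x)
    ; pres = λ where
        (inj₁ x) (inj₁ y) → I.pres x y
        (inj₁ x) (inj₂ y) → refl
        (inj₂ x) (inj₁ y) → refl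
        (inj₂ x) (inj₂ y) → J.pres x y }

-- Counting sequences that are negligible against their own tails

χ-yes : ∀ {P : Set} (d : Dec P) → P → χ (does d) ≡ 1
χ-yes d p = cong χ (dec-true d p)

χ-no : ∀ {P : Set} (d : Dec P) → ¬ P → χ (does d) ≡ 0
χ-no d ¬p = cong χ (dec-false d ¬p)

χ>0⇒ : ∀ {P : Set} (d : Dec P) → 0 < χ (does d) → P
χ>0⇒ d lt = does⇒ d (χ>0⇒true lt)

*>0⇒ˡ : ∀ m n → 0 < m * n → 0 < m
*>0⇒ˡ (suc m) n _ = z<s

*>0⇒ʳ : ∀ m n → 0 < m * n → 0 < n
*>0⇒ʳ m n lt = *>0⇒ˡ n m (subst (0 <_) (*-comm m n) lt)

∑-⊆ : ∀ {A : Set} {f g : A → ℕ} {xs : List A} (ys : List A) → Unique xs →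
      (∀ {x} → x ∈ xs → 0 < f x → x ∈ ys × f x ≤ g x) → ∑ xs f ≤ ∑ ys g
∑-⊆ ys u h = ∑-inj ys id u h (λ _ _ _ _ e → e)

length-upTo : ∀ n → length (upTo n) ≡ n
length-upTo = Listₚ.length-applyUpTo id

-- The bound 2 l e ≤ n makes a shift lose at most half of the size; this is what keeps the weights in
-- `shift-step` comparable.
Shift : ℕ → ℕ → ℕ → Set
Shift e n l = 1 ≤ l × 2 * (l * e) ≤ n

shift? : ∀ e n l → Dec (Shift e n l)
shift? e n l = (1 ≤? l) ×-dec (2 * (l * e) ≤? n)

shift-≤ : ∀ {e n l} → 1 ≤ e → Shift e n l → l ≤ n
shift-≤ {e} {n} {l} e≥1 (_ , b) = begin
  l           ≡⟨ sym (*-identityʳ l) ⟩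
  l * 1       ≤⟨ *-monoʳ-≤ l e≥1 ⟩
  l * e       ≤⟨ m≤m+n (l * e) _ ⟩
  2 * (l * e) ≤⟨ b ⟩
  n           ∎
  where open ≤-Reasoning

abstract
  shifts : ℕ → ℕ → List ℕ
  shifts e n = filter (shift? e n) (upTo (suc n))

  shifts! : ∀ e n → Unique (shifts e n)
  shifts! e n = Uniqueₚ.filter⁺ (shift? e n) (Uniqueₚ.upTo⁺ (suc n))

  ∈-shifts⁺ : ∀ {e n l} → 1 ≤ e → Shift e n l → l ∈ shifts e n
  ∈-shifts⁺ {e} {n} e≥1 s = ∈-filter⁺ (shift? e n) (∈-upTo⁺ (s≤s (shift-≤ e≥1 s))) s

  ∈-shifts⁻ : ∀ {e n l} → l ∈ shifts e n → Shift e n l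
  ∈-shifts⁻ {e} {n} p = proj₂ (∈-filter⁻ (shift? e n) {xs = upTo (suc n)} p)

shift-half : ∀ {e n l} → Shift e n l → l * e ≤ n
shift-half (_ , b) = ≤-trans (m≤m+n _ _) b

tail : ℕ → (ℕ → ℕ) → ℕ → ℕ
tail e c n = ∑ (shifts e n) (λ l → c (n ∸ l * e))

Negligible : ℕ → (ℕ → ℕ) → Set
Negligible e c = ∀ L → ∃[ N ] ∀ n → N ≤ n → L * c n ≤ tail e c n

negligible-0 : ∀ {e c} → (∀ n → c n ≡ 0) → Negligible e c
negligible-0 {c = c} h L = 0 , λ n _ → ≤-trans (≤-reflexive (trans (cong (L *_) (h n)) (*-zeroʳ L))) z≤n

negligible-∑ : ∀ {A : Set} {e} (xs : List A) (c : A → ℕ → ℕ) → (∀ x → Negligible e (c x)) →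
               Negligible e (λ n → ∑ xs (λ x → c x n))
negligible-∑ {e = e} xs c q L with max-bound xs (λ x n → L * c x n ≤ tail e (c x) n) (λ x → q x L)
... | N , b = N , λ n le → begin
  L * ∑ xs (λ x → c x n)                                  ≡⟨ sym (∑-*ˡ xs L _) ⟩
  ∑ xs (λ x → L * c x n)                                  ≤⟨ ∑-mono xs (λ x∈ → b x∈ n le) ⟩
  ∑ xs (λ x → ∑ (shifts e n) (λ l → c x (n ∸ l * e)))     ≡⟨ ∑-swap xs (shifts e n) _ ⟩
  ∑ (shifts e n) (λ l → ∑ xs (λ x → c x (n ∸ l * e)))     ∎
  where open ≤-Reasoning

half-bound : ∀ m {n k} → 2 * m ≤ n → 2 * k ≤ n → k ≤ n ∸ m
half-bound m {n} {k} p q = m+n≤o⇒m≤o∸n k (*-cancelˡ-≤ 2 (begin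
  2 * (k + m)   ≡⟨ *-distribˡ-+ 2 k m ⟩
  2 * k + 2 * m ≤⟨ +-mono-≤ q p ⟩
  n + n         ≡⟨ cong (n +_) (sym (+-identityʳ n)) ⟩
  2 * n         ∎))
  where open ≤-Reasoning

-- A shift loses at most half of n, so from 2 * n₀ on every term of the tail lies in the range where
-- the two sequences agree.
negligible-eventually : ∀ {e c c′} n₀ → (∀ n → n₀ ≤ n → c n ≡ c′ n) → Negligible e c → Negligible e c′
negligible-eventually {e} {c} {c′} n₀ h q L with q L
... | N , b = N + 2 * n₀ , λ n le → begin
  L * c′ n     ≡⟨ cong (L *_) (sym (h n (≤-trans (m≤m+n n₀ _) (≤-trans (m≤n+m (2 * n₀) N) le)))) ⟩
  L * c n      ≤⟨ b n (≤-trans (m≤m+n N _) le) ⟩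
  tail e c n   ≡⟨ ∑-cong (shifts e n) (λ {l} l∈ → h _ (half-bound (l * e) (proj₂ (∈-shifts⁻ l∈)) (≤-trans (m≤n+m (2 * n₀) N) le))) ⟩
  tail e c′ n  ∎
  where open ≤-Reasoning

-- Along a residue class modulo p, t is the sequence of partial sums of b. Unfolding t n down to an
-- argument m below N + p compares all but t m with the tail of t. The term t m is absorbed because
-- t grows along the class and, as p divides e, the tail contains many values that are at least t m.
negligible-chain : ∀ {e p} {b t : ℕ → ℕ} → 1 ≤ e → 1 ≤ p → p ∣ e →
  (∀ n → p ≤ n → t n ≡ b n + t (n ∸ p)) → (∀ n → n < p → t n ≡ b n) →
  Negligible e b → Negligible e t
negligible-chain {e} {p} {b} {t} e≥1 p≥1 (divides c e≡) step base q L with q (2 * L)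
-- Both halves of the estimate cost one tail, hence the factor 2 * L. The doubled bound makes the
-- shifts 1, ..., 2 * L admissible and keeps n ∸ l * e at or above the remaining argument m.
... | N , bnd = 2 * (N + p + 2 * L * e) , λ n le → *-cancelˡ-≤ 2 (begin
  2 * (L * t n)                  ≡⟨ sym (*-assoc 2 L (t n)) ⟩
  2 * L * t n                    ≤⟨ proj₂ (proj₂ (down′ n)) ⟩
  tail e t n + 2 * L * t (proj₁ (down′ n)) ≤⟨ +-monoʳ-≤ (tail e t n) (small n le (down′ n)) ⟩
  tail e t n + tail e t n        ≡⟨ cong (tail e t n +_) (sym (+-identityʳ _)) ⟩
  2 * tail e t n                 ∎)
  where
  open ≤-Reasoning
  K : ℕ
  K = 2 * L
  mono : ∀ j n → t n ≤ t (n + j * p)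
  mono zero    n = ≤-reflexive (cong t (sym (+-identityʳ n)))
  mono (suc j) n = begin
    t n                               ≤⟨ mono j n ⟩
    t (n + j * p)                     ≤⟨ m≤n+m _ (b (n + j * p + p)) ⟩
    b (n + j * p + p) + t (n + j * p) ≡⟨ cong (λ z → b (n + j * p + p) + t z) (sym (m+n∸n≡m (n + j * p) p)) ⟩
    b (n + j * p + p) + t (n + j * p + p ∸ p) ≡⟨ sym (step (n + j * p + p) (m≤n+m p _)) ⟩
    t (n + j * p + p)                 ≡⟨ cong t (assoc′ n (j * p) p) ⟩
    t (n + (p + j * p))               ∎
    where
    assoc′ : ∀ x y z → x + y + z ≡ x + (z + y)
    assoc′ = solve-∀
  -- Every shift of n ∸ p is a shift of n, and for it the recurrence at n ∸ l * e merges the two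
  -- terms into one; for the other shifts of n, `b≤t` suffices.
  tail-step : ∀ n → p ≤ n → tail e b n + tail e t (n ∸ p) ≤ tail e t n
  tail-step n p≤n = begin
    tail e b n + tail e t (n ∸ p)
      ≤⟨ +-monoʳ-≤ (tail e b n) (∑-⊆ {f = λ l → t (n ∸ p ∸ l * e)} {g = λ l → χ (does (shift? e (n ∸ p) l)) * t (n ∸ p ∸ l * e)} (shifts e n) (shifts! e (n ∸ p)) into) ⟩
    tail e b n + ∑ (shifts e n) (λ l → χ (does (shift? e (n ∸ p) l)) * t (n ∸ p ∸ l * e))
      ≡⟨ sym (∑-+ (shifts e n) _ _) ⟩
    ∑ (shifts e n) (λ l → b (n ∸ l * e) + χ (does (shift? e (n ∸ p) l)) * t (n ∸ p ∸ l * e))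
      ≤⟨ ∑-mono (shifts e n) (λ {l} l∈ → pt l) ⟩
    tail e t n ∎
    where
    into : ∀ {l} → l ∈ shifts e (n ∸ p) → 0 < t (n ∸ p ∸ l * e) → l ∈ shifts e n × t (n ∸ p ∸ l * e) ≤ χ (does (shift? e (n ∸ p) l)) * t (n ∸ p ∸ l * e)
    into {l} l∈ _ with ∈-shifts⁻ {e} {n ∸ p} l∈
    ... | s@(l≥1 , le) = ∈-shifts⁺ e≥1 (l≥1 , ≤-trans le (m∸n≤m n p)) ,
          ≤-reflexive (sym (trans (cong (_* t (n ∸ p ∸ l * e)) (χ-yes (shift? e (n ∸ p) l) s)) (+-identityʳ _)))
    b≤t : ∀ m → b m ≤ t m
    b≤t m with p ≤? m
    ... | yes p≤m = ≤-trans (m≤m+n (b m) _) (≤-reflexive (sym (step m p≤m)))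
    ... | no  p≰m = ≤-reflexive (sym (base m (≰⇒> p≰m)))
    pt : ∀ l → b (n ∸ l * e) + χ (does (shift? e (n ∸ p) l)) * t (n ∸ p ∸ l * e) ≤ t (n ∸ l * e)
    pt l with 2 * (l * e) ≤? n ∸ p
    ... | no ¬s = ≤-trans (≤-reflexive (trans (cong (λ z → b (n ∸ l * e) + z * t (n ∸ p ∸ l * e)) (χ-no (shift? e (n ∸ p) l) (¬s ∘ proj₂))) (+-identityʳ _))) (b≤t _)
    ... | yes s = begin
      b (n ∸ l * e) + χ (does (shift? e (n ∸ p) l)) * t (n ∸ p ∸ l * e) ≤⟨ +-monoʳ-≤ (b (n ∸ l * e)) (*-monoˡ-≤ (t (n ∸ p ∸ l * e)) (χ≤1 (does (shift? e (n ∸ p) l)))) ⟩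
      b (n ∸ l * e) + 1 * t (n ∸ p ∸ l * e) ≡⟨ cong (b (n ∸ l * e) +_) (trans (+-identityʳ _) (cong t (∸-swap n p (l * e)))) ⟩
      b (n ∸ l * e) + t (n ∸ l * e ∸ p)     ≡⟨ sym (step (n ∸ l * e) (m+n≤o⇒m≤o∸n p (subst (_≤ n) (+-comm (l * e) p) (m≤n∸o⇒m+o≤n′ p≤n (≤-trans (m≤m+n _ _) s))))) ⟩
      t (n ∸ l * e)                         ∎
      where
      ∸-swap : ∀ x y z → x ∸ y ∸ z ≡ x ∸ z ∸ y
      ∸-swap x y z = trans (∸-+-assoc x y z) (trans (cong (x ∸_) (+-comm y z)) (sym (∸-+-assoc x z y)))
      m≤n∸o⇒m+o≤n′ : ∀ {m n o} → o ≤ n → m ≤ n ∸ o → m + o ≤ n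
      m≤n∸o⇒m+o≤n′ {m} {n} {o} o≤n le = ≤-trans (+-monoˡ-≤ o le) (≤-reflexive (m∸n+n≡m o≤n))
  Reach : ℕ → Set
  Reach n = ∃ λ m → (m < N + p × ∃ λ j → n ≡ m + j * p) × K * t n ≤ tail e t n + K * t m
  reach : ∀ fuel n → n ≤ fuel → Reach n
  reach fuel n le with n <? N + p
  ... | yes n< = n , (n< , 0 , sym (+-identityʳ n)) , m≤n+m _ _
  reach zero n le | no n≮ = ⊥-elim (n≮ (≤-trans (s≤s le) (≤-trans p≥1 (m≤n+m p N))))
  reach (suc fuel) n le | no n≮ with reach fuel (n ∸ p) (≤-pred (≤-trans (∸-monoʳ-< {n} {p} {0} p≥1 p≤n) le))
    where
    p≤n : p ≤ n
    p≤n = ≤-trans (m≤n+m p N) (≮⇒≥ n≮)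
  ... | m , (m< , j , n≡) , ih = m , (m< , suc j , trans (sym (m∸n+n≡m p≤n)) (trans (cong (_+ p) n≡) (assoc′ m (j * p) p))) , (begin
    K * t n                                            ≡⟨ cong (K *_) (step n p≤n) ⟩
    K * (b n + t (n ∸ p))                              ≡⟨ *-distribˡ-+ K (b n) _ ⟩
    K * b n + K * t (n ∸ p)                            ≤⟨ +-mono-≤ (bnd n (≤-trans (m≤m+n N p) (≮⇒≥ n≮))) ih ⟩
    tail e b n + (tail e t (n ∸ p) + K * t m)          ≡⟨ sym (+-assoc (tail e b n) _ _) ⟩
    tail e b n + tail e t (n ∸ p) + K * t m            ≤⟨ +-monoˡ-≤ (K * t m) (tail-step n p≤n) ⟩
    tail e t n + K * t m                               ∎)
    where
    p≤n : p ≤ n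
    p≤n = ≤-trans (m≤n+m p N) (≮⇒≥ n≮)
    assoc′ : ∀ x y z → x + y + z ≡ x + (z + y)
    assoc′ = solve-∀
  down′ : ∀ n → Reach n
  down′ n = reach n n ≤-refl
  small : ∀ n → 2 * (N + p + 2 * L * e) ≤ n → (r : Reach n) → K * t (proj₁ r) ≤ tail e t n
  small n le (m , (m< , j , n≡) , _) = begin
    K * t m                     ≡⟨ cong (_* t m) (sym (length-upTo K)) ⟩
    length (upTo K) * t m       ≡⟨ sym (∑-const (upTo K) (t m)) ⟩
    ∑ (upTo K) (λ _ → t m)      ≤⟨ ∑-inj (shifts e n) suc (Uniqueₚ.upTo⁺ K) into (λ _ _ _ _ → suc-injective) ⟩
    tail e t n                  ∎
    where
    into : ∀ {l} → l ∈ upTo K → 0 < t m → suc l ∈ shifts e n × t m ≤ t (n ∸ suc l * e)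
    into {l} l∈ _ = ∈-shifts⁺ e≥1 (s≤s z≤n , sh) , ≤-trans (mono (j ∸ suc l * c) m) (≤-reflexive (cong t (sym eq)))
      where
      sh : 2 * (suc l * e) ≤ n
      sh = ≤-trans (*-monoʳ-≤ 2 (≤-trans (*-monoˡ-≤ e (∈-upTo⁻ l∈)) (m≤n+m (K * e) (N + p)))) le
      m≤ : m ≤ n ∸ suc l * e
      m≤ = half-bound (suc l * e) sh (≤-trans (*-monoʳ-≤ 2 (≤-trans (<⇒≤ m<) (m≤m+n (N + p) (K * e)))) le)
      le≡ : suc l * e ≡ suc l * c * p
      le≡ = trans (cong (suc l *_) e≡) (sym (*-assoc (suc l) c p))
      lc≤j : suc l * c ≤ j
      lc≤j = *-cancelʳ-≤ (suc l * c) j p {{>-nonZero p≥1}} (+-cancelˡ-≤ m _ _ (begin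
        m + suc l * c * p             ≡⟨ cong (m +_) (sym le≡) ⟩
        m + suc l * e                 ≤⟨ +-monoˡ-≤ (suc l * e) m≤ ⟩
        n ∸ suc l * e + suc l * e     ≡⟨ m∸n+n≡m {n} {suc l * e} (≤-trans (m≤m+n _ _) sh) ⟩
        n                             ≡⟨ n≡ ⟩
        m + j * p                     ∎))
      eq : n ∸ suc l * e ≡ m + (j ∸ suc l * c) * p
      eq = begin-equality
        n ∸ suc l * e                   ≡⟨ cong₂ _∸_ n≡ le≡ ⟩
        m + j * p ∸ suc l * c * p       ≡⟨ +-∸-assoc m (*-monoˡ-≤ p lc≤j) ⟩
        m + (j * p ∸ suc l * c * p)     ≡⟨ cong (m +_) (sym (*-distribʳ-∸ p j (suc l * c))) ⟩
        m + (j ∸ suc l * c) * p         ∎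

-- Typed multisets of trees

deln : ℕ → Fo → Fo → Fo
deln zero    a b = b
deln (suc i) a b = deln i a (del a b)

deln-insn : ∀ i a b → deln i a (insn i a b) ≡ b
deln-insn zero    a b = refl
deln-insn (suc i) a b = trans (cong (deln i a) (del-ins a (insn i a b))) (deln-insn i a b)

record Removed (i : ℕ) (a b : Fo) : Set where
  field
    canon : Can (deln i a b)
    whole : b ≡ insn i a (deln i a b)
    left  : mult a b ≡ i + mult a (deln i a b)
    size≡ : sz b ≡ i * suc (sz a) + sz (deln i a b)

removed : ∀ i {a b} → Can b → i ≤ mult a b → Removed i a b
removed i {a} {b} cb le with insn-split i {a} {b} cb le
... | c , cc , e , m = record
  { canon = subst Can (sym d) cc ; whole = trans e (cong (insn i a) (sym d))
  ; left = trans m (cong (λ z → i + mult a z) (sym d))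
  ; size≡ = trans (cong sz e) (trans (size-insn i a c) (cong (λ z → i * suc (sz a) + sz z) (sym d))) }
  where
  d : deln i a b ≡ c
  d = trans (cong (deln i a) e) (deln-insn i a c)

mult≤sz : ∀ a b → mult a b ≤ sz b
mult≤sz a ε       = z≤n
mult≤sz a (b ▸ c) = +-mono-≤ (χ≤1 (a == b)) (≤-trans (mult≤sz a c) (m≤n+m (sz c) (sz b)))

-- Writes a multiplicity as a number of levels; level i then stands for the removal of suc i copies.
∑-below : ∀ m n → m ≤ n → ∑ (upTo n) (λ i → χ (does (suc i ≤? m))) ≡ m
∑-below m n le = ≤-antisym
  (≤-trans (∑-⊆ {g = λ _ → 1} (upTo m) (Uniqueₚ.upTo⁺ n) (λ {i} _ p → ∈-upTo⁺ (χ>0⇒ (suc i ≤? m) p) , χ≤1 (does (suc i ≤? m))))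
           (≤-reflexive (trans (∑-const (upTo m) 1) (trans (*-identityʳ _) (length-upTo m)))))
  (≤-trans (≤-reflexive (sym (trans (∑-const (upTo m) 1) (trans (*-identityʳ _) (length-upTo m)))))
           (∑-⊆ (upTo n) (Uniqueₚ.upTo⁺ m) (λ {i} i∈ _ → ∈-upTo⁺ (≤-trans (∈-upTo⁻ i∈) le) , ≤-reflexive (sym (χ-yes (suc i ≤? m) (∈-upTo⁻ i∈))))))

-- `deln i a` and `insn i a` are mutually inverse between the two families. The leading factor
-- guards against truncated subtraction when i copies do not fit into n.
count-removed : ∀ (P : Fo → Bool) n a i → Can a →
  ∑ (E n) (λ G → χ (P G) * χ (does (i ≤? mult a G)))
    ≡ χ (does (i * suc (sz a) ≤? n)) * count (n ∸ i * suc (sz a)) (λ H → P (insn i a H))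
count-removed P n a i ca with i * suc (sz a) ≤? n
... | no big = trans (∑-zero (E n) zer) (cong (_* count (n ∸ i * suc (sz a)) (λ H → P (insn i a H))) (sym (χ-no (i * suc (sz a) ≤? n) big)))
  where
  zer : ∀ {G} → G ∈ E n → χ (P G) * χ (does (i ≤? mult a G)) ≡ 0
  zer {G} G∈ = trans (cong (χ (P G) *_) (χ-no (i ≤? mult a G) λ le → big (≤-trans (m≤m+n _ _)
      (≤-reflexive (trans (sym (Removed.size≡ (removed i {a} {G} (proj₁ (∈-E⁻ G∈)) le))) (proj₂ (∈-E⁻ G∈))))))) (*-zeroʳ (χ (P G)))
... | yes fits = trans (≤-antisym upper lower)
    (trans (sym (+-identityʳ _)) (cong (_* count (n ∸ i * suc (sz a)) (λ H → P (insn i a H))) (sym (χ-yes (i * suc (sz a) ≤? n) fits))))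
  where
  m : ℕ
  m = i * suc (sz a)
  upper : ∑ (E n) (λ G → χ (P G) * χ (does (i ≤? mult a G))) ≤ count (n ∸ m) (λ H → P (insn i a H))
  upper = ∑-inj (E (n ∸ m)) (deln i a) (E! n) into inj
    where
    get : ∀ {G} → G ∈ E n → 0 < χ (P G) * χ (does (i ≤? mult a G)) → Removed i a G
    get {G} G∈ pos = removed i (proj₁ (∈-E⁻ G∈)) (χ>0⇒ (i ≤? mult a G) (*>0⇒ʳ (χ (P G)) _ pos))
    into : ∀ {G} → G ∈ E n → 0 < χ (P G) * χ (does (i ≤? mult a G)) →
           deln i a G ∈ E (n ∸ m) × χ (P G) * χ (does (i ≤? mult a G)) ≤ χ (P (insn i a (deln i a G)))
    into {G} G∈ pos = ∈-E⁺′ (Removed.canon r) (sym (trans (cong (_∸ m) (trans (sym (proj₂ (∈-E⁻ G∈))) (Removed.size≡ r))) (m+n∸m≡n m _))) ,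
      ≤-trans (*-monoʳ-≤ (χ (P G)) (χ≤1 (does (i ≤? mult a G)))) (≤-reflexive (trans (*-identityʳ _) (cong (χ ∘ P) (Removed.whole r))))
      where
      r : Removed i a G
      r = get G∈ pos
    inj : ∀ {G G′} → G ∈ E n → G′ ∈ E n → 0 < χ (P G) * χ (does (i ≤? mult a G)) → 0 < χ (P G′) * χ (does (i ≤? mult a G′)) →
          deln i a G ≡ deln i a G′ → G ≡ G′
    inj p q x y e = trans (Removed.whole (get p x)) (trans (cong (insn i a) e) (sym (Removed.whole (get q y))))
  lower : count (n ∸ m) (λ H → P (insn i a H)) ≤ ∑ (E n) (λ G → χ (P G) * χ (does (i ≤? mult a G)))
  lower = ∑-inj (E n) (insn i a) (E! (n ∸ m)) (λ {H} H∈ _ →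
      ∈-E⁺′ (Can-insn i ca (proj₁ (∈-E⁻ H∈))) (trans (size-insn i a H) (trans (cong (m +_) (proj₂ (∈-E⁻ H∈))) (m+[n∸m]≡n fits))) ,
      ≤-reflexive (sym (trans (cong (χ (P (insn i a H)) *_) (χ-yes (i ≤? mult a (insn i a H)) (≤-trans (m≤m+n i _) (≤-reflexive (sym (mult-insn-same i a H)))))) (*-identityʳ _))))
    (λ _ _ _ _ e → insn-injective i a e)

module Typed (A : Alg (Label 0 0)) where
  open Alg A public

  _≡ᴹ_ : M → M → Bool
  x ≡ᴹ y = does (x ≈? y)

  ty : Fo → M
  ty ε       = e₀
  ty (a ▸ b) = rt ([] , []) (ty a) ∙ ty b

  κ : Fo → M
  κ a = rt ([] , []) (ty a)

  ty-fold : ∀ a (α : Pos a → Label 0 0) → fold A a α ≡ ty a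
  ty-fold ε       α = refl
  ty-fold (a ▸ b) α with α top
  ... | [] , [] = cong₂ _∙_ (cong (rt ([] , [])) (ty-fold a (α ∘ down))) (ty-fold b (α ∘ right))

  ty-~ : ∀ {a b} → a ~ b → ty a ≡ ty b
  ty-~ ~ε           = refl
  ty-~ (~▸ p q)     = cong₂ _∙_ (cong (rt ([] , [])) (ty-~ p)) (ty-~ q)
  ty-~ ~swap        = swap-∙ _ _ _
  ty-~ (~trans p q) = trans (ty-~ p) (ty-~ q)

  ty-ins : ∀ a b → ty (ins a b) ≡ κ a ∙ ty b
  ty-ins a b = ty-~ (ins-~ a b)

  ty-insn : ∀ i a b → ty (insn i a b) ≡ pw i (κ a) ∙ ty b
  ty-insn zero    a b = sym (idˡ _)
  ty-insn (suc i) a b = trans (ty-ins a (insn i a b)) (trans (cong (κ a ∙_) (ty-insn i a b)) (sym (assoc _ _ _)))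

  treeCount : (Fo → Bool) → M → ℕ → ℕ
  treeCount B σ k = count k (λ a → B a ∧ (κ a ≡ᴹ σ))

  forestCount : (Fo → Bool) → M → ℕ → ℕ
  forestCount B μ n = count n (λ G → allC B G ∧ (ty G ≡ᴹ μ))

  -- If i copies of a large tree S are replaced by i copies of a smaller tree of the same type, the forest
  -- type is unchanged; forests without large trees contain some small tree very often, and then copies
  -- of it can be removed without changing the type, by aperiodicity.
  module Multiset (B : Fo → Bool) (e : ℕ) (e≥1 : 1 ≤ e) (hyp : ∀ σ → Negligible e (treeCount B σ)) (μ : M) where
    private
      t : M → ℕ → ℕ
      t = treeCount B

      f : ℕ → ℕ
      f = forestCount B μ

      P : Fo → Bool
      P G = allC B G ∧ (ty G ≡ᴹ μ)

      h : M → ℕ → ℕ → ℕ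
      h σ i m = count m (λ H → allC B H ∧ ((pw i σ ∙ ty H) ≡ᴹ μ))

      ψ : ℕ → ℕ → ℕ → ℕ
      ψ k i m = suc k * ∑ elems (λ σ → t σ k * h σ i m)

      -- Counts, with weight suc k, the pairs of a tree of size suc k and a forest that together
      -- with i copies of the tree has type μ and size n. Summed over k and i this is the typed
      -- version of the recurrence for multisets that comes from the logarithmic derivative of the
      -- Euler product.
      Φ : ℕ → ℕ → ℕ → ℕ
      Φ n k i = χ (does (i * suc k ≤? n)) * ψ k i (n ∸ i * suc k)

      part : ℕ → Fo → ℕ
      part k G = ∑ (E k) (λ a → suc k * mult a G)

      allC-insn : ∀ i a H → allC B (insn (suc i) a H) ≡ B a ∧ allC B H
      allC-insn zero    a H = allC-ins B a H
      allC-insn (suc i) a H = trans (allC-ins B a (insn (suc i) a H)) (trans (cong (B a ∧_) (allC-insn i a H)) (idem (B a) _))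
        where
        idem : ∀ x y → x ∧ (x ∧ y) ≡ x ∧ y
        idem true  y = refl
        idem false y = refl

      count-typed : ∀ i a m → count m (λ H → P (insn (suc i) a H)) ≡ χ (B a) * h (κ a) (suc i) m
      count-typed i a m = trans (∑-cong (E m) (λ {H} _ → pt H)) (∑-*ˡ (E m) (χ (B a)) _)
        where
        pt : ∀ H → χ (P (insn (suc i) a H)) ≡ χ (B a) * χ (allC B H ∧ ((pw (suc i) (κ a) ∙ ty H) ≡ᴹ μ))
        pt H rewrite allC-insn i a H | ty-insn (suc i) a H with B a
        ... | true  = sym (+-identityʳ _)
        ... | false = refl

      by-type : ∀ i k m → ∑ (E k) (λ a → χ (B a) * h (κ a) i m) ≡ ∑ elems (λ σ → t σ k * h σ i m)
      by-type i k m = begin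
        ∑ (E k) (λ a → χ (B a) * h (κ a) i m)
          ≡⟨ ∑-cong (E k) (λ {a} _ → cong (χ (B a) *_) (sym (∑-δ _≈?_ (λ σ → h σ i m) unique (complete (κ a))))) ⟩
        ∑ (E k) (λ a → χ (B a) * ∑ elems (λ σ → χ (κ a ≡ᴹ σ) * h σ i m))
          ≡⟨ ∑-cong (E k) (λ {a} _ → sym (∑-*ˡ elems (χ (B a)) _)) ⟩
        ∑ (E k) (λ a → ∑ elems (λ σ → χ (B a) * (χ (κ a ≡ᴹ σ) * h σ i m)))
          ≡⟨ ∑-swap (E k) elems _ ⟩
        ∑ elems (λ σ → ∑ (E k) (λ a → χ (B a) * (χ (κ a ≡ᴹ σ) * h σ i m)))
          ≡⟨ ∑-cong elems (λ {σ} _ → trans (∑-cong (E k) (λ {a} _ →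
               trans (sym (*-assoc (χ (B a)) _ _)) (cong (_* h σ i m) (sym (χ-∧ (B a) (κ a ≡ᴹ σ)))))) (∑-*ʳ (E k) (h σ i m) _)) ⟩
        ∑ elems (λ σ → t σ k * h σ i m) ∎
        where open ≡-Reasoning

      part-identity : ∀ n k → ∑ (E n) (λ G → χ (P G) * part k G) ≡ ∑ (upTo n) (λ i → Φ n k (suc i))
      part-identity n k = begin
        ∑ (E n) (λ G → χ (P G) * ∑ (E k) (λ a → suc k * mult a G))
          ≡⟨ ∑-cong (E n) (λ {G} G∈ → trans (sym (∑-*ˡ (E k) (χ (P G)) _)) (∑-cong (E k) (λ {a} _ → levels G∈ a))) ⟩
        ∑ (E n) (λ G → ∑ (E k) (λ a → ∑ (upTo n) (λ i → suc k * (χ (P G) * χ (does (suc i ≤? mult a G))))))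
          ≡⟨ ∑-swap (E n) (E k) _ ⟩
        ∑ (E k) (λ a → ∑ (E n) (λ G → ∑ (upTo n) (λ i → suc k * (χ (P G) * χ (does (suc i ≤? mult a G))))))
          ≡⟨ ∑-cong (E k) (λ {a} a∈ → trans (∑-swap (E n) (upTo n) _) (∑-cong (upTo n) (λ {i} _ → single a∈ i))) ⟩
        ∑ (E k) (λ a → ∑ (upTo n) (λ i → c i * (suc k * (χ (B a) * h (κ a) (suc i) (n ∸ suc i * suc k)))))
          ≡⟨ ∑-swap (E k) (upTo n) _ ⟩
        ∑ (upTo n) (λ i → ∑ (E k) (λ a → c i * (suc k * (χ (B a) * h (κ a) (suc i) (n ∸ suc i * suc k)))))
          ≡⟨ ∑-cong (upTo n) (λ {i} _ → trans (∑-*ˡ (E k) (c i) _) (cong (c i *_)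
               (trans (∑-*ˡ (E k) (suc k) _) (cong (suc k *_) (by-type (suc i) k (n ∸ suc i * suc k)))))) ⟩
        ∑ (upTo n) (λ i → Φ n k (suc i)) ∎
        where
        open ≡-Reasoning
        c : ℕ → ℕ
        c i = χ (does (suc i * suc k ≤? n))
        levels : ∀ {G} → G ∈ E n → ∀ a → χ (P G) * (suc k * mult a G) ≡ ∑ (upTo n) (λ i → suc k * (χ (P G) * χ (does (suc i ≤? mult a G))))
        levels {G} G∈ a = begin
          χ (P G) * (suc k * mult a G)   ≡⟨ *-swap (χ (P G)) (suc k) (mult a G) ⟩
          suc k * (χ (P G) * mult a G)   ≡⟨ cong (λ z → suc k * (χ (P G) * z)) (sym (∑-below (mult a G) n (subst (mult a G ≤_) (proj₂ (∈-E⁻ G∈)) (mult≤sz a G)))) ⟩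
          suc k * (χ (P G) * ∑ (upTo n) (λ i → χ (does (suc i ≤? mult a G)))) ≡⟨ cong (suc k *_) (sym (∑-*ˡ (upTo n) (χ (P G)) _)) ⟩
          suc k * ∑ (upTo n) (λ i → χ (P G) * χ (does (suc i ≤? mult a G)))   ≡⟨ sym (∑-*ˡ (upTo n) (suc k) _) ⟩
          ∑ (upTo n) (λ i → suc k * (χ (P G) * χ (does (suc i ≤? mult a G)))) ∎
        single : ∀ {a} → a ∈ E k → ∀ i → ∑ (E n) (λ G → suc k * (χ (P G) * χ (does (suc i ≤? mult a G))))
                 ≡ c i * (suc k * (χ (B a) * h (κ a) (suc i) (n ∸ suc i * suc k)))
        single {a} a∈ i = begin
          ∑ (E n) (λ G → suc k * (χ (P G) * χ (does (suc i ≤? mult a G)))) ≡⟨ ∑-*ˡ (E n) (suc k) _ ⟩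
          suc k * ∑ (E n) (λ G → χ (P G) * χ (does (suc i ≤? mult a G)))   ≡⟨ cong (suc k *_) (count-removed P n a (suc i) (proj₁ (∈-E⁻ a∈))) ⟩
          suc k * (χ (does (suc i * suc (sz a) ≤? n)) * count (n ∸ suc i * suc (sz a)) (λ H → P (insn (suc i) a H)))
            ≡⟨ cong (λ s → suc k * (χ (does (suc i * suc s ≤? n)) * count (n ∸ suc i * suc s) (λ H → P (insn (suc i) a H)))) (proj₂ (∈-E⁻ a∈)) ⟩
          suc k * (c i * count (n ∸ suc i * suc k) (λ H → P (insn (suc i) a H))) ≡⟨ cong (λ z → suc k * (c i * z)) (count-typed i a _) ⟩
          suc k * (c i * (χ (B a) * h (κ a) (suc i) (n ∸ suc i * suc k))) ≡⟨ *-swap (suc k) (c i) _ ⟩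
          c i * (suc k * (χ (B a) * h (κ a) (suc i) (n ∸ suc i * suc k))) ∎

      sum-parts : ∀ {n G} → G ∈ E n → ∑ (upTo n) (λ k → part k G) ≡ n
      sum-parts {n} {G} G∈ = trans (∑-cong (upTo n) (λ {k} _ → ∑-cong (E k) (λ {a} a∈ → cong (λ s → suc s * mult a G) (sym (proj₂ (∈-E⁻ a∈))))))
          (trans (csum-mult (λ a → suc (sz a)) n (proj₁ (∈-E⁻ G∈)) (≤-reflexive (proj₂ (∈-E⁻ G∈)))) (trans (total G) (proj₂ (∈-E⁻ G∈))))
        where
        total : ∀ G → csum (λ a → suc (sz a)) G ≡ sz G
        total ε       = refl
        total (a ▸ b) = cong (λ z → suc (sz a + z)) (total b)

      -- Each forest is counted once per node: a tree of size suc k with multiplicity j contributes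
      -- suc k at each of the levels 1, ..., j.
      identity : ∀ n → ∑ (upTo n) (λ k → ∑ (upTo n) (λ i → Φ n k (suc i))) ≡ n * f n
      identity n = begin
        ∑ (upTo n) (λ k → ∑ (upTo n) (λ i → Φ n k (suc i)))     ≡⟨ ∑-cong (upTo n) (λ {k} _ → sym (part-identity n k)) ⟩
        ∑ (upTo n) (λ k → ∑ (E n) (λ G → χ (P G) * part k G))   ≡⟨ ∑-swap (upTo n) (E n) _ ⟩
        ∑ (E n) (λ G → ∑ (upTo n) (λ k → χ (P G) * part k G))   ≡⟨ ∑-cong (E n) (λ {G} G∈ → trans (∑-*ˡ (upTo n) (χ (P G)) _) (cong (χ (P G) *_) (sum-parts G∈))) ⟩
        ∑ (E n) (λ G → χ (P G) * n)                             ≡⟨ ∑-*ʳ (E n) n _ ⟩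
        f n * n                                                 ≡⟨ *-comm (f n) n ⟩
        n * f n                                                 ∎
        where open ≡-Reasoning

      Φ>0⇒ : ∀ n k i → 0 < Φ n k i → i * suc k ≤ n
      Φ>0⇒ n k i pos = χ>0⇒ (i * suc k ≤? n) (*>0⇒ˡ _ (ψ k i (n ∸ i * suc k)) pos)

      identity-≤ : ∀ n m → ∑ (upTo m) (λ i → ∑ (upTo m) (λ k → Φ n k (suc i))) ≤ n * f n
      identity-≤ n m = ≤-trans (∑-⊆ (upTo n) (Uniqueₚ.upTo⁺ m) (λ {i} _ pos → case i-small i pos of λ i<n → ∈-upTo⁺ i<n , k-range i))
                         (≤-reflexive (trans (∑-swap (upTo n) (upTo n) _) (identity n)))
        where
        k-range : ∀ i → ∑ (upTo m) (λ k → Φ n k (suc i)) ≤ ∑ (upTo n) (λ k → Φ n k (suc i))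
        k-range i = ∑-⊆ (upTo n) (Uniqueₚ.upTo⁺ m) (λ {k} _ pos → ∈-upTo⁺ (≤-trans (m≤m+n (suc k) _) (Φ>0⇒ n k (suc i) pos)) , ≤-refl)
        i-small : ∀ i → 0 < ∑ (upTo m) (λ k → Φ n k (suc i)) → i < n
        i-small i pos with suc i ≤? n
        ... | yes p = p
        ... | no ¬p = ⊥-elim (<-irrefl refl (≤-trans pos (≤-reflexive (∑-zero (upTo m) (λ {k} _ →
                cong (_* ψ k (suc i) (n ∸ suc i * suc k)) (χ-no (suc i * suc k ≤? n) (λ q → ¬p (≤-trans (≤-trans (≤-reflexive (sym (*-identityʳ (suc i)))) (*-monoʳ-≤ (suc i) (s≤s z≤n))) q))))))))

      -- The hypothesis trades a tree for smaller ones of the same type. Since all i copies change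
      -- alike, the remaining forest and its condition `h σ i` stay the same. Only the weight suc k
      -- drops, at most by a factor 2, because a shift loses at most half.
      shift-step : ∀ L n k i → 1 ≤ i → (∀ σ → L * t σ k ≤ tail e (t σ) k) →
                   L * Φ n k i ≤ 2 * ∑ (shifts e k) (λ l → Φ (n ∸ i * l * e) (k ∸ l * e) i)
      shift-step L n k i i≥1 neg with i * suc k ≤? n
      ... | no ¬fit = ≤-trans (≤-reflexive (trans (cong (λ z → L * (z * ψ k i (n ∸ i * suc k))) (χ-no (i * suc k ≤? n) ¬fit)) (*-zeroʳ L))) z≤n
      ... | yes fit = begin
        L * (χ (does (i * suc k ≤? n)) * ψ k i m)
          ≡⟨ cong (λ z → L * (z * ψ k i m)) (χ-yes (i * suc k ≤? n) fit) ⟩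
        L * (1 * (suc k * ∑ elems (λ σ → t σ k * h σ i m)))
          ≡⟨ arrange L (suc k) _ ⟩
        suc k * (L * ∑ elems (λ σ → t σ k * h σ i m))
          ≡⟨ cong (suc k *_) (trans (sym (∑-*ˡ elems L _)) (∑-cong elems (λ {σ} _ → sym (*-assoc L (t σ k) _)))) ⟩
        suc k * ∑ elems (λ σ → L * t σ k * h σ i m)
          ≤⟨ *-monoʳ-≤ (suc k) (∑-mono elems (λ {σ} _ → *-monoˡ-≤ (h σ i m) (neg σ))) ⟩
        suc k * ∑ elems (λ σ → tail e (t σ) k * h σ i m)
          ≡⟨ cong (suc k *_) (∑-cong elems (λ {σ} _ → sym (∑-*ʳ (shifts e k) (h σ i m) _))) ⟩
        suc k * ∑ elems (λ σ → ∑ (shifts e k) (λ l → t σ (k ∸ l * e) * h σ i m))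
          ≡⟨ cong (suc k *_) (∑-swap elems (shifts e k) _) ⟩
        suc k * ∑ (shifts e k) (λ l → ∑ elems (λ σ → t σ (k ∸ l * e) * h σ i m))
          ≡⟨ sym (∑-*ˡ (shifts e k) (suc k) _) ⟩
        ∑ (shifts e k) (λ l → suc k * ∑ elems (λ σ → t σ (k ∸ l * e) * h σ i m))
          ≤⟨ ∑-mono (shifts e k) (λ {l} l∈ → term l (∈-shifts⁻ l∈)) ⟩
        ∑ (shifts e k) (λ l → 2 * Φ (n ∸ i * l * e) (k ∸ l * e) i)
          ≡⟨ ∑-*ˡ (shifts e k) 2 _ ⟩
        2 * ∑ (shifts e k) (λ l → Φ (n ∸ i * l * e) (k ∸ l * e) i) ∎
        where
        open ≤-Reasoning
        m : ℕ
        m = n ∸ i * suc k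
        arrange : ∀ x y z → x * (1 * (y * z)) ≡ y * (x * z)
        arrange = solve-∀
        term : ∀ l → Shift e k l → suc k * ∑ elems (λ σ → t σ (k ∸ l * e) * h σ i m) ≤ 2 * Φ (n ∸ i * l * e) (k ∸ l * e) i
        term l s = begin
          suc k * Σ′                            ≤⟨ *-monoˡ-≤ Σ′ dbl ⟩
          2 * suc k′ * Σ′                       ≡⟨ *-assoc 2 (suc k′) Σ′ ⟩
          2 * (suc k′ * Σ′)                     ≡⟨ cong (2 *_) (sym (+-identityʳ (suc k′ * Σ′))) ⟩
          2 * (1 * ψ k′ i m)                    ≡⟨ cong₂ (λ z w → 2 * (z * ψ k′ i w)) (sym (χ-yes (i * suc k′ ≤? n′) fit′)) m≡ ⟩
          2 * Φ n′ k′ i                         ∎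
          where
          k′ n′ Σ′ : ℕ
          k′ = k ∸ l * e
          n′ = n ∸ i * l * e
          Σ′ = ∑ elems (λ σ → t σ k′ * h σ i m)
          k≡ : k′ + l * e ≡ k
          k≡ = m∸n+n≡m (shift-half {e} {k} {l} s)
          dbl : suc k ≤ 2 * suc k′
          dbl = subst (λ z → suc z ≤ 2 * suc k′) k≡ (+-cancelʳ-≤ (l * e) _ _ (begin
            suc (k′ + l * e) + l * e            ≡⟨ reassoc k′ (l * e) ⟩
            suc k′ + 2 * (l * e)                ≤⟨ +-monoʳ-≤ (suc k′) (proj₂ s) ⟩
            suc k′ + k                          ≡⟨ cong (suc k′ +_) (sym k≡) ⟩
            suc k′ + (k′ + l * e)               ≤⟨ n≤1+n _ ⟩
            suc (suc k′ + (k′ + l * e))         ≡⟨ reassoc′ k′ (l * e) ⟩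
            2 * suc k′ + l * e                  ∎))
            where
            reassoc : ∀ x y → suc (x + y) + y ≡ suc x + 2 * y
            reassoc = solve-∀
            reassoc′ : ∀ x y → suc (suc x + (x + y)) ≡ 2 * suc x + y
            reassoc′ = solve-∀
          split : i * suc k ≡ i * suc k′ + i * l * e
          split = trans (cong (λ z → i * suc z) (sym k≡)) (distr i k′ l e)
            where
            distr : ∀ i x l e → i * suc (x + l * e) ≡ i * suc x + i * l * e
            distr = solve-∀
          fit′ : i * suc k′ ≤ n′
          fit′ = m+n≤o⇒m≤o∸n _ (subst (_≤ n) split fit)
          m≡ : m ≡ n′ ∸ i * suc k′
          m≡ = trans (cong (n ∸_) (trans split (+-comm (i * suc k′) _))) (sym (∸-+-assoc n (i * l * e) (i * suc k′)))

      -- For fixed i the total loss suc i * l and the new size k ∸ l * e determine l and k, so no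
      -- pair is counted twice. The loss is an admissible shift of n because each copy has lost at
      -- most half of its own size.
      reindex : ∀ n i → ∑ (upTo n) (λ k → ∑ (shifts e k) (λ l → Φ (n ∸ suc i * l * e) (k ∸ l * e) (suc i)))
                        ≤ ∑ (shifts e n) (λ l → ∑ (upTo n) (λ k → Φ (n ∸ l * e) k (suc i)))
      reindex n i = begin
        ∑ (upTo n) (λ k → ∑ (shifts e k) (λ l → Φ (n ∸ suc i * l * e) (k ∸ l * e) (suc i)))
          ≤⟨ ∑-mono (upTo n) (λ {k} k∈ → ∑-⊆ {g = λ l → F (k , l)} (upTo (suc n)) (shifts! e k) (λ {l} l∈ _ → inside k∈ l∈ , ≤-reflexive (sym (trans (cong (_* Φ (n ∸ suc i * l * e) (k ∸ l * e) (suc i)) (χ-yes (shift? e k l) (∈-shifts⁻ l∈))) (+-identityʳ _))))) ⟩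
        ∑ (upTo n) (λ k → ∑ (upTo (suc n)) (λ l → F (k , l)))
          ≡⟨ sym (∑-× (upTo n) (upTo (suc n)) F) ⟩
        ∑ (cartesianProduct (upTo n) (upTo (suc n))) F
          ≤⟨ ∑-inj (cartesianProduct (shifts e n) (upTo n)) (λ (k , l) → suc i * l , k ∸ l * e)
               (Uniqueₚ.cartesianProduct⁺ (Uniqueₚ.upTo⁺ n) (Uniqueₚ.upTo⁺ (suc n)))
               (λ {(k , l)} p pos → into k l (proj₁ (∈-cartesianProduct⁻ (upTo n) (upTo (suc n)) p)) pos)
               (λ {(k , l)} {(k′ , l′)} _ _ x y q → inj k l k′ l′ x y q) ⟩
        ∑ (cartesianProduct (shifts e n) (upTo n)) (λ (l , k) → Φ (n ∸ l * e) k (suc i))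
          ≡⟨ ∑-× (shifts e n) (upTo n) _ ⟩
        ∑ (shifts e n) (λ l → ∑ (upTo n) (λ k → Φ (n ∸ l * e) k (suc i))) ∎
        where
        open ≤-Reasoning
        F : ℕ × ℕ → ℕ
        F (k , l) = χ (does (shift? e k l)) * Φ (n ∸ suc i * l * e) (k ∸ l * e) (suc i)
        inside : ∀ {k l} → k ∈ upTo n → l ∈ shifts e k → l ∈ upTo (suc n)
        inside {k} k∈ l∈ = ∈-upTo⁺ (s≤s (≤-trans (shift-≤ e≥1 (∈-shifts⁻ {e} {k} l∈)) (<⇒≤ (∈-upTo⁻ k∈))))
        sh : ∀ k l → 0 < F (k , l) → Shift e k l
        sh k l pos = χ>0⇒ (shift? e k l) (*>0⇒ˡ _ (Φ (n ∸ suc i * l * e) (k ∸ l * e) (suc i)) pos)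
        into : ∀ k l → k ∈ upTo n → 0 < F (k , l) → (suc i * l , k ∸ l * e) ∈ cartesianProduct (shifts e n) (upTo n)
                 × F (k , l) ≤ Φ (n ∸ suc i * l * e) (k ∸ l * e) (suc i)
        into k l k∈ pos =
          ∈-cartesianProduct⁺ (∈-shifts⁺ e≥1 (≤-trans (proj₁ s) (m≤m+n l _) , bound)) (∈-upTo⁺ (≤-trans (s≤s (m∸n≤m k (l * e))) (∈-upTo⁻ k∈))) ,
          ≤-trans (*-monoˡ-≤ (Φ (n ∸ suc i * l * e) (k ∸ l * e) (suc i)) (χ≤1 (does (shift? e k l)))) (≤-reflexive (+-identityʳ _))
          where
          s : Shift e k l
          s = sh k l pos
          fit : suc i * suc (k ∸ l * e) ≤ n ∸ suc i * l * e
          fit = Φ>0⇒ _ (k ∸ l * e) (suc i) (*>0⇒ʳ (χ (does (shift? e k l))) _ pos)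
          bound : 2 * (suc i * l * e) ≤ n
          bound = begin
            2 * (suc i * l * e)                         ≡⟨ arr (suc i) l e ⟩
            suc i * (2 * (l * e))                       ≤⟨ *-monoʳ-≤ (suc i) (proj₂ s) ⟩
            suc i * k                                   ≡⟨ cong (suc i *_) (sym (m∸n+n≡m (shift-half {e} {k} {l} s))) ⟩
            suc i * (k ∸ l * e + l * e)                 ≤⟨ ≤-trans (*-monoʳ-≤ (suc i) (n≤1+n _)) (≤-reflexive (arr′ (suc i) (k ∸ l * e) l e)) ⟩
            suc i * suc (k ∸ l * e) + suc i * l * e     ≤⟨ +-monoˡ-≤ (suc i * l * e) fit ⟩
            n ∸ suc i * l * e + suc i * l * e           ≡⟨ m∸n+n≡m {n} {suc i * l * e} (<⇒≤ (m∸n≢0⇒n<m (λ z → <-irrefl refl (≤-trans (s≤s z≤n) (≤-trans fit (≤-reflexive z)))))) ⟩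
            n                                           ∎
            where
            arr : ∀ i l e → 2 * (i * l * e) ≡ i * (2 * (l * e))
            arr = solve-∀
            arr′ : ∀ i k l e → i * suc (k + l * e) ≡ i * suc k + i * l * e
            arr′ = solve-∀
        inj : ∀ k l k′ l′ → 0 < F (k , l) → 0 < F (k′ , l′) → (suc i * l , k ∸ l * e) ≡ (suc i * l′ , k′ ∸ l′ * e) → (k , l) ≡ (k′ , l′)
        inj k l k′ l′ x y q with *-cancelˡ-≡ l l′ (suc i) (cong proj₁ q)
        ... | refl = cong (_, l) (trans (sym (m∸n+n≡m (shift-half {e} {k} {l} (sh k l x))))
                      (trans (cong (_+ l * e) (cong proj₂ q)) (m∸n+n≡m (shift-half {e} {k′} {l} (sh k′ l y)))))

      big-bound : ∀ L N₁ n → (∀ k → N₁ ≤ k → ∀ σ → L * t σ k ≤ tail e (t σ) k) →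
        L * ∑ (E n) (λ G → χ (P G) * ∑ (upTo n) (λ k → χ (does (N₁ ≤? k)) * part k G)) ≤ 2 * (n * tail e f n)
      big-bound L N₁ n neg = begin
        L * ∑ (E n) (λ G → χ (P G) * ∑ (upTo n) (λ k → d k * part k G))
          ≡⟨ cong (L *_) (trans (∑-cong (E n) (λ {G} _ → sym (∑-*ˡ (upTo n) (χ (P G)) _))) (∑-swap (E n) (upTo n) _)) ⟩
        L * ∑ (upTo n) (λ k → ∑ (E n) (λ G → χ (P G) * (d k * part k G)))
          ≡⟨ cong (L *_) (∑-cong (upTo n) (λ {k} _ → trans (∑-cong (E n) (λ {G} _ → *-swap (χ (P G)) (d k) _)) (trans (∑-*ˡ (E n) (d k) _) (cong (d k *_) (part-identity n k))))) ⟩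
        L * ∑ (upTo n) (λ k → d k * ∑ (upTo n) (λ i → Φ n k (suc i)))
          ≡⟨ sym (∑-*ˡ (upTo n) L _) ⟩
        ∑ (upTo n) (λ k → L * (d k * ∑ (upTo n) (λ i → Φ n k (suc i))))
          ≤⟨ ∑-mono (upTo n) (λ {k} _ → one-size k) ⟩
        ∑ (upTo n) (λ k → ∑ (upTo n) (λ i → 2 * ∑ (shifts e k) (λ l → Φ (n ∸ suc i * l * e) (k ∸ l * e) (suc i))))
          ≡⟨ ∑-swap (upTo n) (upTo n) _ ⟩
        ∑ (upTo n) (λ i → ∑ (upTo n) (λ k → 2 * ∑ (shifts e k) (λ l → Φ (n ∸ suc i * l * e) (k ∸ l * e) (suc i))))
          ≡⟨ trans (∑-cong (upTo n) (λ _ → ∑-*ˡ (upTo n) 2 _)) (∑-*ˡ (upTo n) 2 _) ⟩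
        2 * ∑ (upTo n) (λ i → ∑ (upTo n) (λ k → ∑ (shifts e k) (λ l → Φ (n ∸ suc i * l * e) (k ∸ l * e) (suc i))))
          ≤⟨ *-monoʳ-≤ 2 (∑-mono (upTo n) (λ {i} _ → reindex n i)) ⟩
        2 * ∑ (upTo n) (λ i → ∑ (shifts e n) (λ l → ∑ (upTo n) (λ k → Φ (n ∸ l * e) k (suc i))))
          ≡⟨ cong (2 *_) (∑-swap (upTo n) (shifts e n) _) ⟩
        2 * ∑ (shifts e n) (λ l → ∑ (upTo n) (λ i → ∑ (upTo n) (λ k → Φ (n ∸ l * e) k (suc i))))
          ≤⟨ *-monoʳ-≤ 2 (∑-mono (shifts e n) (λ {l} _ → ≤-trans (identity-≤ (n ∸ l * e) n) (*-monoˡ-≤ (f (n ∸ l * e)) (m∸n≤m n (l * e))))) ⟩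
        2 * ∑ (shifts e n) (λ l → n * f (n ∸ l * e))
          ≡⟨ cong (2 *_) (∑-*ˡ (shifts e n) n _) ⟩
        2 * (n * tail e f n) ∎
        where
        open ≤-Reasoning
        d : ℕ → ℕ
        d k = χ (does (N₁ ≤? k))
        one-size : ∀ k → L * (d k * ∑ (upTo n) (λ i → Φ n k (suc i)))
                     ≤ ∑ (upTo n) (λ i → 2 * ∑ (shifts e k) (λ l → Φ (n ∸ suc i * l * e) (k ∸ l * e) (suc i)))
        one-size k with N₁ ≤? k
        ... | no ¬p = ≤-trans (≤-reflexive (trans (cong (λ z → L * (z * ∑ (upTo n) (λ i → Φ n k (suc i)))) (χ-no (N₁ ≤? k) ¬p)) (*-zeroʳ L))) z≤n
        ... | yes p = begin
          L * (d k * ∑ (upTo n) (λ i → Φ n k (suc i)))   ≡⟨ cong (λ z → L * (z * ∑ (upTo n) (λ i → Φ n k (suc i)))) (χ-yes (N₁ ≤? k) p) ⟩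
          L * (1 * ∑ (upTo n) (λ i → Φ n k (suc i)))     ≡⟨ cong (L *_) (+-identityʳ _) ⟩
          L * ∑ (upTo n) (λ i → Φ n k (suc i))           ≡⟨ sym (∑-*ˡ (upTo n) L _) ⟩
          ∑ (upTo n) (λ i → L * Φ n k (suc i))           ≤⟨ ∑-mono (upTo n) (λ {i} _ → shift-step L n k (suc i) (s≤s z≤n) (neg k p)) ⟩
          ∑ (upTo n) (λ i → 2 * ∑ (shifts e k) (λ l → Φ (n ∸ suc i * l * e) (k ∸ l * e) (suc i))) ∎

      -- The deletion of r * e copies loses a multiple of e and so realises a shift, while the
      -- `threshold` copies that stay behind fix the type.
      often-one : ∀ n a r H → Can a → H ≡ threshold + r * e → r * suc (sz a) * e ≤ n →
        ∑ (E n) (λ G → χ (P G) * χ (does (H ≤? mult a G))) ≤ f (n ∸ r * suc (sz a) * e)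
      often-one n a r .(threshold + r * e) ca refl fits = ∑-inj (E (n ∸ r * suc (sz a) * e)) (deln (r * e) a) (E! n) into inj
        where
        H : ℕ
        H = threshold + r * e
        get : ∀ {G} → G ∈ E n → 0 < χ (P G) * χ (does (H ≤? mult a G)) → Removed (r * e) a G
        get {G} G∈ pos = removed (r * e) (proj₁ (∈-E⁻ G∈)) (≤-trans (m≤n+m (r * e) threshold) (χ>0⇒ (H ≤? mult a G) (*>0⇒ʳ (χ (P G)) _ pos)))
        into : ∀ {G} → G ∈ E n → 0 < χ (P G) * χ (does (H ≤? mult a G)) →
               deln (r * e) a G ∈ E (n ∸ r * suc (sz a) * e) × χ (P G) * χ (does (H ≤? mult a G)) ≤ χ (P (deln (r * e) a G))
        into {G} G∈ pos = ∈-E⁺′ R.canon (sym (trans (cong₂ _∸_ (trans (sym (proj₂ (∈-E⁻ G∈))) R.size≡) (arr r (suc (sz a)) e)) (m+n∸m≡n (r * e * suc (sz a)) _))) ,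
            ≤-trans (*-monoʳ-≤ (χ (P G)) (χ≤1 (does (H ≤? mult a G)))) (≤-reflexive (trans (*-identityʳ _) (cong χ same)))
          where
          module R = Removed (get G∈ pos)
          arr : ∀ x y z → x * y * z ≡ x * z * y
          arr = solve-∀
          c : Fo
          c = deln (r * e) a G
          still : threshold ≤ mult a c
          still = +-cancelˡ-≤ (r * e) _ _ (subst₂ _≤_ (+-comm threshold (r * e)) R.left (χ>0⇒ (H ≤? mult a G) (*>0⇒ʳ (χ (P G)) _ pos)))
          module C = Removed (removed threshold {a} {c} R.canon still)
          ty-c : ty c ≡ pw threshold (κ a) ∙ ty (deln threshold a c)
          ty-c = trans (cong ty C.whole) (ty-insn threshold a _)
          ty-same : ty G ≡ ty c
          ty-same = begin
            ty G                                                                     ≡⟨ cong ty R.whole ⟩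
            ty (insn (r * e) a c)                                                    ≡⟨ ty-insn (r * e) a c ⟩
            pw (r * e) (κ a) ∙ ty c                                                  ≡⟨ cong (pw (r * e) (κ a) ∙_) ty-c ⟩
            pw (r * e) (κ a) ∙ (pw threshold (κ a) ∙ ty (deln threshold a c))        ≡⟨ sym (assoc _ _ _) ⟩
            (pw (r * e) (κ a) ∙ pw threshold (κ a)) ∙ ty (deln threshold a c)        ≡⟨ cong (_∙ ty (deln threshold a c)) (sym (pw-+ (r * e) threshold (κ a))) ⟩
            pw (r * e + threshold) (κ a) ∙ ty (deln threshold a c)                   ≡⟨ cong (_∙ ty (deln threshold a c)) (pw-stable (r * e + threshold) (κ a) (m≤n+m threshold (r * e))) ⟩
            pw threshold (κ a) ∙ ty (deln threshold a c)                             ≡⟨ sym ty-c ⟩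
            ty c                                                                     ∎
            where open ≡-Reasoning
          all-c : allC B G ≡ true → allC B c ≡ true
          all-c p = strip (r * e) (subst (λ z → allC B z ≡ true) R.whole p)
            where
            strip : ∀ i → allC B (insn i a c) ≡ true → allC B c ≡ true
            strip zero    q = q
            strip (suc i) q = strip i (∧-elimʳ {B a} (trans (sym (allC-ins B a (insn i a c))) q))
          P-true : P G ≡ true
          P-true = χ>0⇒true (*>0⇒ˡ (χ (P G)) _ pos)
          same : P G ≡ P c
          same = trans P-true (sym (∧-intro (all-c (∧-elimˡ P-true)) (trans (cong (_≡ᴹ μ) (sym ty-same)) (∧-elimʳ {allC B G} P-true))))
        inj : ∀ {G G′} → G ∈ E n → G′ ∈ E n → 0 < χ (P G) * χ (does (H ≤? mult a G)) → 0 < χ (P G′) * χ (does (H ≤? mult a G′)) →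
              deln (r * e) a G ≡ deln (r * e) a G′ → G ≡ G′
        inj p q x y eq = trans (Removed.whole (get p x)) (trans (cong (insn (r * e) a) eq) (sym (Removed.whole (get q y))))

      -- A forest with threshold + J * e copies of a admits the deletions for every r from 1 to J,
      -- and different r lead to different shifts; so the same forests are charged J times to the
      -- tail.
      often : ∀ J N₁ n {k a} → k < N₁ → a ∈ E k → 2 * (J * N₁ * e) ≤ n →
        J * ∑ (E n) (λ G → χ (P G) * χ (does (threshold + J * e ≤? mult a G))) ≤ tail e f n
      often J N₁ n {k} {a} k<N₁ a∈ big = begin
        J * cnt (threshold + J * e)                            ≡⟨ cong (_* cnt (threshold + J * e)) (sym (length-upTo J)) ⟩
        length (upTo J) * cnt (threshold + J * e)              ≡⟨ sym (∑-const (upTo J) (cnt (threshold + J * e))) ⟩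
        ∑ (upTo J) (λ _ → cnt (threshold + J * e))             ≤⟨ ∑-inj (shifts e n) (λ r → suc r * suc (sz a)) (Uniqueₚ.upTo⁺ J) into
                                                                    (λ {r} {r′} _ _ _ _ q → suc-injective (*-cancelʳ-≡ (suc r) (suc r′) (suc (sz a)) q)) ⟩
        tail e f n                                             ∎
        where
        open ≤-Reasoning
        cnt : ℕ → ℕ
        cnt H = ∑ (E n) (λ G → χ (P G) * χ (does (H ≤? mult a G)))
        cnt-anti : ∀ {H H′} → H ≤ H′ → cnt H′ ≤ cnt H
        cnt-anti {H} {H′} le = ∑-mono (E n) (λ {G} _ → *-monoʳ-≤ (χ (P G)) (lem (mult a G)))
          where
          lem : ∀ m → χ (does (H′ ≤? m)) ≤ χ (does (H ≤? m))
          lem m with H′ ≤? m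
          ... | yes p = ≤-trans (χ≤1 (does (H′ ≤? m))) (≤-reflexive (sym (χ-yes (H ≤? m) (≤-trans le p))))
          ... | no ¬p = ≤-trans (≤-reflexive (χ-no (H′ ≤? m) ¬p)) z≤n
        into : ∀ {r} → r ∈ upTo J → 0 < cnt (threshold + J * e) →
               suc r * suc (sz a) ∈ shifts e n × cnt (threshold + J * e) ≤ f (n ∸ suc r * suc (sz a) * e)
        into {r} r∈ _ = ∈-shifts⁺ e≥1 (s≤s z≤n , b) ,
            ≤-trans (cnt-anti (+-monoʳ-≤ threshold (*-monoˡ-≤ e (∈-upTo⁻ r∈)))) (often-one n a (suc r) (threshold + suc r * e) (proj₁ (∈-E⁻ a∈)) refl (≤-trans (m≤m+n _ _) b))
          where
          b : 2 * (suc r * suc (sz a) * e) ≤ n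
          b = ≤-trans (*-monoʳ-≤ 2 (*-monoˡ-≤ e (*-mono-≤ (∈-upTo⁻ r∈) (subst (λ z → suc z ≤ N₁) (sym (proj₂ (∈-E⁻ a∈))) k<N₁)))) big

      -- If no small tree occurs H times, the small components together contain at most n/2 nodes,
      -- so the large ones contain at least n/2. Otherwise the second summand is at least n by
      -- itself.
      pointwise : ∀ N₁ H n {G} → G ∈ E n → 2 * (∑ (upTo N₁) (λ k → length (E k)) * (N₁ * H)) ≤ n →
        n ≤ 2 * ∑ (upTo n) (λ k → χ (does (N₁ ≤? k)) * part k G)
              + n * ∑ (upTo N₁) (λ k → ∑ (E k) (λ a → χ (does (H ≤? mult a G))))
      pointwise N₁ H n {G} G∈ large with ∑ (upTo N₁) (λ k → ∑ (E k) (λ a → χ (does (H ≤? mult a G)))) in eq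
      ... | suc s = ≤-trans (m≤m+n n (n * s)) (≤-trans (≤-reflexive (sym (*-suc n s))) (m≤n+m (n * suc s) _))
      ... | zero  = ≤-trans (+-cancelˡ-≤ n _ _ (begin
        n + n                              ≡⟨ cong₂ _+_ n≡ n≡ ⟩
        (small + big) + (small + big)      ≡⟨ arr small big ⟩
        2 * small + 2 * big                ≤⟨ +-monoˡ-≤ (2 * big) (≤-trans (*-monoʳ-≤ 2 small≤) large) ⟩
        n + 2 * big                        ∎)) (m≤m+n _ _)
        where
        open ≤-Reasoning
        arr : ∀ x y → (x + y) + (x + y) ≡ 2 * x + 2 * y
        arr = solve-∀
        small big : ℕ
        small = ∑ (upTo n) (λ k → χ (does (suc k ≤? N₁)) * part k G)
        big   = ∑ (upTo n) (λ k → χ (does (N₁ ≤? k)) * part k G)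
        cases : ∀ k → part k G ≡ χ (does (suc k ≤? N₁)) * part k G + χ (does (N₁ ≤? k)) * part k G
        cases k with N₁ ≤? k
        ... | yes p = sym (trans (cong₂ (λ x y → x * part k G + y * part k G) (χ-no (suc k ≤? N₁) (≤⇒≯ p)) (χ-yes (N₁ ≤? k) p)) (+-identityʳ _))
        ... | no ¬p = sym (trans (cong₂ (λ x y → x * part k G + y * part k G) (χ-yes (suc k ≤? N₁) (≰⇒> ¬p)) (χ-no (N₁ ≤? k) ¬p)) (trans (+-identityʳ _) (+-identityʳ _)))
        n≡ : n ≡ small + big
        n≡ = trans (sym (sum-parts G∈)) (trans (∑-cong (upTo n) (λ {k} _ → cases k)) (∑-+ (upTo n) _ _))
        rare : ∀ {k a} → k ∈ upTo N₁ → a ∈ E k → mult a G ≤ H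
        rare {k} {a} k∈ a∈ with H ≤? mult a G
        ... | no ¬p = <⇒≤ (≰⇒> ¬p)
        ... | yes p with trans (sym (χ-yes (H ≤? mult a G) p)) (∑≡0⇒ {f = λ a → χ (does (H ≤? mult a G))} (∑≡0⇒ {f = λ k → ∑ (E k) (λ a → χ (does (H ≤? mult a G)))} eq k∈) a∈)
        ...   | ()
        small≤ : small ≤ ∑ (upTo N₁) (λ k → length (E k)) * (N₁ * H)
        small≤ = begin
          small
            ≤⟨ ∑-⊆ {g = λ k → part k G} (upTo N₁) (Uniqueₚ.upTo⁺ n) (λ {k} _ pos → ∈-upTo⁺ (χ>0⇒ (suc k ≤? N₁) (*>0⇒ˡ _ (part k G) pos)) ,
                 ≤-trans (*-monoˡ-≤ (part k G) (χ≤1 (does (suc k ≤? N₁)))) (≤-reflexive (+-identityʳ _))) ⟩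
          ∑ (upTo N₁) (λ k → part k G)
            ≤⟨ ∑-mono (upTo N₁) (λ {k} k∈ → ∑-≤ {xs = E k} _ (N₁ * H) (λ a∈ → *-mono-≤ (∈-upTo⁻ k∈) (rare k∈ a∈))) ⟩
          ∑ (upTo N₁) (λ k → length (E k) * (N₁ * H))
            ≡⟨ ∑-*ʳ (upTo N₁) (N₁ * H) _ ⟩
          ∑ (upTo N₁) (λ k → length (E k)) * (N₁ * H) ∎

    multiset-negligible : Negligible e (forestCount B μ)
    multiset-negligible L with max-bound elems (λ σ k → 6 * L * t σ k ≤ tail e (t σ) k) (λ σ → hyp σ (6 * L))
    ... | N₁ , neg = suc (X + Y) , λ n le → *-cancelˡ-≤ (3 * suc (n ∸ 1)) (begin
      3 * suc (n ∸ 1) * (L * f n)                   ≡⟨ cong (λ z → 3 * z * (L * f n)) (pred≡ n le) ⟩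
      3 * n * (L * f n)                             ≡⟨ arr₁ n L (f n) ⟩
      3 * L * (f n * n)                             ≤⟨ *-monoʳ-≤ (3 * L) (sum-up n le) ⟩
      3 * L * (2 * BIG n + n * OFT n)               ≡⟨ arr₂ L (BIG n) n (OFT n) ⟩
      6 * L * BIG n + n * (3 * L * OFT n)           ≤⟨ +-mono-≤ (big-bound (6 * L) N₁ n (λ k k≥ σ → neg (complete σ) k k≥)) (*-monoʳ-≤ n (oft-bound n le)) ⟩
      2 * (n * tail e f n) + n * tail e f n         ≡⟨ arr₃ n (tail e f n) ⟩
      3 * n * tail e f n                            ≡⟨ cong (λ z → 3 * z * tail e f n) (sym (pred≡ n le)) ⟩
      3 * suc (n ∸ 1) * tail e f n                  ∎)
      where
      open ≤-Reasoning
      -- R is the number of small trees, and the factor suc R in J pays for the sum over them. The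
      -- budget is three tails: `big-bound` with 6 * L uses two of them and the frequent small trees
      -- one. X and Y are the size requirements of `pointwise` and `often`.
      R J H X Y : ℕ
      R = ∑ (upTo N₁) (λ k → length (E k))
      J = 3 * L * suc R
      H = threshold + J * e
      X = 2 * (R * (N₁ * H))
      Y = 2 * (J * N₁ * e)
      BIG OFT : ℕ → ℕ
      BIG n = ∑ (E n) (λ G → χ (P G) * ∑ (upTo n) (λ k → χ (does (N₁ ≤? k)) * part k G))
      OFT n = ∑ (upTo N₁) (λ k → ∑ (E k) (λ a → ∑ (E n) (λ G → χ (P G) * χ (does (H ≤? mult a G)))))
      arr₁ : ∀ n L f → 3 * n * (L * f) ≡ 3 * L * (f * n)
      arr₁ = solve-∀
      arr₂ : ∀ L b n o → 3 * L * (2 * b + n * o) ≡ 6 * L * b + n * (3 * L * o)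
      arr₂ = solve-∀
      arr₃ : ∀ n d → 2 * (n * d) + n * d ≡ 3 * n * d
      arr₃ = solve-∀
      pred≡ : ∀ n → suc (X + Y) ≤ n → suc (n ∸ 1) ≡ n
      pred≡ (suc n) _ = refl
      sum-up : ∀ n → suc (X + Y) ≤ n → f n * n ≤ 2 * BIG n + n * OFT n
      sum-up n le = begin
        f n * n                        ≡⟨ sym (∑-*ʳ (E n) n _) ⟩
        ∑ (E n) (λ G → χ (P G) * n)    ≤⟨ ∑-mono (E n) (λ {G} G∈ → *-monoʳ-≤ (χ (P G)) (pointwise N₁ H n G∈ (≤-trans (m≤m+n X Y) (<⇒≤ le)))) ⟩
        ∑ (E n) (λ G → χ (P G) * (2 * bg G + n * of′ G)) ≡⟨ ∑-cong (E n) (λ {G} _ → arr₄ (χ (P G)) (bg G) n (of′ G)) ⟩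
        ∑ (E n) (λ G → 2 * (χ (P G) * bg G) + n * (χ (P G) * of′ G)) ≡⟨ trans (∑-+ (E n) _ _) (cong₂ _+_ (∑-*ˡ (E n) 2 _) (∑-*ˡ (E n) n _)) ⟩
        2 * BIG n + n * ∑ (E n) (λ G → χ (P G) * of′ G) ≡⟨ cong (λ z → 2 * BIG n + n * z) swapped ⟩
        2 * BIG n + n * OFT n          ∎
        where
        bg of′ : Fo → ℕ
        bg G = ∑ (upTo n) (λ k → χ (does (N₁ ≤? k)) * part k G)
        of′ G = ∑ (upTo N₁) (λ k → ∑ (E k) (λ a → χ (does (H ≤? mult a G))))
        arr₄ : ∀ p b n o → p * (2 * b + n * o) ≡ 2 * (p * b) + n * (p * o)
        arr₄ = solve-∀
        swapped : ∑ (E n) (λ G → χ (P G) * of′ G) ≡ OFT n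
        swapped = trans (∑-cong (E n) (λ {G} _ → trans (sym (∑-*ˡ (upTo N₁) (χ (P G)) _)) (∑-cong (upTo N₁) (λ {k} _ → sym (∑-*ˡ (E k) (χ (P G)) _)))))
          (trans (∑-swap (E n) (upTo N₁) _) (∑-cong (upTo N₁) (λ {k} _ → ∑-swap (E n) (E k) _)))
      oft-bound : ∀ n → suc (X + Y) ≤ n → 3 * L * OFT n ≤ tail e f n
      oft-bound n le = *-cancelˡ-≤ (suc R) (begin
        suc R * (3 * L * OFT n)      ≡⟨ arr₅ (suc R) (3 * L) (OFT n) ⟩
        J * OFT n                    ≡⟨ trans (sym (∑-*ˡ (upTo N₁) J _)) (∑-cong (upTo N₁) (λ {k} _ → sym (∑-*ˡ (E k) J _))) ⟩
        ∑ (upTo N₁) (λ k → ∑ (E k) (λ a → J * ∑ (E n) (λ G → χ (P G) * χ (does (H ≤? mult a G)))))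
          ≤⟨ ∑-mono (upTo N₁) (λ {k} k∈ → ∑-≤ {xs = E k} _ (tail e f n) (λ a∈ → often J N₁ n (∈-upTo⁻ k∈) a∈ (≤-trans (m≤n+m Y X) (<⇒≤ le)))) ⟩
        ∑ (upTo N₁) (λ k → length (E k) * tail e f n) ≡⟨ ∑-*ʳ (upTo N₁) (tail e f n) _ ⟩
        R * tail e f n               ≤⟨ m≤n+m _ (tail e f n) ⟩
        suc R * tail e f n           ∎)
        where
        arr₅ : ∀ x y z → x * (y * z) ≡ y * x * z
        arr₅ = solve-∀

-- Realizability of types is decidable

module Evaluation {X : Set} (F : Finite X) (z : X) (op : X → X → X) where
  open Finite F

  ev : Fo → X
  ev ε       = z
  ev (a ▸ b) = op (ev a) (ev b)

  private
    vals : ℕ → List X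
    vals k = map ev (enumDepth k)

    val? : ∀ k x → Dec (x ∈ vals k)
    val? k x = Any.any? (x ≈?_) (vals k)

    Stable : ℕ → Set
    Stable k = ∀ x → x ∈ vals (suc k) → x ∈ vals k

    ε∈ : ∀ k → ε ∈ enumDepth k
    ε∈ zero    = here refl
    ε∈ (suc k) = here refl

    ▸∈ : ∀ {k x y} → x ∈ vals k → y ∈ vals k → op x y ∈ vals (suc k)
    ▸∈ {k} p q with ∈-map⁻ ev p | ∈-map⁻ ev q
    ... | a , a∈ , refl | b , b∈ , refl = ∈-map⁺ ev {x = a ▸ b} {xs = enumDepth (suc k)} (there (∈-map⁺ (uncurry _▸_) (∈-cartesianProduct⁺ a∈ b∈)))

    grows : ∀ k {a} → a ∈ enumDepth k → a ∈ enumDepth (suc k)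
    grows zero    (here refl) = here refl
    grows (suc k) (here refl) = here refl
    grows (suc k) (there p) with ∈-map⁻ (uncurry _▸_) p
    ... | (a , b) , ab∈ , refl with ∈-cartesianProduct⁻ (enumDepth k) (enumDepth k) ab∈
    ...   | a∈ , b∈ = there (∈-map⁺ (uncurry _▸_) (∈-cartesianProduct⁺ (grows k a∈) (grows k b∈)))

    vals-grow : ∀ k {x} → x ∈ vals k → x ∈ vals (suc k)
    vals-grow k p with ∈-map⁻ ev p
    ... | a , a∈ , refl = ∈-map⁺ ev (grows k a∈)

    card : ℕ → ℕ
    card k = ∑ elems (λ x → χ (does (val? k x)))

    stable-or-grow : ∀ k → (∃ λ j → Stable j) ⊎ k ≤ card k
    stable-or-grow zero = inj₂ z≤n
    stable-or-grow (suc k) with stable-or-grow k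
    ... | inj₁ s = inj₁ s
    ... | inj₂ le with ∃? (λ x → val? (suc k) x ×-dec ¬? (val? k x))
    ...   | no ¬p = inj₁ (k , λ x p → [ id , (λ ¬q → ⊥-elim (¬p (x , p , ¬q))) ]′ (dec⊎ (val? k x)))
      where
      dec⊎ : ∀ {P : Set} → Dec P → P ⊎ ¬ P
      dec⊎ (yes p) = inj₁ p
      dec⊎ (no ¬p) = inj₂ ¬p
    ...   | yes (x , new , old) = inj₂ (begin
      suc k                                                                  ≤⟨ s≤s le ⟩
      suc (card k)                                                           ≡⟨ cong (_+ card k) (sym (∑-δ _≈?_ (λ _ → 1) unique (complete x))) ⟩
      ∑ elems (λ y → χ (does (x ≈? y)) * 1) + card k                         ≡⟨ sym (∑-+ elems _ _) ⟩
      ∑ elems (λ y → χ (does (x ≈? y)) * 1 + χ (does (val? k y)))            ≤⟨ ∑-mono elems (λ {y} _ → pt y) ⟩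
      card (suc k)                                                           ∎)
      where
      open ≤-Reasoning
      pt : ∀ y → χ (does (x ≈? y)) * 1 + χ (does (val? k y)) ≤ χ (does (val? (suc k) y))
      pt y with x ≈? y | val? k y
      ... | yes refl | yes q = ⊥-elim (old q)
      ... | yes refl | no _  = ≤-reflexive (sym (χ-yes (val? (suc k) y) new))
      ... | no _     | yes q = ≤-reflexive (sym (χ-yes (val? (suc k) y) (vals-grow k q)))
      ... | no _     | no _  = z≤n

    stable : ∃ λ j → Stable j
    stable with stable-or-grow (suc (length elems))
    ... | inj₁ s = s
    ... | inj₂ le = ⊥-elim (<-irrefl refl (≤-trans le (≤-trans (∑-≤ {xs = elems} _ 1 (λ {x} _ → χ≤1 (does (val? (suc (length elems)) x)))) (≤-reflexive (*-identityʳ _)))))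

    all-vals : ∀ {k} → Stable k → ∀ a → ev a ∈ vals k
    all-vals {k} s ε   = ∈-map⁺ ev {x = ε} (ε∈ k)
    all-vals s (a ▸ b) = s (op (ev a) (ev b)) (▸∈ (all-vals s a) (all-vals s b))

  -- The sets of values reached at depth at most k increase with k and cannot grow strictly more
  -- than |X| times. Once such a set repeats it is closed under `op`, so it contains every value.
  realizable? : ∀ {P : X → Set} → (∀ x → Dec (P x)) → Dec (∃ λ a → P (ev a))
  realizable? {P} P? with stable
  ... | k , s with Any.any? P? (vals k)
  ...   | yes p = yes (found p)
    where
    found : ∀ {as} → Any P (map ev as) → ∃ λ a → P (ev a)
    found {a ∷ as} (here q)  = a , q
    found {a ∷ as} (there q) = found q
  ...   | no ¬p = no (λ (a , q) → ¬p (lose (all-vals s a) q))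
    where
    lose : ∀ {x xs} → x ∈ xs → P x → Any P xs
    lose (here refl) p = here p
    lose (there m)   p = there (lose m p)

-- Comparison of sums along a covering map, and subexponential growth

∑-onto : ∀ {A B : Set} (_≟A_ : DecidableEquality A) {f : A → ℕ} {g : B → ℕ} {xs : List A} (ys : List B) (φ : B → A) →
  Unique xs → (∀ {x} → x ∈ xs → 0 < f x → ∃ λ y → y ∈ ys × φ y ≡ x × f x ≤ g y) → ∑ xs f ≤ ∑ ys g
∑-onto _≟A_ {f} {g} {xs} ys φ u h = begin
  ∑ xs f                                                  ≤⟨ ∑-mono xs (λ x∈ → pt x∈) ⟩
  ∑ xs (λ x → ∑ ys (λ y → χ (does (x ≟A φ y)) * g y))     ≡⟨ ∑-swap xs ys _ ⟩
  ∑ ys (λ y → ∑ xs (λ x → χ (does (x ≟A φ y)) * g y))     ≤⟨ ∑-mono ys (λ {y} _ → ≤-trans (≤-reflexive (∑-*ʳ xs (g y) _)) (≤-trans (*-monoˡ-≤ (g y) (once (φ y))) (≤-reflexive (+-identityʳ _)))) ⟩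
  ∑ ys g                                                  ∎
  where
  open ≤-Reasoning
  pt : ∀ {x} → x ∈ xs → f x ≤ ∑ ys (λ y → χ (does (x ≟A φ y)) * g y)
  pt {x} x∈ with f x in eq
  ... | zero  = z≤n
  ... | suc n with h x∈ (subst (0 <_) (sym eq) z<s)
  ...   | y , y∈ , φy , le = ≤-trans (≤-trans (subst (_≤ g y) eq le) (≤-reflexive (sym (trans (cong (_* g y) (χ-yes (x ≟A φ y) (sym φy))) (+-identityʳ _)))))
                               (∑-∈ (λ y → χ (does (x ≟A φ y)) * g y) y∈)
  once : ∀ a → ∑ xs (λ x → χ (does (x ≟A a))) ≤ 1
  once a = ∑-⊆ {g = λ _ → 1} (a ∷ []) u (λ {x} _ pos → here (χ>0⇒ (x ≟A a) pos) , χ≤1 (does (x ≟A a)))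

-- The statement c(n) ≤ B(1 + 1/s)^n for every s with denominators cleared: the limsup of the n-th
-- roots is at most 1, that is, the radius is at least 1.
SubExp : (ℕ → ℕ) → Set
SubExp c = ∀ s → 1 ≤ s → ∃[ B ] ∀ n → c n * s ^ n ≤ B * suc s ^ n

n<2^n : ∀ n → suc n ≤ 2 ^ n
n<2^n zero    = ≤-refl
n<2^n (suc n) = ≤-trans (+-mono-≤ (m^n>0 2 n) (n<2^n n)) (≤-reflexive (cong (2 ^ n +_) (sym (+-identityʳ (2 ^ n)))))

^-distribʳ-* : ∀ a b n → (a * b) ^ n ≡ a ^ n * b ^ n
^-distribʳ-* a b zero    = refl
^-distribʳ-* a b (suc n) = trans (cong (a * b *_) (^-distribʳ-* a b n)) (arr a b (a ^ n) (b ^ n))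
  where
  arr : ∀ a b x y → a * b * (x * y) ≡ a * x * (b * y)
  arr = solve-∀

-- Bernoulli's inequality in the form (1 + 1/S)^s ≤ S/(S - s), free of division.
bernoulli : ∀ S s → s ≤ S → (S ∸ s) * suc S ^ s ≤ S * S ^ s
bernoulli S zero    le = ≤-refl
bernoulli S (suc s) le = begin
  (S ∸ suc s) * (suc S * suc S ^ s)     ≡⟨ sym (*-assoc (S ∸ suc s) (suc S) _) ⟩
  (S ∸ suc s) * suc S * suc S ^ s       ≤⟨ *-monoˡ-≤ (suc S ^ s) step ⟩
  S * (S ∸ s) * suc S ^ s               ≡⟨ *-assoc S (S ∸ s) _ ⟩
  S * ((S ∸ s) * suc S ^ s)             ≤⟨ *-monoʳ-≤ S (bernoulli S s (<⇒≤ le)) ⟩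
  S * (S * S ^ s)                       ∎
  where
  open ≤-Reasoning
  S∸s : suc (S ∸ suc s) ≡ S ∸ s
  S∸s = sym (+-∸-assoc 1 le)
  step : (S ∸ suc s) * suc S ≤ S * (S ∸ s)
  step = begin
    (S ∸ suc s) * suc S                 ≡⟨ *-suc (S ∸ suc s) S ⟩
    (S ∸ suc s) + (S ∸ suc s) * S       ≤⟨ +-monoˡ-≤ ((S ∸ suc s) * S) (m∸n≤m S (suc s)) ⟩
    suc (S ∸ suc s) * S                 ≡⟨ cong (_* S) S∸s ⟩
    (S ∸ s) * S                         ≡⟨ *-comm (S ∸ s) S ⟩
    S * (S ∸ s)                         ∎

-- A doubling every s sizes meets a growth of at most 3/2 per s sizes; the quotient (4/3)^k cannot
-- stay below a linear function. The linear factor in the hypothesis is there because one tree may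
-- be read as several words, at most one for each of its nodes.
subexp-contradiction : ∀ {c} n₀ s → 1 ≤ s → SubExp c → (∀ k → 2 ^ k ≤ suc (n₀ + k * s) * c (n₀ + k * s)) → ⊥
subexp-contradiction {c} n₀ s s≥1 sub big with sub (3 * s) (≤-trans s≥1 (m≤m+n s _))
-- At j = V the bounds read (V + 1)² ≤ 2^(2V) ≤ (V + 1)V.
... | B , bound = <-irrefl refl (≤-trans (*-monoʳ-< (suc V) (n<1+n V)) (≤-trans (growth V) (lin V)))
  where
  open ≤-Reasoning
  -- By Bernoulli's inequality, (1 + 1/S)^s ≤ 3/2 for this S.
  S : ℕ
  S = 3 * s
  S>0 : 0 < S
  S>0 = ≤-trans s≥1 (m≤m+n s _)
  base : 2 * suc S ^ s ≤ 3 * S ^ s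
  base = *-cancelˡ-≤ s {{>-nonZero s≥1}} (begin
    s * (2 * suc S ^ s)      ≡⟨ arr s (suc S ^ s) ⟩
    (2 * s) * suc S ^ s      ≡⟨ cong (_* suc S ^ s) (sym (trans (cong (_∸ s) (arr₃ s)) (m+n∸n≡m (2 * s) s))) ⟩
    (S ∸ s) * suc S ^ s      ≤⟨ bernoulli S s (m≤m+n s _) ⟩
    S * S ^ s                ≡⟨ arr₂ s (S ^ s) ⟩
    s * (3 * S ^ s)          ∎)
    where
    arr : ∀ s x → s * (2 * x) ≡ (2 * s) * x
    arr = solve-∀
    arr₂ : ∀ s x → 3 * s * x ≡ s * (3 * x)
    arr₂ = solve-∀
    arr₃ : ∀ s → 3 * s ≡ 2 * s + s
    arr₃ = solve-∀
  ^-ks : ∀ x k → x ^ (k * s) ≡ (x ^ s) ^ k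
  ^-ks x k = trans (cong (x ^_) (*-comm k s)) (sym (^-*-assoc x s k))
  basek : ∀ k → 2 ^ k * suc S ^ (k * s) ≤ 3 ^ k * S ^ (k * s)
  basek k = begin
    2 ^ k * suc S ^ (k * s)       ≡⟨ cong (2 ^ k *_) (^-ks (suc S) k) ⟩
    2 ^ k * (suc S ^ s) ^ k       ≡⟨ sym (^-distribʳ-* 2 (suc S ^ s) k) ⟩
    (2 * suc S ^ s) ^ k           ≤⟨ ^-monoˡ-≤ k base ⟩
    (3 * S ^ s) ^ k               ≡⟨ ^-distribʳ-* 3 (S ^ s) k ⟩
    3 ^ k * (S ^ s) ^ k           ≡⟨ cong (3 ^ k *_) (sym (^-ks S k)) ⟩
    3 ^ k * S ^ (k * s)           ∎
  W : ℕ
  W = B * suc S ^ n₀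
  four : ∀ k → 4 ^ k ≤ suc (n₀ + k * s) * W * 3 ^ k
  four k = *-cancelʳ-≤ _ _ (S ^ (k * s)) {{>-nonZero (m^n>0 S {{>-nonZero S>0}} (k * s))}} (begin
    4 ^ k * S ^ (k * s)                                        ≤⟨ *-monoʳ-≤ (4 ^ k) (≤-trans (≤-reflexive (sym (+-identityʳ _))) (*-monoˡ-≤ (S ^ (k * s)) (m^n>0 S {{>-nonZero S>0}} n₀))) ⟩
    4 ^ k * (S ^ n₀ * S ^ (k * s))                             ≡⟨ cong (4 ^ k *_) (sym (^-distribˡ-+-* S n₀ (k * s))) ⟩
    4 ^ k * S ^ n                                              ≡⟨ cong (_* S ^ n) (^-distribʳ-* 2 2 k) ⟩
    2 ^ k * 2 ^ k * S ^ n                                      ≤⟨ *-monoˡ-≤ (S ^ n) (*-monoʳ-≤ (2 ^ k) (big k)) ⟩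
    2 ^ k * (suc n * c n) * S ^ n                              ≡⟨ arr (2 ^ k) (suc n) (c n) (S ^ n) ⟩
    2 ^ k * suc n * (c n * S ^ n)                              ≤⟨ *-monoʳ-≤ (2 ^ k * suc n) (bound n) ⟩
    2 ^ k * suc n * (B * suc S ^ n)                            ≡⟨ cong (λ z → 2 ^ k * suc n * (B * z)) (^-distribˡ-+-* (suc S) n₀ (k * s)) ⟩
    2 ^ k * suc n * (B * (suc S ^ n₀ * suc S ^ (k * s)))       ≡⟨ arr₂ (2 ^ k) (suc n) B (suc S ^ n₀) (suc S ^ (k * s)) ⟩
    suc n * W * (2 ^ k * suc S ^ (k * s))                      ≤⟨ *-monoʳ-≤ (suc n * W) (basek k) ⟩
    suc n * W * (3 ^ k * S ^ (k * s))                          ≡⟨ sym (*-assoc (suc n * W) (3 ^ k) _) ⟩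
    suc n * W * 3 ^ k * S ^ (k * s)                            ∎)
    where
    n : ℕ
    n = n₀ + k * s
    arr : ∀ p q r t → p * (q * r) * t ≡ p * q * (r * t)
    arr = solve-∀
    arr₂ : ∀ p q b u v → p * q * (b * (u * v)) ≡ q * (b * u) * (p * v)
    arr₂ = solve-∀
  -- Taking k = 3j turns (4/3)^k into (64/27)^j, which is at least 2^j since 54 ≤ 64.
  two : ∀ j → 2 ^ j ≤ suc (n₀ + 3 * j * s) * W
  two j = *-cancelʳ-≤ _ _ (27 ^ j) {{>-nonZero (m^n>0 27 j)}} (begin
    2 ^ j * 27 ^ j                              ≡⟨ sym (^-distribʳ-* 2 27 j) ⟩
    54 ^ j                                      ≤⟨ ^-monoˡ-≤ j (m≤m+n 54 10) ⟩
    64 ^ j                                      ≡⟨ ^-*-assoc 4 3 j ⟩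
    4 ^ (3 * j)                                 ≤⟨ four (3 * j) ⟩
    suc (n₀ + 3 * j * s) * W * 3 ^ (3 * j)      ≡⟨ cong (suc (n₀ + 3 * j * s) * W *_) (sym (^-*-assoc 3 3 j)) ⟩
    suc (n₀ + 3 * j * s) * W * 27 ^ j           ∎)
  V : ℕ
  V = suc (n₀ + 6 * s) * W
  growth : ∀ j → suc j * suc j ≤ 2 ^ (2 * j)
  growth j = ≤-trans (*-mono-≤ (n<2^n j) (n<2^n j)) (≤-reflexive (trans (sym (^-distribˡ-+-* 2 j j)) (cong (2 ^_) (cong (j +_) (sym (+-identityʳ j))))))
  lin : ∀ j → 2 ^ (2 * j) ≤ suc j * V
  lin j = begin
    2 ^ (2 * j)                            ≤⟨ two (2 * j) ⟩
    suc (n₀ + 3 * (2 * j) * s) * W         ≤⟨ *-monoˡ-≤ W (≤-trans (m≤m+n (suc (n₀ + 3 * (2 * j) * s)) (j + j * n₀ + 6 * s)) (≤-reflexive (arr n₀ j s))) ⟩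
    suc j * suc (n₀ + 6 * s) * W           ≡⟨ *-assoc (suc j) (suc (n₀ + 6 * s)) W ⟩
    suc j * V                              ∎
    where
    arr : ∀ n j s → suc (n + 3 * (2 * j) * s) + (j + j * n + 6 * s) ≡ suc j * suc (n + 6 * s)
    arr = solve-∀


-- Loops in the type automaton

∨-swap : ∀ x y z → x ∨ (y ∨ z) ≡ y ∨ (x ∨ z)
∨-swap true  true  z = refl
∨-swap true  false z = refl
∨-swap false true  z = refl
∨-swap false false z = refl

-- Levi's lemma for words.
++-split : ∀ {A : Set} (as : List A) {bs cs ds} → as ++ bs ≡ cs ++ ds →
  (∃ λ vs → cs ≡ as ++ vs × bs ≡ vs ++ ds) ⊎ (∃ λ vs → as ≡ cs ++ vs × ds ≡ vs ++ bs)
++-split []       {cs = cs} e = inj₁ (cs , refl , e)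
++-split (a ∷ as) {cs = []} e = inj₂ (a ∷ as , refl , sym e)
++-split (a ∷ as) {cs = c ∷ cs} e with ∷-injective e
... | refl , e′ with ++-split as e′
...   | inj₁ (vs , p , q) = inj₁ (vs , cong (a ∷_) p , q)
...   | inj₂ (vs , p , q) = inj₂ (vs , cong (a ∷_) p , q)

words : ∀ k → List (Vec Bool k)
words k = Finite.elems (finVec k)

count-words : ∀ k → ∑ (words k) (λ _ → 1) ≡ 2 ^ k
count-words zero    = refl
count-words (suc k) = trans (∑-map (uncurry _∷_) (cartesianProduct (true ∷ false ∷ []) (words k)) (λ _ → 1))
  (trans (∑-× (true ∷ false ∷ []) (words k) (λ _ → 1)) (cong₂ (λ x y → x + (y + 0)) (count-words k) (count-words k)))

module Structure (A : Alg (Label 0 0)) where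
  open Typed A

  -- A one-hole tree context, listed from the root: each entry is the forest of siblings of the next node on the path.
  Context : Set
  Context = List Fo

  plug : Context → Fo → Fo
  plug []       a = a
  plug (h ∷ hs) a = ins (plug hs a) h

  kplug : Context → M → M
  kplug []       τ = τ
  kplug (h ∷ hs) τ = rt ([] , []) (kplug hs τ ∙ ty h)

  κ-plug : ∀ hs a → κ (plug hs a) ≡ kplug hs (κ a)
  κ-plug []       a = refl
  κ-plug (h ∷ hs) a = cong (rt ([] , [])) (trans (ty-ins (plug hs a) h) (cong (_∙ ty h) (κ-plug hs a)))

  plug-++ : ∀ hs ks a → plug (hs ++ ks) a ≡ plug hs (plug ks a)
  plug-++ []       ks a = refl
  plug-++ (h ∷ hs) ks a = cong (λ z → ins z h) (plug-++ hs ks a)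

  kplug-++ : ∀ hs ks τ → kplug (hs ++ ks) τ ≡ kplug hs (kplug ks τ)
  kplug-++ []       ks τ = refl
  kplug-++ (h ∷ hs) ks τ = cong (λ z → rt ([] , []) (z ∙ ty h)) (kplug-++ hs ks τ)

  csz : Context → ℕ
  csz []       = 0
  csz (h ∷ hs) = suc (sz h + csz hs)

  csz-++ : ∀ hs ks → csz (hs ++ ks) ≡ csz hs + csz ks
  csz-++ []       ks = refl
  csz-++ (h ∷ hs) ks = cong suc (trans (cong (sz h +_) (csz-++ hs ks)) (sym (+-assoc (sz h) _ _)))

  sz-plug : ∀ hs a → sz (plug hs a) ≡ csz hs + sz a
  sz-plug []       a = refl
  sz-plug (h ∷ hs) a = trans (size-ins (plug hs a) h) (cong suc (trans (cong (_+ sz h) (sz-plug hs a)) (arr (csz hs) (sz a) (sz h))))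
    where
    arr : ∀ x y z → x + y + z ≡ z + x + y
    arr = solve-∀

  Can-plug : ∀ {hs a} → All Can hs → Can a → Can (plug hs a)
  Can-plug []       ca = ca
  Can-plug (c ∷ cs) ca = Can-ins (Can-plug cs ca) c

  plug-injective : ∀ hs {a b} → plug hs a ≡ plug hs b → a ≡ b
  plug-injective []       e = e
  plug-injective (h ∷ hs) e = plug-injective hs (ins-injectiveˡ h e)

  -- All decompositions of a tree into a context of given length and a subtree, one for each node at that depth.
  paths : ℕ → Fo → List Context
  pathsVia : ℕ → Fo → Fo → List Context
  paths zero    G = [] ∷ []
  paths (suc r) G = pathsVia r G G
  pathsVia r G ε       = []
  pathsVia r G (c ▸ H) = map (del c G ∷_) (paths r c) ++ pathsVia r G H

  length-paths : ∀ r G → length (paths r G) ≤ suc (sz G)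
  length-pathsVia : ∀ r G H → length (pathsVia r G H) ≤ sz H
  length-paths zero    G = s≤s z≤n
  length-paths (suc r) G = m≤n⇒m≤1+n (length-pathsVia r G G)
  length-pathsVia r G ε       = z≤n
  length-pathsVia r G (c ▸ H) = begin
    length (map (del c G ∷_) (paths r c) ++ pathsVia r G H)         ≡⟨ length-++ (map (del c G ∷_) (paths r c)) ⟩
    length (map (del c G ∷_) (paths r c)) + length (pathsVia r G H) ≡⟨ cong (_+ length (pathsVia r G H)) (length-map (del c G ∷_) (paths r c)) ⟩
    length (paths r c) + length (pathsVia r G H)                    ≤⟨ +-mono-≤ (length-paths r c) (length-pathsVia r G H) ⟩
    suc (sz c) + sz H                                               ∎
    where open ≤-Reasoning

  ∈-pathsVia : ∀ r G {c hs} H → 0 < mult c H → hs ∈ paths r c → (del c G ∷ hs) ∈ pathsVia r G H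
  ∈-pathsVia r G {c} (b ▸ H) m p with c ≟F b
  ... | yes refl = ∈-++⁺ˡ (∈-map⁺ (del c G ∷_) p)
  ... | no _     = ∈-++⁺ʳ (map (del b G ∷_) (paths r b)) (∈-pathsVia r G H m p)

  ∈-paths : ∀ hs b → hs ∈ paths (length hs) (plug hs b)
  ∈-paths []       b = here refl
  ∈-paths (h ∷ hs) b = subst (λ z → (z ∷ hs) ∈ paths (suc (length hs)) (ins (plug hs b) h)) (del-ins (plug hs b) h)
    (∈-pathsVia (length hs) _ (ins (plug hs b) h) pos (∈-paths hs b))
    where
    pos : 0 < mult (plug hs b) (ins (plug hs b) h)
    pos = subst (0 <_) (sym (trans (mult-ins (plug hs b) (plug hs b) h) (cong (λ z → χ z + mult (plug hs b) h) (==-refl (plug hs b))))) z<s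

  -- Speaks of every node of the child forest but not of the root above it; in this way one can
  -- consider trees of type σ whose inner nodes avoid σ. `good` includes the root, and `occ` leaves
  -- it out like `allow`.
  allow : (M → Bool) → Fo → Bool
  allow S ε       = true
  allow S (a ▸ b) = (S (κ a) ∧ allow S a) ∧ allow S b

  good : (M → Bool) → Fo → Bool
  good S a = S (κ a) ∧ allow S a

  allow-allC : ∀ S a → allow S a ≡ allC (good S) a
  allow-allC S ε       = refl
  allow-allC S (a ▸ b) = cong (good S a ∧_) (allow-allC S b)

  allow-~ : ∀ S {a b} → a ~ b → allow S a ≡ allow S b
  allow-~ S ~ε           = refl
  allow-~ S (~▸ p q)     = cong₂ _∧_ (cong₂ _∧_ (cong (S ∘ rt ([] , [])) (ty-~ p)) (allow-~ S p)) (allow-~ S q)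
  allow-~ S (~swap {a} {b} {c}) = ∧-swap (good S a) (good S b) (allow S c)
  allow-~ S (~trans p q) = trans (allow-~ S p) (allow-~ S q)

  allow-ins : ∀ S a b → allow S (ins a b) ≡ good S a ∧ allow S b
  allow-ins S a b = allow-~ S (ins-~ a b)

  occ : M → Fo → Bool
  occ σ ε       = false
  occ σ (a ▸ b) = ((κ a ≡ᴹ σ) ∨ occ σ a) ∨ occ σ b

  occ-~ : ∀ σ {a b} → a ~ b → occ σ a ≡ occ σ b
  occ-~ σ ~ε           = refl
  occ-~ σ (~▸ p q)     = cong₂ _∨_ (cong₂ _∨_ (cong (λ m → rt ([] , []) m ≡ᴹ σ) (ty-~ p)) (occ-~ σ p)) (occ-~ σ q)
  occ-~ σ (~swap {a} {b} {c}) = ∨-swap ((κ a ≡ᴹ σ) ∨ occ σ a) ((κ b ≡ᴹ σ) ∨ occ σ b) (occ σ c)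
  occ-~ σ (~trans p q) = trans (occ-~ σ p) (occ-~ σ q)

  occ-ins : ∀ σ a b → occ σ (ins a b) ≡ ((κ a ≡ᴹ σ) ∨ occ σ a) ∨ occ σ b
  occ-ins σ a b = occ-~ σ (ins-~ a b)

  record Occurrence (σ : M) (a : Fo) : Set where
    field
      ctx  : Context
      sub  : Fo
      can-ctx : All Can ctx
      can-sub : Can sub
      whole : a ≡ plug ctx sub
      typed : κ sub ≡ σ

  private
    component-occ : ∀ σ a → Can a → occ σ a ≡ true → ∃ λ c → 0 < mult c a × Occurrence σ c
    component-occ σ (x ▸ y) (cx , cy , _) o with ∨-elim {(κ x ≡ᴹ σ) ∨ occ σ x} o
    ... | inj₂ oy with component-occ σ y cy oy
    ...   | c , m , O = c , ≤-trans m (m≤n+m (mult c y) _) , O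
    component-occ σ (x ▸ y) (cx , cy , _) o | inj₁ ox = x , subst (λ z → 0 < χ z + mult x y) (sym (==-refl x)) z<s , here-or-below (∨-elim {κ x ≡ᴹ σ} ox)
      where
      here-or-below : (κ x ≡ᴹ σ) ≡ true ⊎ occ σ x ≡ true → Occurrence σ x
      here-or-below (inj₁ e) = record { ctx = [] ; sub = x ; can-ctx = [] ; can-sub = cx ; whole = refl ; typed = does⇒ (κ x ≈? σ) e }
      here-or-below (inj₂ e) with component-occ σ x cx e
      ... | c , m , O = record
        { ctx = del c x ∷ ctx ; sub = sub ; can-ctx = Can-del x cx ∷ can-ctx ; can-sub = can-sub
        ; whole = trans (sym (ins-del cx m)) (cong (λ z → ins z (del c x)) whole) ; typed = typed }
        where open Occurrence O

  proper-occurrence : ∀ σ {a} → Can a → occ σ a ≡ true → Σ (Occurrence σ a) λ O → Occurrence.ctx O ≢ []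
  proper-occurrence σ {a} ca o with component-occ σ a ca o
  ... | c , m , O = record
    { ctx = del c a ∷ ctx ; sub = sub ; can-ctx = Can-del a ca ∷ can-ctx ; can-sub = can-sub
    ; whole = trans (sym (ins-del ca m)) (cong (λ z → ins z (del c a)) whole) ; typed = typed } , λ ()
    where open Occurrence O

  plug-occ : ∀ σ hs {b} → hs ≢ [] → κ b ≡ σ → occ σ (plug hs b) ≡ true
  plug-occ σ []       ne e = ⊥-elim (ne refl)
  plug-occ σ (h ∷ []) {b} ne e = trans (occ-ins σ b h) (∨-introˡ (∨-introˡ (⇒does (κ b ≈? σ) e)))
  plug-occ σ (h ∷ k ∷ hs) {b} ne e = trans (occ-ins σ (plug (k ∷ hs) b) h) (∨-introˡ (∨-introʳ {κ (plug (k ∷ hs) b) ≡ᴹ σ} (plug-occ σ (k ∷ hs) (λ ()) e)))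

  CtxAllowed : (M → Bool) → M → Context → Set
  CtxAllowed S τ []       = ⊤
  CtxAllowed S τ (h ∷ hs) = S (kplug hs τ) ≡ true × allow S h ≡ true × CtxAllowed S τ hs

  allow-plug⁻ : ∀ S hs {b} → allow S (plug hs b) ≡ true → CtxAllowed S (κ b) hs × allow S b ≡ true
  allow-plug⁻ S []       p = tt , p
  allow-plug⁻ S (h ∷ hs) {b} p = (subst (λ z → S z ≡ true) (κ-plug hs b) (∧-elimˡ q) , ∧-elimʳ {good S (plug hs b)} p′ , proj₁ ih) , proj₂ ih
    where
    p′ : good S (plug hs b) ∧ allow S h ≡ true
    p′ = trans (sym (allow-ins S (plug hs b) h)) p
    q : good S (plug hs b) ≡ true
    q = ∧-elimˡ p′
    ih : CtxAllowed S (κ b) hs × allow S b ≡ true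
    ih = allow-plug⁻ S hs (∧-elimʳ {S (κ (plug hs b))} q)

  allow-plug⁺ : ∀ S hs {b} → CtxAllowed S (κ b) hs → allow S b ≡ true → allow S (plug hs b) ≡ true
  allow-plug⁺ S []       _ p = p
  allow-plug⁺ S (h ∷ hs) {b} (q , r , c) p =
    trans (allow-ins S (plug hs b) h) (∧-intro (∧-intro (trans (cong S (κ-plug hs b)) q) (allow-plug⁺ S hs c p)) r)

  -- A first-return loop: the suffixes of a context are the parts of the path below its inner nodes,
  -- so `minimal` says that no inner node of the path has type σ.
  record Primitive (σ : M) (hs : Context) : Set where
    field
      proper   : hs ≢ []
      loop     : kplug hs σ ≡ σ
      minimal  : ∀ us vs → hs ≡ us ++ vs → us ≢ [] → vs ≢ [] → kplug vs σ ≢ σ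

  private
    Splits : M → Context → Set
    Splits σ hs = ∃ λ us → ∃ λ vs → hs ≡ us ++ vs × us ≢ [] × vs ≢ [] × kplug vs σ ≡ σ

    splits? : ∀ σ hs → Dec (Splits σ hs)
    splits? σ [] = no λ where
      ([] , _ , _ , n , _) → n refl
      (_ ∷ _ , _ , () , _)
    splits? σ (h ∷ t) with Listₚ.≡-dec _≟F_ t [] | kplug t σ ≈? σ | splits? σ t
    ... | no t≢[] | yes e | _ = yes (h ∷ [] , t , refl , (λ ()) , t≢[] , e)
    ... | _ | _ | yes (us , vs , e , _ , nv , l) = yes (h ∷ us , vs , cong (h ∷_) e , (λ ()) , nv , l)
    ... | yes t≡[] | _ | no ¬s = no λ where
      ([] , _ , _ , n , _) → n refl
      (_ ∷ [] , vs , e , _ , nv , _) → nv (trans (sym (proj₂ (∷-injective e))) t≡[])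
      (_ ∷ u ∷ us , vs , e , _ , nv , l) → ¬s (u ∷ us , vs , proj₂ (∷-injective e) , (λ ()) , nv , l)
    ... | no _ | no ¬e | no ¬s = no λ where
      ([] , _ , _ , n , _) → n refl
      (_ ∷ [] , vs , e , _ , _ , l) → ¬e (trans (cong (λ z → kplug z σ) (proj₂ (∷-injective e))) l)
      (_ ∷ u ∷ us , vs , e , _ , nv , l) → ¬s (u ∷ us , vs , proj₂ (∷-injective e) , (λ ()) , nv , l)

    -- If some inner node of the path has type σ, the occurrence is moved up to that node; the outer
    -- part of the context is again a loop, and it is shorter.
    prim-fuel : ∀ n σ {a} → κ a ≡ σ → (O : Occurrence σ a) → Occurrence.ctx O ≢ [] → length (Occurrence.ctx O) ≤ n →
                Σ (Occurrence σ a) λ O′ → Primitive σ (Occurrence.ctx O′)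
    prim-fuel n σ {a} e O ne le with splits? σ (Occurrence.ctx O)
    ... | no ¬s = O , record
      { proper = ne
      ; loop = trans (cong (kplug ctx) (sym typed)) (trans (sym (κ-plug ctx sub)) (trans (cong κ (sym whole)) e))
      ; minimal = λ us vs p q r l → ¬s (us , vs , p , q , r , l) }
      where open Occurrence O
    prim-fuel zero σ e O ne le | yes (us , vs , p , nu , nv , l) with Occurrence.ctx O
    ... | [] = ⊥-elim (ne refl)
    prim-fuel (suc n) σ {a} e O ne le | yes (us , vs , p , nu , nv , l) = prim-fuel n σ e O′ nu shorter
      where
      open Occurrence O
      cans : All Can (us ++ vs)
      cans = subst (All Can) p can-ctx
      O′ : Occurrence σ a
      O′ = record
        { ctx = us ; sub = plug vs sub ; can-ctx = Allₚ.++⁻ˡ us cans ; can-sub = Can-plug (Allₚ.++⁻ʳ us cans) can-sub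
        ; whole = trans whole (trans (cong (λ z → plug z sub) p) (plug-++ us vs sub))
        ; typed = trans (κ-plug vs sub) (trans (cong (kplug vs) typed) l) }
      nonempty : ∀ {vs : Context} → vs ≢ [] → 1 ≤ length vs
      nonempty {[]}    q = ⊥-elim (q refl)
      nonempty {_ ∷ _} q = s≤s z≤n
      shorter : length us ≤ n
      shorter = ≤-pred (begin
        suc (length us)             ≡⟨ +-comm 1 (length us) ⟩
        length us + 1               ≤⟨ +-monoʳ-≤ (length us) (nonempty nv) ⟩
        length us + length vs       ≡⟨ sym (trans (cong length p) (length-++ us)) ⟩
        length (Occurrence.ctx O)   ≤⟨ le ⟩
        suc n                       ∎)
        where open ≤-Reasoning

  primitive-occurrence : ∀ σ {a} → Can a → κ a ≡ σ → occ σ a ≡ true → Σ (Occurrence σ a) λ O → Primitive σ (Occurrence.ctx O)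
  primitive-occurrence σ ca e o with proper-occurrence σ ca o
  ... | O , ne = prim-fuel (length (Occurrence.ctx O)) σ e O ne ≤-refl

  -- By Levi's lemma the shorter of two commuting words is a suffix of the longer one. Being a loop
  -- at σ, a proper suffix would be an earlier return, against `minimal`.
  primitive-unique : ∀ σ {hs ks} → hs ++ ks ≡ ks ++ hs → Primitive σ hs → Primitive σ ks → hs ≡ ks
  primitive-unique σ {hs} {ks} comm′ P Q with ++-split hs comm′
  ... | inj₁ ([] , p , q) = sym q
  ... | inj₁ (v ∷ vs , p , q) = ⊥-elim (Primitive.minimal Q (v ∷ vs) hs q (λ ()) (Primitive.proper P) (Primitive.loop P))
  ... | inj₂ ([] , p , q) = q
  ... | inj₂ (v ∷ vs , p , q) = ⊥-elim (Primitive.minimal P (v ∷ vs) ks q (λ ()) (Primitive.proper Q) (Primitive.loop Q))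

  module _ (acc : M → Bool) (sub : SubExp (λ k → count k (λ a → acc (κ a)))) where

    -- Two loops that do not commute generate a free monoid, hence exponentially many trees.
    module _ (σ : M) (ks : Context) (can-ks : All Can ks) (acc-ks : acc (kplug ks σ) ≡ true)
             (b₀ : Fo) (can-b₀ : Can b₀) (κ-b₀ : κ b₀ ≡ σ)
             (U V : Context) (can-U : All Can U) (can-V : All Can V)
             (len : length U ≡ length V) (size≡ : csz U ≡ csz V) (U≢V : U ≢ V)
             (loop-U : kplug U σ ≡ σ) (loop-V : kplug V σ ≡ σ) where
      private
        word : ∀ {k} → Vec Bool k → Context
        word []          = []
        word (true  ∷ w) = U ++ word w
        word (false ∷ w) = V ++ word w

        ++-cancel-length : ∀ (as bs : Context) {cs ds} → length as ≡ length bs → as ++ cs ≡ bs ++ ds → as ≡ bs × cs ≡ ds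
        ++-cancel-length []       []       l e = refl , e
        ++-cancel-length (a ∷ as) (b ∷ bs) l e with ∷-injective e
        ... | refl , e′ with ++-cancel-length as bs (suc-injective l) e′
        ...   | refl , q = refl , q

        word-injective : ∀ {k} (v w : Vec Bool k) → word v ≡ word w → v ≡ w
        word-injective []          []          e = refl
        word-injective (true  ∷ v) (true  ∷ w) e = cong (true ∷_) (word-injective v w (++-cancelˡ U _ _ e))
        word-injective (false ∷ v) (false ∷ w) e = cong (false ∷_) (word-injective v w (++-cancelˡ V _ _ e))
        word-injective (true  ∷ v) (false ∷ w) e = ⊥-elim (U≢V (proj₁ (++-cancel-length U V len e)))
        word-injective (false ∷ v) (true  ∷ w) e = ⊥-elim (U≢V (sym (proj₁ (++-cancel-length V U (sym len) e))))

        can-word : ∀ {k} (w : Vec Bool k) → All Can (word w)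
        can-word []          = []
        can-word (true  ∷ w) = Allₚ.++⁺ can-U (can-word w)
        can-word (false ∷ w) = Allₚ.++⁺ can-V (can-word w)

        loop-word : ∀ {k} (w : Vec Bool k) → kplug (word w) σ ≡ σ
        loop-word []          = refl
        loop-word (true  ∷ w) = trans (kplug-++ U (word w) σ) (trans (cong (kplug U) (loop-word w)) loop-U)
        loop-word (false ∷ w) = trans (kplug-++ V (word w) σ) (trans (cong (kplug V) (loop-word w)) loop-V)

        csz-word : ∀ {k} (w : Vec Bool k) → csz (word w) ≡ k * csz U
        csz-word []          = refl
        csz-word (true  ∷ w) = trans (csz-++ U (word w)) (cong (csz U +_) (csz-word w))
        csz-word (false ∷ w) = trans (csz-++ V (word w)) (cong₂ _+_ (sym size≡) (csz-word w))

        length-word : ∀ {k} (w : Vec Bool k) → length (word w) ≡ k * length U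
        length-word []          = refl
        length-word (true  ∷ w) = trans (length-++ U) (cong (length U +_) (length-word w))
        length-word (false ∷ w) = trans (length-++ V) (cong₂ _+_ (sym len) (length-word w))

        n₀ : ℕ
        n₀ = csz ks + sz b₀

        tree : ∀ {k} → Vec Bool k → Fo
        tree w = plug (ks ++ word w) b₀

        tree∈ : ∀ {k} (w : Vec Bool k) → tree w ∈ E (n₀ + k * csz U)
        tree∈ {k} w = ∈-E⁺′ (Can-plug (Allₚ.++⁺ can-ks (can-word w)) can-b₀)
          (trans (sz-plug (ks ++ word w) b₀) (trans (cong (_+ sz b₀) (trans (csz-++ ks (word w)) (cong (csz ks +_) (csz-word w)))) (arr (csz ks) (k * csz U) (sz b₀))))
          where
          arr : ∀ x y z → x + y + z ≡ x + z + y
          arr = solve-∀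

        tree-acc : ∀ {k} (w : Vec Bool k) → acc (κ (tree w)) ≡ true
        tree-acc w = trans (cong acc (trans (κ-plug (ks ++ word w) b₀) (trans (kplug-++ ks (word w) (κ b₀)) (cong (kplug ks) (trans (cong (kplug (word w)) κ-b₀) (loop-word w)))))) acc-ks

        -- Different words may produce equal trees. All words with k blocks have the same context
        -- length r, and a decomposition of a given tree at depth r comes from one of its nodes; so
        -- at most suc n words share a tree.
        many-trees : ∀ k → 2 ^ k ≤ suc (n₀ + k * csz U) * count (n₀ + k * csz U) (λ a → acc (κ a))
        many-trees k = begin
          2 ^ k                                                            ≡⟨ sym (count-words k) ⟩
          ∑ (words k) (λ _ → 1)                                            ≡⟨ ∑-cong (words k) (λ {w} _ → sym (trans (∑-δ _≟F_ (λ a → χ (acc (κ a))) (E! n) (tree∈ w)) (cong χ (tree-acc w)))) ⟩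
          ∑ (words k) (λ w → ∑ (E n) (λ a → χ (tree w == a) * χ (acc (κ a)))) ≡⟨ ∑-swap (words k) (E n) _ ⟩
          ∑ (E n) (λ a → ∑ (words k) (λ w → χ (tree w == a) * χ (acc (κ a)))) ≡⟨ ∑-cong (E n) (λ {a} _ → ∑-*ʳ (words k) (χ (acc (κ a))) _) ⟩
          ∑ (E n) (λ a → ∑ (words k) (λ w → χ (tree w == a)) * χ (acc (κ a))) ≤⟨ ∑-mono (E n) (λ {a} a∈ → *-monoˡ-≤ (χ (acc (κ a))) (fibre a∈)) ⟩
          ∑ (E n) (λ a → suc n * χ (acc (κ a)))                            ≡⟨ ∑-*ˡ (E n) (suc n) _ ⟩
          suc n * count n (λ a → acc (κ a))                                ∎
          where
          open ≤-Reasoning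
          n : ℕ
          n = n₀ + k * csz U
          r : ℕ
          r = length ks + k * length U
          fibre : ∀ {a} → a ∈ E n → ∑ (words k) (λ w → χ (tree w == a)) ≤ suc n
          fibre {a} a∈ = begin
            ∑ (words k) (λ w → χ (tree w == a))  ≤⟨ ∑-inj {g = λ _ → 1} (paths r a) (λ w → ks ++ word w) (Finite.unique (finVec k)) into
                                                      (λ {v} {w} _ _ _ _ e → word-injective v w (++-cancelˡ ks _ _ e)) ⟩
            ∑ (paths r a) (λ _ → 1)              ≡⟨ trans (∑-const (paths r a) 1) (*-identityʳ _) ⟩
            length (paths r a)                   ≤⟨ length-paths r a ⟩
            suc (sz a)                           ≡⟨ cong suc (proj₂ (∈-E⁻ a∈)) ⟩
            suc n                                ∎
            where
            into : ∀ {w} → w ∈ words k → 0 < χ (tree w == a) → (ks ++ word w) ∈ paths r a × χ (tree w == a) ≤ 1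
            into {w} _ pos = subst₂ (λ x y → (ks ++ word w) ∈ paths x y) (trans (length-++ ks) (cong (length ks +_) (length-word w)))
                (χ>0⇒ (tree w ≟F a) pos) (∈-paths (ks ++ word w) b₀) , χ≤1 (tree w == a)

        csz>0 : ∀ X Y → length X ≡ length Y → X ≢ Y → 1 ≤ csz X
        csz>0 []      []      _ n = ⊥-elim (n refl)
        csz>0 (_ ∷ _) (_ ∷ _) _ _ = s≤s z≤n

      noncommuting-absurd : ⊥
      noncommuting-absurd = subexp-contradiction {λ k → count k (λ a → acc (κ a))} n₀ (csz U) (csz>0 U V len U≢V) sub many-trees

    Useful : M → Set
    Useful σ = ∃ λ a → acc (κ a) ≡ true × ((κ a ≡ᴹ σ) ∨ occ σ a) ≡ true

    private
      _≟C_ : DecidableEquality Context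
      _≟C_ = Listₚ.≡-dec _≟F_

      useful-context : ∀ {σ} → Useful σ → ∃ λ ks → ∃ λ b → All Can ks × Can b × κ b ≡ σ × acc (kplug ks σ) ≡ true
      useful-context {σ} (a , p , o) with ∨-elim {κ a ≡ᴹ σ} o
      ... | inj₁ e = [] , norm a , [] , Can-norm a , trans (cong (rt ([] , [])) (ty-~ (norm-~ a))) (does⇒ (κ a ≈? σ) e) ,
            subst (λ z → acc z ≡ true) (does⇒ (κ a ≈? σ) e) p
      ... | inj₂ e with proper-occurrence σ (Can-norm a) (trans (occ-~ σ (norm-~ a)) e)
      ...   | O , _ = ctx , sub′ , can-ctx , can-sub , typed ,
                trans (cong acc (trans (cong (kplug ctx) (sym typed)) (trans (sym (κ-plug ctx sub′)) (trans (cong κ (sym whole)) (cong (rt ([] , [])) (ty-~ (norm-~ a))))))) p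
        where open Occurrence O renaming (sub to sub′)

    -- The blocks XY and YX have equal length, which makes products of them uniquely readable, and
    -- equal size, which makes the size of a product depend only on the number of blocks. The useful
    -- context turns these products into accepted trees.
    loops-commute : ∀ {σ} → Useful σ → ∀ {X Y} → All Can X → All Can Y → kplug X σ ≡ σ → kplug Y σ ≡ σ → X ++ Y ≡ Y ++ X
    loops-commute {σ} u {X} {Y} cX cY lX lY with (X ++ Y) ≟C (Y ++ X)
    ... | yes e = e
    ... | no ¬e with useful-context u
    ...   | ks , b , cks , cb , κb , ac = ⊥-elim (noncommuting-absurd σ ks cks ac b cb κb (X ++ Y) (Y ++ X)
              (Allₚ.++⁺ cX cY) (Allₚ.++⁺ cY cX)
              (trans (length-++ X) (trans (+-comm (length X) (length Y)) (sym (length-++ Y))))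
              (trans (csz-++ X Y) (trans (+-comm (csz X) (csz Y)) (sym (csz-++ Y X)))) ¬e
              (trans (kplug-++ X Y σ) (trans (cong (kplug X) lY) lX))
              (trans (kplug-++ Y X σ) (trans (cong (kplug Y) lX) lY)))

-- Induction on the set of allowed types

negligible-χ : ∀ {e c} b → Negligible e c → Negligible e (λ n → χ b * c n)
negligible-χ true  q = negligible-eventually 0 (λ n _ → sym (+-identityʳ _)) q
negligible-χ false q = negligible-0 (λ _ → refl)

-- Each recurring type brings its own period. Properties that hold for all multiples of some number
-- can be combined over finitely many types, since a product serves them all.
Multiples : (ℕ → Set) → Set
Multiples P = Σ ℕ λ e₀ → 1 ≤ e₀ × (∀ e → 1 ≤ e → e₀ ∣ e → P e)

multiples-all : ∀ {A : Set} (xs : List A) {P : A → ℕ → Set} → (∀ x → Multiples (P x)) →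
                Σ ℕ λ e₀ → 1 ≤ e₀ × (∀ e → 1 ≤ e → e₀ ∣ e → ∀ {x} → x ∈ xs → P x e)
multiples-all []       h = 1 , ≤-refl , λ _ _ _ ()
multiples-all (x ∷ xs) h with h x | multiples-all xs h
... | e₁ , p₁ , q₁ | e₂ , p₂ , q₂ = e₁ * e₂ , *-mono-≤ p₁ p₂ , λ where
  e e≥1 d (here refl) → q₁ e e≥1 (∣-trans (m∣m*n e₂) d)
  e e≥1 d (there x∈)  → q₂ e e≥1 (∣-trans (n∣m*n e₁) d) x∈

module Recursion (A : Alg (Label 0 0)) (acc : Alg.M A → Bool)
                 (sub : SubExp (λ k → count k (λ a → acc (Typed.κ A a)))) where
  open Typed A
  open Structure A

  private
    root : M → M
    root = rt ([] , [])

    _∖_ : (M → Bool) → M → M → Bool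
    (S ∖ σ) τ = S τ ∧ not (τ ≡ᴹ σ)

  typeCount : (M → Bool) → M → ℕ → ℕ
  typeCount S σ k = count k (λ a → allow S a ∧ (κ a ≡ᴹ σ))

  typeCount-forests : ∀ S σ k → ∑ elems (λ μ → χ (root μ ≡ᴹ σ) * forestCount (good S) μ k) ≡ typeCount S σ k
  typeCount-forests S σ k = begin
    ∑ elems (λ μ → χ (root μ ≡ᴹ σ) * ∑ (E k) (λ a → χ (allC (good S) a ∧ (ty a ≡ᴹ μ))))
      ≡⟨ ∑-cong elems (λ {μ} _ → sym (∑-*ˡ (E k) (χ (root μ ≡ᴹ σ)) _)) ⟩
    ∑ elems (λ μ → ∑ (E k) (λ a → χ (root μ ≡ᴹ σ) * χ (allC (good S) a ∧ (ty a ≡ᴹ μ))))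
      ≡⟨ ∑-swap elems (E k) _ ⟩
    ∑ (E k) (λ a → ∑ elems (λ μ → χ (root μ ≡ᴹ σ) * χ (allC (good S) a ∧ (ty a ≡ᴹ μ))))
      ≡⟨ ∑-cong (E k) (λ {a} _ → trans (∑-cong elems (λ {μ} _ → pt a μ)) (∑-δ _≈?_ (λ μ → χ (allow S a) * χ (root μ ≡ᴹ σ)) unique (complete (ty a)))) ⟩
    ∑ (E k) (λ a → χ (allow S a) * χ (κ a ≡ᴹ σ))
      ≡⟨ ∑-cong (E k) (λ {a} _ → sym (χ-∧ (allow S a) (κ a ≡ᴹ σ))) ⟩
    typeCount S σ k ∎
    where
    open ≡-Reasoning
    arr : ∀ x y z → x * (y * z) ≡ z * (y * x)
    arr = solve-∀
    pt : ∀ a μ → χ (root μ ≡ᴹ σ) * χ (allC (good S) a ∧ (ty a ≡ᴹ μ)) ≡ χ (ty a ≡ᴹ μ) * (χ (allow S a) * χ (root μ ≡ᴹ σ))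
    pt a μ = trans (cong (χ (root μ ≡ᴹ σ) *_) (trans (χ-∧ (allC (good S) a) (ty a ≡ᴹ μ)) (cong (λ z → χ z * χ (ty a ≡ᴹ μ)) (sym (allow-allC S a)))))
                   (arr (χ (root μ ≡ᴹ σ)) (χ (allow S a)) (χ (ty a ≡ᴹ μ)))

  typeCount-negligible : ∀ {e} S σ → (∀ μ → Negligible e (forestCount (good S) μ)) → Negligible e (typeCount S σ)
  typeCount-negligible S σ q = negligible-eventually {c = λ k → ∑ elems (λ μ → χ (root μ ≡ᴹ σ) * forestCount (good S) μ k)} {c′ = typeCount S σ} 0 (λ k _ → typeCount-forests S σ k)
    (negligible-∑ elems (λ μ k → χ (root μ ≡ᴹ σ) * forestCount (good S) μ k) (λ μ → negligible-χ (root μ ≡ᴹ σ) (q μ)))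

  treeCount-good : ∀ S σ → S σ ≡ true → ∀ k → typeCount S σ k ≡ treeCount (good S) σ k
  treeCount-good S σ Sσ k = ∑-cong (E k) (λ {a} _ → cong χ (pt a))
    where
    pt : ∀ a → allow S a ∧ (κ a ≡ᴹ σ) ≡ (S (κ a) ∧ allow S a) ∧ (κ a ≡ᴹ σ)
    pt a with κ a ≈? σ
    ... | yes e rewrite e | Sσ = refl
    ... | no _ with S (κ a) | allow S a
    ...   | true  | _     = refl
    ...   | false | true  = refl
    ...   | false | false = refl

  treeCount-bad : ∀ S σ → S σ ≡ false → ∀ k → treeCount (good S) σ k ≡ 0
  treeCount-bad S σ Sσ k = ∑-zero (E k) (λ {a} _ → cong χ (pt a))
    where
    pt : ∀ a → (S (κ a) ∧ allow S a) ∧ (κ a ≡ᴹ σ) ≡ false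
    pt a with κ a ≈? σ
    ... | yes e rewrite e | Sσ = refl
    ... | no _ with S (κ a) ∧ allow S a
    ...   | true  = refl
    ...   | false = refl

  allow-remove : ∀ S σ a → allow (S ∖ σ) a ≡ allow S a ∧ not (occ σ a)
  allow-remove S σ ε       = refl
  allow-remove S σ (a ▸ b) rewrite allow-remove S σ a | allow-remove S σ b =
    taut (S (κ a)) (κ a ≡ᴹ σ) (allow S a) (occ σ a) (allow S b) (occ σ b)
    where
    taut : ∀ s e l o m p → ((s ∧ not e) ∧ (l ∧ not o)) ∧ (m ∧ not p) ≡ ((s ∧ l) ∧ m) ∧ not ((e ∨ o) ∨ p)
    taut false e     l     o     m     p = refl
    taut true  true  true  o     true  p = refl
    taut true  true  true  o     false p = refl
    taut true  true  false o     m     p = refl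
    taut true  false false o     m     p = refl
    taut true  false true  true  true  p = refl
    taut true  false true  true  false p = refl
    taut true  false true  false m     p = refl

  recurring : (M → Bool) → M → ℕ → ℕ
  recurring S σ k = count k (λ a → (allow S a ∧ (κ a ≡ᴹ σ)) ∧ occ σ a)

  typeCount-split : ∀ S σ k → typeCount S σ k ≡ typeCount (S ∖ σ) σ k + recurring S σ k
  typeCount-split S σ k = trans (∑-cong (E k) (λ {a} _ → trans (taut (allow S a) (κ a ≡ᴹ σ) (occ σ a))
      (cong (λ z → χ (z ∧ (κ a ≡ᴹ σ)) + χ ((allow S a ∧ (κ a ≡ᴹ σ)) ∧ occ σ a)) (sym (allow-remove S σ a))))) (∑-+ (E k) _ _)
    where
    taut : ∀ l e o → χ (l ∧ e) ≡ χ ((l ∧ not o) ∧ e) + χ ((l ∧ e) ∧ o)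
    taut true  true  true  = refl
    taut true  true  false = refl
    taut true  false true  = refl
    taut true  false false = refl
    taut false _     _     = refl

  module _ (S : M → Bool) (σ : M) where
    private
      X : Set
      X = M × (Bool × Bool)

      op : X → X → X
      op (m , l , o) (m′ , l′ , o′) = root m ∙ m′ , (S (root m) ∧ l) ∧ l′ , ((root m ≡ᴹ σ) ∨ o) ∨ o′

      open Evaluation (fin× fin (fin× finBool finBool)) (e₀ , true , false) op

      ev-value : ∀ a → ev a ≡ (ty a , allow S a , occ σ a)
      ev-value ε       = refl
      ev-value (a ▸ b) = cong₂ op (ev-value a) (ev-value b)

    inspect? : ∀ {P : M → Bool → Bool → Set} → (∀ m l o → Dec (P m l o)) → Dec (∃ λ a → P (ty a) (allow S a) (occ σ a))
    inspect? {P} P? = map′ (λ (a , p) → a , subst Q (ev-value a) p) (λ (a , p) → a , subst Q (sym (ev-value a)) p)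
                        (realizable? {Q} (λ (m , l , o) → P? m l o))
      where
      Q : X → Set
      Q (m , l , o) = P m l o

    Loop : Set
    Loop = ∃ λ a → allow S a ≡ true × κ a ≡ σ × occ σ a ≡ true

    loop? : Dec Loop
    loop? = inspect? {λ m l o → l ≡ true × root m ≡ σ × o ≡ true}
      (λ m l o → (l Data.Bool.≟ true) ×-dec ((root m ≈? σ) ×-dec (o Data.Bool.≟ true)))

    recurring-none : ¬ Loop → ∀ k → recurring S σ k ≡ 0
    recurring-none ¬l k = ∑-zero (E k) (λ {a} _ → [ (λ p → ⊥-elim (¬l (a , ∧-elimˡ {allow S a} (∧-elimˡ p) ,
        does⇒ (κ a ≈? σ) (∧-elimʳ {allow S a} (∧-elimˡ p)) , ∧-elimʳ {allow S a ∧ (κ a ≡ᴹ σ)} p))) , cong χ ]′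
        (true-or-false ((allow S a ∧ (κ a ≡ᴹ σ)) ∧ occ σ a)))

    module _ (u : Useful acc sub σ) (L : Loop) where
      private
        a₁ : Fo
        a₁ = norm (proj₁ L)
        κ-a₁ : κ a₁ ≡ σ
        κ-a₁ = trans (cong root (ty-~ (norm-~ (proj₁ L)))) (proj₁ (proj₂ (proj₂ L)))
        O : Σ (Occurrence σ a₁) λ O → Primitive σ (Occurrence.ctx O)
        O = primitive-occurrence σ (Can-norm (proj₁ L)) κ-a₁ (trans (occ-~ σ (norm-~ (proj₁ L))) (proj₂ (proj₂ (proj₂ L))))
        module O = Occurrence (proj₁ O)
        module P = Primitive (proj₂ O)
        c : Context
        c = O.ctx
        allowed : CtxAllowed S σ c
        allowed = subst (λ τ → CtxAllowed S τ c) O.typed (proj₁ (allow-plug⁻ S c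
          (trans (cong (allow S) (sym O.whole)) (trans (allow-~ S (norm-~ (proj₁ L))) (proj₁ (proj₂ L))))))

      period : ℕ
      period = csz c

      period≥1 : 1 ≤ period
      period≥1 = nonempty c P.proper
        where
        nonempty : ∀ hs → hs ≢ [] → 1 ≤ csz hs
        nonempty []      n = ⊥-elim (n refl)
        nonempty (_ ∷ _) _ = s≤s z≤n

      private
        -- A primitive occurrence of σ in a yields a loop that commutes with the fixed loop c and
        -- hence equals it. So every tree in which σ recurs arises by plugging a tree of type σ into
        -- c.
        unplug : ∀ {k a} → a ∈ E k → 0 < χ ((allow S a ∧ (κ a ≡ᴹ σ)) ∧ occ σ a) →
                 ∃ λ b → Can b × plug c b ≡ a × κ b ≡ σ × allow S b ≡ true
        unplug {k} {a} a∈ pos with primitive-occurrence σ (proj₁ (∈-E⁻ a∈)) κ≡ (∧-elimʳ {allow S a ∧ (κ a ≡ᴹ σ)} p)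
          where
          p : (allow S a ∧ (κ a ≡ᴹ σ)) ∧ occ σ a ≡ true
          p = χ>0⇒true pos
          κ≡ : κ a ≡ σ
          κ≡ = does⇒ (κ a ≈? σ) (∧-elimʳ {allow S a} (∧-elimˡ p))
        ... | O′ , P′ = Q.sub , Q.can-sub , trans (cong (λ z → plug z Q.sub) same) (sym Q.whole) , Q.typed ,
              proj₂ (allow-plug⁻ S Q.ctx (trans (cong (allow S) (sym Q.whole)) (∧-elimˡ {allow S a} (∧-elimˡ (χ>0⇒true pos)))))
          where
          module Q = Occurrence O′
          same : c ≡ Q.ctx
          same = primitive-unique σ (loops-commute acc sub u O.can-ctx Q.can-ctx P.loop (Primitive.loop P′)) (proj₂ O) P′

        size-plug : ∀ {k a b} → a ∈ E k → plug c b ≡ a → k ≡ period + sz b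
        size-plug {b = b} a∈ e = trans (sym (proj₂ (∈-E⁻ a∈))) (trans (cong sz (sym e)) (sz-plug c b))

      recurring-small : ∀ k → k < period → recurring S σ k ≡ 0
      recurring-small k lt = ∑-zero (E k) (λ {a} a∈ → [ (λ p → ⊥-elim (case unplug a∈ (subst (λ z → 0 < χ z) (sym p) z<s) of
          λ (b , _ , e , _) → <⇒≱ lt (≤-trans (m≤m+n period (sz b)) (≤-reflexive (sym (size-plug a∈ e)))))) , cong χ ]′
          (true-or-false ((allow S a ∧ (κ a ≡ᴹ σ)) ∧ occ σ a)))

      recurring-step : ∀ k → period ≤ k → recurring S σ k ≡ typeCount S σ (k ∸ period)
      recurring-step k le = ≤-antisym
        (∑-onto _≟F_ {g = λ b → χ (allow S b ∧ (κ b ≡ᴹ σ))} (E (k ∸ period)) (plug c) (E! k) λ {a} a∈ pos →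
          case unplug a∈ pos of λ (b , cb , e , κb , al) →
            b , ∈-E⁺′ cb (sym (trans (cong (_∸ period) (size-plug a∈ e)) (m+n∸m≡n period (sz b)))) , e ,
            ≤-trans (χ≤1 ((allow S a ∧ (κ a ≡ᴹ σ)) ∧ occ σ a)) (≤-reflexive (sym (cong χ (∧-intro al (⇒does (κ b ≈? σ) κb))))))
        (∑-inj (E k) (plug c) (E! (k ∸ period)) (λ {b} b∈ pos → into b b∈ (χ>0⇒true pos)) (λ _ _ _ _ → plug-injective c))
        where
        into : ∀ b → b ∈ E (k ∸ period) → allow S b ∧ (κ b ≡ᴹ σ) ≡ true →
               plug c b ∈ E k × χ (allow S b ∧ (κ b ≡ᴹ σ)) ≤ χ ((allow S (plug c b) ∧ (κ (plug c b) ≡ᴹ σ)) ∧ occ σ (plug c b))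
        into b b∈ p = ∈-E⁺′ (Can-plug O.can-ctx (proj₁ (∈-E⁻ b∈))) (trans (sz-plug c b) (trans (cong (period +_) (proj₂ (∈-E⁻ b∈))) (m+[n∸m]≡n le))) ,
          ≤-trans (χ≤1 (allow S b ∧ (κ b ≡ᴹ σ))) (≤-reflexive (sym (cong χ (∧-intro (∧-intro
            (allow-plug⁺ S c (subst (λ τ → CtxAllowed S τ c) (sym κb) allowed) (∧-elimˡ p))
            (⇒does (κ (plug c b) ≈? σ) (trans (κ-plug c b) (trans (cong (kplug c) κb) P.loop)))) (plug-occ σ c P.proper κb)))))
          where
          κb : κ b ≡ σ
          κb = does⇒ (κ b ≈? σ) (∧-elimʳ {allow S b} p)

  abstract
    -- The unique primitive loop at σ is the only way in which σ can recur.
    recurrence : ∀ S σ → Useful acc sub σ → Loop S σ → Σ ℕ λ p → 1 ≤ p ×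
      (∀ k → p ≤ k → typeCount S σ k ≡ typeCount (S ∖ σ) σ k + typeCount S σ (k ∸ p)) ×
      (∀ k → k < p → typeCount S σ k ≡ typeCount (S ∖ σ) σ k)
    recurrence S σ u l = period S σ u l , period≥1 S σ u l ,
      (λ k le → trans (typeCount-split S σ k) (cong (typeCount (S ∖ σ) σ k +_) (recurring-step S σ u l k le))) ,
      (λ k lt → trans (typeCount-split S σ k) (trans (cong (typeCount (S ∖ σ) σ k +_) (recurring-small S σ u l k lt)) (+-identityʳ _)))

  -- If σ never recurs, removing it from the allowed set does not affect trees of type σ. If it
  -- does, the counts form a chain over the trees without inner σ, and the period p must divide the
  -- step.
  one-type : ∀ S σ → Useful acc sub σ → Multiples (λ e → ∀ μ → Negligible e (forestCount (good (S ∖ σ)) μ)) →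
             Multiples (λ e → Negligible e (typeCount S σ))
  one-type S σ u (e₁ , e₁≥1 , q) with loop? S σ
  ... | no ¬l = e₁ , e₁≥1 , λ e e≥1 d → negligible-eventually {c = typeCount (S ∖ σ) σ} {c′ = typeCount S σ} 0
          (λ k _ → sym (trans (typeCount-split S σ k) (trans (cong (typeCount (S ∖ σ) σ k +_) (recurring-none S σ ¬l k)) (+-identityʳ _))))
          (typeCount-negligible (S ∖ σ) σ (q e e≥1 d))
  ... | yes l with recurrence S σ u l
  ...   | p , p≥1 , step , base = e₁ * p , *-mono-≤ e₁≥1 p≥1 , λ e e≥1 d →
          negligible-chain {e} {p} {typeCount (S ∖ σ) σ} {typeCount S σ} e≥1 p≥1 (∣-trans (n∣m*n e₁) d) step base
            (typeCount-negligible (S ∖ σ) σ (q e e≥1 (∣-trans (m∣m*n p) d)))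

  -- The number n of allowed types decreases: trees of type σ are reduced by `one-type` to forests
  -- over the types other than σ, and `Multiset` leads back from the trees of all types in S to the
  -- forests over S.
  forests-negligible : ∀ n S → ∑ elems (λ τ → χ (S τ)) ≤ n → (∀ σ → S σ ≡ true → Useful acc sub σ) →
                       Multiples (λ e → ∀ μ → Negligible e (forestCount (good S) μ))
  forests-negligible n S le us with multiples-all elems (trees n S le us)
    where
    trees : ∀ n S → ∑ elems (λ τ → χ (S τ)) ≤ n → (∀ σ → S σ ≡ true → Useful acc sub σ) →
            ∀ σ → Multiples (λ e → Negligible e (treeCount (good S) σ))
    trees n S le us σ with S σ in eq
    ... | false = 1 , ≤-refl , λ _ _ _ → negligible-0 {c = treeCount (good S) σ} (treeCount-bad S σ eq)
    trees zero S le us σ | true = ⊥-elim (<-irrefl refl (≤-trans (≤-trans (≤-reflexive (sym (cong χ eq))) (∑-∈ (λ τ → χ (S τ)) (complete σ))) le))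
    trees (suc n) S le us σ | true with one-type S σ (us σ eq) (forests-negligible n (S ∖ σ) smaller (λ τ p → us τ (∧-elimˡ p)))
      where
      smaller : ∑ elems (λ τ → χ ((S ∖ σ) τ)) ≤ n
      smaller = ≤-pred (begin
        suc (∑ elems (λ τ → χ ((S ∖ σ) τ)))                                    ≡⟨ cong (_+ ∑ elems (λ τ → χ ((S ∖ σ) τ))) (sym (∑-δ _≈?_ (λ _ → 1) unique (complete σ))) ⟩
        ∑ elems (λ τ → χ (σ ≡ᴹ τ) * 1) + ∑ elems (λ τ → χ ((S ∖ σ) τ))         ≡⟨ sym (∑-+ elems _ _) ⟩
        ∑ elems (λ τ → χ (σ ≡ᴹ τ) * 1 + χ ((S ∖ σ) τ))                         ≤⟨ ∑-mono elems (λ {τ} _ → pt τ) ⟩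
        ∑ elems (λ τ → χ (S τ))                                                ≤⟨ le ⟩
        suc n                                                                  ∎)
        where
        open ≤-Reasoning
        pt : ∀ τ → χ (σ ≡ᴹ τ) * 1 + χ (S τ ∧ not (τ ≡ᴹ σ)) ≤ χ (S τ)
        pt τ with σ ≈? τ | τ ≈? σ
        ... | yes refl | yes _ rewrite eq = ≤-refl
        ... | yes refl | no ¬p = ⊥-elim (¬p refl)
        ... | no _     | yes _ with S τ
        ...   | true  = z≤n
        ...   | false = z≤n
        pt τ | no _ | no _ with S τ
        ...   | true  = ≤-refl
        ...   | false = z≤n
    ... | e₀ , e₀≥1 , q = e₀ , e₀≥1 , λ e e≥1 d → negligible-eventually {c = typeCount S σ} {c′ = treeCount (good S) σ} 0 (λ k _ → treeCount-good S σ eq k) (q e e≥1 d)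
  ... | e₀ , e₀≥1 , q = e₀ , e₀≥1 , λ e e≥1 d μ → Multiset.multiset-negligible (good S) e e≥1 (λ σ → q e e≥1 d (complete σ)) μ

  abstract
    useful? : ∀ σ → Dec (Useful acc sub σ)
    useful? σ = inspect? (λ _ → true) σ {λ m l o → acc (root m) ≡ true × ((root m ≡ᴹ σ) ∨ o) ≡ true}
      (λ m l o → (acc (root m) Data.Bool.≟ true) ×-dec (((root m ≡ᴹ σ) ∨ o) Data.Bool.≟ true))

  private
    U : M → Bool
    U σ = does (useful? σ)

    allow-intro : ∀ S b → (∀ τ → occ τ b ≡ true → S τ ≡ true) → allow S b ≡ true
    allow-intro S ε       h = refl
    allow-intro S (a ▸ b) h = ∧-intro (∧-intro (h (κ a) (∨-introˡ (∨-introˡ (⇒does (κ a ≈? κ a) refl))))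
        (allow-intro S a (λ τ o → h τ (∨-introˡ (∨-introʳ {κ a ≡ᴹ τ} o)))))
      (allow-intro S b (λ τ o → h τ (∨-introʳ {(κ a ≡ᴹ τ) ∨ occ τ a} o)))

    accepted-useful : ∀ a → acc (κ a) ≡ true → allow U a ≡ true
    accepted-useful a p = allow-intro U a (λ τ o → ⇒does (useful? τ) (a , p , ∨-introʳ {κ a ≡ᴹ τ} o))

    abstract
      forests : Multiples (λ e → ∀ μ → Negligible e (forestCount (good U) μ))
      forests = forests-negligible (∑ elems (λ τ → χ (U τ))) U ≤-refl (λ σ p → does⇒ (useful? σ) p)

  -- Every node below the root of an accepted tree has a useful type. So for an accepted type σ, the
  -- accepted trees of type σ are the trees of type σ allowed by `U`; for other σ there are none.
  accepted-trees-negligible : Multiples (λ e → ∀ σ → Negligible e (λ k → count k (λ a → acc (κ a) ∧ (κ a ≡ᴹ σ))))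
  accepted-trees-negligible = proj₁ forests , proj₁ (proj₂ forests) , λ e e≥1 d σ →
      negligible-eventually {c = λ k → χ (acc σ) * typeCount U σ k} {c′ = λ k → count k (λ a → acc (κ a) ∧ (κ a ≡ᴹ σ))} 0
        (λ k _ → same σ k) (negligible-χ (acc σ) (typeCount-negligible U σ (proj₂ (proj₂ forests) e e≥1 d)))
    where
    same : ∀ σ k → χ (acc σ) * typeCount U σ k ≡ count k (λ a → acc (κ a) ∧ (κ a ≡ᴹ σ))
    same σ k = trans (sym (∑-*ˡ (E k) (χ (acc σ)) _)) (∑-cong (E k) (λ {a} _ → trans (sym (χ-∧ (acc σ) _)) (cong χ (pt a))))
      where
      pt : ∀ a → acc σ ∧ (allow U a ∧ (κ a ≡ᴹ σ)) ≡ acc (κ a) ∧ (κ a ≡ᴹ σ)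
      pt a = bool-ext
        (λ p → ∧-intro (subst (λ z → acc z ≡ true) (sym (does⇒ (κ a ≈? σ) (∧-elimʳ {allow U a} (∧-elimʳ {acc σ} p)))) (∧-elimˡ p)) (∧-elimʳ {allow U a} (∧-elimʳ {acc σ} p)))
        (λ p → ∧-intro (subst (λ z → acc z ≡ true) (does⇒ (κ a ≈? σ) (∧-elimʳ {acc (κ a)} p)) (∧-elimˡ p)) (∧-intro (accepted-useful a (∧-elimˡ p)) (∧-elimʳ {acc (κ a)} p)))

-- Forests with few copies of a given tree

-- Every m sizes cost a factor 1 + 1/s, and as m ≥ 1 this is at most 1 + 1/s per size. The finitely
-- many sizes below N + m are absorbed by B.
ratio⇒subexp : ∀ {c m} → 1 ≤ m → (∀ s → 1 ≤ s → ∃[ N ] ∀ n → N ≤ n → m ≤ n → s * c n ≤ suc s * c (n ∸ m)) → SubExp c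
ratio⇒subexp {c} {m} m≥1 ratio s s≥1 with ratio s s≥1
... | N , step = B , λ n → go n n ≤-refl
  where
  open ≤-Reasoning
  B : ℕ
  B = ∑ (upTo (N + m)) (λ k → c k * s ^ k)
  go : ∀ fuel n → n ≤ fuel → c n * s ^ n ≤ B * suc s ^ n
  go fuel n le with n <? N + m
  ... | yes lt = ≤-trans (∑-∈ (λ k → c k * s ^ k) (∈-upTo⁺ lt)) (≤-trans (≤-reflexive (sym (*-identityʳ B))) (*-monoʳ-≤ B (m^n>0 (suc s) n)))
  go zero n le | no ge = ⊥-elim (ge (≤-trans (s≤s le) (≤-trans m≥1 (m≤n+m m N))))
  go (suc fuel) n le | no ge = begin
    c n * s ^ n                                          ≡⟨ cong (λ z → c n * s ^ z) n≡ ⟩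
    c n * (s * s ^ (n′ + (m ∸ 1)))                       ≡⟨ arr (c n) s _ ⟩
    s * c n * s ^ (n′ + (m ∸ 1))                         ≤⟨ *-mono-≤ (step n (≤-trans (m≤m+n N m) (≮⇒≥ ge)) m≤n) (≤-trans (≤-reflexive (^-distribˡ-+-* s n′ (m ∸ 1))) (*-monoʳ-≤ (s ^ n′) (^-monoˡ-≤ (m ∸ 1) (n≤1+n s)))) ⟩
    suc s * c n′ * (s ^ n′ * suc s ^ (m ∸ 1))            ≡⟨ arr₂ (suc s) (c n′) (s ^ n′) (suc s ^ (m ∸ 1)) ⟩
    suc s * suc s ^ (m ∸ 1) * (c n′ * s ^ n′)            ≤⟨ *-monoʳ-≤ (suc s * suc s ^ (m ∸ 1)) (go fuel n′ (≤-pred (≤-trans (∸-monoʳ-< {n} {m} {0} m≥1 m≤n) le))) ⟩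
    suc s * suc s ^ (m ∸ 1) * (B * suc s ^ n′)           ≡⟨ arr₃ (suc s) (suc s ^ (m ∸ 1)) B (suc s ^ n′) ⟩
    B * (suc s * (suc s ^ n′ * suc s ^ (m ∸ 1)))         ≡⟨ cong (λ z → B * (suc s * z)) (sym (^-distribˡ-+-* (suc s) n′ (m ∸ 1))) ⟩
    B * suc s ^ suc (n′ + (m ∸ 1))                       ≡⟨ cong (λ z → B * suc s ^ z) (sym n≡) ⟩
    B * suc s ^ n                                        ∎
    where
    m≤n : m ≤ n
    m≤n = ≤-trans (m≤n+m m N) (≮⇒≥ ge)
    n′ : ℕ
    n′ = n ∸ m
    n≡ : n ≡ suc (n′ + (m ∸ 1))
    n≡ = trans (sym (m∸n+n≡m m≤n)) (trans (cong (n′ +_) (sym (m+[n∸m]≡n m≥1))) (+-suc n′ (m ∸ 1)))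
    arr : ∀ a b c → a * (b * c) ≡ b * a * c
    arr = solve-∀
    arr₂ : ∀ a b c d → a * b * (c * d) ≡ a * d * (b * c)
    arr₂ = solve-∀
    arr₃ : ∀ a b c d → a * b * (c * d) ≡ c * (a * (d * b))
    arr₃ = solve-∀

module Components (T : Fo → Bool) (a₀ : Fo) (can-a₀ : Can a₀) (T-a₀ : T a₀ ≡ true) where

  m : ℕ
  m = suc (sz a₀)

  all : ℕ → ℕ
  all n = count n (allC T)

  others : Fo → Bool
  others a = T a ∧ not (a₀ == a)

  without : ℕ → ℕ
  without n = count n (allC others)

  few : ℕ → ℕ → ℕ
  few C n = count n (λ G → allC T G ∧ does (suc (mult a₀ G) ≤? C))

  private
    others-T : ∀ G → allC others G ≡ true → allC T G ≡ true
    others-T ε       p = refl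
    others-T (a ▸ b) p = ∧-intro (∧-elimˡ {T a} (∧-elimˡ p)) (others-T b (∧-elimʳ {others a} p))

    others-mult : ∀ G → allC others G ≡ true → mult a₀ G ≡ 0
    others-mult ε       p = refl
    others-mult (a ▸ b) p with a₀ == a
    ... | false = others-mult b (∧-elimʳ {T a ∧ true} p)
    ... | true  = ⊥-elim (true≢false (∧-elimʳ {T a} (∧-elimˡ p)) refl)

    mult-others : ∀ G → allC T G ≡ true → mult a₀ G ≡ 0 → allC others G ≡ true
    mult-others ε       p q = refl
    mult-others (a ▸ b) p q = ∧-intro (∧-intro (∧-elimˡ p) (cong not (dec-false (a₀ ≟F a) ne))) (mult-others b (∧-elimʳ {T a} p) (m+n≡0⇒n≡0 (χ (a₀ == a)) q))
      where
      ne : a₀ ≢ a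
      ne refl with trans (sym (cong χ (==-refl a₀))) (m+n≡0⇒m≡0 (χ (a₀ == a₀)) q)
      ... | ()

    T-insn : ∀ i G → allC T G ≡ true → allC T (insn i a₀ G) ≡ true
    T-insn zero    G p = p
    T-insn (suc i) G p = trans (allC-ins T a₀ (insn i a₀ G)) (∧-intro T-a₀ (T-insn i G p))

    T-deln : ∀ i G → allC T (insn i a₀ G) ≡ true → allC T G ≡ true
    T-deln zero    G p = p
    T-deln (suc i) G p = T-deln i G (∧-elimʳ {T a₀} (trans (sym (allC-ins T a₀ (insn i a₀ G))) p))

  all-mono : ∀ j n → j * m ≤ n → all (n ∸ j * m) ≤ all n
  all-mono j n le = ∑-inj (E n) (insn j a₀) (E! (n ∸ j * m))
    (λ {H} H∈ pos → ∈-E⁺′ (Can-insn j can-a₀ (proj₁ (∈-E⁻ H∈))) (trans (size-insn j a₀ H) (trans (cong (j * m +_) (proj₂ (∈-E⁻ H∈))) (m+[n∸m]≡n le))) ,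
      ≤-trans (χ≤1 (allC T H)) (≤-reflexive (sym (cong χ (T-insn j H (χ>0⇒true pos))))))
    (λ _ _ _ _ → insn-injective j a₀)

  all-split : ∀ n → m ≤ n → all n ≤ all (n ∸ m) + without n
  all-split n le = begin
    all n                                                                                  ≤⟨ ∑-mono (E n) (λ {G} _ → pt G) ⟩
    ∑ (E n) (λ G → χ (allC T G) * χ (does (1 ≤? mult a₀ G)) + χ (allC others G))           ≡⟨ ∑-+ (E n) _ _ ⟩
    ∑ (E n) (λ G → χ (allC T G) * χ (does (1 ≤? mult a₀ G))) + without n                   ≡⟨ cong (_+ without n) (count-removed (allC T) n a₀ 1 can-a₀) ⟩
    χ (does (1 * m ≤? n)) * count (n ∸ 1 * m) (λ H → allC T (ins a₀ H)) + without n        ≤⟨ +-monoˡ-≤ (without n) (≤-trans (*-monoˡ-≤ _ (χ≤1 (does (1 * m ≤? n)))) (≤-reflexive (+-identityʳ _))) ⟩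
    count (n ∸ 1 * m) (λ H → allC T (ins a₀ H)) + without n                                ≡⟨ cong₂ _+_ (trans (∑-cong (E (n ∸ 1 * m)) (λ {H} _ → cong χ (trans (allC-ins T a₀ H) (cong (_∧ allC T H) T-a₀)))) (cong (λ z → all (n ∸ z)) (+-identityʳ m))) refl ⟩
    all (n ∸ m) + without n                                                                ∎
    where
    open ≤-Reasoning
    pt : ∀ G → χ (allC T G) ≤ χ (allC T G) * χ (does (1 ≤? mult a₀ G)) + χ (allC others G)
    pt G with 1 ≤? mult a₀ G
    ... | yes p = ≤-trans (≤-reflexive (sym (trans (cong (χ (allC T G) *_) (χ-yes (1 ≤? mult a₀ G) p)) (*-identityʳ _)))) (m≤m+n _ _)
    ... | no ¬p = ≤-trans lem (m≤n+m _ _)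
      where
      lem : χ (allC T G) ≤ χ (allC others G)
      lem with true-or-false (allC T G)
      ... | inj₁ t = ≤-trans (χ≤1 (allC T G)) (≤-reflexive (sym (cong χ (mult-others G t (n≤0⇒n≡0 (≤-pred (≰⇒> ¬p)))))))
      ... | inj₂ f = ≤-trans (≤-reflexive (cong χ f)) z≤n

  -- Adding l * q copies of `a₀` to a forest without it gives a forest with exactly l * q copies and
  -- compensates the shift by l * q * m. Different l give disjoint families, so the whole tail fits
  -- inside `all n`.
  tail-bound : ∀ q n → 1 ≤ q → tail (q * m) without n ≤ all n
  tail-bound q n q≥1 = begin
    ∑ (shifts e n) (λ l → without (n ∸ l * e))                                                    ≤⟨ ∑-mono (shifts e n) (λ {l} l∈ → layer l (shift-half {e} {n} {l} (∈-shifts⁻ l∈))) ⟩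
    ∑ (shifts e n) (λ l → ∑ (E n) (λ G → χ (allC T G) * χ (does (l * q ≟ mult a₀ G))))            ≡⟨ ∑-swap (shifts e n) (E n) _ ⟩
    ∑ (E n) (λ G → ∑ (shifts e n) (λ l → χ (allC T G) * χ (does (l * q ≟ mult a₀ G))))            ≡⟨ ∑-cong (E n) (λ {G} _ → ∑-*ˡ (shifts e n) (χ (allC T G)) _) ⟩
    ∑ (E n) (λ G → χ (allC T G) * ∑ (shifts e n) (λ l → χ (does (l * q ≟ mult a₀ G))))            ≤⟨ ∑-mono (E n) (λ {G} _ → *-monoʳ-≤ (χ (allC T G)) (once (mult a₀ G))) ⟩
    ∑ (E n) (λ G → χ (allC T G) * 1)                                                              ≡⟨ ∑-cong (E n) (λ _ → *-identityʳ _) ⟩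
    all n                                                                                         ∎
    where
    open ≤-Reasoning
    e : ℕ
    e = q * m
    once : ∀ j → ∑ (shifts e n) (λ l → χ (does (l * q ≟ j))) ≤ 1
    once j = ∑-inj {g = λ _ → 1} (j ∷ []) (_* q) (shifts! e n) (λ {l} _ pos → here (χ>0⇒ (l * q ≟ j) pos) , χ≤1 (does (l * q ≟ j)))
               (λ {l} {l′} _ _ _ _ eq → *-cancelʳ-≡ l l′ q {{>-nonZero q≥1}} eq)
    layer : ∀ l → l * e ≤ n → without (n ∸ l * e) ≤ ∑ (E n) (λ G → χ (allC T G) * χ (does (l * q ≟ mult a₀ G)))
    layer l le = ∑-inj (E n) (insn (l * q) a₀) (E! (n ∸ l * e)) into (λ _ _ _ _ → insn-injective (l * q) a₀)
      where
      into : ∀ {H} → H ∈ E (n ∸ l * e) → 0 < χ (allC others H) →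
             insn (l * q) a₀ H ∈ E n × χ (allC others H) ≤ χ (allC T (insn (l * q) a₀ H)) * χ (does (l * q ≟ mult a₀ (insn (l * q) a₀ H)))
      into {H} H∈ pos = ∈-E⁺′ (Can-insn (l * q) can-a₀ (proj₁ (∈-E⁻ H∈)))
          (trans (size-insn (l * q) a₀ H) (trans (cong₂ _+_ (*-assoc l q m) (proj₂ (∈-E⁻ H∈))) (m+[n∸m]≡n le))) ,
          ≤-trans (χ≤1 (allC others H)) (≤-reflexive (sym (cong₂ (λ x y → χ x * y) (T-insn (l * q) H (others-T H o))
            (χ-yes (l * q ≟ mult a₀ (insn (l * q) a₀ H)) (sym (trans (mult-insn-same (l * q) a₀ H) (trans (cong (l * q +_) (others-mult H o)) (+-identityʳ _))))))))
        where
        o : allC others H ≡ true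
        o = χ>0⇒true pos

  few-split : ∀ C n → few C n ≤ ∑ (upTo C) (λ j → χ (does (j * m ≤? n)) * without (n ∸ j * m))
  few-split C n = begin
    few C n                                                                                ≤⟨ ∑-mono (E n) (λ {G} _ → pt G) ⟩
    ∑ (E n) (λ G → ∑ (upTo C) (λ j → χ (allC T G) * χ (does (mult a₀ G ≟ j))))             ≡⟨ ∑-swap (E n) (upTo C) _ ⟩
    ∑ (upTo C) (λ j → ∑ (E n) (λ G → χ (allC T G) * χ (does (mult a₀ G ≟ j))))             ≤⟨ ∑-mono (upTo C) (λ {j} _ → layer j) ⟩
    ∑ (upTo C) (λ j → χ (does (j * m ≤? n)) * without (n ∸ j * m))                         ∎
    where
    open ≤-Reasoning
    pt : ∀ G → χ (allC T G ∧ does (suc (mult a₀ G) ≤? C)) ≤ ∑ (upTo C) (λ j → χ (allC T G) * χ (does (mult a₀ G ≟ j)))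
    pt G with suc (mult a₀ G) ≤? C
    ... | yes p = ≤-trans (≤-reflexive (χ-∧ (allC T G) _)) (≤-trans (*-monoʳ-≤ (χ (allC T G)) (≤-trans (χ≤1 (does (suc (mult a₀ G) ≤? C))) (≤-reflexive (sym (χ-yes (mult a₀ G ≟ mult a₀ G) refl)))))
                    (∑-∈ (λ j → χ (allC T G) * χ (does (mult a₀ G ≟ j))) (∈-upTo⁺ p)))
    ... | no ¬p = ≤-trans (≤-reflexive (trans (χ-∧ (allC T G) _) (trans (cong (χ (allC T G) *_) (χ-no (suc (mult a₀ G) ≤? C) ¬p)) (*-zeroʳ (χ (allC T G)))))) z≤n
    layer : ∀ j → ∑ (E n) (λ G → χ (allC T G) * χ (does (mult a₀ G ≟ j))) ≤ χ (does (j * m ≤? n)) * without (n ∸ j * m)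
    layer j with j * m ≤? n
    ... | no ¬p = ≤-trans (≤-reflexive (∑-zero (E n) zer)) z≤n
      where
      zer : ∀ {G} → G ∈ E n → χ (allC T G) * χ (does (mult a₀ G ≟ j)) ≡ 0
      zer {G} G∈ = trans (cong (χ (allC T G) *_) (χ-no (mult a₀ G ≟ j) λ eq → ¬p (≤-trans (m≤m+n _ _)
        (≤-reflexive (trans (sym (Removed.size≡ (removed j {a₀} {G} (proj₁ (∈-E⁻ G∈)) (≤-reflexive (sym eq))))) (proj₂ (∈-E⁻ G∈))))))) (*-zeroʳ (χ (allC T G)))
    ... | yes p = ≤-trans (∑-inj (E (n ∸ j * m)) (deln j a₀) (E! n) into inj)
                    (≤-trans (≤-reflexive (sym (+-identityʳ _))) (≤-reflexive (cong (_* without (n ∸ j * m)) (sym (χ-yes (j * m ≤? n) p)))))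
      where
      eq′ : ∀ {G} → 0 < χ (allC T G) * χ (does (mult a₀ G ≟ j)) → mult a₀ G ≡ j
      eq′ {G} pos = χ>0⇒ (mult a₀ G ≟ j) (*>0⇒ʳ (χ (allC T G)) _ pos)
      get : ∀ {G} → G ∈ E n → 0 < χ (allC T G) * χ (does (mult a₀ G ≟ j)) → Removed j a₀ G
      get {G} G∈ pos = removed j (proj₁ (∈-E⁻ G∈)) (≤-reflexive (sym (eq′ {G} pos)))
      into : ∀ {G} → G ∈ E n → 0 < χ (allC T G) * χ (does (mult a₀ G ≟ j)) →
             deln j a₀ G ∈ E (n ∸ j * m) × χ (allC T G) * χ (does (mult a₀ G ≟ j)) ≤ χ (allC others (deln j a₀ G))
      into {G} G∈ pos = ∈-E⁺′ R.canon (sym (trans (cong (_∸ j * m) (trans (sym (proj₂ (∈-E⁻ G∈))) R.size≡)) (m+n∸m≡n (j * m) _))) ,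
          ≤-trans (*-mono-≤ (χ≤1 (allC T G)) (χ≤1 (does (mult a₀ G ≟ j)))) (≤-reflexive (sym (cong χ (mult-others (deln j a₀ G)
            (T-deln j _ (subst (λ z → allC T z ≡ true) R.whole (χ>0⇒true (*>0⇒ˡ (χ (allC T G)) _ pos))))
            (+-cancelˡ-≡ j _ _ (trans (sym R.left) (trans (eq′ {G} pos) (sym (+-identityʳ j)))))))))
        where module R = Removed (get G∈ pos)
      inj : ∀ {G G′} → G ∈ E n → G′ ∈ E n → 0 < χ (allC T G) * χ (does (mult a₀ G ≟ j)) → 0 < χ (allC T G′) * χ (does (mult a₀ G′ ≟ j)) →
            deln j a₀ G ≡ deln j a₀ G′ → G ≡ G′
      inj p q x y eq = trans (Removed.whole (get p x)) (trans (cong (insn j a₀) eq) (sym (Removed.whole (get q y))))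

  module _ (rare : ∀ L → ∃[ N ] ∀ n → N ≤ n → L * without n ≤ all n) where

    -- The layers with exactly j copies, j < C, are copies of `without` at n ∸ j * m; the factor suc
    -- C pays for their number, and `all-mono` returns to size n.
    few-rare : ∀ C L → ∃[ N ] ∀ n → N ≤ n → L * few C n ≤ all n
    few-rare C L with rare (L * suc C)
    ... | N , b = N + C * m , λ n le → *-cancelˡ-≤ (suc C) (begin
      suc C * (L * few C n)                                                             ≤⟨ *-monoʳ-≤ (suc C) (*-monoʳ-≤ L (few-split C n)) ⟩
      suc C * (L * ∑ (upTo C) (λ j → χ (does (j * m ≤? n)) * without (n ∸ j * m)))      ≡⟨ arr (suc C) L _ ⟩
      L * suc C * ∑ (upTo C) (λ j → χ (does (j * m ≤? n)) * without (n ∸ j * m))        ≡⟨ sym (∑-*ˡ (upTo C) (L * suc C) _) ⟩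
      ∑ (upTo C) (λ j → L * suc C * (χ (does (j * m ≤? n)) * without (n ∸ j * m)))      ≤⟨ ∑-≤ {xs = upTo C} _ (all n) (λ {j} j∈ → term n le j (∈-upTo⁻ j∈)) ⟩
      length (upTo C) * all n                                                           ≡⟨ cong (_* all n) (length-upTo C) ⟩
      C * all n                                                                         ≤⟨ m≤n+m (C * all n) (all n) ⟩
      suc C * all n                                                                     ∎)
      where
      open ≤-Reasoning
      arr : ∀ x y z → x * (y * z) ≡ y * x * z
      arr = solve-∀
      term : ∀ n → N + C * m ≤ n → ∀ j → j < C → L * suc C * (χ (does (j * m ≤? n)) * without (n ∸ j * m)) ≤ all n
      term n le j j<C = begin
        L * suc C * (χ (does (j * m ≤? n)) * without (n ∸ j * m))  ≤⟨ *-monoʳ-≤ (L * suc C) (≤-trans (*-monoˡ-≤ (without (n ∸ j * m)) (χ≤1 (does (j * m ≤? n)))) (≤-reflexive (+-identityʳ _))) ⟩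
        L * suc C * without (n ∸ j * m)                            ≤⟨ b (n ∸ j * m) (m+n≤o⇒m≤o∸n N (≤-trans (+-monoʳ-≤ N jm≤) le)) ⟩
        all (n ∸ j * m)                                            ≤⟨ all-mono j n (≤-trans jm≤ (≤-trans (m≤n+m (C * m) N) le)) ⟩
        all n                                                      ∎
        where
        jm≤ : j * m ≤ C * m
        jm≤ = *-monoˡ-≤ m (<⇒≤ j<C)

    all-subexp : SubExp all
    all-subexp = ratio⇒subexp {all} {m} (s≤s z≤n) λ s _ → case rare (suc s) of λ (N , b) → N , λ n le m≤n →
      +-cancelˡ-≤ (all n) _ _ (begin
        all n + s * all n                         ≤⟨ *-monoʳ-≤ (suc s) (all-split n m≤n) ⟩
        suc s * (all (n ∸ m) + without n)         ≡⟨ *-distribˡ-+ (suc s) (all (n ∸ m)) (without n) ⟩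
        suc s * all (n ∸ m) + suc s * without n   ≤⟨ +-monoʳ-≤ (suc s * all (n ∸ m)) (b n le) ⟩
        suc s * all (n ∸ m) + all n               ≡⟨ +-comm (suc s * all (n ∸ m)) (all n) ⟩
        all n + suc s * all (n ∸ m)               ∎)
      where open ≤-Reasoning

module Rarity (A : Alg (Label 0 0)) (acc : Alg.M A → Bool)
              (sub : SubExp (λ k → count k (λ a → acc (Typed.κ A a))))
              (a₀ : Fo) (can-a₀ : Can a₀) (acc-a₀ : acc (Typed.κ A a₀) ≡ true) where
  open Typed A
  open Components (acc ∘ κ) a₀ can-a₀ acc-a₀

  private
    abstract
      trees : Multiples (λ e → ∀ σ → Negligible e (λ k → count k (λ a → acc (κ a) ∧ (κ a ≡ᴹ σ))))
      trees = Recursion.accepted-trees-negligible A acc sub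

    q : ℕ
    q = proj₁ trees

    -- The step q * m is a multiple of q, as the negligibility of the accepted trees demands, and of
    -- m, so that every shift can be compensated by copies of `a₀`.
    e≥1 : 1 ≤ q * m
    e≥1 = *-mono-≤ (proj₁ (proj₂ trees)) (s≤s z≤n)

    -- Leaving out the single tree `a₀` changes the counts only at size `sz a₀`, and a finite change
    -- does not affect negligibility.
    trees-others : ∀ σ → Negligible (q * m) (treeCount others σ)
    trees-others σ = negligible-eventually {c = λ k → count k (λ a → acc (κ a) ∧ (κ a ≡ᴹ σ))} {c′ = treeCount others σ} m
        (λ k le → ∑-cong (E k) (λ {a} a∈ → cong (λ z → χ (z ∧ (κ a ≡ᴹ σ))) (pt a k le (∈-E⁻ a∈))))
        (proj₂ (proj₂ trees) (q * m) e≥1 (m∣m*n m) σ)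
      where
      pt : ∀ a k → m ≤ k → Can a × sz a ≡ k → acc (κ a) ≡ others a
      pt a k le (_ , s) = sym (trans (cong (λ z → acc (κ a) ∧ not z) (dec-false (a₀ ≟F a) (λ eq → <-irrefl (trans (cong sz eq) s) le))) (∧-identityʳ (acc (κ a))))

    without-negligible : Negligible (q * m) without
    without-negligible = negligible-eventually {c = λ n → ∑ elems (λ μ → forestCount others μ n)} {c′ = without} 0 (λ n _ → sum-types n)
        (negligible-∑ elems (forestCount others) (λ μ → Multiset.multiset-negligible others (q * m) e≥1 trees-others μ))
      where
      sum-types : ∀ n → ∑ elems (λ μ → forestCount others μ n) ≡ without n
      sum-types n = trans (∑-swap elems (E n) _) (∑-cong (E n) (λ {G} _ → trans (∑-cong elems (λ {μ} _ → trans (χ-∧ (allC others G) (ty G ≡ᴹ μ)) (*-comm (χ (allC others G)) _)))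
        (∑-δ _≈?_ (λ _ → χ (allC others G)) unique (complete (ty G)))))

  rare : ∀ L → ∃[ N ] ∀ n → N ≤ n → L * without n ≤ all n
  rare L = proj₁ (without-negligible L) , λ n le → ≤-trans (proj₂ (without-negligible L) n le) (tail-bound q n (proj₁ (proj₂ trees)))

-- Radius of convergence

module ℚS = Data.Rational.Solver.+-*-Solver

private
  unnorm : ∀ m d → ℚ.toℚᵘ (⁺ m ℚ./ suc d) ℚᵘ.≃ ℚᵘ.mkℚᵘ (⁺ m) d
  unnorm m d = ℚₚ.toℚᵘ-fromℚᵘ (ℚᵘ.mkℚᵘ (⁺ m) d)

ofℕ-* : ∀ m n → ofℕ (m * n) ≡ ofℕ m ℚ.* ofℕ n
ofℕ-* m n = ℚₚ.toℚᵘ-injective (ℚᵘₚ.≃-trans (unnorm (m * n) 0) (ℚᵘₚ.≃-trans (ℚᵘ.*≡* (cong (ℤ._* ⁺ 1) (ℤₚ.pos-* m n)))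
  (ℚᵘₚ.≃-sym (ℚᵘₚ.≃-trans (ℚₚ.toℚᵘ-homo-* (ofℕ m) (ofℕ n)) (ℚᵘₚ.*-cong (unnorm m 0) (unnorm n 0))))))

ofℕ-+ : ∀ m n → ofℕ (m + n) ≡ ofℕ m ℚ.+ ofℕ n
ofℕ-+ m n = ℚₚ.toℚᵘ-injective (ℚᵘₚ.≃-trans (unnorm (m + n) 0)
  (ℚᵘₚ.≃-trans (ℚᵘ.*≡* (cong (ℤ._* ⁺ 1) (sym (cong₂ ℤ._+_ (ℤₚ.*-identityʳ (⁺ m)) (ℤₚ.*-identityʳ (⁺ n))))))
  (ℚᵘₚ.≃-sym (ℚᵘₚ.≃-trans (ℚₚ.toℚᵘ-homo-+ (ofℕ m) (ofℕ n)) (ℚᵘₚ.+-cong (unnorm m 0) (unnorm n 0))))))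

denominator-clears : ∀ m d → ofℕ (suc d) ℚ.* (⁺ m ℚ./ suc d) ≡ ofℕ m
denominator-clears m d = ℚₚ.toℚᵘ-injective (ℚᵘₚ.≃-trans (ℚₚ.toℚᵘ-homo-* (ofℕ (suc d)) (⁺ m ℚ./ suc d))
  (ℚᵘₚ.≃-trans (ℚᵘₚ.*-cong (unnorm (suc d) 0) (unnorm m d)) (ℚᵘₚ.≃-trans (ℚᵘ.*≡* eq) (ℚᵘₚ.≃-sym (unnorm m 0)))))
  where
  eq : ⁺ suc d ℤ.* ⁺ m ℤ.* ⁺ 1 ≡ ⁺ m ℤ.* ⁺ suc (d + 0)
  eq = trans (ℤₚ.*-identityʳ _) (trans (ℤₚ.*-comm (⁺ suc d) (⁺ m)) (cong (λ z → ⁺ m ℤ.* ⁺ suc z) (sym (+-identityʳ d))))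

ofℕ-mono : ∀ {m n} → m ≤ n → ofℕ m ℚ.≤ ofℕ n
ofℕ-mono {m} {n} le = ℚₚ.toℚᵘ-cancel-≤ (ℚᵘₚ.≤-respʳ-≃ (ℚᵘₚ.≃-sym (unnorm n 0)) (ℚᵘₚ.≤-respˡ-≃ (ℚᵘₚ.≃-sym (unnorm m 0))
  (ℚᵘ.*≤* (subst₂ ℤ._≤_ (sym (ℤₚ.*-identityʳ (⁺ m))) (sym (ℤₚ.*-identityʳ (⁺ n))) (ℤ.+≤+ le)))))

ofℕ-cancel : ∀ {m n} → ofℕ m ℚ.≤ ofℕ n → m ≤ n
ofℕ-cancel {m} {n} le with ℚᵘₚ.≤-respʳ-≃ (unnorm n 0) (ℚᵘₚ.≤-respˡ-≃ (unnorm m 0) (ℚₚ.toℚᵘ-mono-≤ le))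
... | ℚᵘ.*≤* p = ℤₚ.drop‿+≤+ (subst₂ ℤ._≤_ (ℤₚ.*-identityʳ (⁺ m)) (ℤₚ.*-identityʳ (⁺ n)) p)

ofℕ≥0 : ∀ n → 0ℚ ℚ.≤ ofℕ n
ofℕ≥0 n = ofℕ-mono {0} {n} z≤n

bounded-by-ofℕ : ∀ p → ∃[ b ] p ℚ.≤ ofℕ b
bounded-by-ofℕ p@(ℚ.mkℚ n d c) = ℤ.∣ n ∣ , ℚₚ.toℚᵘ-cancel-≤ (ℚᵘₚ.≤-respʳ-≃ (ℚᵘₚ.≃-sym (unnorm ℤ.∣ n ∣ 0)) (ℚᵘ.*≤* (le n)))
  where
  le : ∀ n → n ℤ.* ⁺ 1 ℤ.≤ ⁺ ℤ.∣ n ∣ ℤ.* ⁺ suc d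
  le (⁺ k) = subst₂ ℤ._≤_ (sym (ℤₚ.*-identityʳ (⁺ k))) (ℤₚ.pos-* k (suc d)) (ℤ.+≤+ (≤-trans (≤-reflexive (sym (*-identityʳ k))) (*-monoʳ-≤ k (s≤s (z≤n {d})))))
  le ℤ.-[1+ k ] = subst₂ ℤ._≤_ (sym (ℤₚ.*-identityʳ ℤ.-[1+ k ])) (ℤₚ.pos-* (suc k) (suc d)) ℤ.-≤+

private
  nn : ∀ {p} → 0ℚ ℚ.≤ p → ℚ.NonNegative p
  nn = ℚ.nonNegative

*-mono-≥0 : ∀ {p q r s} → 0ℚ ℚ.≤ p → 0ℚ ℚ.≤ r → p ℚ.≤ q → r ℚ.≤ s → p ℚ.* r ℚ.≤ q ℚ.* s
*-mono-≥0 {p} {q} {r} {s} p≥0 r≥0 p≤q r≤s = ℚₚ.≤-trans (ℚₚ.*-monoʳ-≤-nonNeg r {{nn r≥0}} p≤q) (ℚₚ.*-monoˡ-≤-nonNeg q {{nn (ℚₚ.≤-trans p≥0 p≤q)}} r≤s)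

*-≥0 : ∀ {p q} → 0ℚ ℚ.≤ p → 0ℚ ℚ.≤ q → 0ℚ ℚ.≤ p ℚ.* q
*-≥0 {p} {q} p≥0 q≥0 = ℚₚ.≤-trans (ℚₚ.≤-reflexive (sym (ℚₚ.*-zeroʳ p))) (ℚₚ.*-monoˡ-≤-nonNeg p {{nn p≥0}} q≥0)

pow-≥0 : ∀ {x} → 0ℚ ℚ.≤ x → ∀ n → 0ℚ ℚ.≤ pow x n
pow-≥0 x≥0 zero    = ofℕ≥0 1
pow-≥0 x≥0 (suc n) = *-≥0 x≥0 (pow-≥0 x≥0 n)

pow-mono : ∀ {x y} → 0ℚ ℚ.≤ x → x ℚ.≤ y → ∀ n → pow x n ℚ.≤ pow y n
pow-mono x≥0 le zero    = ℚₚ.≤-refl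
pow-mono x≥0 le (suc n) = *-mono-≥0 x≥0 (pow-≥0 x≥0 n) le (pow-mono x≥0 le n)

pow-* : ∀ x y n → pow (x ℚ.* y) n ≡ pow x n ℚ.* pow y n
pow-* x y zero    = refl
pow-* x y (suc n) = trans (cong ((x ℚ.* y) ℚ.*_) (pow-* x y n)) (arr x y (pow x n) (pow y n))
  where
  arr : ∀ a b c d → (a ℚ.* b) ℚ.* (c ℚ.* d) ≡ (a ℚ.* c) ℚ.* (b ℚ.* d)
  arr = ℚS.solve 4 (λ a b c d → (a ℚS.:* b) ℚS.:* (c ℚS.:* d) ℚS.:= (a ℚS.:* c) ℚS.:* (b ℚS.:* d)) refl

pow-ofℕ : ∀ m n → pow (ofℕ m) n ≡ ofℕ (m ^ n)
pow-ofℕ m zero    = refl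
pow-ofℕ m (suc n) = trans (cong (ofℕ m ℚ.*_) (pow-ofℕ m n)) (sym (ofℕ-* m (m ^ n)))

module _ {c : ℕ → ℕ} {x : ℚ} (x≥0 : 0ℚ ℚ.≤ x) where

  private
    term≥0 : ∀ n → 0ℚ ℚ.≤ ofℕ (c n) ℚ.* pow x n
    term≥0 n = *-≥0 (ofℕ≥0 (c n)) (pow-≥0 x≥0 n)

    p≤p+q : ∀ {p q} → 0ℚ ℚ.≤ q → p ℚ.≤ p ℚ.+ q
    p≤p+q {p} {q} le = ℚₚ.≤-trans (ℚₚ.≤-reflexive (sym (ℚₚ.+-identityʳ p))) (ℚₚ.+-monoʳ-≤ p le)

  partialSum≥0 : ∀ N → 0ℚ ℚ.≤ partialSum c x N
  partialSum≥0 zero    = ℚₚ.≤-refl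
  partialSum≥0 (suc N) = ℚₚ.≤-trans (partialSum≥0 N) (p≤p+q (term≥0 N))

  term≤partialSum : ∀ n → ofℕ (c n) ℚ.* pow x n ℚ.≤ partialSum c x (suc n)
  term≤partialSum n = ℚₚ.≤-trans (ℚₚ.≤-reflexive (sym (ℚₚ.+-identityˡ _))) (ℚₚ.+-monoˡ-≤ _ (partialSum≥0 n))

  partialSum-mono : ∀ {M N} → M ≤ N → partialSum c x M ℚ.≤ partialSum c x N
  partialSum-mono {M} {zero}  z≤n = ℚₚ.≤-refl
  partialSum-mono {M} {suc N} le with m≤n⇒m<n∨m≡n le
  ... | inj₁ (s≤s lt) = ℚₚ.≤-trans (partialSum-mono lt) (p≤p+q (term≥0 N))
  ... | inj₂ refl     = ℚₚ.≤-refl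

fraction≥0 : ∀ m d → 0ℚ ℚ.≤ (⁺ m ℚ./ suc d)
fraction≥0 m d = ℚₚ.toℚᵘ-cancel-≤ (ℚᵘₚ.≤-respʳ-≃ (ℚᵘₚ.≃-sym (unnorm m d)) (ℚᵘ.*≤* (subst (⁺ 0 ℤ.≤_) (sym (ℤₚ.*-identityʳ (⁺ m))) (ℤ.+≤+ z≤n))))

fraction<1 : ∀ s → (⁺ s ℚ./ suc s) ℚ.< 1ℚ
fraction<1 s = ℚₚ.toℚᵘ-cancel-< (ℚᵘₚ.<-respˡ-≃ (ℚᵘₚ.≃-sym (unnorm s s)) (ℚᵘ.*<* (subst₂ ℤ._<_ (sym (ℤₚ.*-identityʳ (⁺ s))) (sym (ℤₚ.*-identityˡ (⁺ suc s))) (ℤ.+<+ (n<1+n s)))))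

-- At x = s/(s + 1) each single term is bounded by the bound on the partial sums; clearing the
-- denominator (s + 1)^n gives the estimate.
radius⇒subexp : ∀ {c} → RadiusGe1 c → SubExp c
radius⇒subexp {c} rad s s≥1 with rad (⁺ s ℚ./ suc s) (fraction≥0 s s) (fraction<1 s)
... | Q , bound with bounded-by-ofℕ Q
...   | b , Q≤b = b , λ n → ofℕ-cancel (begin
  ofℕ (c n * s ^ n)                                          ≡⟨ ofℕ-* (c n) (s ^ n) ⟩
  ofℕ (c n) ℚ.* ofℕ (s ^ n)                                  ≡⟨ cong (ofℕ (c n) ℚ.*_) (sym (trans (sym (pow-* (ofℕ (suc s)) x n)) (trans (cong (λ z → pow z n) (denominator-clears s s)) (pow-ofℕ s n)))) ⟩
  ofℕ (c n) ℚ.* (pow (ofℕ (suc s)) n ℚ.* pow x n)            ≡⟨ arr (ofℕ (c n)) (pow (ofℕ (suc s)) n) (pow x n) ⟩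
  (ofℕ (c n) ℚ.* pow x n) ℚ.* pow (ofℕ (suc s)) n            ≤⟨ ℚₚ.*-monoʳ-≤-nonNeg (pow (ofℕ (suc s)) n) {{nn (pow-≥0 (ofℕ≥0 (suc s)) n)}} (ℚₚ.≤-trans (term≤partialSum {c} (fraction≥0 s s) n) (ℚₚ.≤-trans (bound (suc n)) Q≤b)) ⟩
  ofℕ b ℚ.* pow (ofℕ (suc s)) n                              ≡⟨ cong (ofℕ b ℚ.*_) (pow-ofℕ (suc s) n) ⟩
  ofℕ b ℚ.* ofℕ (suc s ^ n)                                  ≡⟨ sym (ofℕ-* b (suc s ^ n)) ⟩
  ofℕ (b * suc s ^ n)                                        ∎)
  where
  open ℚₚ.≤-Reasoning
  x : ℚ
  x = ⁺ s ℚ./ suc s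
  arr : ∀ a b c → a ℚ.* (b ℚ.* c) ≡ (a ℚ.* c) ℚ.* b
  arr = ℚS.solve 3 (λ a b c → a ℚS.:* (b ℚS.:* c) ℚS.:= (a ℚS.:* c) ℚS.:* b) refl

-- A fraction n/(d + 1) below 1 has n ≤ d. The slightly larger (d + 1)/(d + 2) is used because its
-- numerator is positive, which `subexp⇒radius` needs to choose s ≥ 1.
below-one : ∀ x → x ℚ.< 1ℚ → ∃[ r ] x ℚ.≤ (⁺ suc r ℚ./ suc (suc r))
below-one x@(ℚ.mkℚ n d c) (ℚ.*<* lt) = d , ℚₚ.toℚᵘ-cancel-≤ (ℚᵘₚ.≤-respʳ-≃ (ℚᵘₚ.≃-sym (unnorm (suc d) (suc d))) (ℚᵘ.*≤* (le n (subst₂ ℤ._<_ (ℤₚ.*-identityʳ n) (ℤₚ.*-identityˡ (⁺ suc d)) lt))))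
  where
  le : ∀ n → n ℤ.< ⁺ suc d → n ℤ.* ⁺ suc (suc d) ℤ.≤ ⁺ suc d ℤ.* ⁺ suc d
  le (⁺ k) (ℤ.+<+ (s≤s k≤d)) = subst₂ ℤ._≤_ (ℤₚ.pos-* k (suc (suc d))) (ℤₚ.pos-* (suc d) (suc d))
    (ℤ.+≤+ (≤-trans (*-monoˡ-≤ (suc (suc d)) k≤d) (≤-trans (n≤1+n _) (≤-reflexive (arr d)))))
    where
    arr : ∀ d → suc (d * suc (suc d)) ≡ suc d * suc d
    arr = solve-∀
  le ℤ.-[1+ k ] _ = ℤ.-≤+

subexp⇒radius : ∀ {c} → SubExp c → RadiusGe1 c
subexp⇒radius {c} sub x x≥0 x<1 with below-one x x<1
-- For s = r(r + 2) one has s + 1 = (r + 1)². Hence c(n)z^n with z = r/(r + 1) is at most B((r +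
-- 1)/(r + 2))^n, a term of a convergent geometric series with ratio y.
... | d , x≤z with sub (r * suc (suc r)) (s≤s z≤n)
  where
  r : ℕ
  r = suc d
...   | B , bound = ofℕ B ℚ.* R₂ , λ N → ℚₚ.≤-trans (ℚₚ.≤-trans (ℚₚ.≤-reflexive (sym (ℚₚ.+-identityʳ _))) (ℚₚ.+-monoʳ-≤ (partialSum c x N) (*-≥0 (*-≥0 (ofℕ≥0 B) (ofℕ≥0 (suc (suc r)))) (pow-≥0 (fraction≥0 (suc r) (suc r)) N)))) (invariant N)
  where
  open ℚₚ.≤-Reasoning
  r : ℕ
  r = suc d
  z y R₁ R₂ : ℚ
  z = ⁺ r ℚ./ suc r
  y = ⁺ suc r ℚ./ suc (suc r)
  R₁ = ofℕ (suc r)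
  R₂ = ofℕ (suc (suc r))
  ofℕ-pos : ∀ k → 1 ≤ k → ℚ.Positive (ofℕ k)
  ofℕ-pos k k≥1 = ℚ.positive (ℚₚ.<-≤-trans (ℚₚ.positive⁻¹ 1ℚ) (ofℕ-mono {1} {k} k≥1))
  term : ∀ n → ofℕ (c n) ℚ.* pow x n ℚ.≤ ofℕ B ℚ.* pow y n
  term n = ℚₚ.≤-trans (ℚₚ.*-monoˡ-≤-nonNeg (ofℕ (c n)) {{nn (ofℕ≥0 (c n))}} (pow-mono x≥0 x≤z n))
    (ℚₚ.*-cancelʳ-≤-pos (ofℕ (suc r ^ n * suc (suc r) ^ n)) {{ofℕ-pos _ (*-mono-≤ (m^n>0 (suc r) n) (m^n>0 (suc (suc r)) n))}} (begin
      (ofℕ (c n) ℚ.* pow z n) ℚ.* ofℕ (suc r ^ n * suc (suc r) ^ n)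
        ≡⟨ cong ((ofℕ (c n) ℚ.* pow z n) ℚ.*_) (trans (ofℕ-* (suc r ^ n) _) (cong₂ ℚ._*_ (sym (pow-ofℕ (suc r) n)) refl)) ⟩
      (ofℕ (c n) ℚ.* pow z n) ℚ.* (pow R₁ n ℚ.* ofℕ (suc (suc r) ^ n))
        ≡⟨ arr (ofℕ (c n)) (pow z n) (pow R₁ n) (ofℕ (suc (suc r) ^ n)) ⟩
      ofℕ (c n) ℚ.* ((pow R₁ n ℚ.* pow z n) ℚ.* ofℕ (suc (suc r) ^ n))
        ≡⟨ cong (λ w → ofℕ (c n) ℚ.* (w ℚ.* ofℕ (suc (suc r) ^ n))) (trans (sym (pow-* R₁ z n)) (trans (cong (λ w → pow w n) (denominator-clears r r)) (pow-ofℕ r n))) ⟩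
      ofℕ (c n) ℚ.* (ofℕ (r ^ n) ℚ.* ofℕ (suc (suc r) ^ n))
        ≡⟨ cong (ofℕ (c n) ℚ.*_) (sym (ofℕ-* (r ^ n) _)) ⟩
      ofℕ (c n) ℚ.* ofℕ (r ^ n * suc (suc r) ^ n)
        ≡⟨ sym (ofℕ-* (c n) _) ⟩
      ofℕ (c n * (r ^ n * suc (suc r) ^ n))
        ≤⟨ ofℕ-mono nat ⟩
      ofℕ (B * (suc r ^ n * suc r ^ n))
        ≡⟨ trans (ofℕ-* B _) (cong (ofℕ B ℚ.*_) (ofℕ-* (suc r ^ n) (suc r ^ n))) ⟩
      ofℕ B ℚ.* (ofℕ (suc r ^ n) ℚ.* ofℕ (suc r ^ n))
        ≡⟨ cong (λ w → ofℕ B ℚ.* (w ℚ.* ofℕ (suc r ^ n))) (sym (trans (sym (pow-* R₂ y n)) (trans (cong (λ w → pow w n) (denominator-clears (suc r) (suc r))) (pow-ofℕ (suc r) n)))) ⟩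
      ofℕ B ℚ.* ((pow R₂ n ℚ.* pow y n) ℚ.* ofℕ (suc r ^ n))
        ≡⟨ arr₂ (ofℕ B) (pow R₂ n) (pow y n) (ofℕ (suc r ^ n)) ⟩
      (ofℕ B ℚ.* pow y n) ℚ.* (ofℕ (suc r ^ n) ℚ.* pow R₂ n)
        ≡⟨ cong ((ofℕ B ℚ.* pow y n) ℚ.*_) (sym (trans (ofℕ-* (suc r ^ n) _) (cong (ofℕ (suc r ^ n) ℚ.*_) (sym (pow-ofℕ (suc (suc r)) n))))) ⟩
      (ofℕ B ℚ.* pow y n) ℚ.* ofℕ (suc r ^ n * suc (suc r) ^ n) ∎))
    where
    arr : ∀ a b c d → (a ℚ.* b) ℚ.* (c ℚ.* d) ≡ a ℚ.* ((c ℚ.* b) ℚ.* d)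
    arr = ℚS.solve 4 (λ a b c d → (a ℚS.:* b) ℚS.:* (c ℚS.:* d) ℚS.:= a ℚS.:* ((c ℚS.:* b) ℚS.:* d)) refl
    arr₂ : ∀ a b c d → a ℚ.* ((b ℚ.* c) ℚ.* d) ≡ (a ℚ.* c) ℚ.* (d ℚ.* b)
    arr₂ = ℚS.solve 4 (λ a b c d → a ℚS.:* ((b ℚS.:* c) ℚS.:* d) ℚS.:= (a ℚS.:* c) ℚS.:* (d ℚS.:* b)) refl
    nat : c n * (r ^ n * suc (suc r) ^ n) ≤ B * (suc r ^ n * suc r ^ n)
    nat = ≤-trans (≤-reflexive (cong (c n *_) (sym (^-distribʳ-* r (suc (suc r)) n)))) (≤-trans (bound n)
      (≤-reflexive (cong (B *_) (trans (cong (_^ n) (sq r)) (^-distribʳ-* (suc r) (suc r) n)))))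
      where
      sq : ∀ r → suc (r * suc (suc r)) ≡ suc r * suc r
      sq = solve-∀
  -- The geometric series with ratio y has sum r + 2 = 1/(1 - y); the second summand is its
  -- remainder after N terms.
  invariant : ∀ N → partialSum c x N ℚ.+ ((ofℕ B ℚ.* R₂) ℚ.* pow y N) ℚ.≤ ofℕ B ℚ.* R₂
  invariant zero    = ℚₚ.≤-reflexive (trans (ℚₚ.+-identityˡ _) (ℚₚ.*-identityʳ _))
  invariant (suc N) = ℚₚ.≤-trans (begin
    (S ℚ.+ ofℕ (c N) ℚ.* pow x N) ℚ.+ ((ofℕ B ℚ.* R₂) ℚ.* (y ℚ.* pow y N)) ≤⟨ ℚₚ.+-monoˡ-≤ _ (ℚₚ.+-monoʳ-≤ S (term N)) ⟩
    (S ℚ.+ ofℕ B ℚ.* pow y N) ℚ.+ ((ofℕ B ℚ.* R₂) ℚ.* (y ℚ.* pow y N))     ≡⟨ arr S (ofℕ B) (pow y N) R₂ y ⟩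
    S ℚ.+ ((ofℕ B ℚ.* (1ℚ ℚ.+ R₂ ℚ.* y)) ℚ.* pow y N)                        ≡⟨ cong (λ w → S ℚ.+ ((ofℕ B ℚ.* w) ℚ.* pow y N)) (trans (cong (1ℚ ℚ.+_) (denominator-clears (suc r) (suc r))) (sym (ofℕ-+ 1 (suc r)))) ⟩
    S ℚ.+ ((ofℕ B ℚ.* R₂) ℚ.* pow y N)                                       ∎) (invariant N)
    where
    S : ℚ
    S = partialSum c x N
    arr : ∀ s b p r y → (s ℚ.+ b ℚ.* p) ℚ.+ ((b ℚ.* r) ℚ.* (y ℚ.* p)) ≡ s ℚ.+ ((b ℚ.* (1ℚ ℚ.+ r ℚ.* y)) ℚ.* p)
    arr = ℚS.solve 5 (λ s b p r y → (s ℚS.:+ b ℚS.:* p) ℚS.:+ ((b ℚS.:* r) ℚS.:* (y ℚS.:* p)) ℚS.:= s ℚS.:+ ((b ℚS.:* (ℚS.con 1ℚ ℚS.:+ r ℚS.:* y)) ℚS.:* p)) refl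

-- For x > 1 every nonzero term is at least 1, so infinitely many of them push the partial sums
-- above any bound.
infinite⇒radius≤1 : ∀ {c} → (∀ N → ∃[ n ] N ≤ n × 0 < c n) → RadiusLe1 c
infinite⇒radius≤1 {c} inf x x>1 (Q , bound) with bounded-by-ofℕ Q
... | b , Q≤b with reach (suc b)
  where
  x≥0 : 0ℚ ℚ.≤ x
  x≥0 = ℚₚ.≤-trans (ofℕ≥0 1) (ℚₚ.<⇒≤ x>1)
  pow≥1 : ∀ n → 1ℚ ℚ.≤ pow x n
  pow≥1 zero    = ℚₚ.≤-refl
  pow≥1 (suc n) = *-mono-≥0 (ofℕ≥0 1) (ofℕ≥0 1) (ℚₚ.<⇒≤ x>1) (pow≥1 n)
  reach : ∀ k → ∃[ N ] ofℕ k ℚ.≤ partialSum c x N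
  reach zero = 0 , ℚₚ.≤-refl
  reach (suc k) with reach k
  ... | N , le with inf N
  ...   | n , N≤n , pos = suc n , (begin
    ofℕ (suc k)                                          ≡⟨ trans (cong ofℕ (+-comm 1 k)) (ofℕ-+ k 1) ⟩
    ofℕ k ℚ.+ 1ℚ                                         ≤⟨ ℚₚ.+-mono-≤ (ℚₚ.≤-trans le (partialSum-mono {c} x≥0 N≤n)) (*-mono-≥0 (ofℕ≥0 1) (ofℕ≥0 1) (ofℕ-mono pos) (pow≥1 n)) ⟩
    partialSum c x (suc n)                               ∎)
    where open ℚₚ.≤-Reasoning
... | N , le = <-irrefl refl (ofℕ-cancel {suc b} {b} (ℚₚ.≤-trans le (ℚₚ.≤-trans (bound N) Q≤b)))

-- Counting functions of classes of structures

rep⇒≅ : ∀ {S T a} → Rep S a → Rep T a → S ≅ T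
rep⇒≅ I J = OIso⇒≅ (otrans I (osym J))

rep-≅ : ∀ {S T a b} → Can a → Can b → Rep S a → Rep T b → S ≅ T → a ≡ b
rep-≅ {a = a} {b} ca cb I J e = ~⇒≡ ca cb (iso⇒~ a b (otrans (osym I) (otrans (≅⇒OIso e) J)))

record Counted (C : Class) (P : Fo → Bool) : Set where
  field
    shape  : ∀ S → C S → ∃ λ a → Can a × Rep S a × P a ≡ true
    member : ∀ a S → Can a → Rep S a → P a ≡ true → C S

length-filter-count : ∀ (P : Fo → Bool) (xs : List Fo) → length (filter (λ a → P a Data.Bool.≟ true) xs) ≡ ∑ xs (λ a → χ (P a))
length-filter-count P [] = refl
length-filter-count P (x ∷ xs) with P x
... | true  = cong suc (length-filter-count P xs)
... | false = length-filter-count P xs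

counted⇒countIs : ∀ {C P} → Counted C P → CountingFunction C (λ n → count n P)
counted⇒countIs {C} {P} K n = subst (CountIs C n) (length-filter-count P (E n))
  ( (λ i → strOf (lookup xs i))
  , (λ i → member _ _ (canon i) (strOf-rep _) (accepted i) , size-ok i)
  , (λ i j e → lookup-unique (Uniqueₚ.filter⁺ P? (E! n)) i j (rep-≅ (canon i) (canon j) (strOf-rep _) (strOf-rep _) e))
  , find )
  where
  open Counted K
  P? : ∀ a → Dec (P a ≡ true)
  P? a = P a Data.Bool.≟ true
  xs : List Fo
  xs = filter P? (E n)
  in-E : ∀ i → lookup xs i ∈ E n × P (lookup xs i) ≡ true
  in-E i = ∈-filter⁻ P? {xs = E n} (∈-lookup i)
  canon : ∀ i → Can (lookup xs i)
  canon i = proj₁ (∈-E⁻ (proj₁ (in-E i)))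
  size-ok : ∀ i → sz (lookup xs i) ≡ n
  size-ok i = proj₂ (∈-E⁻ (proj₁ (in-E i)))
  accepted : ∀ i → P (lookup xs i) ≡ true
  accepted i = proj₂ (in-E i)
  find : ∀ S → C S → size S ≡ n → Σ (Fin (length xs)) λ i → S ≅ strOf (lookup xs i)
  find S c s with shape S c
  ... | a , ca , I , p = Any.index a∈ , subst (λ z → S ≅ strOf z) (Anyₚ.lookup-index a∈) (rep⇒≅ I (strOf-rep a))
    where
    a∈ : a ∈ xs
    a∈ = ∈-filter⁺ P? (∈-E⁺′ ca (trans (sym (rep-size I)) s)) p

countIs-unique : ∀ {C n k l} → CountIs C n k → CountIs C n l → k ≡ l
countIs-unique a b = ≤-antisym (half a b) (half b a)
  where
  half : ∀ {C n k l} → CountIs C n k → CountIs C n l → k ≤ l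
  half (v , vC , vI , vF) (w , wC , wI , wF) = Finₚ.injective⇒≤ {f = f} inj
    where
    f : Fin _ → Fin _
    f i = proj₁ (wF (v i) (proj₁ (vC i)) (proj₂ (vC i)))
    iso : ∀ i → v i ≅ w (f i)
    iso i = proj₂ (wF (v i) (proj₁ (vC i)) (proj₂ (vC i)))
    inj : ∀ {i j} → f i ≡ f j → i ≡ j
    inj {i} {j} e = vI i j (OIso⇒≅ (otrans (≅⇒OIso (iso i)) (osym (≅⇒OIso (subst (λ z → v j ≅ w z) (sym e) (iso j))))))

counted-unique : ∀ {C P c} → Counted C P → CountingFunction C c → ∀ n → c n ≡ count n P
counted-unique K cf n = countIs-unique (cf n) (counted⇒countIs K n)

count-cong : ∀ n {P Q : Fo → Bool} → (∀ {a} → a ∈ E n → P a ≡ Q a) → count n P ≡ count n Q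
count-cong n h = ∑-cong (E n) (λ a∈ → cong χ (h a∈))

module Recognized (φ : Sentence) where
  open Recognizer (recognize φ) public using (alg; acc)
  open Recognizer (recognize φ) using (sound; complete)
  open Typed alg public using (ty; κ; ty-fold; ty-~)

  holds⇒acc : ∀ {S a} → Rep S a → S ⊨ φ → acc (ty a) ≡ true
  holds⇒acc {S} {a} I s = trans (cong acc (sym (ty-fold a (label noFO noFO))))
    (sound a noFO noFO (satD-transfer I φ (λ ()) (λ ()) (Sat⇒SatD S φ s)))

  acc⇒holds : ∀ {S a} → Rep S a → acc (ty a) ≡ true → S ⊨ φ
  acc⇒holds {S} {a} I e = SatD⇒Sat S φ (satD-transfer (osym I) φ (λ ()) (λ ())
    (complete a noFO noFO (trans (cong acc (ty-fold a (label noFO noFO))) e)))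

nonempty : Fo → Bool
nonempty ε       = false
nonempty (_ ▸ _) = true

nonempty⇒≢ε : ∀ {a} → nonempty a ≡ true → a ≢ ε
nonempty⇒≢ε {_ ▸ _} _ ()

≢ε⇒nonempty : ∀ {a} → a ≢ ε → nonempty a ≡ true
≢ε⇒nonempty {ε}     n = ⊥-elim (n refl)
≢ε⇒nonempty {_ ▸ _} _ = refl

size⇒nonempty : ∀ {a n} → sz a ≡ suc n → nonempty a ≡ true
size⇒nonempty {_ ▸ _} _ = refl

forest-rep : ∀ {S} → IsForest S → ∃ λ a → Can a × Rep S a × a ≢ ε
forest-rep {S} F with Decompose.canonical S F
... | a , ca , I = a , ca , I , λ where refl → <-irrefl refl (subst (1 ≤_) (rep-size I) (IsForest.nonempty F))

rep-tree : ∀ {S a} → Rep S (a ▸ ε) → IsTree S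
rep-tree {S} {a} I = rep-forest I (λ ()) , from top , λ x → below x (to x) refl
  where
  open OIso I
  below : ∀ x (p : Pos (a ▸ ε)) → to x ≡ p → S ⊢ x ≼ from top
  below x top      e = inj₁ (trans (sym (from-to x)) (cong from e))
  below x (down p) e = inj₂ (trans (pres x (from top)) (trans (cong₂ ltP e (to-from top)) refl))

tree-shape : ∀ {S a} → Rep S a → IsTree S → ∃ λ b → a ≡ b ▸ ε
tree-shape {a = ε} I (_ , r , _) = ⊥-elim (no-pos (OIso.to I r))
tree-shape {a = b ▸ ε} I _ = b , refl
tree-shape {S} {b ▸ c ▸ d} I (_ , r , mx) = ⊥-elim (two-tops (above top) (above (right top)))
  where
  open OIso I
  above : ∀ p → p ≡ to r ⊎ ltP p (to r) ≡ true
  above p with mx (from p)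
  ... | inj₁ e = inj₁ (trans (sym (to-from p)) (cong to e))
  ... | inj₂ e = inj₂ (trans (cong (λ z → ltP z (to r)) (sym (to-from p))) (trans (sym (pres (from p) r)) e))
  two-tops : (top ≡ to r ⊎ ltP top (to r) ≡ true) → (right top ≡ to r ⊎ ltP (right top) (to r) ≡ true) → ⊥
  two-tops (inj₁ e) (inj₁ f) with trans e (sym f)
  ... | ()
  two-tops (inj₁ e) (inj₂ f) with trans (cong (ltP (right top)) e) f
  ... | ()

component-~ : ∀ {c} a → 0 < mult c a → ∃ λ b → a ~ c ▸ b
component-~ {c} (a ▸ b) m with c ≟F a
... | yes refl = b , ~refl
... | no _ with component-~ b m
...   | d , e = a ▸ d , ~trans (~▸ ~refl e) ~swap

allC-intro : ∀ {B} a → (∀ c → 0 < mult c a → B c ≡ true) → allC B a ≡ true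
allC-intro ε       h = refl
allC-intro (a ▸ b) h = ∧-intro (h a (subst (λ z → 0 < χ z + mult a b) (sym (==-refl a)) z<s)) (allC-intro b (λ c m → h c (≤-trans m (m≤n+m (mult c b) _))))

module AdequateClass (φ : Sentence) (adq : Adequate (MSOForestClass φ)) where
  open Recognized φ public
  open Adequate adq
  open Alg alg using (idʳ)

  T : Fo → Bool
  T a = acc (κ a)

  private
    in-class : ∀ {S a} → Rep S a → a ≢ ε → acc (ty a) ≡ true → MSOForestClass φ S
    in-class I ne e = rep-forest I ne , acc⇒holds I e

  components⇒accepted : ∀ a → a ≢ ε → allC T a ≡ true → acc (ty a) ≡ true
  components⇒accepted ε       ne p = ⊥-elim (ne refl)
  components⇒accepted (a ▸ ε) ne p = trans (cong acc (idʳ (κ a))) (∧-elimˡ p)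
  components⇒accepted (a ▸ b@(_ ▸ _)) ne p = holds⇒acc (rep-⊕ {a = a ▸ ε} {b} (strOf-rep (a ▸ ε)) (strOf-rep b))
    (proj₂ (sums _ _ (in-class (strOf-rep (a ▸ ε)) (λ ()) (trans (cong acc (idʳ (κ a))) (∧-elimˡ p)))
      (in-class (strOf-rep b) (λ ()) (components⇒accepted b (λ ()) (∧-elimʳ {T a} p)))))

  forest-member : ∀ a → a ≢ ε → allC T a ≡ true → MSOForestClass φ (strOf a)
  forest-member a ne p = in-class (strOf-rep a) ne (components⇒accepted a ne p)

  accepted⇒components : ∀ a → acc (ty a) ≡ true → allC T a ≡ true
  accepted⇒components a e = allC-intro a (λ c m → comp c (component-~ a m))
    where
    comp : ∀ c → (∃ λ b → a ~ c ▸ b) → T c ≡ true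
    comp c (ε , a~) = trans (cong acc (trans (sym (idʳ (κ c))) (sym (ty-~ a~)))) e
    comp c (b@(_ ▸ _) , a~) = trans (cong acc (sym (idʳ (κ c)))) (holds⇒acc (strOf-rep (c ▸ ε)) (proj₂ (components (strOf (c ▸ ε)) (strOf (c ▸ b))
      (in-class (strOf-rep (c ▸ b)) (λ ()) (trans (cong acc (sym (ty-~ a~))) e))
      (rep-tree (strOf-rep (c ▸ ε)) , inj₂ (strOf b , rep-forest (strOf-rep b) (λ ()) ,
        rep⇒≅ (strOf-rep (c ▸ b)) (rep-⊕ {a = c ▸ ε} {b} (strOf-rep (c ▸ ε)) (strOf-rep b)))))))

  restricted : ∀ (ψ : Sentence) → Counted (Restrict (MSOForestClass φ) ψ)
                 (λ a → (nonempty a ∧ allC T a) ∧ Recognized.acc ψ (Recognized.ty ψ a))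
  restricted ψ = record
    { shape = λ S ((F , s) , s′) → let a , ca , I , ne = forest-rep F in
        a , ca , I , ∧-intro (∧-intro (≢ε⇒nonempty ne) (accepted⇒components a (holds⇒acc I s))) (Recognized.holds⇒acc ψ I s′)
    ; member = λ a S ca I p → let ne = nonempty⇒≢ε (∧-elimˡ {nonempty a} (∧-elimˡ p)) in
        in-class I ne (components⇒accepted a ne (∧-elimʳ {nonempty a} (∧-elimˡ p))) , Recognized.acc⇒holds ψ I (∧-elimʳ {nonempty a ∧ allC T a} p) }

  -- The empty `ε` satisfies `allC T` without being a forest, hence the factor `nonempty`. It
  -- matters only at size 0, which is why `forest-counts` starts at suc n.
  counted : Counted (MSOForestClass φ) (λ a → nonempty a ∧ allC T a)
  counted = record
    { shape = λ S (F , s) → let a , ca , I , ne = forest-rep F in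
        a , ca , I , ∧-intro (≢ε⇒nonempty ne) (accepted⇒components a (holds⇒acc I s))
    ; member = λ a S ca I p → let ne = nonempty⇒≢ε (∧-elimˡ p) in in-class I ne (components⇒accepted a ne (∧-elimʳ {nonempty a} p)) }

  private
    single : Fo → Bool
    single ε           = false
    single (a ▸ ε)     = T a
    single (_ ▸ _ ▸ _) = false

    single⇒ : ∀ a → single a ≡ true → ∃ λ b → a ≡ b ▸ ε × T b ≡ true
    single⇒ (b ▸ ε) e = b , refl , e

    trees-counted : Counted (TreesOf (MSOForestClass φ)) single
    trees-counted = record
      { shape = λ S ((F , s) , tr) → let a , ca , I , ne = forest-rep F ; b , e = tree-shape I tr in
          a , ca , I , trans (cong single e) (trans (cong acc (trans (sym (idʳ (κ b))) (cong ty (sym e)))) (holds⇒acc I s))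
      ; member = λ a S ca I p → let b , e , t = single⇒ a p ; I′ = subst (Rep S) e I in
          in-class I′ (λ ()) (trans (cong acc (idʳ (κ b))) t) , rep-tree I′ }

    single-suc : ∀ k → count (suc k) single ≡ count k T
    single-suc k = ≤-antisym
      (∑-onto _≟F_ {g = λ b → χ (T b)} (E k) (λ b → b ▸ ε) (E! (suc k)) λ {a} a∈ pos →
        case single⇒ a (χ>0⇒true pos) of λ where
          (b , refl , t) → b , ∈-E⁺′ (proj₁ (proj₁ (∈-E⁻ a∈))) (trans (sym (+-identityʳ (sz b))) (suc-injective (proj₂ (∈-E⁻ a∈)))) , refl , ≤-refl)
      (∑-inj (E (suc k)) (λ b → b ▸ ε) (E! k)
        (λ {b} b∈ _ → ∈-E⁺′ (proj₁ (∈-E⁻ b∈) , tt , tt) (cong suc (trans (+-identityʳ (sz b)) (proj₂ (∈-E⁻ b∈)))) , ≤-refl)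
        (λ _ _ _ _ e → proj₁ (▸-injective e)))

  module _ {t : ℕ → ℕ} (tc : CountingFunction (TreesOf (MSOForestClass φ)) t) where

    -- The index drops by one because a tree is represented by its child forest, which lacks the
    -- root.
    tree-counts : ∀ k → t (suc k) ≡ count k T
    tree-counts k = trans (counted-unique trees-counted tc (suc k)) (single-suc k)

    tree-subexp : SubExp t → SubExp (λ k → count k T)
    tree-subexp sub s s≥1 = B * suc s , λ k → begin
      count k T * s ^ k             ≤⟨ *-monoʳ-≤ (count k T) (≤-trans (≤-reflexive (sym (+-identityʳ _))) (*-monoˡ-≤ (s ^ k) s≥1)) ⟩
      count k T * s ^ suc k         ≡⟨ cong (_* s ^ suc k) (sym (tree-counts k)) ⟩
      t (suc k) * s ^ suc k         ≤⟨ proj₂ (sub s s≥1) (suc k) ⟩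
      B * (suc s * suc s ^ k)       ≡⟨ sym (*-assoc B (suc s) _) ⟩
      B * suc s * suc s ^ k         ∎
      where
      open ≤-Reasoning
      B : ℕ
      B = proj₁ (sub s s≥1)

  module _ {f : ℕ → ℕ} (fc : CountingFunction (MSOForestClass φ) f) where

    forest-counts : ∀ n → f (suc n) ≡ count (suc n) (allC T)
    forest-counts n = trans (counted-unique counted fc (suc n)) (count-cong (suc n) (λ {a} a∈ → cong (_∧ allC T a) (size⇒nonempty (proj₂ (∈-E⁻ a∈)))))

    tree≤forest : ∀ {t} → CountingFunction (TreesOf (MSOForestClass φ)) t → ∀ n → t n ≤ f n
    tree≤forest {t} tc n = begin
      t n                                      ≡⟨ counted-unique trees-counted tc n ⟩
      count n single                           ≤⟨ ∑-mono (E n) (λ {a} _ → pt a) ⟩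
      count n (λ a → nonempty a ∧ allC T a)    ≡⟨ sym (counted-unique counted fc n) ⟩
      f n                                      ∎
      where
      open ≤-Reasoning
      pt : ∀ a → χ (single a) ≤ χ (nonempty a ∧ allC T a)
      pt ε           = z≤n
      pt (a ▸ ε)     = ≤-reflexive (cong χ (sym (∧-identityʳ (T a))))
      pt (_ ▸ _ ▸ _) = z≤n

    restricted-counts : ∀ ψ {fψ} → CountingFunction (Restrict (MSOForestClass φ) ψ) fψ →
      ∀ n → fψ (suc n) ≡ count (suc n) (λ a → allC T a ∧ Recognized.acc ψ (Recognized.ty ψ a))
    restricted-counts ψ c n = trans (counted-unique (restricted ψ) c (suc n))
      (count-cong (suc n) (λ {a} a∈ → cong (λ z → (z ∧ allC T a) ∧ Recognized.acc ψ (Recognized.ty ψ a)) (size⇒nonempty (proj₂ (∈-E⁻ a∈)))))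

-- Being a component is MSO-definable

-- What a first-order formula can say about a tuple of nodes: they form an induced copy of the tree,
-- contain everything below its root, and the root is maximal. Such a copy is a whole component.
record ComponentEmbedding (a₀ a : Fo) : Set where
  field
    emb       : Pos (a₀ ▸ ε) → Pos a
    injective : ∀ {p q} → emb p ≡ emb q → p ≡ q
    pres      : ∀ p q → ltP (emb p) (emb q) ≡ ltP p q
    closed    : ∀ y → ltP y (emb top) ≡ true → ∃ λ p → y ≡ emb p
    maximal   : ∀ y → ltP (emb top) y ≢ true

component⇒embedding : ∀ {a₀ a} → 0 < mult a₀ a → ComponentEmbedding a₀ a
component⇒embedding {a₀} {a} m with component-~ a m
... | b , a~ = record
  { emb = to ∘ j
  ; injective = λ e → j-inj _ _ (to-injective e)
  ; pres = λ p q → trans (sym (pres (j p) (j q))) (j-pres p q)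
  ; closed = λ y l → let p , e = below (from y) (trans (pres (from y) top) (trans (cong (λ z → ltP z (to top)) (to-from y)) l)) in
      p , trans (sym (to-from y)) (cong to e)
  ; maximal = λ y l → no-above (from y) (trans (pres top (from y)) (trans (cong (ltP (to top)) (to-from y)) l)) }
  where
  open OIso (~⇒iso (~sym a~))
  j : Pos (a₀ ▸ ε) → Pos (a₀ ▸ b)
  j top      = top
  j (down p) = down p
  j-inj : ∀ p q → j p ≡ j q → p ≡ q
  j-inj top      top      e = refl
  j-inj (down p) (down q) e = cong down (down-injective e)
  j-pres : ∀ p q → ltP (j p) (j q) ≡ ltP p q
  j-pres top      top      = refl
  j-pres top      (down q) = refl
  j-pres (down p) top      = refl
  j-pres (down p) (down q) = refl
  below : ∀ (y : Pos (a₀ ▸ b)) → ltP y top ≡ true → ∃ λ p → y ≡ j p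
  below (down p) _ = down p , refl
  no-above : ∀ (y : Pos (a₀ ▸ b)) → ltP top y ≢ true
  no-above y ()

embedding⇒component : ∀ {a₀ a} → Can a₀ → Can a → ComponentEmbedding a₀ a → 0 < mult a₀ a
embedding⇒component {a₀} {a} c₀ ca C = subst (λ z → 0 < mult a₀ z) (sym a≡) (subst (0 <_) (sym (trans (mult-ins a₀ a₀ (norm R.rest)) (cong (λ z → χ z + mult a₀ (norm R.rest)) (==-refl a₀)))) z<s)
  where
  open ComponentEmbedding C
  not-true : ∀ {b} → b ≢ true → b ≡ false
  not-true {true}  n = ⊥-elim (n refl)
  not-true {false} n = refl
  module R = RootFirst (root-first a (emb top) (λ y → not-true (maximal y)))
  module J = OIso R.iso
  J-down : ∀ p → ∃ λ q → J.to (emb (down p)) ≡ down q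
  J-down p with J.to (emb (down p)) in eq | trans (sym (J.pres (emb (down p)) (emb top))) (pres (down p) top)
  ... | down q  | _ = q , refl
  ... | top     | l with trans (sym l) (cong (ltP top) R.moved)
  ...   | ()
  J-down p | right q | l with trans (sym l) (cong (ltP (right q)) R.moved)
  ...   | ()
  back : ∀ q → ∃ λ p → J.from (down q) ≡ emb (down p)
  back q with closed (J.from (down q)) (trans (J.pres (J.from (down q)) (emb top)) (cong₂ ltP (J.to-from (down q)) R.moved))
  ... | down p , e = p , e
  ... | top , e with trans (sym (J.to-from (down q))) (trans (cong J.to e) R.moved)
  ...   | ()
  I : PIso a₀ R.kids
  I = record
    { to = proj₁ ∘ J-down ; from = proj₁ ∘ back
    ; to-from = λ q → down-injective (trans (sym (proj₂ (J-down (proj₁ (back q))))) (trans (cong J.to (sym (proj₂ (back q)))) (J.to-from (down q))))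
    ; from-to = λ p → down-injective (injective (trans (sym (proj₂ (back (proj₁ (J-down p))))) (trans (cong J.from (sym (proj₂ (J-down p)))) (J.from-to (emb (down p))))))
    ; pres = λ p q → trans (sym (pres (down p) (down q))) (trans (J.pres _ _) (cong₂ ltP (proj₂ (J-down p)) (proj₂ (J-down q)))) }
  a≡ : a ≡ ins a₀ (norm R.rest)
  a≡ = trans (sym (norm-Can ca)) (trans (~⇒norm R.equiv) (cong (λ z → ins z (norm R.rest)) (trans (sym (~⇒norm (iso⇒~ a₀ R.kids I))) (norm-Can c₀))))

-- The empty conjunction is an equation of a variable with itself, so at least one variable must be
-- in scope; hence the index suc i.
bigAnd bigOr : ∀ {i j} n → (Fin n → Formula (suc i) j) → Formula (suc i) j
bigAnd zero    F = Fin.zero ≐ Fin.zero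
bigAnd (suc n) F = F Fin.zero ∧' bigAnd n (F ∘ Fin.suc)
bigOr zero     F = ¬' (Fin.zero ≐ Fin.zero)
bigOr (suc n)  F = F Fin.zero ∨' bigOr n (F ∘ Fin.suc)

∃* : ∀ n → Formula n 0 → Sentence
∃* zero    φ = φ
∃* (suc n) φ = ∃* n (∃₁ φ)

module _ {D : Set} {l : D → D → Bool} where

  bigAnd⁺ : ∀ {i j} n (F : Fin n → Formula (suc i) j) {ρ σ} → (∀ k → SatD D l ρ σ (F k)) → SatD D l ρ σ (bigAnd n F)
  bigAnd⁺ zero    F h = refl
  bigAnd⁺ (suc n) F h = h Fin.zero , bigAnd⁺ n (F ∘ Fin.suc) (h ∘ Fin.suc)

  bigAnd⁻ : ∀ {i j} n (F : Fin n → Formula (suc i) j) {ρ σ} → SatD D l ρ σ (bigAnd n F) → ∀ k → SatD D l ρ σ (F k)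
  bigAnd⁻ (suc n) F (p , q) Fin.zero    = p
  bigAnd⁻ (suc n) F (p , q) (Fin.suc k) = bigAnd⁻ n (F ∘ Fin.suc) q k

  bigOr⁺ : ∀ {i j} n (F : Fin n → Formula (suc i) j) {ρ σ} k → SatD D l ρ σ (F k) → SatD D l ρ σ (bigOr n F)
  bigOr⁺ (suc n) F Fin.zero    p = inj₁ p
  bigOr⁺ (suc n) F (Fin.suc k) p = inj₂ (bigOr⁺ n (F ∘ Fin.suc) k p)

  bigOr⁻ : ∀ {i j} n (F : Fin n → Formula (suc i) j) {ρ σ} → SatD D l ρ σ (bigOr n F) → ∃ λ k → SatD D l ρ σ (F k)
  bigOr⁻ zero    F p = ⊥-elim (p refl)
  bigOr⁻ (suc n) F (inj₁ p) = Fin.zero , p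
  bigOr⁻ (suc n) F (inj₂ p) = let k , q = bigOr⁻ n (F ∘ Fin.suc) p in Fin.suc k , q

  ∃*⁺ : ∀ n (φ : Formula n 0) (ρ : Fin n → D) → SatD D l ρ noFO φ → SatD D l noFO noFO (∃* n φ)
  ∃*⁺ zero    φ ρ p = satD-transfer oid φ (λ ()) (λ ()) p
  ∃*⁺ (suc n) φ ρ p = ∃*⁺ n (∃₁ φ) (ρ ∘ Fin.suc) (ρ Fin.zero , satD-transfer oid φ (λ where Fin.zero → refl ; (Fin.suc k) → refl) (λ ()) p)

  ∃*⁻ : ∀ n (φ : Formula n 0) → SatD D l noFO noFO (∃* n φ) → ∃ λ (ρ : Fin n → D) → SatD D l ρ noFO φ
  ∃*⁻ zero    φ p = noFO , p
  ∃*⁻ (suc n) φ p = let ρ , a , q = ∃*⁻ n (∃₁ φ) p in extend a ρ , q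

module ComponentSentence (a₀ : Fo) where
  private
    N : ℕ
    N = sz (a₀ ▸ ε)

    rel : Fin N → Fin N → Bool
    rel x y = ltP (finPos (a₀ ▸ ε) x) (finPos (a₀ ▸ ε) y)

    order : Bool → Fin N → Fin N → Formula N 0
    order true  x y = x ≺' y
    order false x y = ¬' (x ≺' y)

    distinct : ∀ {x y : Fin N} → Dec (x ≡ y) → Formula N 0
    distinct {x} {y} (yes _) = x ≐ x
    distinct {x} {y} (no _)  = ¬' (x ≐ y)

    literal : Fin N → Fin N → Formula N 0
    literal x y = order (rel x y) x y ∧' distinct (x Finₚ.≟ y)

    listed : Fin N → Formula (suc N) 0
    listed x = Fin.zero ≐ Fin.suc x

    -- Variable 0 stands for the root, since `posFin` maps `top` to `Fin.zero`; under one more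
    -- quantifier it becomes `Fin.suc Fin.zero`. The three parts correspond to the induced copy, its
    -- downward closure and the maximality of the root.
    diagram closure body : Formula N 0
    diagram = bigAnd N (λ x → bigAnd N (literal x))
    closure = ∀₁ ((¬' (Fin.zero ≺' Fin.suc Fin.zero)) ∨' bigOr N listed)
    body    = diagram ∧' (closure ∧' ∀₁ (¬' (Fin.suc Fin.zero ≺' Fin.zero)))

  hasComponent : Sentence
  hasComponent = ∃* N body

  module _ {a : Fo} where
    private
      Sat′ : ∀ {i} → (Fin i → Pos a) → Formula i 0 → Set
      Sat′ ρ φ = SatD (Pos a) ltP ρ noFO φ

      order⁺ : ∀ (ρ : Fin N → Pos a) b x y → ltP (ρ x) (ρ y) ≡ b → Sat′ ρ (order b x y)
      order⁺ ρ true  x y e = e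
      order⁺ ρ false x y e e′ = true≢false e′ e

      order⁻ : ∀ (ρ : Fin N → Pos a) b x y → Sat′ ρ (order b x y) → ltP (ρ x) (ρ y) ≡ b
      order⁻ ρ true  x y e = e
      order⁻ ρ false x y n with ltP (ρ x) (ρ y)
      ... | true  = ⊥-elim (n refl)
      ... | false = refl

      distinct⁺ : ∀ (ρ : Fin N → Pos a) {x y} (d : Dec (x ≡ y)) → (ρ x ≡ ρ y → x ≡ y) → Sat′ ρ (distinct d)
      distinct⁺ ρ (yes _) h = refl
      distinct⁺ ρ (no ¬p) h = ¬p ∘ h

      distinct⁻ : ∀ (ρ : Fin N → Pos a) {x y} (d : Dec (x ≡ y)) → Sat′ ρ (distinct d) → ρ x ≡ ρ y → x ≡ y
      distinct⁻ ρ (yes p) _ _ = p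
      distinct⁻ ρ (no _)  n e = ⊥-elim (n e)

    embedding⇒sat : ComponentEmbedding a₀ a → SatD (Pos a) ltP noFO noFO hasComponent
    embedding⇒sat C = ∃*⁺ N body ρ (bigAnd⁺ N (λ x → bigAnd N (literal x)) (λ x → bigAnd⁺ N (literal x) (λ y →
          order⁺ ρ (rel x y) x y (pres (finPos (a₀ ▸ ε) x) (finPos (a₀ ▸ ε) y)) ,
          distinct⁺ ρ (x Finₚ.≟ y) (λ e → trans (sym (posFin-finPos (a₀ ▸ ε) x)) (trans (cong (posFin (a₀ ▸ ε)) (injective e)) (posFin-finPos (a₀ ▸ ε) y))))) ,
        cl , maximal)
      where
      open ComponentEmbedding C
      ρ : Fin N → Pos a
      ρ x = emb (finPos (a₀ ▸ ε) x)
      cl : Sat′ ρ closure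
      cl y with true-or-false (ltP y (emb top))
      ... | inj₂ e = inj₁ (λ e′ → true≢false e′ e)
      ... | inj₁ e = let p , q = closed y e in inj₂ (bigOr⁺ N listed (posFin (a₀ ▸ ε) p) (trans q (cong emb (sym (finPos-posFin (a₀ ▸ ε) p)))))

    sat⇒embedding : SatD (Pos a) ltP noFO noFO hasComponent → ComponentEmbedding a₀ a
    sat⇒embedding s = record
      { emb = ρ ∘ posFin (a₀ ▸ ε)
      ; injective = λ {p} {q} e → trans (sym (finPos-posFin (a₀ ▸ ε) p)) (trans (cong (finPos (a₀ ▸ ε))
          (distinct⁻ ρ (posFin (a₀ ▸ ε) p Finₚ.≟ posFin (a₀ ▸ ε) q) (proj₂ (pair (posFin (a₀ ▸ ε) p) (posFin (a₀ ▸ ε) q))) e)) (finPos-posFin (a₀ ▸ ε) q))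
      ; pres = λ p q → trans (order⁻ ρ _ _ _ (proj₁ (pair (posFin (a₀ ▸ ε) p) (posFin (a₀ ▸ ε) q)))) (cong₂ ltP (finPos-posFin (a₀ ▸ ε) p) (finPos-posFin (a₀ ▸ ε) q))
      ; closed = cl
      ; maximal = proj₂ (proj₂ (proj₂ found)) }
      where
      found : ∃ λ (ρ : Fin N → Pos a) → Sat′ ρ body
      found = ∃*⁻ N body s
      ρ : Fin N → Pos a
      ρ = proj₁ found
      pair : ∀ x y → Sat′ ρ (order (rel x y) x y) × Sat′ ρ (distinct (x Finₚ.≟ y))
      pair x y = bigAnd⁻ N (literal x) (bigAnd⁻ N (λ x → bigAnd N (literal x)) (proj₁ (proj₂ found)) x) y
      cl : ∀ y → ltP y (ρ Fin.zero) ≡ true → ∃ λ p → y ≡ ρ (posFin (a₀ ▸ ε) p)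
      cl y e with proj₁ (proj₂ (proj₂ found)) y
      ... | inj₁ n = ⊥-elim (n e)
      ... | inj₂ q = let x , eq = bigOr⁻ N listed q in
            finPos (a₀ ▸ ε) x , trans eq (cong ρ (sym (posFin-finPos (a₀ ▸ ε) x)))

  open Recognizer (recognize hasComponent)

  component-recognized : ∀ {a} → Can a₀ → Can a → Recognized.acc hasComponent (Recognized.ty hasComponent a) ≡ does (1 ≤? mult a₀ a)
  component-recognized {a} c₀ ca = bool-ext
    (λ e → ⇒does (1 ≤? mult a₀ a) (embedding⇒component c₀ ca (sat⇒embedding (complete a noFO noFO (trans (cong acc (Recognized.ty-fold hasComponent a (label noFO noFO))) e)))))
    (λ e → trans (cong acc (sym (Recognized.ty-fold hasComponent a (label noFO noFO)))) (sound a noFO noFO (embedding⇒sat (component⇒embedding (does⇒ (1 ≤? mult a₀ a) e)))))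

-- Exponential upper bound and positivity

-- The preorder code of the underlying binary tree. It is prefix-free and has 2n + 1 bits, which is
-- the source of the bound 2^(2n+1).
bits : Fo → List Bool
bits ε       = false ∷ []
bits (a ▸ b) = true ∷ bits a ++ bits b

length-bits : ∀ a → length (bits a) ≡ suc (2 * sz a)
length-bits ε       = refl
length-bits (a ▸ b) = cong suc (trans (length-++ (bits a)) (trans (cong₂ _+_ (length-bits a) (length-bits b)) (arr (sz a) (sz b))))
  where
  arr : ∀ x y → suc (2 * x) + suc (2 * y) ≡ 2 * suc (x + y)
  arr = solve-∀

bits-prefix : ∀ a b {xs ys} → bits a ++ xs ≡ bits b ++ ys → a ≡ b × xs ≡ ys
bits-prefix ε       ε       e = refl , proj₂ (∷-injective e)
bits-prefix (a ▸ b) (c ▸ d) {xs} {ys} e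
  with bits-prefix a c (trans (sym (++-assoc (bits a) (bits b) xs)) (trans (proj₂ (∷-injective e)) (++-assoc (bits c) (bits d) ys)))
... | refl , e′ with bits-prefix b d e′
...   | refl , e″ = refl , e″

pad : ∀ k → List Bool → Vec Bool k
pad zero    _        = []
pad (suc k) []       = false ∷ pad k []
pad (suc k) (x ∷ xs) = x ∷ pad k xs

pad-injective : ∀ k {xs ys} → length xs ≡ k → length ys ≡ k → pad k xs ≡ pad k ys → xs ≡ ys
pad-injective zero    {[]}     {[]}     _ _ _ = refl
pad-injective (suc k) {x ∷ xs} {y ∷ ys} p q e =
  cong₂ _∷_ (Vecₚ.∷-injectiveˡ e) (pad-injective k (suc-injective p) (suc-injective q) (Vecₚ.∷-injectiveʳ e))

count≤2^ : ∀ n P → count n P ≤ 2 ^ suc (2 * n)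
count≤2^ n P = ≤-trans (∑-inj {g = λ _ → 1} (words (suc (2 * n))) (λ a → pad (suc (2 * n)) (bits a)) (E! n)
    (λ {a} _ _ → Finite.complete (finVec (suc (2 * n))) _ , χ≤1 (P a))
    (λ {a} {b} a∈ b∈ _ _ e → proj₁ (bits-prefix a b (cong (_++ []) (pad-injective (suc (2 * n)) (len a∈) (len b∈) e)))))
  (≤-reflexive (count-words (suc (2 * n))))
  where
  len : ∀ {a} → a ∈ E n → length (bits a) ≡ suc (2 * n)
  len {a} a∈ = trans (length-bits a) (cong (λ z → suc (2 * z)) (proj₂ (∈-E⁻ a∈)))

-- Sizes of forests modulo the size of a tree

sz-app : ∀ a b → sz (app a b) ≡ sz a + sz b
sz-app ε       b = refl
sz-app (a ▸ c) b = cong suc (trans (cong (sz a +_) (sz-app c b)) (sym (+-assoc (sz a) (sz c) (sz b))))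

allC-app : ∀ {B} a b → allC B a ≡ true → allC B b ≡ true → allC B (app a b) ≡ true
allC-app ε       b p q = q
allC-app {B} (a ▸ c) b p q = ∧-intro (∧-elimˡ p) (allC-app c b (∧-elimʳ {B a} p) q)

copies : ℕ → Fo → Fo → Fo
copies zero    a b = b
copies (suc k) a b = app a (copies k a b)

sz-copies : ∀ k a b → sz (copies k a b) ≡ k * sz a + sz b
sz-copies zero    a b = refl
sz-copies (suc k) a b = trans (sz-app a _) (trans (cong (sz a +_) (sz-copies k a b)) (sym (+-assoc (sz a) _ _)))

allC-copies : ∀ {B} k a b → allC B a ≡ true → allC B b ≡ true → allC B (copies k a b) ≡ true
allC-copies zero    a b p q = q
allC-copies (suc k) a b p q = allC-app a _ p (allC-copies k a b p q)

sz-norm : ∀ a → sz (norm a) ≡ sz a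
sz-norm ε       = refl
sz-norm (a ▸ b) = trans (size-ins (norm a) (norm b)) (cong₂ (λ x y → suc (x + y)) (sz-norm a) (sz-norm b))

least : ∀ {P : ℕ → Set} → (∀ n → Dec (P n)) → ∀ k → P (suc k) → ∃ λ g → 1 ≤ g × g ≤ suc k × P g × (∀ r → 1 ≤ r → r < g → ¬ P r)
least {P} P? k p = go k 0 (sym (+-identityʳ k)) (λ { (suc r) _ (s≤s ()) })
  where
  go : ∀ fuel j → k ≡ fuel + j → (∀ r → 1 ≤ r → r < suc j → ¬ P r) → ∃ λ g → 1 ≤ g × g ≤ suc k × P g × (∀ r → 1 ≤ r → r < g → ¬ P r)
  go fuel j e below with P? (suc j)
  ... | yes q = suc j , s≤s z≤n , s≤s (≤-trans (m≤n+m j fuel) (≤-reflexive (sym e))) , q , below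
  go zero j e below | no ¬q = ⊥-elim (¬q (subst (P ∘ suc) e p))
  go (suc fuel) j e below | no ¬q = go fuel (suc j) (trans e (sym (+-suc fuel j))) λ r r≥1 r< → case m≤n⇒m<n∨m≡n (≤-pred r<) of λ where
    (inj₁ lt)   → below r r≥1 lt
    (inj₂ refl) → ¬q

module _ (m : ℕ) .{{_ : NonZero m}} where

  %-cong-+ : ∀ a b c d → a % m ≡ b % m → c % m ≡ d % m → (a + c) % m ≡ (b + d) % m
  %-cong-+ a b c d p q = trans (%-distribˡ-+ a c m) (trans (cong₂ (λ x y → (x + y) % m) p q) (sym (%-distribˡ-+ b d m)))

  %-cong-* : ∀ k a b → a % m ≡ b % m → (k * a) % m ≡ (k * b) % m
  %-cong-* zero    a b p = refl
  %-cong-* (suc k) a b p = %-cong-+ a b (k * a) (k * b) p (%-cong-* k a b p)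

  %-difference : ∀ {a b} → b ≤ a → a % m ≡ b % m → ∃ λ j → a ≡ b + j * m
  %-difference {a} {b} le e = a / m ∸ b / m , (begin
    a                                              ≡⟨ m≡m%n+[m/n]*n a m ⟩
    a % m + a / m * m                              ≡⟨ cong₂ (λ x y → x + y * m) e (sym (m+[n∸m]≡n (/-monoˡ-≤ m le))) ⟩
    b % m + (b / m + (a / m ∸ b / m)) * m          ≡⟨ arr (b % m) (b / m) (a / m ∸ b / m) m ⟩
    b % m + b / m * m + (a / m ∸ b / m) * m        ≡⟨ cong (_+ (a / m ∸ b / m) * m) (sym (m≡m%n+[m/n]*n b m)) ⟩
    b + (a / m ∸ b / m) * m                        ∎)
    where
    open ≡-Reasoning
    arr : ∀ r x y m → r + (x + y) * m ≡ r + x * m + y * m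
    arr = solve-∀

module Positivity (A : Alg (Label 0 0)) (acc : Alg.M A → Bool) (a₀ : Fo) (acc-a₀ : acc (Typed.κ A a₀) ≡ true)
                  (d : ℕ) (d∣ : ∀ G → allC (acc ∘ Typed.κ A) G ≡ true → d ∣ sz G)
                  (greatest : ∀ e → (∀ G → allC (acc ∘ Typed.κ A) G ≡ true → e ∣ sz G) → e ∣ d) where
  open Typed A

  private
    T : Fo → Bool
    T a = acc (κ a)

    m : ℕ
    m = suc (sz a₀)

    T-tree : allC T (a₀ ▸ ε) ≡ true
    T-tree = ∧-intro acc-a₀ refl

    sz-tree : sz (a₀ ▸ ε) ≡ m
    sz-tree = cong suc (+-identityʳ (sz a₀))

    Real : ℕ → Set
    Real r = ∃ λ G → allC T G ≡ true × sz G % m ≡ r % m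

    X : Set
    X = M × (Bool × Fin m)

    md : ℕ → Fin m
    md k = fromℕ< (m%n<n k m)

    op : X → X → X
    op (x , _ , i) (y , c , j) = rt ([] , []) x ∙ y , acc (rt ([] , []) x) ∧ c , md (suc (toℕ i + toℕ j))

    module Ev = Evaluation (fin× fin (fin× finBool (finFin m))) (e₀ , true , Fin.zero) op

    toℕ-md : ∀ k → toℕ (md k) ≡ k % m
    toℕ-md k = Finₚ.toℕ-fromℕ< (m%n<n k m)

    ev-ty : ∀ a → proj₁ (Ev.ev a) ≡ ty a
    ev-ty ε       = refl
    ev-ty (a ▸ b) = cong₂ (λ x y → rt ([] , []) x ∙ y) (ev-ty a) (ev-ty b)

    ev-all : ∀ a → proj₁ (proj₂ (Ev.ev a)) ≡ allC T a
    ev-all ε       = refl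
    ev-all (a ▸ b) = cong₂ (λ x y → acc (rt ([] , []) x) ∧ y) (ev-ty a) (ev-all b)

    ev-size : ∀ a → toℕ (proj₂ (proj₂ (Ev.ev a))) ≡ sz a % m
    ev-size ε       = refl
    ev-size (a ▸ b) = trans (toℕ-md (suc (toℕ (proj₂ (proj₂ (Ev.ev a))) + toℕ (proj₂ (proj₂ (Ev.ev b)))))) (%-cong-+ m 1 1 (toℕ (proj₂ (proj₂ (Ev.ev a))) + toℕ (proj₂ (proj₂ (Ev.ev b)))) (sz a + sz b) refl (trans (cong₂ (λ x y → (x + y) % m) (ev-size a) (ev-size b)) (sym (%-distribˡ-+ (sz a) (sz b) m))))

    real? : ∀ r → Dec (Real r)
    real? r = map′ (λ (a , p , q) → a , trans (sym (ev-all a)) p , trans (sym (ev-size a)) q) (λ (a , p , q) → a , trans (ev-all a) p , trans (ev-size a) q)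
      (Ev.realizable? {λ (_ , b , i) → b ≡ true × toℕ i ≡ r % m} (λ (_ , b , i) → (b Data.Bool.≟ true) ×-dec (toℕ i ≟ r % m)))

    abstract
      -- The gcd is found as the least positive residue modulo m that is realised by a size. The
      -- search is effective because a finite algebra can track membership together with the size
      -- modulo m; residue m itself is realised by the tree of `a₀`.
      minimal : ∃ λ g → 1 ≤ g × g ≤ m × Real g × (∀ r → 1 ≤ r → r < g → ¬ Real r)
      minimal = least real? (sz a₀) (a₀ ▸ ε , T-tree , cong (_% m) sz-tree)

    g : ℕ
    g = proj₁ minimal

    g≥1 : 1 ≤ g
    g≥1 = proj₁ (proj₂ minimal)

    g≤m : g ≤ m
    g≤m = proj₁ (proj₂ (proj₂ minimal))

    G₁ : Fo
    G₁ = proj₁ (proj₁ (proj₂ (proj₂ (proj₂ minimal))))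

    T-G₁ : allC T G₁ ≡ true
    T-G₁ = proj₁ (proj₂ (proj₁ (proj₂ (proj₂ (proj₂ minimal)))))

    sz-G₁ : sz G₁ % m ≡ g % m
    sz-G₁ = proj₂ (proj₂ (proj₁ (proj₂ (proj₂ (proj₂ minimal)))))

    instance
      g≢0 : NonZero g
      g≢0 = >-nonZero g≥1

    -- Since `sz a₀` is m - 1, it acts as -1 modulo m: adding q * sz a₀ copies of `G₁` subtracts q *
    -- g from the size of G. With q = sz G / g the remainder of the division would become a smaller
    -- realised residue.
    g∣size : ∀ G → allC T G ≡ true → g ∣ sz G
    g∣size G p with sz G % g in eq
    ... | zero  = m%n≡0⇒n∣m (sz G) g eq
    ... | suc r = ⊥-elim (proj₂ (proj₂ (proj₂ (proj₂ minimal))) (suc r) (s≤s z≤n) (subst (_< g) eq (m%n<n (sz G) g))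
                    (copies (q * sz a₀) G₁ G , allC-copies (q * sz a₀) G₁ G T-G₁ p , (begin
        sz (copies (q * sz a₀) G₁ G) % m          ≡⟨ cong (_% m) (sz-copies (q * sz a₀) G₁ G) ⟩
        (q * sz a₀ * sz G₁ + sz G) % m            ≡⟨ %-cong-+ m (q * sz a₀ * sz G₁) (q * sz a₀ * g) (sz G) (sz G) (%-cong-* m (q * sz a₀) (sz G₁) g sz-G₁) refl ⟩
        (q * sz a₀ * g + sz G) % m                ≡⟨ cong (λ z → (q * sz a₀ * g + z) % m) (trans (m≡m%n+[m/n]*n (sz G) g) (cong (_+ q * g) eq)) ⟩
        (q * sz a₀ * g + (suc r + q * g)) % m     ≡⟨ cong (_% m) (arr q (sz a₀) g (suc r)) ⟩
        (suc r + q * g * m) % m                   ≡⟨ [m+kn]%n≡m%n (suc r) (q * g) m ⟩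
        suc r % m                                 ∎)))
      where
      open ≡-Reasoning
      q : ℕ
      q = sz G / g
      arr : ∀ q s g r → q * s * g + (r + q * g) ≡ r + q * g * suc s
      arr = solve-∀

    d∣m : d ∣ m
    d∣m = subst (d ∣_) sz-tree (d∣ (a₀ ▸ ε) T-tree)

    d∣g : d ∣ g
    d∣g with m≤n⇒m<n∨m≡n g≤m
    ... | inj₂ e  = subst (d ∣_) (sym e) d∣m
    ... | inj₁ lt = ∣m+n∣m⇒∣n (subst (d ∣_) (trans (m≡m%n+[m/n]*n (sz G₁) m) (trans (cong (_+ sz G₁ / m * m) (trans sz-G₁ (m<n⇒m%n≡m lt))) (+-comm g _))) (d∣ G₁ T-G₁)) (∣n⇒∣m*n (sz G₁ / m) d∣m)

    d≡g : d ≡ g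
    d≡g = ∣-antisym d∣g (greatest g g∣size)

  divisor≥1 : 1 ≤ d
  divisor≥1 = subst (1 ≤_) (sym d≡g) g≥1

  -- Modulo m, n * d agrees with the size of n % m copies of `G₁`; the difference is a multiple of m
  -- and is filled with copies of the tree of `a₀`. The bound on n ensures that the copies of `G₁`
  -- fit.
  exists-size : ∃[ N ] ∀ n → N ≤ n → ∃ λ G → allC T G ≡ true × sz G ≡ n * d
  exists-size = m * sz G₁ , λ n le →
    let b = n % m * sz G₁
        b≤ : b ≤ n * d
        b≤ = ≤-trans (*-monoˡ-≤ (sz G₁) (<⇒≤ (m%n<n n m))) (≤-trans le (≤-trans (≤-reflexive (sym (*-identityʳ n))) (*-monoʳ-≤ n divisor≥1)))
        j , e = %-difference m b≤ (residue n)
    in copies j (a₀ ▸ ε) (copies (n % m) G₁ ε) , allC-copies j (a₀ ▸ ε) _ T-tree (allC-copies (n % m) G₁ ε T-G₁ refl) ,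
       trans (sz-copies j (a₀ ▸ ε) _) (trans (cong₂ _+_ (cong (j *_) sz-tree) (trans (sz-copies (n % m) G₁ ε) (+-identityʳ b))) (trans (+-comm (j * m) b) (sym e)))
    where
    residue : ∀ n → n * d % m ≡ n % m * sz G₁ % m
    residue n = begin
      n * d % m            ≡⟨ cong (λ z → n * z % m) d≡g ⟩
      n * g % m            ≡⟨ cong (_% m) (*-comm n g) ⟩
      g * n % m            ≡⟨ %-cong-* m g n (n % m) (sym (m%n%n≡m%n n m)) ⟩
      g * (n % m) % m      ≡⟨ cong (_% m) (*-comm g (n % m)) ⟩
      n % m * g % m        ≡⟨ %-cong-* m (n % m) g (sz G₁) (sym sz-G₁) ⟩
      n % m * sz G₁ % m    ∎
      where open ≡-Reasoning

  private
    allC-norm : ∀ G → allC T (norm G) ≡ allC T G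
    allC-norm ε       = refl
    allC-norm (a ▸ b) = trans (allC-ins T (norm a) (norm b)) (cong₂ _∧_ (cong (acc ∘ rt ([] , [])) (ty-~ (norm-~ a))) (allC-norm b))

  count-positive : ∃[ N ] ∀ n → N ≤ n → 0 < count (n * d) (allC T)
  count-positive = proj₁ exists-size , λ n le → let G , p , s = proj₂ exists-size n le in
    ≤-trans (≤-reflexive (sym (cong χ (trans (allC-norm G) p)))) (∑-∈ (λ a → χ (allC T a)) (∈-E⁺′ (Can-norm G) (trans (sz-norm G) s)))

-- The zero-one law

module RichForests (A : Alg (Label 0 0)) where
  open Typed A

  prod : (M → ℕ) → List M → M
  prod n []       = e₀
  prod n (τ ∷ τs) = pw (n τ) τ ∙ prod n τs

  prod-cong : ∀ {n n′} τs → (∀ {τ} → τ ∈ τs → pw (n τ) τ ≡ pw (n′ τ) τ) → prod n τs ≡ prod n′ τs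
  prod-cong []       h = refl
  prod-cong (τ ∷ τs) h = cong₂ _∙_ (h (here refl)) (prod-cong τs (h ∘ there))

  prod-suc : ∀ n {σ} τs → Unique τs → σ ∈ τs → σ ∙ prod n τs ≡ prod (λ τ → χ (σ ≡ᴹ τ) + n τ) τs
  prod-suc n {σ} (.σ ∷ τs) (σ∉ ∷ u) (here refl) = trans (sym (assoc σ _ _)) (cong₂ _∙_
    (cong (λ z → pw (χ z + n σ) σ) (sym (dec-true (σ ≈? σ) refl)))
    (prod-cong τs (λ {τ} τ∈ → cong (λ z → pw (χ z + n τ) τ) (sym (dec-false (σ ≈? τ) (All.lookup σ∉ τ∈))))))
  prod-suc n {σ} (τ ∷ τs) (τ∉ ∷ u) (there p) = trans (swap-∙ σ _ _) (cong₂ _∙_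
    (cong (λ z → pw (χ z + n τ) τ) (sym (dec-false (σ ≈? τ) (λ e → All.lookup τ∉ p (sym e)))))
    (prod-suc n τs u p))

  typeMult : M → Fo → ℕ
  typeMult τ = csum (λ a → χ (κ a ≡ᴹ τ))

  ty-prod : ∀ G → ty G ≡ prod (λ τ → typeMult τ G) elems
  ty-prod ε       = sym (trivial elems)
    where
    trivial : ∀ τs → prod (λ _ → 0) τs ≡ e₀
    trivial []       = refl
    trivial (τ ∷ τs) = trans (idˡ _) (trivial τs)
  ty-prod (a ▸ b) = trans (cong (κ a ∙_) (ty-prod b)) (prod-suc (λ τ → typeMult τ b) elems unique (complete (κ a)))

  mult≤typeMult : ∀ a G → mult a G ≤ typeMult (κ a) G
  mult≤typeMult a ε       = z≤n
  mult≤typeMult a (b ▸ c) = +-mono-≤ lem (mult≤typeMult a c)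
    where
    lem : χ (a == b) ≤ χ (κ b ≡ᴹ κ a)
    lem with a ≟F b
    ... | yes refl = ≤-reflexive (sym (χ-yes (κ b ≈? κ b) refl))
    ... | no _     = z≤n

  module _ (T : Fo → Bool) (Realized : M → Set) (realized? : ∀ τ → Dec (Realized τ))
           (realized : ∀ a → T a ≡ true → Realized (κ a)) where

    richType : M
    richType = prod (λ τ → χ (does (realized? τ)) * threshold) elems

    -- By `ty-prod` only the powers of the tree types matter: those of realised types have passed
    -- the threshold, where powers are constant, and those of all other types have exponent 0.
    rich-type : ∀ G → allC T G ≡ true → (∀ τ → Realized τ → threshold ≤ typeMult τ G) → ty G ≡ richType
    rich-type G p rich = trans (ty-prod G) (prod-cong elems (λ {τ} _ → pt τ))
      where
      absent : ∀ τ → ¬ Realized τ → ∀ G → allC T G ≡ true → typeMult τ G ≡ 0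
      absent τ ¬r ε       p = refl
      absent τ ¬r (a ▸ b) p = cong₂ _+_ (χ-no (κ a ≈? τ) (λ e → ¬r (subst Realized e (realized a (∧-elimˡ p))))) (absent τ ¬r b (∧-elimʳ {T a} p))
      pt : ∀ τ → pw (typeMult τ G) τ ≡ pw (χ (does (realized? τ)) * threshold) τ
      pt τ with realized? τ
      ... | yes r = trans (pw-stable _ τ (rich τ r)) (cong (λ z → pw z τ) (sym (+-identityʳ threshold)))
      ... | no ¬r = cong (λ z → pw z τ) (absent τ ¬r G p)

module ZeroOne (φ : Sentence) (adq : Adequate (MSOForestClass φ))
               (sub : SubExp (λ k → count k (AdequateClass.T φ adq)))
               (ψ : Sentence) where
  open AdequateClass φ adq
  private
    module Ψ = Recognized ψ
    -- The product algebra records membership in the class and the truth of ψ at once, so that a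
    -- single typical type settles both.
    P : Alg (Label 0 0)
    P = alg ⊗ Ψ.alg
    module TP = Typed P
    module RF = RichForests P
    open Alg P using (M; fin; elems; complete; unique; _≈?_; threshold)

    ty-pair : ∀ a → TP.ty a ≡ (ty a , Ψ.ty a)
    ty-pair ε       = refl
    ty-pair (a ▸ b) = cong₂ (λ x y → Alg._∙_ P (Alg.rt P ([] , []) x) y) (ty-pair a) (ty-pair b)

    Realized : M → Set
    Realized τ = ∃ λ a → T a ≡ true × TP.κ a ≡ τ

    module Ev = Evaluation fin (Alg.e₀ P) (λ x y → Alg._∙_ P (Alg.rt P ([] , []) x) y)

    ev-ty : ∀ a → Ev.ev a ≡ TP.ty a
    ev-ty ε       = refl
    ev-ty (a ▸ b) = cong₂ (λ x y → Alg._∙_ P (Alg.rt P ([] , []) x) y) (ev-ty a) (ev-ty b)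

    abstract
      realized? : ∀ τ → Dec (Realized τ)
      realized? τ = map′
        (λ (a , p , q) → a , trans (cong (acc ∘ proj₁ ∘ Alg.rt P ([] , [])) (sym (trans (ev-ty a) (ty-pair a)))) p , trans (cong (Alg.rt P ([] , [])) (sym (ev-ty a))) q)
        (λ (a , p , q) → a , trans (cong (acc ∘ proj₁ ∘ Alg.rt P ([] , [])) (trans (ev-ty a) (ty-pair a))) p , trans (cong (Alg.rt P ([] , [])) (ev-ty a)) q)
        (Ev.realizable? {λ x → acc (proj₁ (Alg.rt P ([] , []) x)) ≡ true × Alg.rt P ([] , []) x ≡ τ}
          (λ x → (acc (proj₁ (Alg.rt P ([] , []) x)) Data.Bool.≟ true) ×-dec (Alg.rt P ([] , []) x ≈? τ)))

    μ : M
    μ = RF.richType T Realized realized? (λ a p → a , p , refl)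

    all : ℕ → ℕ
    all n = count n (allC T)

    representative : ∀ {τ} → Realized τ → ∃ λ a → Can a × T a ≡ true × TP.κ a ≡ τ
    representative (a , p , q) = norm a , Can-norm a , trans (cong (acc ∘ Alg.rt alg ([] , [])) (ty-~ (norm-~ a))) p , trans (cong (Alg.rt P ([] , [])) (TP.ty-~ (norm-~ a))) q

    few : ∀ {τ} → Dec (Realized τ) → ℕ → ℕ
    few (yes r) n = let a , _ = representative r in count n (λ G → allC T G ∧ does (suc (mult a G) ≤? threshold))
    few (no _)  n = 0

    few-rare : ∀ {τ} (r : Dec (Realized τ)) L → ∃[ N ] ∀ n → N ≤ n → L * few r n ≤ all n
    few-rare (yes r) L = let a , ca , t , _ = representative r in
      Components.few-rare T a ca t (Rarity.rare alg acc sub a ca t) threshold L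
    few-rare (no _)  L = 0 , λ n _ → ≤-trans (≤-reflexive (*-zeroʳ L)) z≤n

    atypical : ℕ → ℕ
    atypical n = count n (λ G → allC T G ∧ not (TP.ty G TP.≡ᴹ μ))

    -- A forest of the class without the rich type has fewer than `threshold` components of some
    -- realised type, hence also fewer than `threshold` copies of the tree chosen to represent it.
    -- This leaves finitely many trees to which `few-rare` applies.
    atypical-few : ∀ n → atypical n ≤ ∑ elems (λ τ → few (realized? τ) n)
    atypical-few n = ≤-trans (∑-mono (E n) (λ {G} _ → pt G)) (≤-trans (≤-reflexive (∑-swap (E n) elems _)) (∑-mono elems (λ {τ} _ → le (realized? τ))))
      where
      ind : ∀ {τ} → Dec (Realized τ) → Fo → ℕ
      ind (yes r) G = χ (allC T G ∧ does (suc (mult (proj₁ (representative r)) G) ≤? threshold))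
      ind (no _)  G = 0
      le : ∀ {τ} (r : Dec (Realized τ)) → ∑ (E n) (ind r) ≤ few r n
      le (yes r) = ≤-refl
      le (no _)  = ≤-reflexive (∑-0 (E n))
      pt : ∀ G → χ (allC T G ∧ not (TP.ty G TP.≡ᴹ μ)) ≤ ∑ elems (λ τ → ind (realized? τ) G)
      pt G with ∑ elems (λ τ → ind (realized? τ) G) in eq
      ... | suc _ = ≤-trans (χ≤1 (allC T G ∧ not (TP.ty G TP.≡ᴹ μ))) (s≤s z≤n)
      ... | zero with true-or-false (allC T G)
      ...   | inj₂ f = ≤-reflexive (cong (λ z → χ (z ∧ not (TP.ty G TP.≡ᴹ μ))) f)
      ...   | inj₁ t = ≤-reflexive (cong χ (trans (cong (_∧ not (TP.ty G TP.≡ᴹ μ)) t) (cong not (⇒does (TP.ty G ≈? μ) (RF.rich-type T Realized realized? (λ a p → a , p , refl) G t rich)))))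
        where
        rich : ∀ τ → Realized τ → threshold ≤ RF.typeMult τ G
        rich τ r = go (realized? τ) (∑≡0⇒ {f = λ τ → ind (realized? τ) G} eq (complete τ))
          where
          go : (r : Dec (Realized τ)) → ind r G ≡ 0 → threshold ≤ RF.typeMult τ G
          go (no ¬r) _ = ⊥-elim (¬r r)
          go (yes r) z = let a , ca , ta , κa = representative r in
            ≤-trans (≮⇒≥ (λ lt → case trans (sym (cong χ (∧-intro t (⇒does (suc (mult a G) ≤? threshold) lt)))) z of λ ()))
              (≤-trans (RF.mult≤typeMult a G) (≤-reflexive (cong (λ z → RF.typeMult z G) κa)))

    atypical-rare : ∀ L → ∃[ N ] ∀ n → N ≤ n → L * atypical n ≤ all n
    atypical-rare L with max-bound elems (λ τ n → L * suc (length elems) * few (realized? τ) n ≤ all n) (λ τ → few-rare (realized? τ) (L * suc (length elems)))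
    ... | N , b = N , λ n le → *-cancelˡ-≤ (suc (length elems)) (begin
      suc (length elems) * (L * atypical n)                                    ≤⟨ *-monoʳ-≤ (suc (length elems)) (*-monoʳ-≤ L (atypical-few n)) ⟩
      suc (length elems) * (L * ∑ elems (λ τ → few (realized? τ) n))           ≡⟨ arr (suc (length elems)) L _ ⟩
      L * suc (length elems) * ∑ elems (λ τ → few (realized? τ) n)             ≡⟨ sym (∑-*ˡ elems (L * suc (length elems)) _) ⟩
      ∑ elems (λ τ → L * suc (length elems) * few (realized? τ) n)             ≤⟨ ∑-≤ {xs = elems} _ (all n) (λ τ∈ → b τ∈ n le) ⟩
      length elems * all n                                                     ≤⟨ m≤n+m _ (all n) ⟩
      suc (length elems) * all n                                               ∎)
      where
      open ≤-Reasoning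
      arr : ∀ x y z → x * (y * z) ≡ y * x * z
      arr = solve-∀

  holds fails : ℕ → ℕ
  holds n = count n (λ G → allC T G ∧ Ψ.acc (Ψ.ty G))
  fails n = count n (λ G → allC T G ∧ not (Ψ.acc (Ψ.ty G)))

  holds+fails : ∀ n → count n (allC T) ≡ holds n + fails n
  holds+fails n = trans (∑-cong (E n) (λ {G} _ → pt (allC T G) (Ψ.acc (Ψ.ty G)))) (∑-+ (E n) _ _)
    where
    pt : ∀ x y → χ x ≡ χ (x ∧ y) + χ (x ∧ not y)
    pt true  true  = refl
    pt true  false = refl
    pt false _     = refl

  private
    χ-∧-≤ : ∀ x y → χ (x ∧ y) ≤ χ (x ∧ true)
    χ-∧-≤ true  y = χ≤1 y
    χ-∧-≤ false y = z≤n

  -- Almost all forests have the type `μ`, and its second component carries the value of ψ.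
  dichotomy : (∀ L → ∃[ N ] ∀ n → N ≤ n → L * holds n ≤ count n (allC T)) ⊎ (∀ L → ∃[ N ] ∀ n → N ≤ n → L * fails n ≤ count n (allC T))
  dichotomy with true-or-false (Ψ.acc (proj₂ μ))
  ... | inj₁ t = inj₂ λ L → let N , b = atypical-rare L in N , λ n le → ≤-trans (*-monoʳ-≤ L (∑-mono (E n) (λ {G} _ → pt t G))) (b n le)
    where
    pt : Ψ.acc (proj₂ μ) ≡ true → ∀ G → χ (allC T G ∧ not (Ψ.acc (Ψ.ty G))) ≤ χ (allC T G ∧ not (TP.ty G TP.≡ᴹ μ))
    pt t G with TP.ty G ≈? μ
    ... | no _  = χ-∧-≤ (allC T G) (not (Ψ.acc (Ψ.ty G)))
    ... | yes e = ≤-reflexive (cong (λ z → χ (allC T G ∧ not z)) (trans (cong (Ψ.acc ∘ proj₂) (trans (sym (ty-pair G)) e)) t))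
  ... | inj₂ f = inj₁ λ L → let N , b = atypical-rare L in N , λ n le → ≤-trans (*-monoʳ-≤ L (∑-mono (E n) (λ {G} _ → pt f G))) (b n le)
    where
    pt : Ψ.acc (proj₂ μ) ≡ false → ∀ G → χ (allC T G ∧ Ψ.acc (Ψ.ty G)) ≤ χ (allC T G ∧ not (TP.ty G TP.≡ᴹ μ))
    pt f G with TP.ty G ≈? μ
    ... | no _  = χ-∧-≤ (allC T G) (Ψ.acc (Ψ.ty G))
    ... | yes e = ≤-reflexive (cong (λ z → χ (allC T G ∧ z)) (trans (cong (Ψ.acc ∘ proj₂) (trans (sym (ty-pair G)) e)) f))

-- Equivalence of the zero-one law and the two radius conditions

module Equivalence (φ : Sentence) (inhabited : Σ Str (MSOForestClass φ)) (adq : Adequate (MSOForestClass φ))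
                   (f : ℕ → ℕ) (fc : CountingFunction (MSOForestClass φ) f)
                   (t : ℕ → ℕ) (tc : CountingFunction (TreesOf (MSOForestClass φ)) t)
                   (d : ℕ) (gcd : IsGcdOfSizes (MSOForestClass φ) d) where
  open AdequateClass φ adq

  private
    first-tree : ∀ G → Can G → nonempty G ∧ allC T G ≡ true → ∃ λ a → Can a × T a ≡ true
    first-tree (a ▸ b) (ca , _) p = a , ca , ∧-elimˡ p

    abstract
      some-tree : ∃ λ a → Can a × T a ≡ true
      some-tree = let G , cG , _ , p = Counted.shape counted (proj₁ inhabited) (proj₂ inhabited) in first-tree G cG p

    a₀ : Fo
    a₀ = proj₁ some-tree

    can-a₀ : Can a₀
    can-a₀ = proj₁ (proj₂ some-tree)

    T-a₀ : T a₀ ≡ true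
    T-a₀ = proj₂ (proj₂ some-tree)

    module C = Components T a₀ can-a₀ T-a₀
    open C using (all; m)

    all≡f : ∀ {n} → 1 ≤ n → f n ≡ all n
    all≡f {suc n} _ = forest-counts fc n

    f≤all : ∀ n → f n ≤ all n
    f≤all n = ≤-trans (≤-reflexive (counted-unique counted fc n)) (∑-mono (E n) (λ {a} _ → pt (nonempty a) (allC T a)))
      where
      pt : ∀ x y → χ (x ∧ y) ≤ χ y
      pt true  y = ≤-refl
      pt false y = z≤n

    d∣size : ∀ G → allC T G ≡ true → d ∣ sz G
    d∣size ε           p = divides 0 refl
    d∣size G@(_ ▸ _)   p = proj₁ gcd (strOf G) (forest-member G (λ ()) p)

    greatest : ∀ e → (∀ G → allC T G ≡ true → e ∣ sz G) → e ∣ d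
    greatest e h = proj₂ gcd e λ S c → let G , _ , I , p = Counted.shape counted S c in
      subst (e ∣_) (sym (rep-size I)) (h G (∧-elimʳ {nonempty G} p))

    module Pos₊ = Positivity alg acc a₀ T-a₀ d d∣size greatest

    n≤n*d : ∀ n → n ≤ n * d
    n≤n*d n = ≤-trans (≤-reflexive (sym (*-identityʳ n))) (*-monoʳ-≤ n Pos₊.divisor≥1)

    radius≤1 : RadiusLe1 f
    radius≤1 = infinite⇒radius≤1 λ N → suc N * m , ≤-trans (n≤1+n N) (≤-trans (≤-reflexive (sym (*-identityʳ (suc N)))) (*-monoʳ-≤ (suc N) (s≤s z≤n))) ,
      subst (0 <_) (sym (all≡f {suc N * m} (s≤s z≤n))) (≤-trans (≤-reflexive (sym (cong χ (copies-T (suc N)))))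
        (∑-∈ (λ a → χ (allC T a)) (∈-E⁺′ (Can-insn (suc N) can-a₀ tt) (trans (size-insn (suc N) a₀ ε) (+-identityʳ _)))))
      where
      copies-T : ∀ i → allC T (insn i a₀ ε) ≡ true
      copies-T zero    = refl
      copies-T (suc i) = trans (allC-ins T a₀ (insn i a₀ ε)) (∧-intro T-a₀ (copies-T i))

    subexp⇒radius≡1 : SubExp all → RadiusEq1 f
    subexp⇒radius≡1 sub = subexp⇒radius (λ s s≥1 → let B , b = sub s s≥1 in B , λ n → ≤-trans (*-monoˡ-≤ (s ^ n) (f≤all n)) (b n)) , radius≤1

    trees-subexp : RadiusGe1 t → SubExp (λ k → count k T)
    trees-subexp rad = tree-subexp tc (radius⇒subexp rad)

  forest-radius⇒tree-radius : RadiusEq1 f → RadiusGe1 t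
  forest-radius⇒tree-radius (rad , _) = subexp⇒radius λ s s≥1 →
    let B , b = radius⇒subexp rad s s≥1 in B , λ n → ≤-trans (*-monoˡ-≤ (s ^ n) (tree≤forest fc tc n)) (b n)

  tree-radius⇒forest-radius : RadiusGe1 t → RadiusEq1 f
  tree-radius⇒forest-radius rad = subexp⇒radius≡1 (C.all-subexp (Rarity.rare alg acc (trees-subexp rad) a₀ can-a₀ T-a₀))

  radius⇒zero-one : RadiusEq1 f → ZeroOneLaw (MSOForestClass φ) f d
  radius⇒zero-one rad ψ fψ cψ = [ inj₁ ∘ limit-zero , inj₂ ∘ limit-one ]′ Z.dichotomy
    where
    module Z = ZeroOne φ adq (trees-subexp (forest-radius⇒tree-radius rad)) ψ
    fψ≡ : ∀ {n} → 1 ≤ n → fψ n ≡ Z.holds n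
    fψ≡ {suc n} _ = restricted-counts fc ψ cψ n
    -- The `suc` keeps n * d positive: at size 0, `all` counts the empty forest and f does not.
    module At (N₁ n : ℕ) (le : suc (N₁ + proj₁ Pos₊.count-positive) ≤ n) where
      n≥1 : 1 ≤ n * d
      n≥1 = ≤-trans (s≤s z≤n) (≤-trans le (n≤n*d n))
      n≥N₁ : N₁ ≤ n * d
      n≥N₁ = ≤-trans (≤-trans (m≤m+n N₁ _) (<⇒≤ le)) (n≤n*d n)
      positive : 0 < f (n * d)
      positive = subst (0 <_) (sym (all≡f n≥1)) (proj₂ Pos₊.count-positive n (≤-trans (m≤n+m _ N₁) (<⇒≤ le)))
      f≡ : f (n * d) ≡ Z.holds (n * d) + Z.fails (n * d)
      f≡ = trans (all≡f n≥1) (Z.holds+fails (n * d))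
    limit-zero : (∀ L → ∃[ N ] ∀ n → N ≤ n → L * Z.holds n ≤ all n) → LimitZero fψ f d
    limit-zero rare k = suc (N₁ + proj₁ Pos₊.count-positive) , λ n le → let open At N₁ n le in
        positive , subst₂ (λ x y → suc k * x ≤ y) (sym (fψ≡ n≥1)) (sym (all≡f n≥1)) (proj₂ (rare (suc k)) (n * d) n≥N₁)
      where
      N₁ : ℕ
      N₁ = proj₁ (rare (suc k))
    limit-one : (∀ L → ∃[ N ] ∀ n → N ≤ n → L * Z.fails n ≤ all n) → LimitOne fψ f d
    limit-one rare k = suc (N₁ + proj₁ Pos₊.count-positive) , λ n le → let open At N₁ n le in
        positive , subst₂ _≤_ (sym (fψ≡ n≥1)) (sym f≡) (m≤m+n _ _) ,
        subst₂ (λ x y → suc k * x ≤ y) (sym (trans (cong₂ _∸_ f≡ (fψ≡ n≥1)) (m+n∸m≡n (Z.holds (n * d)) _))) (sym (all≡f n≥1))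
          (proj₂ (rare (suc k)) (n * d) n≥N₁)
      where
      N₁ : ℕ
      N₁ = proj₁ (rare (suc k))

  private
    ψ₀ : Sentence
    ψ₀ = ComponentSentence.hasComponent a₀

    f₀ : ℕ → ℕ
    f₀ n = count n (λ a → (nonempty a ∧ allC T a) ∧ Recognized.acc ψ₀ (Recognized.ty ψ₀ a))

    f₀-counts : CountingFunction (Restrict (MSOForestClass φ) ψ₀) f₀
    f₀-counts = counted⇒countIs (restricted ψ₀)

    -- Deleting one copy of `a₀` is a bijection from the forests with this component onto all
    -- forests of size n ∸ m, the empty one included.
    f₀≡ : ∀ n → m ≤ n → f₀ n ≡ all (n ∸ m)
    f₀≡ (suc n) le = begin
      f₀ (suc n)
        ≡⟨ restricted-counts fc ψ₀ f₀-counts n ⟩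
      count (suc n) (λ a → allC T a ∧ Recognized.acc ψ₀ (Recognized.ty ψ₀ a))
        ≡⟨ ∑-cong (E (suc n)) (λ {G} G∈ → trans (χ-∧ (allC T G) _) (cong (λ z → χ (allC T G) * χ z) (ComponentSentence.component-recognized a₀ can-a₀ (proj₁ (∈-E⁻ G∈))))) ⟩
      ∑ (E (suc n)) (λ G → χ (allC T G) * χ (does (1 ≤? mult a₀ G)))
        ≡⟨ count-removed (allC T) (suc n) a₀ 1 can-a₀ ⟩
      χ (does (1 * m ≤? suc n)) * count (suc n ∸ 1 * m) (λ H → allC T (ins a₀ H))
        ≡⟨ cong (_* count (suc n ∸ 1 * m) (λ H → allC T (ins a₀ H))) (χ-yes (1 * m ≤? suc n) (≤-trans (≤-reflexive (+-identityʳ m)) le)) ⟩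
      1 * count (suc n ∸ 1 * m) (λ H → allC T (ins a₀ H))
        ≡⟨ +-identityʳ _ ⟩
      count (suc n ∸ 1 * m) (λ H → allC T (ins a₀ H))
        ≡⟨ count-cong (suc n ∸ 1 * m) (λ {H} _ → trans (allC-ins T a₀ H) (cong (_∧ allC T H) T-a₀)) ⟩
      all (suc n ∸ 1 * m)
        ≡⟨ cong (λ z → all (suc n ∸ z)) (+-identityʳ m) ⟩
      all (suc n ∸ m) ∎
      where open ≡-Reasoning

    d∣m : d ∣ m
    d∣m = subst (d ∣_) (cong suc (+-identityʳ (sz a₀))) (d∣size (a₀ ▸ ε) (∧-intro T-a₀ refl))

  -- If almost no forest had a₀ as a component, `all` would outgrow every exponential.
  ¬limit-zero-from : ∀ m′ → m ≡ m′ * d → ∀ N →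
    (∀ n → N ≤ n → (0 < f (n * d)) × (suc (2 * 4 ^ m ∸ 1) * f₀ (n * d) ≤ f (n * d))) → ⊥
  ¬limit-zero-from m′ m≡ N bound = <-irrefl refl (≤-trans (n<2^n B) (*-cancelʳ-≤ _ _ ((4 ^ m) ^ B) {{>-nonZero (m^n>0 (4 ^ m) {{>-nonZero (m^n>0 4 m)}} B)}} (begin
      2 ^ B * (4 ^ m) ^ B                      ≡⟨ sym (^-distribʳ-* 2 (4 ^ m) B) ⟩
      (2 * 4 ^ m) ^ B                          ≤⟨ grow B ⟩
      all (N * d + B * m)                      ≤⟨ count≤2^ (N * d + B * m) (allC T) ⟩
      2 ^ suc (2 * (N * d + B * m))            ≡⟨ cong (2 ^_) (arr (N * d) (B * m)) ⟩
      2 ^ (suc (2 * (N * d)) + 2 * (B * m))    ≡⟨ ^-distribˡ-+-* 2 (suc (2 * (N * d))) (2 * (B * m)) ⟩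
      B * 2 ^ (2 * (B * m))                    ≡⟨ cong (B *_) (trans (sym (^-*-assoc 2 2 (B * m))) (trans (cong (4 ^_) (*-comm B m)) (sym (^-*-assoc 4 m B)))) ⟩
      B * (4 ^ m) ^ B                          ∎)))
    where
    open ≤-Reasoning
    -- Adding m to the size multiplies the upper bound 2^(2n+1) by 4^m, so a growth by K, twice as
    -- much, must overtake it. B is the upper bound at the starting size N * d, and after B steps it
    -- would give 2^B ≤ B. The limit is used with k = K ∸ 1 because it is stated for 1/(k + 1).
    B K : ℕ
    B = 2 ^ suc (2 * (N * d))
    K = 2 * 4 ^ m
    arr : ∀ x y → suc (2 * (x + y)) ≡ suc (2 * x) + 2 * y
    arr = solve-∀
    K≡ : suc (K ∸ 1) ≡ K
    K≡ = m+[n∸m]≡n (*-mono-≤ (s≤s (z≤n {1})) (m^n>0 4 m))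
    step : ∀ n → N ≤ n → K * all (n * d) ≤ all (n * d + m)
    step n le = begin
      K * all (n * d)                         ≡⟨ cong₂ (λ x y → x * all y) (sym K≡) (sym (m+n∸n≡m (n * d) m)) ⟩
      suc (K ∸ 1) * all (n * d + m ∸ m)       ≡⟨ cong (suc (K ∸ 1) *_) (sym (f₀≡ (n * d + m) (m≤n+m m _))) ⟩
      suc (K ∸ 1) * f₀ (n * d + m)            ≡⟨ cong (λ z → suc (K ∸ 1) * f₀ z) shift ⟩
      suc (K ∸ 1) * f₀ ((n + m′) * d)         ≤⟨ proj₂ (bound (n + m′) (≤-trans le (m≤m+n n m′))) ⟩
      f ((n + m′) * d)                        ≤⟨ f≤all _ ⟩
      all ((n + m′) * d)                      ≡⟨ cong all (sym shift) ⟩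
      all (n * d + m)                         ∎
      where
      shift : n * d + m ≡ (n + m′) * d
      shift = trans (cong (n * d +_) m≡) (sym (*-distribʳ-+ d n m′))
    grow : ∀ j → K ^ j ≤ all (N * d + j * m)
    grow zero    = ≤-trans (proj₁ (bound N ≤-refl)) (≤-trans (f≤all (N * d)) (≤-reflexive (cong all (sym (+-identityʳ (N * d))))))
    grow (suc j) = begin
      K * K ^ j                        ≤⟨ *-monoʳ-≤ K (grow j) ⟩
      K * all (N * d + j * m)          ≡⟨ cong (λ z → K * all z) place ⟩
      K * all ((N + j * m′) * d)       ≤⟨ step (N + j * m′) (m≤m+n N _) ⟩
      all ((N + j * m′) * d + m)       ≡⟨ cong all (trans (cong (_+ m) (sym place)) (arr₂ (N * d) (j * m) m)) ⟩
      all (N * d + (m + j * m))        ∎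
      where
      place : N * d + j * m ≡ (N + j * m′) * d
      place = trans (cong (λ z → N * d + j * z) m≡) (arr₃ N d j m′)
        where
        arr₃ : ∀ N d j m → N * d + j * (m * d) ≡ (N + j * m) * d
        arr₃ = solve-∀
      arr₂ : ∀ x y z → x + y + z ≡ x + (z + y)
      arr₂ = solve-∀

  ¬limit-zero : ¬ LimitZero f₀ f d
  ¬limit-zero lim = ¬limit-zero-from (_∣_.quotient d∣m) (_∣_.equality d∣m) (proj₁ (lim (2 * 4 ^ m ∸ 1))) (proj₂ (lim (2 * 4 ^ m ∸ 1)))

  limit-one⇒subexp : LimitOne f₀ f d → SubExp all
  limit-one⇒subexp lim = ratio⇒subexp {all} {m} (s≤s z≤n) λ s _ → let N , b = lim s in N * d , λ n le m≤n → go s N b n le m≤n (d ∣? n)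
    where
    open ≤-Reasoning
    go : ∀ s N → (∀ n → N ≤ n → (0 < f (n * d)) × (f₀ (n * d) ≤ f (n * d)) × (suc s * (f (n * d) ∸ f₀ (n * d)) ≤ f (n * d))) →
         ∀ n → N * d ≤ n → m ≤ n → Dec (d ∣ n) → s * all n ≤ suc s * all (n ∸ m)
    -- The law speaks only of multiples of d; at all other sizes there is no forest and the ratio
    -- estimate is trivial.
    go s N b n le m≤n (no ¬d) = ≤-trans (≤-reflexive (trans (cong (s *_) (∑-zero (E n) zer)) (*-zeroʳ s))) z≤n
      where
      zer : ∀ {G} → G ∈ E n → χ (allC T G) ≡ 0
      zer {G} G∈ with true-or-false (allC T G)
      ... | inj₂ e = cong χ e
      ... | inj₁ e = ⊥-elim (¬d (subst (d ∣_) (proj₂ (∈-E⁻ G∈)) (d∣size G e)))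
    go s N b .(q * d) le m≤n (yes (divides q refl)) = +-cancelˡ-≤ (all n) _ _ (begin
      suc s * all n                                                     ≤⟨ *-monoʳ-≤ (suc s) (m≤n+m∸n (all n) (all (n ∸ m))) ⟩
      suc s * (all (n ∸ m) + (all n ∸ all (n ∸ m)))                     ≡⟨ *-distribˡ-+ (suc s) (all (n ∸ m)) _ ⟩
      suc s * all (n ∸ m) + suc s * (all n ∸ all (n ∸ m))               ≤⟨ +-monoʳ-≤ (suc s * all (n ∸ m)) (subst₂ (λ x y → suc s * (x ∸ y) ≤ x) f≡ (f₀≡ n m≤n) (proj₂ (proj₂ (b q q≥N)))) ⟩
      suc s * all (n ∸ m) + all n                                       ≡⟨ +-comm (suc s * all (n ∸ m)) (all n) ⟩
      all n + suc s * all (n ∸ m)                                       ∎)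
      where
      n : ℕ
      n = q * d
      f≡ : f n ≡ all n
      f≡ = all≡f (≤-trans (s≤s z≤n) m≤n)
      q≥N : N ≤ q
      q≥N = *-cancelʳ-≤ N q d {{>-nonZero Pos₊.divisor≥1}} le

  zero-one⇒radius : ZeroOneLaw (MSOForestClass φ) f d → RadiusEq1 f
  zero-one⇒radius law = [ (λ lim → ⊥-elim (¬limit-zero lim)) , (λ lim → subexp⇒radius≡1 (limit-one⇒subexp lim)) ]′ (law ψ₀ f₀ f₀-counts)

theorem5p1 : (φ : Sentence) →
    Σ Str (MSOForestClass φ) →
    Adequate (MSOForestClass φ) →
    (f : ℕ → ℕ) → CountingFunction (MSOForestClass φ) f →
    (t : ℕ → ℕ) → CountingFunction (TreesOf (MSOForestClass φ)) t →
    (d : ℕ) → IsGcdOfSizes (MSOForestClass φ) d →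
    ((ZeroOneLaw (MSOForestClass φ) f d → RadiusEq1 f) × (RadiusEq1 f → ZeroOneLaw (MSOForestClass φ) f d))
    × ((RadiusEq1 f → RadiusGe1 t) × (RadiusGe1 t → RadiusEq1 f))
theorem5p1 φ inhabited adq f fc t tc d gcd =
  (zero-one⇒radius , radius⇒zero-one) , (forest-radius⇒tree-radius , tree-radius⇒forest-radius)
  where open Equivalence φ inhabited adq f fc t tc d gcd
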